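{- Work in the combinatorial polyomino setting described in the context. (a) Every polyomino which admits two different $4$-neighbour lattice tilings of the plane is a polyomino deformation of some polyomino described by a descendant chain. (b) Conversely, every descendant chain $U=U_1:\cdots:U_8$ describes a polyomino, i.e. $\psi_\square(U_1U_2\cdots U_8)$ is a simple closed polyline bounding a polyomino; and every polyomino deformation of such a polyomino admits two different $4$-neighbour lattice tilings of the plane.
   Context: Polyominoes and grid conventions. A polyomino is a polygon that is a union of unit cells of the standard integer grid, joined along sides. A lattice tiling of the plane by a polygon $[S]$ with lattice $L$ is the family of translates $[S]+\mathbf{u}$, $\mathbf{u}\in L$, which cover the plane and have pairwise disjoint interiors. In this combinatorial setting all tiles are required to consist of cells of one fixed unit grid, so $L\subseteq\mathbb{Z}^2$. Two tiles are neighbours when their boundaries share a polyline of positive length. A $4$-neighbour lattice tiling is a lattice tiling in which every tile has exactly $4$ neighbours. Two lattice tilings of the same polygon are different when they are different families of tiles. Words. Let $\mathcal{A}_\square=\{\mathsf{R},\mathsf{L},\mathsf{U},\mathsf{D}\}$ with reversal $\mathsf{R}^{ -1}=\mathsf{L}$, $\mathsf{L}^{ -1}=\mathsf{R}$, $\mathsf{U}^{ -1}=\mathsf{D}$, $\mathsf{D}^{ -1}=\mathsf{U}$. The reverse of a word $w_1\cdots w_k$ is $w_k^{ -1}\cdots w_1^{ -1}$. The standard valuation $\psi_\square$ sends $\mathsf{R},\mathsf{L},\mathsf{U},\mathsf{D}$ to unit segments pointing right, left, up, down, respectively. A word $W$ is evaluated to the polyline $\psi_\square(W)$ by concatenating these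 segments; it is defined up to translation. Chains. A word chain is a cyclic sequence $U=U_1:U_2:\cdots:U_8$ of words, with indices taken modulo $8$, and $U_{i:j}=U_iU_{i+1}\cdots U_j$. It is an interleaved double chain when $U_iU_{i+1}=(U_{i+4}U_{i+5})^{ -1}$ for all $i$. Lifts. For $V=\varphi(U)$ define: - $f_i$, for $i=1,2,3,4$: $V_j=U_j$ for $j\not\equiv i \pmod 4$, and $V_j=(U_{j+3}U_{j+4}U_{j+5})^{ -1}$ for $j\equiv i\pmod 4$. - $g^\star_{\mathrm{odd}}$: $V_i=(U_{i-2}U_{i-1}U_iU_{i+1}U_{i+2})^{ -1}$ for odd $i$, and $V_i=U_{i+3}U_{i+4}U_{i+5}$ for even $i$. - $g^\star_{\mathrm{even}}$: the same as $g^\star_{\mathrm{odd}}$ with "odd" and "even" swapped. Descendant chains. The Greek cross is the chain $\mathsf{R}:\mathsf{U}\mathsf{R}:\mathsf{U}:\mathsf{L}\mathsf{U}:\mathsf{L}:\mathsf{D}\mathsf{L}:\mathsf{D}:\mathsf{R}\mathsf{D}$. A descendant chain is any chain obtained from the Greek cross by applying a finite sequence of maps from $\{f_1,f_2,f_3,f_4,g^\star_{\mathrm{odd}},g^\star_{\mathrm{even}}\}$. A polyomino is described by a descendant chain $U$ if its boundary is $\psi_\square(U_1\cdots U_8)$. Polyomino deformations. Let $\Phi$ be a polyomino whose boundary is $\psi_\square(W)$ for a word $W$. Let the building block be a polyomino whose boundary word is, up to cyclic shift, $W_A W_B W_A^{ -1}W_B^{ -1}$ for some nonempty words $W_A,W_B$.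 Then the word $W[\mathsf{R}\to W_A,\mathsf{L}\to W_A^{ -1},\mathsf{U}\to W_B,\mathsf{D}\to W_B^{ -1}]$ (simultaneous letter substitution) describes a simple closed polyline. The polyomino it bounds is a polyomino deformation of $\Phi$; it is defined up to translation. -}

module Defs where

open import Data.Bool using (Bool; true; false; _xor_; _∧_)
open import Data.Nat using (ℕ; _≤_; _%_)
open import Data.Integer using (ℤ; +_; -[1+_]; _+_; _-_; _*_; _<?_)
import Data.Integer.Properties as ℤP
open import Data.Fin using (Fin; toℕ; fromℕ<)
open import Data.Nat.DivMod using (_mod_)
open import Data.List using (List; []; _∷_; _++_; length; concatMap)
open import Data.List.Relation.Unary.Unique.Propositional using (Unique)
open import Data.Product using (Σ; _×_; _,_; ∃)
open import Relation.Binary.PropositionalEquality using (_≡_; _≢_)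
open import Relation.Nullary using (¬_)
open import Relation.Nullary.Decidable using (⌊_⌋)

-- Grid points / cells.  A cell is named by the integer coordinates of
-- its lower-left corner: cell (x , y) = [x,x+1] × [y,y+1].

Cell : Set
Cell = ℤ × ℤ

_⊕_ : Cell → Cell → Cell
(a , b) ⊕ (c , d) = (a + c , b + d)

_⊖_ : Cell → Cell → Cell
(a , b) ⊖ (c , d) = (a - c , b - d)

_·_ : ℤ → Cell → Cell
m · (a , b) = (m * a , m * b)

infixl 6 _⊕_ _⊖_
infixl 7 _·_

data Letter : Set where
  R L U D : Letter

Word : Set
Word = List Letter

inv : Letter → Letter
inv R = L
inv L = R
inv U = D
inv D = U

rev : Word → Word
rev [] = []
rev (x ∷ w) = rev w ++ (inv x ∷ [])

step : Letter → Cell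
step R = (+ 1 , + 0)
step L = (-[1+ 0 ] , + 0)
step U = (+ 0 , + 1)
step D = (+ 0 , -[1+ 0 ])

verts : Cell → Word → List Cell
verts p [] = []
verts p (x ∷ w) = p ∷ verts (p ⊕ step x) w

endpoint : Cell → Word → Cell
endpoint p [] = p
endpoint p (x ∷ w) = endpoint (p ⊕ step x) w

-- ψ□(W) is a simple closed polyline: closed, at least 3 edges, and the
-- vertices p₀,…,p_{k-1} pairwise distinct (for unit grid paths this is
-- exactly simplicity of the closed polyline).
IsSimpleClosed : Word → Set
IsSimpleClosed W =
  endpoint (+ 0 , + 0) W ≡ (+ 0 , + 0) × 3 ≤ length W × Unique (verts (+ 0 , + 0) W)

-- Interior of the closed polyline ψ□(W) started at p (ray casting /
-- parity rule): cell (x , y) is inside iff the horizontal ray from its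
-- centre to the right crosses an odd number of vertical edges.
crosses : ℤ → ℤ → Cell → Letter → Bool
crosses x y (a , b) U = ⌊ x <? a ⌋ ∧ ⌊ b ℤP.≟ y ⌋
crosses x y (a , b) D = ⌊ x <? a ⌋ ∧ ⌊ b ℤP.≟ (y + + 1) ⌋
crosses x y p R = false
crosses x y p L = false

insideFrom : Cell → Word → Cell → Bool
insideFrom p [] c = false
insideFrom p (l ∷ w) (x , y) = crosses x y p l xor insideFrom (p ⊕ step l) w (x , y)

Shape : Set
Shape = Cell → Bool

Bounds : Word → Shape → Set
Bounds W P = IsSimpleClosed W × Σ Cell (λ p → ∀ c → P c ≡ insideFrom p W c)

IsPolyomino : Shape → Set
IsPolyomino P = Σ Word (λ W → Bounds W P)

-- Chains U = U₁ : ⋯ : U₈, indexed by Fin 8 (index i ↔ U_{i+1}), indices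
-- taken modulo 8.

Chain : Set
Chain = Fin 8 → Word

_+ᶠ_ : Fin 8 → ℕ → Fin 8
i +ᶠ k = (toℕ i Data.Nat.+ k) mod 8

concat8 : Chain → Word
concat8 V = V (0 mod 8) ++ V (1 mod 8) ++ V (2 mod 8) ++ V (3 mod 8)
         ++ V (4 mod 8) ++ V (5 mod 8) ++ V (6 mod 8) ++ V (7 mod 8)

greek : Chain
greek i = table (toℕ i)
  where
  table : ℕ → Word
  table 0 = R ∷ []
  table 1 = U ∷ R ∷ []
  table 2 = U ∷ []
  table 3 = L ∷ U ∷ []
  table 4 = L ∷ []
  table 5 = D ∷ L ∷ []
  table 6 = D ∷ []
  table _ = R ∷ D ∷ []

-- U_{i+a} ⋯ U_{i+b} written out via offsets (ℕ offsets mod 8; −2 ≡ 6, −1 ≡ 7)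
seg3 : Chain → Fin 8 → Word
seg3 V j = V (j +ᶠ 3) ++ V (j +ᶠ 4) ++ V (j +ᶠ 5)

seg5 : Chain → Fin 8 → Word
seg5 V i = V (i +ᶠ 6) ++ V (i +ᶠ 7) ++ V i ++ V (i +ᶠ 1) ++ V (i +ᶠ 2)

-- f_i for i = r+1, r : Fin 4 :  V_j = (U_{j+3}U_{j+4}U_{j+5})⁻¹ when j ≡ i (mod 4)
-- (1-based j ≡ r+1 mod 4  ⇔  0-based index ≡ r mod 4).
f : Fin 4 → Chain → Chain
f r V j with toℕ j % 4 Data.Nat.≟ toℕ r
... | Relation.Nullary.yes _ = rev (seg3 V j)
... | Relation.Nullary.no _ = V j

-- g*_odd : V_i = (U_{i-2}⋯U_{i+2})⁻¹ for odd (1-based) i, V_i = U_{i+3}U_{i+4}U_{i+5}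
-- for even i.  0-based index k is 1-based odd iff k is even.
gOdd : Chain → Chain
gOdd V k with toℕ k % 2 Data.Nat.≟ 0
... | Relation.Nullary.yes _ = rev (seg5 V k)
... | Relation.Nullary.no _ = seg3 V k

gEven : Chain → Chain
gEven V k with toℕ k % 2 Data.Nat.≟ 1
... | Relation.Nullary.yes _ = rev (seg5 V k)
... | Relation.Nullary.no _ = seg3 V k

data Descendant : Chain → Set where
  base  : Descendant greek
  byF   : ∀ {V} (r : Fin 4) → Descendant V → Descendant (f r V)
  byOdd : ∀ {V} → Descendant V → Descendant (gOdd V)
  byEven : ∀ {V} → Descendant V → Descendant (gEven V)

subst : Word → Word → Word → Word
subst WA WB = concatMap σ
  where
  σ : Letter → Word
  σ R = WA
  σ L = rev WA
  σ U = WB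
  σ D = rev WB

IsDeformation : Shape → Shape → Set
IsDeformation P Φ =
  Σ Word λ W → Bounds W Φ ×
  Σ Word λ WA → Σ Word λ WB →
    WA ≢ [] × WB ≢ [] ×
    IsSimpleClosed (WA ++ WB ++ rev WA ++ rev WB) ×   -- building block is a polyomino
    Bounds (subst WA WB W) P

det : Cell → Cell → ℤ
det (a₁ , a₂) (b₁ , b₂) = a₁ * b₂ - a₂ * b₁

InL : Cell → Cell → Cell → Set
InL a b v = Σ ℤ λ m → Σ ℤ λ n → v ≡ m · a ⊕ n · b

Tile : Shape → Cell → Shape
Tile P u c = P (c ⊖ u)

IsLatticeTiling : Shape → Cell → Cell → Set
IsLatticeTiling P a b =
  det a b ≢ + 0 ×
  (∀ c → Σ Cell λ u → InL a b u × Tile P u c ≡ true) ×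
  (∀ c u u' → InL a b u → InL a b u' → Tile P u c ≡ true → Tile P u' c ≡ true → u ≡ u')

data Edge : Set where
  horiz : Cell → Edge   -- [x,x+1] × {y}, between cells (x,y-1) and (x,y)
  vert  : Cell → Edge   -- {x} × [y,y+1], between cells (x-1,y) and (x,y)

side₁ side₂ : Edge → Cell
side₁ (horiz (x , y)) = (x , y - + 1)
side₁ (vert (x , y)) = (x - + 1 , y)
side₂ (horiz c) = c
side₂ (vert c) = c

OnBoundary : Shape → Edge → Set
OnBoundary A e = (A (side₁ e) xor A (side₂ e)) ≡ true

-- boundaries share a polyline of positive length (⇔ share a unit edge,
-- as boundaries are unions of unit grid edges)
Neighbours : Shape → Shape → Set
Neighbours A B = Σ Edge λ e → OnBoundary A e × OnBoundary B e

HasFourNeighbours : Shape → Cell → Cell → Cell → Set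
HasFourNeighbours P a b u =
  Σ (Fin 4 → Cell) λ vs →
    (∀ i → InL a b (vs i) × vs i ≢ u × Neighbours (Tile P u) (Tile P (vs i))) ×
    (∀ i j → vs i ≡ vs j → i ≡ j) ×
    (∀ v → InL a b v → v ≢ u → Neighbours (Tile P u) (Tile P v) → Σ (Fin 4) λ i → vs i ≡ v)

IsFourNeighbourLatticeTiling : Shape → Cell → Cell → Set
IsFourNeighbourLatticeTiling P a b =
  IsLatticeTiling P a b × (∀ u → InL a b u → HasFourNeighbours P a b u)

SameTiling : Shape → Cell → Cell → Cell → Cell → Set
SameTiling P a b a' b' =
  (∀ u → InL a b u → Σ Cell λ u' → InL a' b' u' × (∀ c → Tile P u c ≡ Tile P u' c)) ×
  (∀ u' → InL a' b' u' → Σ Cell λ u → InL a b u × (∀ c → Tile P u' c ≡ Tile P u c))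

TwoFourNeighbourTilings : Shape → Set
TwoFourNeighbourTilings P =
  Σ Cell λ a → Σ Cell λ b → Σ Cell λ a' → Σ Cell λ b' →
    IsFourNeighbourLatticeTiling P a b ×
    IsFourNeighbourLatticeTiling P a' b' ×
    ¬ SameTiling P a b a' b'

{-# OPTIONS --safe #-}
module Submission where

open import Defs renaming (endpoint to tip; _⊕_ to _<>_; insideFrom to inside; Letter to Ltr)
open import Data.Bool using (Bool; true; false; if_then_else_; T; _∧_; _∨_; not; _xor_)
open import Data.Nat as N using (_≤_; _<_; ℕ; zero; suc; _≡ᵇ_)
import Data.Nat.Properties as Q
import Data.Nat.DivMod as ND
import Data.Nat.Tactic.RingSolver as NS
open import Data.Integer as Z using (_+_; _*_; ℤ; +_; -[1+_])
import Data.Integer.Properties as Y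
import Data.Integer.DivMod as ZD
open import Data.Integer.Tactic.RingSolver renaming (solve-∀ to ring) using ()
open import Data.Fin as F using (Fin)
open import Data.Nat.DivMod using (_mod_)
open import Data.List using (List; []; _++_; map; take; drop; reverse; concatMap) renaming (length to #; _∷_ to _::_)
import Data.List.Properties as I
import Data.List.Relation.Unary.All.Properties as AllP
import Data.List.Relation.Unary.AllPairs.Properties as APP
import Data.List.Relation.Unary.Unique.Propositional.Properties as UP
open import Data.List.Relation.Unary.All as All renaming (_∷_ to _::_) using (All; [])
open import Data.List.Relation.Unary.AllPairs renaming (_∷_ to _::_) using ([])
open import Data.List.Relation.Unary.Unique.Propositional using (Unique)
open import Data.Product renaming (proj₁ to fst; proj₂ to snd) using (Σ; _×_; _,_; ∃)
open import Data.Maybe using (Maybe; just; nothing)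
open import Data.Empty renaming (⊥-elim to !!) using (⊥)
open import Data.Sum renaming (inj₁ to inl; inj₂ to inr) using (_⊎_)
import Data.Sum
import Data.Product.Properties as DP
open import Data.Unit using (⊤; tt)
open import Relation.Binary.PropositionalEquality
  renaming (_≡_ to _==_; _≢_ to _!=_; subst to tp; sym to !; trans to infixr 4.5 _∙_; cong to ap; cong₂ to ap2)
  using (refl; module ≡-Reasoning)
open import Relation.Nullary using (¬_; Dec; yes; no)
open import Relation.Nullary.Decidable using (⌊_⌋)
open import Relation.Binary using (tri<; tri≈; tri>)
open import Tactic.MonoidSolver using (solve)
open import Data.List.Membership.Propositional using (_∈_)
open import Data.List.Membership.Propositional.Properties using (∈-map⁺; ∈-map⁻)
open import Data.List.Membership.Propositional.Properties.WithK using (unique∧set⇒bag)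
open import Data.List.Relation.Binary.BagAndSetEquality using (∼bag⇒↭)
open import Data.List.Relation.Binary.Permutation.Propositional using (_↭_)
import Data.List.Relation.Binary.Permutation.Propositional as ↭
open import Data.List.Relation.Unary.Any renaming (here to hit; there to miss) using ()
open import Data.Fin.Properties using (pigeonhole)
import Data.Fin.Properties as FP
open import Function.Bundles using (mk⇔)
open NS renaming (solve-∀ to ringN) using ()
open I renaming (++-identityʳ to ++-id; ++-assoc to ++-as; length-++ to #-++) using ()
open Q renaming (≤-trans to ≤-tr; ≤-reflexive to ≤-re) using ()

open Y renaming (+-identityʳ to +0; +-identityˡ to 0+) using ()

words = I.++-monoid Ltr

pattern i0 = F.zero
pattern i1 = F.suc i0
pattern i2 = F.suc i1
pattern i3 = F.suc i2

inv-inv : ∀ l -> inv (inv l) == l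
inv-inv R = refl
inv-inv L = refl
inv-inv U = refl
inv-inv D = refl

rev-++ : ∀ u v -> rev (u ++ v) == rev v ++ rev u
rev-++ [] v = ! (++-id (rev v))
rev-++ (x :: u) v =
 ap (_++ (inv x :: [])) (rev-++ u v) ∙ ++-as (rev v) (rev u) (inv x :: [])

rr : ∀ u -> rev (rev u) == u
rr [] = refl
rr (x :: u) =
 rev-++ (rev u) (inv x :: []) ∙ (ap2 _::_ (inv-inv x) (rr u))

len-rev : ∀ u -> # (rev u) == # u
len-rev [] = refl
len-rev (x :: u) =
 #-++ (rev u) ∙ (Q.+-comm _ 1) ∙ ap suc (len-rev u)

rev-[] : ∀ u -> rev u == [] -> u == []
rev-[] u e = ! (rr u) ∙ ap rev e

++-≢[]ˡ : ∀ {A : Set} (u : List A) {v} -> u != [] -> u ++ v != []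
++-≢[]ˡ [] n _ = n refl
++-≢[]ˡ (x :: u) n ()

-- A word is a disk word if it bounds a combinatorial (possibly overlapping) disk,

data Disk : Word -> Set where
 cell   : Disk (R :: U :: L :: D :: [])
 rotate : ∀ u v -> Disk (u ++ v) -> Disk (v ++ u)
 glue   : ∀ a p b q c s -> Disk ((a :: p) ++ (b :: q)) -> Disk (rev (b :: q) ++ (c :: s)) ->
      Disk ((a :: p) ++ (c :: s))

glue-≢[] : ∀ p q s -> p != [] -> q != [] -> s != [] ->
      Disk (p ++ q) -> Disk (rev q ++ s) -> Disk (p ++ s)
glue-≢[] [] q s p≢ q≢ s≢ _ _ = !! (p≢ refl)
glue-≢[] (a :: p) [] s p≢ q≢ s≢ _ _ = !! (q≢ refl)
glue-≢[] (a :: p) (b :: q) [] p≢ q≢ s≢ _ _ = !! (s≢ refl)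
glue-≢[] (a :: p) (b :: q) (c :: s) _ _ _ = glue a p b q c s

-- The reflection in a vertical axis, composed with reversal so that orientation is kept.

rflc : Ltr -> Ltr
rflc R = L
rflc L = R
rflc U = U
rflc D = D

mir : Word -> Word
mir w = rev (map rflc w)

mir-++ : ∀ u v -> mir (u ++ v) == mir v ++ mir u
mir-++ u v = ap rev (I.map-++ rflc u v) ∙ rev-++ (map rflc u) (map rflc v)

inv-rflc : ∀ l -> inv (rflc l) == rflc (inv l)
inv-rflc R = refl
inv-rflc L = refl
inv-rflc U = refl
inv-rflc D = refl

rflc-rflc : ∀ l -> rflc (rflc l) == l
rflc-rflc R = refl
rflc-rflc L = refl
rflc-rflc U = refl
rflc-rflc D = refl

map-rev : ∀ (g : Ltr -> Ltr) -> (∀ l -> inv (g l) == g (inv l)) -> ∀ w -> map g (rev w) == rev (map g w)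
map-rev g h [] = refl
map-rev g h (x :: w) = I.map-++ g (rev w) (inv x :: []) ∙ (ap2 _++_ (map-rev g h w) (ap (_:: []) (! (h x))))

mir-rev : ∀ w -> mir (rev w) == rev (mir w)
mir-rev w = ap rev (map-rev rflc inv-rflc w)

mir-mir : ∀ w -> mir (mir w) == w
mir-mir w = (ap rev (map-rev rflc inv-rflc (map rflc w)) ∙ (rr _) ∙ ! (I.map-∘ w) ∙ I.map-cong rflc-rflc w ∙ I.map-id w)

mir-≢[] : ∀ u -> u != [] -> mir u != []
mir-≢[] u u≢ e = u≢ (! (mir-mir u) ∙ ap mir e)

Disk-mir : ∀ {w} -> Disk w -> Disk (mir w)
Disk-mir cell = rotate (R :: []) (U :: L :: D :: []) cell
Disk-mir (rotate u v d) =
 tp Disk (! (mir-++ v u)) (rotate (mir v) (mir u) (tp Disk (mir-++ u v) (Disk-mir d)))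
Disk-mir (glue a p b q c s d1 d2) = tp Disk (! (mir-++ P S)) (rotate (mir P) (mir S) (glue-≢[] (mir P) (mir Q) (mir S) (mir-≢[] P \ ()) (mir-≢[] Q \ ()) (mir-≢[] S \ ())
 (rotate (mir Q) (mir P) (tp Disk (mir-++ P Q) (Disk-mir d1))) (tp Disk (ap (_++ mir S) (mir-rev Q)) (rotate (mir S) (mir (rev Q)) (tp Disk (mir-++ (rev Q) S) (Disk-mir d2))))))
 where
 P Q S : Word
 P = a :: p
 Q = b :: q
 S = c :: s

tleft : Ltr -> Ltr
tleft R = U
tleft U = L
tleft L = D
tleft D = R

inv-tleft : ∀ l -> inv (tleft l) == tleft (inv l)
inv-tleft R = refl
inv-tleft L = refl
inv-tleft U = refl
inv-tleft D = refl

Disk-tleft : ∀ {w} -> Disk w -> Disk (map tleft w)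
Disk-tleft cell = rotate (R :: []) (U :: L :: D :: []) cell
Disk-tleft (rotate u v d) =
 tp Disk (! (I.map-++ tleft v u)) (rotate (map tleft u) (map tleft v) (tp Disk (I.map-++ tleft u v) (Disk-tleft d)))
Disk-tleft (glue a p b q c s d1 d2) =
 tp Disk (! (I.map-++ tleft (a :: p) (c :: s))) (glue (tleft a) (map tleft p) (tleft b) (map tleft q) (tleft c) (map tleft s) (tp Disk (I.map-++ tleft (a :: p) (b :: q)) (Disk-tleft d1))
  (tp Disk (I.map-++ tleft (rev (b :: q)) (c :: s) ∙
     ap (_++ map tleft (c :: s)) (map-rev tleft inv-tleft (b :: q))) (Disk-tleft d2)))

-- Formal words in the eight parts of a chain and their reversals.  Indices are read modulo 8.

data Arc : Set where
 _⁺ _⁻ : ℕ -> Arc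

infix 8 _⁺ _⁻

Frm : Set
Frm = List Arc

opp : Arc -> Arc
opp (n ⁺) = n ⁻
opp (n ⁻) = n ⁺

oppo : Frm -> Frm
oppo [] = []
oppo (x :: w) = oppo w ++ (opp x :: [])

shiftArc : ℕ -> Arc -> Arc
shiftArc k (n ⁺) = (k N.+ n) ⁺
shiftArc k (n ⁻) = (k N.+ n) ⁻

sh : ℕ -> Frm -> Frm
sh k = map (shiftArc k)

same : Arc -> Arc -> Bool
same (m ⁺) (n ⁺) = (m N.% 8) ≡ᵇ (n N.% 8)
same (m ⁻) (n ⁻) = (m N.% 8) ≡ᵇ (n N.% 8)
same _ _ = false

sames : Frm -> Frm -> Bool
sames [] [] = true
sames (x :: u) (y :: v) = same x y ∧ sames u v
sames _ _ = false

Chn : Set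
Chn = ℕ -> Word

arc : Chn -> Arc -> Word
arc A (n ⁺) = A n
arc A (n ⁻) = rev (A n)

⟦_⟧ : Frm -> Chn -> Word
⟦ [] ⟧ A = []
⟦ x :: w ⟧ A = arc A x ++ ⟦ w ⟧ A

record IsCh (A : Chn) : Set where
 field
  perio    : ∀ n -> A (8 N.+ n) == A n
  laced : ∀ n -> A n ++ A (1 N.+ n) == rev (A (4 N.+ n) ++ A (5 N.+ n))
  nonem    : ∀ n -> A n != []

⟦++⟧ : ∀ A u v -> ⟦ u ++ v ⟧ A == ⟦ u ⟧ A ++ ⟦ v ⟧ A
⟦++⟧ A [] v = refl
⟦++⟧ A (x :: u) v = ap (arc A x ++_) (⟦++⟧ A u v) ∙ ! (++-as (arc A x) _ _)

arc-opp : ∀ A x -> arc A (opp x) == rev (arc A x)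
arc-opp A (n ⁺) = refl
arc-opp A (n ⁻) = ! (rr (A n))

⟦opposite⟧ : ∀ A u -> ⟦ oppo u ⟧ A == rev (⟦ u ⟧ A)
⟦opposite⟧ A [] = refl
⟦opposite⟧ A (x :: u) = (⟦++⟧ A (oppo u) (opp x :: []) ∙ (ap2 _++_ (⟦opposite⟧ A u) ((++-id _) ∙ arc-opp A x)) ∙ ! (rev-++ (arc A x) (⟦ u ⟧ A)))

module _ {A : Chn} (per : ∀ n -> A (8 N.+ n) == A n) where
 perio-* : ∀ k n -> A (n N.+ k N.* 8) == A n
 perio-* zero n = ap A (Q.+-identityʳ n)
 perio-* (suc k) n = ap A (lemma n (k N.* 8)) ∙ (per _) ∙ perio-* k n
  where
  lemma : ∀ n m -> n N.+ (8 N.+ m) == 8 N.+ (n N.+ m)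
  lemma n m = ! (Q.+-assoc n 8 m) ∙ ap (N._+ m) (Q.+-comm n 8) ∙ Q.+-assoc 8 n m

 mod8 : ∀ n -> A n == A (n N.% 8)
 mod8 n = ap A (ND.m≡m%n+[m/n]*n n 8) ∙ perio-* (n N./ 8) (n N.% 8)

 same-sound : ∀ x y -> same x y == true -> arc A x == arc A y
 same-sound (m ⁺) (n ⁺) e = mod8 m ∙ ap A (Q.≡ᵇ⇒≡ _ _ (tp T (! e) tt)) ∙ ! (mod8 n)
 same-sound (m ⁻) (n ⁻) e = ap rev (same-sound (m ⁺) (n ⁺) e)

 sames-sound : ∀ u v -> sames u v == true -> ⟦ u ⟧ A == ⟦ v ⟧ A
 sames-sound [] [] e = refl
 sames-sound (x :: u) (y :: v) e with same x y in ex
 ... | true = ap2 _++_ (same-sound x y ex) (sames-sound u v e)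

⟦⟧-nonem : ∀ {A} -> (∀ n -> A n != []) -> ∀ x w -> ⟦ x :: w ⟧ A != []
⟦⟧-nonem ne (n ⁺) w = ++-≢[]ˡ _ (ne n)
⟦⟧-nonem {A} ne (n ⁻) w = ++-≢[]ˡ _ (\ e -> ne n (rev-[] (A n) e))

exchange : Arc -> Arc -> Maybe (Arc × Arc)
exchange (m ⁺) (n ⁺) = if ((1 N.+ m) N.% 8) ≡ᵇ (n N.% 8) then just ((5 N.+ m) ⁻ , (4 N.+ m) ⁻) else nothing
exchange (m ⁻) (n ⁻) = if ((1 N.+ n) N.% 8) ≡ᵇ (m N.% 8) then just ((4 N.+ n) ⁺ , (5 N.+ n) ⁺) else nothing
exchange _ _ = nothing

exchange-sound : ∀ {A} -> IsCh A -> ∀ x y x' y' -> exchange x y == just (x' , y') ->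
         ⟦ x :: y :: [] ⟧ A == ⟦ x' :: y' :: [] ⟧ A
exchange-sound {A} ch (m ⁺) (n ⁺) x' y' e with ((1 N.+ m) N.% 8) ≡ᵇ (n N.% 8) in eq
exchange-sound {A} ch (m ⁺) (n ⁺) x' y' refl | true = (ap (A m ++_) (++-id _) ∙ ap (A m ++_) (! (same-sound perio ((1 N.+ m) ⁺) (n ⁺) eq)) ∙ laced m ∙ rev-++ (A (4 N.+ m)) (A (5 N.+ m)) ∙ ap (rev (A (5 N.+ m)) ++_) (! (++-id _)))
  where open IsCh ch
exchange-sound {A} ch (m ⁻) (n ⁻) x' y' e with ((1 N.+ n) N.% 8) ≡ᵇ (m N.% 8) in eq
exchange-sound {A} ch (m ⁻) (n ⁻) x' y' refl | true = (ap (rev (A m) ++_) (++-id _) ∙ ap (\ z -> rev z ++ rev (A n)) (! (same-sound perio ((1 N.+ n) ⁺) (m ⁺) eq)) ∙ ! (rev-++ (A n) (A (1 N.+ n))) ∙ ap rev (laced n) ∙ (rr _) ∙ ap (A (4 N.+ n) ++_) (! (++-id _)))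
  where open IsCh ch

-- Local derivations.  `swap i` applies `exchange` at position i.  `paste i c r k` rotates the piece c
-- by r, splits it as new ++ old⁻¹ with `new` of length k, and replaces `old` at position i by `new`.
data Move (C : Set) : Set where
 swap  : ℕ -> Move C
 paste : ℕ -> C -> ℕ -> ℕ -> Move C

module Derivation {C : Set} (word : C -> Frm) where

 rotateBy : ℕ -> Frm -> Frm
 rotateBy r w = drop r w ++ take r w

 swapHead : Frm -> Maybe Frm
 swapHead (x :: y :: w) with exchange x y
 ... | just (x' , y') = just (x' :: y' :: w)
 ... | nothing = nothing
 swapHead _ = nothing

 neᵇ : Frm -> Bool
 neᵇ [] = false
 neᵇ (_ :: _) = true

 -- In strict mode the rest of the word around the replaced part has to be nonempty.
 move : Bool -> Move C -> Frm -> Maybe Frm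
 move strict (swap i) w with swapHead (drop i w)
 ... | just v = just (take i w ++ v)
 ... | nothing = nothing
 move strict (paste i c r k) w =
  if sames (take (# old) (drop i w)) old ∧ (neᵇ new ∧ (neᵇ old ∧ (not strict ∨ neᵇ (take i w ++ rest))))
  then just (take i w ++ (new ++ rest)) else nothing
  where
  new old rest : Frm
  new = take k (rotateBy r (word c))
  old = oppo (drop k (rotateBy r (word c)))
  rest = drop (# old) (drop i w)

 run : List (Move C) -> Frm -> Maybe Frm
 run [] w = just w
 run (m :: ms) w with move false m w
 ... | just v = run ms v
 ... | nothing = nothing

 runClosed : List (ℕ × Move C) -> Frm -> Maybe Frm
 runClosed [] w = just w
 runClosed ((r , m) :: ms) w with move true m w
 ... | just v = runClosed ms (rotateBy r v)
 ... | nothing = nothing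

 module Sound {A : Chn} (ch : IsCh A) (good : ∀ c -> Disk (⟦ word c ⟧ A)) where
  open IsCh ch

  take-drop : ∀ n (w : Frm) -> ⟦ w ⟧ A == ⟦ take n w ⟧ A ++ ⟦ drop n w ⟧ A
  take-drop n w = ap (\ z -> ⟦ z ⟧ A) (! (I.take++drop≡id n w)) ∙ ⟦++⟧ A (take n w) (drop n w)

  Disk-rotateBy : ∀ r w -> Disk (⟦ w ⟧ A) -> Disk (⟦ rotateBy r w ⟧ A)
  Disk-rotateBy r w d = tp Disk (! (⟦++⟧ A (drop r w) (take r w))) (rotate (⟦ take r w ⟧ A) (⟦ drop r w ⟧ A) (tp Disk (take-drop r w) d))

  swapHead-sound : ∀ w v -> swapHead w == just v -> ⟦ w ⟧ A == ⟦ v ⟧ A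
  swapHead-sound (x :: y :: w) v e with exchange x y in eq
  swapHead-sound (x :: y :: w) _ refl | just (x' , y') = (⟦++⟧ A (x :: y :: []) w ∙ ap (_++ ⟦ w ⟧ A) (exchange-sound ch x y x' y' eq) ∙ ! (⟦++⟧ A (x' :: y' :: []) w))

  nonEmpty-sound : ∀ w -> neᵇ w == true -> ⟦ w ⟧ A != []
  nonEmpty-sound (x :: w) _ = ⟦⟧-nonem nonem x w

  paste-word : ∀ P new old rest Q -> new != [] -> old != [] -> (P ++ rest) ++ Q != [] -> Disk (new ++ rev old) ->
         Disk ((P ++ (old ++ rest)) ++ Q) -> Disk ((P ++ (new ++ rest)) ++ Q)
  paste-word P new old rest Q new≢ old≢ ctx≢ piece d = unrotate new (glue-≢[] ((rest ++ Q) ++ P) old new ctx≢' old≢ new≢ (rerotate old d) (rotate new (rev old) piece))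
   where
   e1 : ∀ z -> (P ++ (z ++ rest)) ++ Q == (P ++ z) ++ (rest ++ Q)
   e1 z = ((++-as P _ Q) ∙ ap (P ++_) (++-as z rest Q) ∙ ! (++-as P z _))
   rerotate : ∀ z -> Disk ((P ++ (z ++ rest)) ++ Q) -> Disk (((rest ++ Q) ++ P) ++ z)
   rerotate z h = tp Disk (! (++-as (rest ++ Q) P z)) (rotate (P ++ z) (rest ++ Q) (tp Disk (e1 z) h))
   unrotate : ∀ z -> Disk (((rest ++ Q) ++ P) ++ z) -> Disk ((P ++ (z ++ rest)) ++ Q)
   unrotate z h = tp Disk (! (e1 z)) (rotate (rest ++ Q) (P ++ z) (tp Disk (++-as (rest ++ Q) P z) h))
   ctx≢' : (rest ++ Q) ++ P != []
   ctx≢' e = ctx≢ (ap2 _++_ (ap2 _++_ (I.++-conicalʳ (rest ++ Q) P e) (I.++-conicalˡ rest Q e')) (I.++-conicalʳ rest Q e'))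
    where
    e' : rest ++ Q == []
    e' = I.++-conicalˡ (rest ++ Q) P e

  ∧-≡ : ∀ {a b} -> a ∧ b == true -> a == true × b == true
  ∧-≡ {true} {true} _ = refl , refl

  move-sound : ∀ strict m w v -> move strict m w == just v -> ∀ Q -> strict == true ⊎ Q != [] -> Disk (⟦ w ⟧ A ++ Q) -> Disk (⟦ v ⟧ A ++ Q)
  move-sound strict (swap i) w v e Q q d with swapHead (drop i w) in eq
  move-sound strict (swap i) w _ refl Q q d | just v = tp (\ z -> Disk (z ++ Q)) (take-drop i w ∙
   ap (⟦ take i w ⟧ A ++_) (swapHead-sound (drop i w) v eq) ∙ ! (⟦++⟧ A (take i w) v)) d
  move-sound strict (paste i c r k) w v e Q q d
   with sames (take (# (oppo (drop k (rotateBy r (word c))))) (drop i w)) (oppo (drop k (rotateBy r (word c))))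
      ∧ (neᵇ (take k (rotateBy r (word c))) ∧ (neᵇ (oppo (drop k (rotateBy r (word c))))
      ∧ (not strict ∨ neᵇ (take i w ++ drop (# (oppo (drop k (rotateBy r (word c))))) (drop i w))))) in eq
  move-sound strict (paste i c r k) w _ refl Q q d | true with ∧-≡ eq
  ... | e1 , eq' with ∧-≡ eq'
  ... | e2 , eq'' with ∧-≡ eq''
  ... | e3 , e4 = tp (\ z -> Disk (z ++ Q)) (! split-new) (paste-word (⟦ P ⟧ A) (⟦ new ⟧ A) (⟦ old ⟧ A) (⟦ rest ⟧ A) Q (nonEmpty-sound new e2) (nonEmpty-sound old e3) (context q e4)
      piece (tp (\ z -> Disk (z ++ Q)) split-old d))
   where
   context : strict == true ⊎ Q != [] -> not strict ∨ neᵇ (take i w ++ drop (# (oppo (drop k (rotateBy r (word c))))) (drop i w)) == true ->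
    (⟦ take i w ⟧ A ++ ⟦ drop (# (oppo (drop k (rotateBy r (word c))))) (drop i w) ⟧ A) ++ Q != []
   context (inl refl) h z = nonEmpty-sound _ h ((⟦++⟧ A (take i w) _) ∙ (I.++-conicalˡ _ Q z))
   context (inr q≢) _ z = q≢ (I.++-conicalʳ _ Q z)
   P new old rest tail : Frm
   P = take i w
   new = take k (rotateBy r (word c))
   tail = drop k (rotateBy r (word c))
   old = oppo tail
   rest = drop (# old) (drop i w)
   split-old : ⟦ w ⟧ A == ⟦ P ⟧ A ++ (⟦ old ⟧ A ++ ⟦ rest ⟧ A)
   split-old = take-drop i w ∙ ap (⟦ P ⟧ A ++_) (take-drop (# old) (drop i w) ∙
    ap (_++ ⟦ rest ⟧ A) (sames-sound perio (take (# old) (drop i w)) old e1))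
   split-new : ⟦ P ++ (new ++ rest) ⟧ A == ⟦ P ⟧ A ++ (⟦ new ⟧ A ++ ⟦ rest ⟧ A)
   split-new = (⟦++⟧ A P _) ∙ ap (⟦ P ⟧ A ++_) (⟦++⟧ A new rest)
   piece : Disk (⟦ new ⟧ A ++ rev (⟦ old ⟧ A))
   piece = tp Disk ((take-drop k (rotateBy r (word c)) ∙ ap (⟦ new ⟧ A ++_) (! (rr _)) ∙ ap (\ z -> ⟦ new ⟧ A ++ rev z) (! (⟦opposite⟧ A tail)))) (Disk-rotateBy r (word c) (good c))

  run-sound : ∀ ms w v -> run ms w == just v -> ∀ Q -> Q != [] -> Disk (⟦ w ⟧ A ++ Q) -> Disk (⟦ v ⟧ A ++ Q)
  run-sound [] w _ refl Q _ d = d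
  run-sound (m :: ms) w v e Q q d with move false m w in eq
  ... | just u = run-sound ms u v e Q q (move-sound false m w u eq Q (inr q) d)

  runClosed-sound : ∀ ms w v -> runClosed ms w == just v -> Disk (⟦ w ⟧ A) -> Disk (⟦ v ⟧ A)
  runClosed-sound [] w _ refl d = d
  runClosed-sound ((r , m) :: ms) w v e d with move true m w in eq
  ... | just u = runClosed-sound ms (rotateBy r u) v e (Disk-rotateBy r u (tp Disk (++-id _) (move-sound true m w u eq [] (inl refl) (tp Disk (! (++-id _)) d))))

infix 3 _↝_
_↝_ : Word -> Word -> Set
u ↝ v = ∀ Q -> Q != [] -> Disk (u ++ Q) -> Disk (v ++ Q)

++-≢[]ʳ : ∀ {A : Set} (u : List A) {v} -> v != [] -> u ++ v != []
++-≢[]ʳ u n e = n (I.++-conicalʳ u _ e)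

↝-refl : ∀ u -> u ↝ u
↝-refl u Q _ d = d

↝-trans : ∀ {u v w} -> u ↝ v -> v ↝ w -> u ↝ w
↝-trans h k Q q d = k Q q (h Q q d)

++-↝ : ∀ {u u' v v'} -> u ↝ u' -> v ↝ v' -> (u ++ v) ↝ (u' ++ v')
++-↝ {u} {u'} {v} {v'} h k Q q d = tp Disk (! (++-as u' v' Q)) (rotate (v' ++ Q) u' (tp Disk (e v') (k (Q ++ u') (++-≢[]ˡ Q q) (tp Disk (! (e v)) (rotate u' (v ++ Q) (h (v ++ Q) (++-≢[]ʳ v q) (tp Disk (++-as u v Q) d)))))))
 where
 e : ∀ z -> z ++ (Q ++ u') == (z ++ Q) ++ u'
 e z = ! (++-as z Q u')

↝-within : ∀ {u v} -> u ↝ v -> ∀ P S -> P ++ S != [] -> Disk (P ++ (u ++ S)) -> Disk (P ++ (v ++ S))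
↝-within {u} {v} h P S ne d = rotate (v ++ S) P (tp Disk (! (++-as v S P)) (h (S ++ P) (\ e -> ne (ap2 _++_ (I.++-conicalʳ S P e) (I.++-conicalˡ S P e))) (tp Disk (++-as u S P) (rotate P (u ++ S) d))))

pow : ℕ -> Word -> Word
pow zero w = []
pow (suc n) w = w ++ pow n w

pow-↝ : ∀ {u v} -> u ↝ v -> ∀ n -> pow n u ↝ pow n v
pow-↝ h zero = ↝-refl []
pow-↝ h (suc n) = ++-↝ h (pow-↝ h n)

pow-comm : ∀ n w -> pow n w ++ w == w ++ pow n w
pow-comm zero w = ! (++-id w)
pow-comm (suc n) w = ++-as w (pow n w) w ∙ ap (w ++_) (pow-comm n w)

-- The invariant.  With x = U_k, y = U_{k+1}, z = U_{k+2} and x̄ = U_{k+4}⁻¹ etc., the band words are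

-- x y z x⁻¹ y⁻¹ z⁻¹, ȳ z̄ y⁻¹ z⁻¹ and x̄ ȳ x⁻¹ y⁻¹ into the three kinds of bands.

data Kind : Set where
 hex left right : Kind

start end : Kind -> Frm
start hex = 2 ⁻ :: []
start left    = 2 ⁻ :: []
start right   = 4 ⁻ :: []
end hex = 0 ⁺ :: 1 ⁺ :: 2 ⁺ :: 0 ⁻ :: 1 ⁻ :: []
end left    = 5 ⁻ :: 6 ⁻ :: 1 ⁻ :: []
end right   = 5 ⁻ :: 0 ⁻ :: 1 ⁻ :: []

up down oct : Frm
up   = 0 ⁺ :: 6 ⁻ :: []
down = 0 ⁻ :: 6 ⁺ :: []
oct = 0 ⁺ :: 1 ⁺ :: 2 ⁺ :: 3 ⁺ :: 4 ⁺ :: 5 ⁺ :: 6 ⁺ :: 7 ⁺ :: []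

band : Chn -> Kind -> ℕ -> ℕ -> Word
band A κ k n = ⟦ sh k (start κ) ⟧ A ++ (pow n (⟦ sh k up ⟧ A) ++ (⟦ sh k (end κ) ⟧ A ++ pow n (⟦ sh k down ⟧ A)))

Bands : Chn -> Kind -> ℕ -> Set
Bands A κ k = ∀ n -> Disk (band A κ k n)

record Good (A : Chn) : Set where
 field
  chain : IsCh A
  whole : Disk (⟦ oct ⟧ A)
  bands : ∀ κ k -> Bands A κ k

data Piece : Set where
 whole      : Piece
 plain wide : Kind -> ℕ -> Piece

pieceWord : Piece -> Frm
pieceWord whole = oct
pieceWord (plain κ k) = sh k (start κ ++ end κ)
pieceWord (wide κ k) = sh k (start κ ++ (up ++ (end κ ++ down)))

open Derivation pieceWord public

⟦shift++⟧ : ∀ A k u v -> ⟦ sh k (u ++ v) ⟧ A == ⟦ sh k u ⟧ A ++ ⟦ sh k v ⟧ A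
⟦shift++⟧ A k u v = ap (\ z -> ⟦ z ⟧ A) (I.map-++ (shiftArc k) u v) ∙ ⟦++⟧ A (sh k u) (sh k v)

pieceGood : ∀ {A} -> Good A -> ∀ c -> Disk (⟦ pieceWord c ⟧ A)
pieceGood G whole = Good.whole G
pieceGood {A} G (plain κ k) = tp Disk (! (⟦shift++⟧ A k (start κ) (end κ) ∙
  ap (⟦ sh k (start κ) ⟧ A ++_) (! (++-id _)))) (Good.bands G κ k 0)
pieceGood {A} G (wide κ k) = tp Disk (! (⟦shift++⟧ A k (start κ) (up ++ (end κ ++ down)) ∙
  ap (⟦ sh k (start κ) ⟧ A ++_) (⟦shift++⟧ A k up (end κ ++ down) ∙ (ap2 _++_ (! (++-id _)) (⟦shift++⟧ A k (end κ) down ∙ ap (⟦ sh k (end κ) ⟧ A ++_) (! (++-id _))))))) (Good.bands G κ k 1)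

reaches : Maybe Frm -> Frm -> Bool
reaches (just v) w = sames v w
reaches nothing _ = false

module _ {A : Chn} (G : Good A) where
 private module S = Sound (Good.chain G) (pieceGood G)

 derive : ∀ u ms v -> reaches (run ms u) v == true -> ⟦ u ⟧ A ↝ ⟦ v ⟧ A
 derive u ms v e Q q d with run ms u in eq
 ... | just w = tp (\ z -> Disk (z ++ Q)) (sames-sound (IsCh.perio (Good.chain G)) w v e) (S.run-sound ms u w eq Q q d)

 deriveClosed : ∀ c r ms v -> reaches (runClosed ms (rotateBy r (pieceWord c))) v == true -> Disk (⟦ v ⟧ A)
 deriveClosed c r ms v e with runClosed ms (rotateBy r (pieceWord c)) in eq
 ... | just w = tp Disk (sames-sound (IsCh.perio (Good.chain G)) w v e) (S.runClosed-sound ms _ w eq (S.Disk-rotateBy r (pieceWord c) (pieceGood G c)))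

module _ {A : Chn} (ch : IsCh A) where
 swaps : List ℕ -> Frm -> Maybe Frm
 swaps [] w = just w
 swaps (i :: is) w with swapHead (drop i w)
 ... | just v = swaps is (take i w ++ v)
 ... | nothing = nothing

 swapHead-≡ : ∀ w v -> swapHead w == just v -> ⟦ w ⟧ A == ⟦ v ⟧ A
 swapHead-≡ (x :: y :: w) v e with exchange x y in eq
 swapHead-≡ (x :: y :: w) _ refl | just (x' , y') = ⟦++⟧ A (x :: y :: []) w ∙
  ap (_++ ⟦ w ⟧ A) (exchange-sound ch x y x' y' eq) ∙ ! (⟦++⟧ A (x' :: y' :: []) w)

 swaps-≡ : ∀ is u v -> reaches (swaps is u) v == true -> ⟦ u ⟧ A == ⟦ v ⟧ A
 swaps-≡ [] u v e = sames-sound (IsCh.perio ch) u v e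
 swaps-≡ (i :: is) u v e with swapHead (drop i u) in eq
 ... | just w = (ap (\ z -> ⟦ z ⟧ A) (! (I.take++drop≡id i u)) ∙ ⟦++⟧ A (take i u) (drop i u) ∙
   ap (⟦ take i u ⟧ A ++_) (swapHead-≡ (drop i u) w eq) ∙ ! (⟦++⟧ A (take i u) w)) ∙
   swaps-≡ is (take i u ++ w) v e

trl : ℕ -> Chn -> Chn
trl m A n = A (m N.+ n)

⟦⟧-cong : ∀ {A B} -> (∀ n -> A n == B n) -> ∀ w -> ⟦ w ⟧ A == ⟦ w ⟧ B
⟦⟧-cong e [] = refl
⟦⟧-cong e (n ⁺ :: w) = ap2 _++_ (e n) (⟦⟧-cong e w)
⟦⟧-cong e (n ⁻ :: w) = ap2 _++_ (ap rev (e n)) (⟦⟧-cong e w)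

⟦⟧-trl : ∀ A m k w -> ⟦ sh k w ⟧ (trl m A) == ⟦ sh (m N.+ k) w ⟧ A
⟦⟧-trl A m k [] = refl
⟦⟧-trl A m k (n ⁺ :: w) = ap2 _++_ (ap A (! (Q.+-assoc m k n))) (⟦⟧-trl A m k w)
⟦⟧-trl A m k (n ⁻ :: w) = ap2 _++_ (ap (\ z -> rev (A z)) (! (Q.+-assoc m k n))) (⟦⟧-trl A m k w)

⟦⟧-perio : ∀ {A} -> (∀ n -> A (8 N.+ n) == A n) -> ∀ k w -> ⟦ sh (8 N.+ k) w ⟧ A == ⟦ sh k w ⟧ A
⟦⟧-perio per k [] = refl
⟦⟧-perio per k (n ⁺ :: w) = ap2 _++_ (per (k N.+ n)) (⟦⟧-perio per k w)
⟦⟧-perio per k (n ⁻ :: w) = ap2 _++_ (ap rev (per (k N.+ n))) (⟦⟧-perio per k w)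

band-≡ : ∀ {A B κ k l} -> (∀ w -> ⟦ sh k w ⟧ A == ⟦ sh l w ⟧ B) -> ∀ n -> band A κ k n == band B κ l n
band-≡ {κ = κ} e n = ap2 _++_ (e (start κ)) (ap2 _++_ (ap (pow n) (e up)) (ap2 _++_ (e (end κ)) (ap (pow n) (e down))))

Bands-≡ : ∀ {A B κ k l} -> (∀ w -> ⟦ sh k w ⟧ A == ⟦ sh l w ⟧ B) -> Bands A κ k -> Bands B κ l
Bands-≡ {κ = κ} e h n = tp Disk (band-≡ {κ = κ} e n) (h n)

IsChain-resp : ∀ {A B} -> (∀ n -> A n == B n) -> IsCh A -> IsCh B
IsChain-resp {A} {B} e ch = record
 { perio = \ n -> ! (e (8 N.+ n)) ∙ perio n ∙ e n ; laced = \ n -> ! (ap2 _++_ (e n) (e (1 N.+ n))) ∙ laced n ∙ ap rev (ap2 _++_ (e (4 N.+ n)) (e (5 N.+ n))) ; nonem = \ n z -> nonem n (e n ∙ z) }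
 where open IsCh ch

Good-resp : ∀ {A B} -> (∀ n -> A n == B n) -> Good A -> Good B
Good-resp e G = record
 { chain = IsChain-resp e (Good.chain G) ; whole = tp Disk (⟦⟧-cong e oct) (Good.whole G) ; bands = \ κ k -> Bands-≡ {κ = κ} (\ w -> ⟦⟧-cong e (sh k w)) (Good.bands G κ k) }

IsChain-suc : ∀ {A} -> IsCh A -> IsCh (\ n -> A (suc n))
IsChain-suc {A} ch = record
 { perio = \ n -> perio (suc n) ; laced = \ n -> laced (suc n) ; nonem = \ n -> nonem (suc n) }
 where open IsCh ch

Good-suc : ∀ {A} -> Good A -> Good (\ n -> A (suc n))
Good-suc {A} G = record
 { chain = IsChain-suc (Good.chain G) ; whole = tp Disk (e (A 1) (A 2) (A 3) (A 4) (A 5) (A 6) (A 7) (A 8)) (rotate (A 8) _ (tp Disk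
  (ap (_++ (A 1 ++ (A 2 ++ (A 3 ++ (A 4 ++ (A 5 ++ (A 6 ++ (A 7 ++ [])))))))) (! (IsCh.perio (Good.chain G) 0))) (Good.whole G))) ; bands = \ κ k -> Bands-≡ {κ = κ} (\ w -> ! (⟦⟧-trl A 1 k w)) (Good.bands G κ (suc k)) }
 where
 e : ∀ a b c d e f g h -> (a ++ (b ++ (c ++ (d ++ (e ++ (f ++ (g ++ []))))))) ++ h == a ++ (b ++ (c ++ (d ++ (e ++ (f ++ (g ++ (h ++ [])))))))
 e a b c d e f g h = solve words

Good-trl : ∀ m {A} -> Good A -> Good (trl m A)
Good-trl zero G = G
Good-trl (suc m) {A} G = Good-trl m (Good-suc G)

mird : Chn -> Chn
mird A n = mir (A (7 N.* n))

swapSides : Kind -> Kind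
swapSides hex = hex
swapSides left = right
swapSides right = left

mir-pow : ∀ n w -> mir (pow n w) == pow n (mir w)
mir-pow zero w = refl
mir-pow (suc n) w = mir-++ w (pow n w) ∙ ap (_++ mir w) (mir-pow n w) ∙ pow-comm n (mir w)

reflectArc : Arc -> Arc
reflectArc (n ⁺) = (7 N.* n) ⁺
reflectArc (n ⁻) = (7 N.* n) ⁻

reflected : Frm -> Frm
reflected [] = []
reflected (x :: w) = reflected w ++ (reflectArc x :: [])

⟦mirrored⟧ : ∀ A w -> ⟦ w ⟧ (mird A) == mir (⟦ reflected w ⟧ A)
⟦mirrored⟧ A [] = refl
⟦mirrored⟧ A (x :: w) = (ap2 _++_ (arcCase x) (⟦mirrored⟧ A w)) ∙
  ! (mir-++ (⟦ reflected w ⟧ A) _) ∙ ap mir (! (⟦++⟧ A (reflected w) _))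
 where
 arcCase : ∀ y -> arc (mird A) y == mir (⟦ reflectArc y :: [] ⟧ A)
 arcCase (n ⁺) = ap mir (! (++-id (A (7 N.* n))))
 arcCase (n ⁻) = ! (mir-rev (A (7 N.* n))) ∙ ap mir (! (++-id (rev (A (7 N.* n)))))

front mid : Kind -> Frm
front hex = 0 ⁺ :: 1 ⁺ :: 2 ⁺ :: []
front left    = 5 ⁻ :: []
front right   = 5 ⁻ :: []
mid hex = 0 ⁻ :: []
mid left    = 6 ⁻ :: []
mid right   = 0 ⁻ :: []

frontSwaps : Kind -> List ℕ
frontSwaps hex = 2 :: 1 :: []
frontSwaps _       = 1 :: 0 :: []

end-split : ∀ κ -> end κ == front κ ++ (mid κ ++ (1 ⁻ :: []))
end-split hex = refl
end-split left = refl
end-split right = refl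

pow-slide : ∀ n {u v w} -> u ++ w == w ++ v -> pow n u ++ w == w ++ pow n v
pow-slide zero {w = w} e = ! (++-id w)
pow-slide (suc n) {u} {v} {w} e = ((++-as u _ w) ∙ ap (u ++_) (pow-slide n e) ∙ ! (++-as u w _) ∙ ap (_++ pow n v) e ∙ (++-as w v _))

up' down' : Frm
up'   = 4 ⁻ :: 2 ⁺ :: []
down' = 4 ⁺ :: 2 ⁻ :: []

turned : ∀ K F M G u v u' v' -> u ++ F == F ++ u' -> G ++ v == v' ++ G -> ∀ n ->
     Disk (K ++ (pow n u ++ ((F ++ (M ++ G)) ++ pow n v))) ->
     Disk (pow n v' ++ ((G ++ (K ++ F)) ++ (pow n u' ++ M)))
turned K F M G u v u' v' e1 e2 n d = tp Disk (f2 K F M G (pow n u') (pow n v')) (rotate (K ++ (F ++ (pow n u' ++ M))) (pow n v' ++ G) (tp Disk eq d))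
 where
 f1 : ∀ K F M G u v -> K ++ (u ++ ((F ++ (M ++ G)) ++ v)) == K ++ ((u ++ F) ++ (M ++ (G ++ v)))
 f1 K F M G u v = solve words
 f2 : ∀ K F M G u v -> (v ++ G) ++ (K ++ (F ++ (u ++ M))) == v ++ ((G ++ (K ++ F)) ++ (u ++ M))
 f2 K F M G u v = solve words
 f3 : ∀ K F M G u v -> K ++ ((F ++ u) ++ (M ++ (v ++ G))) == (K ++ (F ++ (u ++ M))) ++ (v ++ G)
 f3 K F M G u v = solve words
 eq : K ++ (pow n u ++ ((F ++ (M ++ G)) ++ pow n v)) == (K ++ (F ++ (pow n u' ++ M))) ++ (pow n v' ++ G)
 eq = (f1 K F M G (pow n u) (pow n v) ∙ ap2 (\ a b -> K ++ (a ++ (M ++ b))) (pow-slide n e1) (! (pow-slide n (! e2))) ∙ f3 K F M G (pow n u') (pow n v'))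

module _ {A : Chn} (ch : IsCh A) (κ : Kind) (k m : ℕ) (c1 : sames (reflected (sh k (start (swapSides κ)))) (sh m (mid κ)) == true)
 (c2 : sames (reflected (sh k (end (swapSides κ)))) (sh m ((1 ⁻ :: []) ++ (start κ ++ front κ))) == true) (c3 : sames (reflected (sh k up)) (sh m up') == true) (c4 : sames (reflected (sh k down)) (sh m down') == true)
 (c5 : reaches (swaps ch (frontSwaps κ) (sh m (up ++ front κ))) (sh m (front κ ++ up')) == true) (c6 : reaches (swaps ch (0 :: 1 :: []) (sh m ((1 ⁻ :: []) ++ down))) (sh m (down' ++ (1 ⁻ :: []))) == true)
 where
 private
  s : Frm -> Word
  s w = ⟦ sh m w ⟧ A
  via : ∀ u v -> sames (reflected u) (sh m v) == true -> ⟦ u ⟧ (mird A) == mir (s v)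
  via u v c = ⟦mirrored⟧ A u ∙ ap mir (sames-sound (IsCh.perio ch) (reflected u) (sh m v) c)

 Bands-mird : Bands A κ m -> Bands (mird A) (swapSides κ) k
 Bands-mird h n = tp Disk (! eq) (Disk-mir (turned (s (start κ)) (s (front κ)) (s (mid κ)) (s (1 ⁻ :: [])) (s up) (s down) (s up') (s down')
  (! (⟦shift++⟧ A m up (front κ)) ∙ swaps-≡ ch (frontSwaps κ) (sh m (up ++ front κ)) (sh m (front κ ++ up')) c5 ∙ ⟦shift++⟧ A m (front κ) up')
  (! (⟦shift++⟧ A m (1 ⁻ :: []) down) ∙ swaps-≡ ch (0 :: 1 :: []) (sh m ((1 ⁻ :: []) ++ down)) (sh m (down' ++ (1 ⁻ :: []))) c6 ∙ ⟦shift++⟧ A m down' (1 ⁻ :: [])) n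
  (tp (\ z -> Disk (s (start κ) ++ (pow n (s up) ++ (z ++ pow n (s down))))) e-end (h n))))
  where
  e-end : s (end κ) == s (front κ) ++ (s (mid κ) ++ s (1 ⁻ :: []))
  e-end = ap s (end-split κ) ∙ (⟦shift++⟧ A m (front κ) _) ∙ ap (s (front κ) ++_) (⟦shift++⟧ A m (mid κ) _)
  e-core : s ((1 ⁻ :: []) ++ (start κ ++ front κ)) == s (1 ⁻ :: []) ++ (s (start κ) ++ s (front κ))
  e-core = ⟦shift++⟧ A m (1 ⁻ :: []) (start κ ++ front κ) ∙ ap (s (1 ⁻ :: []) ++_) (⟦shift++⟧ A m (start κ) (front κ))
  Kˢ Fˢ Uˢ Dˢ : Word
  Kˢ = s (mid κ)
  Fˢ = s ((1 ⁻ :: []) ++ (start κ ++ front κ))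
  Uˢ = s up'
  Dˢ = s down'
  eq : band (mird A) (swapSides κ) k n ==
     mir (pow n Dˢ ++ ((s (1 ⁻ :: []) ++ (s (start κ) ++ s (front κ))) ++ (pow n Uˢ ++ Kˢ)))
  eq = ((ap2 _++_ (via (sh k (start (swapSides κ))) (mid κ) c1) (ap2 _++_ (ap (pow n) (via (sh k up) up' c3)) (ap2 _++_ (via (sh k (end (swapSides κ))) ((1 ⁻ :: []) ++ (start κ ++ front κ)) c2) (ap (pow n) (via (sh k down) down' c4))))) ∙ ap2 (\ a b -> mir Kˢ ++ (a ++ (mir Fˢ ++ b))) (! (mir-pow n Uˢ)) (! (mir-pow n Dˢ)) ∙ ap (\ z -> mir Kˢ ++ (mir (pow n Uˢ) ++ z)) (! (mir-++ (pow n Dˢ) Fˢ)) ∙ ! (++-as (mir Kˢ) _ _) ∙ ap (_++ mir (pow n Dˢ ++ Fˢ)) (! (mir-++ (pow n Uˢ) Kˢ)) ∙ ! (mir-++ (pow n Dˢ ++ Fˢ) (pow n Uˢ ++ Kˢ)) ∙ ap mir ((++-as (pow n Dˢ) Fˢ _) ∙ ap (\ z -> pow n Dˢ ++ (z ++ (pow n Uˢ ++ Kˢ))) e-core))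

im : (ℕ -> Frm) -> Frm -> Frm
im φ [] = []
im φ (n ⁺ :: w) = φ n ++ im φ w
im φ (n ⁻ :: w) = oppo (φ n) ++ im φ w

lftd : (ℕ -> Frm) -> Chn -> Chn
lftd φ A n = ⟦ φ n ⟧ A

⟦image⟧ : ∀ φ A w -> ⟦ im φ w ⟧ A == ⟦ w ⟧ (lftd φ A)
⟦image⟧ φ A [] = refl
⟦image⟧ φ A (n ⁺ :: w) = ⟦++⟧ A (φ n) (im φ w) ∙ ap (⟦ φ n ⟧ A ++_) (⟦image⟧ φ A w)
⟦image⟧ φ A (n ⁻ :: w) = ⟦++⟧ A (oppo (φ n)) (im φ w) ∙ (ap2 _++_ (⟦opposite⟧ A (φ n)) (⟦image⟧ φ A w))

fT gT : ℕ -> Frm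
fT 0 = 5 ⁻ :: 4 ⁻ :: 3 ⁻ :: []
fT 4 = 1 ⁻ :: 0 ⁻ :: 7 ⁻ :: []
fT n = n ⁺ :: []
gT 0 = 2 ⁻ :: 1 ⁻ :: 0 ⁻ :: 7 ⁻ :: 6 ⁻ :: []
gT 1 = 4 ⁺ :: 5 ⁺ :: 6 ⁺ :: []
gT 2 = 4 ⁻ :: 3 ⁻ :: 2 ⁻ :: 1 ⁻ :: 0 ⁻ :: []
gT 3 = 6 ⁺ :: 7 ⁺ :: 0 ⁺ :: []
gT 4 = 6 ⁻ :: 5 ⁻ :: 4 ⁻ :: 3 ⁻ :: 2 ⁻ :: []
gT 5 = 0 ⁺ :: 1 ⁺ :: 2 ⁺ :: []
gT 6 = 0 ⁻ :: 7 ⁻ :: 6 ⁻ :: 5 ⁻ :: 4 ⁻ :: []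
gT _ = 2 ⁺ :: 3 ⁺ :: 4 ⁺ :: []

fSub gSub : ℕ -> Frm
fSub n = fT (n N.% 8)
gSub n = gT (n N.% 8)

eight : (P : ℕ -> Set) -> P 0 -> P 1 -> P 2 -> P 3 -> P 4 -> P 5 -> P 6 -> P 7 -> ∀ n -> P (n N.% 8)
eight P p₀ p1 p2 p3 p4 p5 p6 p7 n = go (n N.% 8) (ND.m%n<n n 8)
 where
 go : ∀ m -> m < 8 -> P m
 go 0 _ = p₀
 go 1 _ = p1
 go 2 _ = p2
 go 3 _ = p3
 go 4 _ = p4
 go 5 _ = p5
 go 6 _ = p6
 go 7 _ = p7
 go (suc (suc (suc (suc (suc (suc (suc (suc m)))))))) (N.s≤s (N.s≤s (N.s≤s (N.s≤s (N.s≤s (N.s≤s (N.s≤s (N.s≤s ()))))))))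

Perio : Chn -> Set
Perio A = ∀ n -> A (8 N.+ n) == A n

agree : ∀ {V W} -> Perio V -> Perio W -> V 0 == W 0 -> V 1 == W 1 -> V 2 == W 2 -> V 3 == W 3 ->
    V 4 == W 4 -> V 5 == W 5 -> V 6 == W 6 -> V 7 == W 7 -> ∀ n -> V n == W n
agree {V} {W} pV pW e0 e1 e2 e3 e4 e5 e6 e7 n =
 mod8 pV n ∙ eight (\ m -> V m == W m) e0 e1 e2 e3 e4 e5 e6 e7 n ∙ ! (mod8 pW n)

translated : ∀ {A} -> Perio A -> ∀ m u w -> sames u (sh (m N.+ 0) w) == true -> ⟦ u ⟧ A == ⟦ sh 0 w ⟧ (trl m A)
translated {A} per m u w c = sames-sound per u (sh (m N.+ 0) w) c ∙ ! (⟦⟧-trl A m 0 w)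

Perio-trl : ∀ {A} m -> Perio A -> Perio (trl m A)
Perio-trl {A} m per n = ap A (e m n) ∙ per (m N.+ n)
 where
 e : ∀ m n -> m N.+ (8 N.+ n) == 8 N.+ (m N.+ n)
 e m n = ! (Q.+-assoc m 8 n) ∙ ap (N._+ n) (Q.+-comm m 8) ∙ Q.+-assoc 8 m n

Perio-mird : ∀ {A} -> Perio A -> Perio (mird A)
Perio-mird {A} per n = ap mir (ap A (Q.*-distribˡ-+ 7 8 n ∙ Q.+-comm 56 (7 N.* n)) ∙ perio-* per 7 (7 N.* n))

Bands-trl : ∀ {V W} κ k m -> (∀ n -> trl m V n == W n) -> Bands W κ k -> Bands V κ (m N.+ k)
Bands-trl {V} κ k m e = Bands-≡ {κ = κ} \ w -> ⟦⟧-cong (\ n -> ! (e n)) (sh k w) ∙ ⟦⟧-trl V m k w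

IsChain-trl : ∀ m {A} -> IsCh A -> IsCh (trl m A)
IsChain-trl zero ch = ch
IsChain-trl (suc m) ch = IsChain-trl m (IsChain-suc ch)

module _ {A : Chn} (ch : IsCh A) where
 open IsCh ch

 mird-chain : IsCh (mird A)
 mird-chain = record { perio = Perio-mird perio ; laced = inter ; nonem = \ n -> mir-≢[] _ (nonem (7 N.* n)) }
  where
  arith : ∀ k n -> A (7 N.* (k N.+ n)) == A (7 N.* k N.+ 7 N.* n)
  arith k n = ap A (Q.*-distribˡ-+ 7 k n)
  -- 7 (k + n) = (7 k - 7) + (7 + 7 n), and U_{7+7n} is the second word of the mirrored pair.
  inter : ∀ n -> mird A n ++ mird A (1 N.+ n) == rev (mird A (4 N.+ n) ++ mird A (5 N.+ n))
  inter n = (! (mir-++ (A (7 N.* (1 N.+ n))) (A (7 N.* n))) ∙ ap2 (\ a b -> mir (a ++ b)) (arith 1 n) (! (perio (7 N.* n))) ∙ ap mir (laced m) ∙ mir-rev (A (4 N.+ m) ++ A (5 N.+ m)) ∙ ap rev (mir-++ (A (4 N.+ m)) (A (5 N.+ m))) ∙ ap2 (\ a b -> rev (mir a ++ mir b)) (e 4 tt) (e 5 tt))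
   where
   m : ℕ
   m = 7 N.+ 7 N.* n
   e : ∀ k -> T ((7 N.* k N.% 8) ≡ᵇ ((9 N.∸ k N.+ 7) N.% 8)) -> A (9 N.∸ k N.+ m) == A (7 N.* (k N.+ n))
   e k c = ap A (! (Q.+-assoc (9 N.∸ k) 7 (7 N.* n))) ∙ congr (9 N.∸ k N.+ 7) (7 N.* k) (! (Q.≡ᵇ⇒≡ (7 N.* k N.% 8) ((9 N.∸ k N.+ 7) N.% 8) c)) ∙
        ! (arith k n)
    where
    congr : ∀ a b -> a N.% 8 == b N.% 8 -> A (a N.+ 7 N.* n) == A (b N.+ 7 N.* n)
    congr a b h = ap A (Q.+-comm a (7 N.* n)) ∙ step' a ∙ ap (\ z -> A (7 N.* n N.+ z)) h ∙
     ! (step' b) ∙ ap A (Q.+-comm (7 N.* n) b)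
     where
     step' : ∀ a -> A (7 N.* n N.+ a) == A (7 N.* n N.+ a N.% 8)
     step' a = mod8 (Perio-trl (7 N.* n) perio) a

 mird-trl : ∀ n -> trl 1 (mird A) n == mird (trl 7 A) n
 mird-trl n = ap (\ z -> mir (A z)) (Q.*-distribˡ-+ 7 1 n)

mird-bands : ∀ {A} -> Good A -> ∀ κ k -> Bands (mird A) κ k
mird-bands G hex zero = Bands-mird (Good.chain G) hex 0 6 refl refl refl refl refl refl (Good.bands G hex 6)
mird-bands G left zero = Bands-mird (Good.chain G) right 0 6 refl refl refl refl refl refl (Good.bands G right 6)
mird-bands G right zero = Bands-mird (Good.chain G) left 0 6 refl refl refl refl refl refl (Good.bands G left 6)
mird-bands G κ (suc k) = Bands-trl κ k 1 (mird-trl (Good.chain G)) (mird-bands (Good-trl 7 G) κ k)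

Good-mird : ∀ {A} -> Good A -> Good (mird A)
Good-mird {A} G = record { chain = mird-chain ch ; whole = whole' ; bands = mird-bands G }
 where
 ch = Good.chain G
 whole' : Disk (⟦ oct ⟧ (mird A))
 whole' = tp Disk (! (⟦mirrored⟧ A oct ∙ ap mir (sames-sound (IsCh.perio ch) (reflected oct) (rotateBy 1 oct) refl))) (Disk-mir (Sound.Disk-rotateBy ch (pieceGood G) 1 oct (Good.whole G)))

module _ {y T B Z : Word} (h : y ↝ (T ++ (y ++ B))) (Z≢ : Z != []) where
 iterate : Disk (y ++ Z) -> ∀ n -> Disk (pow n T ++ (y ++ (pow n B ++ Z)))
 iterate d zero = d
 iterate d (suc n) = tp Disk (e (pow n T) T y B (pow n B) Z ∙ ap (_++ (y ++ ((B ++ pow n B) ++ Z))) (pow-comm n T)) (↝-within h (pow n T) (pow n B ++ Z) (++-≢[]ʳ (pow n T) (++-≢[]ʳ (pow n B) Z≢)) (iterate d n))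
  where
  e : ∀ t T y B b Z -> t ++ ((T ++ (y ++ B)) ++ (b ++ Z)) == (t ++ T) ++ (y ++ ((B ++ b) ++ Z))
  e t T y B b Z = solve words

bandOf : Word -> Word -> Word -> Word -> ℕ -> Word
bandOf K B F T n = K ++ (pow n B ++ (F ++ pow n T))

close1 : ∀ {K B F T y} -> y ↝ (T ++ (y ++ B)) -> y ↝ (T ++ (K ++ B)) -> F != [] -> Disk (y ++ F) -> ∀ n -> Disk (bandOf K B F T (suc n))
close1 {K} {B} {F} {T} {y} h l F≢ d n = tp Disk (e2 K (B ++ pow n B) F (T ++ pow n T)) (rotate (T ++ pow n T) _ (tp Disk (e1 (pow n T) T K B (pow n B) F ∙ ap (_++ (K ++ ((B ++ pow n B) ++ F))) (pow-comm n T))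
 (↝-within l (pow n T) (pow n B ++ F) (++-≢[]ʳ (pow n T) (++-≢[]ʳ (pow n B) F≢)) (iterate h F≢ d n))))
 where
 e1 : ∀ t T y B b Z -> t ++ ((T ++ (y ++ B)) ++ (b ++ Z)) == (t ++ T) ++ (y ++ ((B ++ b) ++ Z))
 e1 t T y B b Z = solve words
 e2 : ∀ K B F T -> (K ++ (B ++ F)) ++ T == K ++ (B ++ (F ++ T))
 e2 K B F T = solve words

convert : ∀ {K K' B B' F F' T T'} -> K ↝ K' -> B ↝ B' -> F ↝ F' -> T ↝ T' -> ∀ Q -> Q != [] ->
     ∀ n -> Disk (Q ++ bandOf K B F T n) -> Disk (Q ++ bandOf K' B' F' T' n)
convert {K} {K'} {B} {B'} {F} {F'} {T} {T'} k b f t Q q n d = rotate (bandOf K' B' F' T' n) Q (++-↝ k (++-↝ (pow-↝ b n) (++-↝ f (pow-↝ t n))) Q q (rotate Q (bandOf K B F T n) d))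

convertNonempty : ∀ {K B B' F T T'} -> K != [] -> B ↝ B' -> T ↝ T' -> ∀ n -> Disk (bandOf K B F T n) -> Disk (bandOf K B' F T' n)
convertNonempty {K} {B} {B'} {F} {T} {T'} K≢ b t n d =
 convert {[]} {[]} {B} {B'} {F} {F} {T} {T'} (↝-refl []) b (↝-refl F) t K K≢ n d

close2 : ∀ {K B B' F T T' y} -> K != [] -> F != [] -> y ↝ (T ++ (y ++ B)) -> y ↝ (K ++ B) -> B ↝ B' -> T ↝ T' ->
     Disk (T ++ (y ++ F)) -> ∀ n -> Disk (bandOf K B' F T' (suc n))
close2 {K} {B} {B'} {F} {T} {T'} {y} K≢ F≢ h l b t d n = convertNonempty {K} {B} {B'} {F} {T} {T'} K≢ b t (suc n) (tp Disk (e2 K B (pow n B) F T (pow n T)) (rotate (pow n T) _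
 (↝-within l (pow n T) (pow n B ++ (F ++ T)) (++-≢[]ʳ (pow n T) (++-≢[]ʳ (pow n B) (++-≢[]ˡ F F≢))) (iterate h (++-≢[]ˡ F F≢) (tp Disk (e1 y F T) (rotate T (y ++ F) d)) n))))
 where
 e1 : ∀ y F T -> (y ++ F) ++ T == y ++ (F ++ T)
 e1 y F T = solve words
 e2 : ∀ K B b F T t -> ((K ++ B) ++ (b ++ (F ++ T))) ++ t == K ++ ((B ++ b) ++ (F ++ (T ++ t)))
 e2 K B b F T t = solve words

close3 : ∀ {K' K B1 B F T X} -> K' != [] -> F != [] -> X ↝ (B1 ++ (X ++ T)) -> X ↝ (F ++ T) -> K' ↝ (K ++ B) -> B1 ↝ B ->
     Disk (K' ++ X) -> ∀ n -> Disk (bandOf K B F T (suc n))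
close3 {K'} {K} {B1} {B} {F} {T} {X} K≢ F≢ h l k b d n = tp Disk (e2 K B (pow n B) tail) (↝-within (pow-↝ b n) (K ++ B) tail (++-≢[]ʳ (K ++ B) tail≢)
 (k (pow n B1 ++ tail) (++-≢[]ʳ (pow n B1) tail≢) (rotate (pow n B1 ++ tail) K' (tp Disk (e1 (pow n B1) F T (pow n T) K') (↝-within l (pow n B1) (pow n T ++ K') (++-≢[]ʳ (pow n B1) (++-≢[]ʳ (pow n T) K≢))
 (iterate h K≢ (rotate K' X d) n))))))
 where
 tail : Word
 tail = F ++ (T ++ pow n T)
 tail≢ : tail != []
 tail≢ = ++-≢[]ˡ F F≢
 e1 : ∀ b F T t K -> b ++ ((F ++ T) ++ (t ++ K)) == (b ++ (F ++ (T ++ t))) ++ K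
 e1 b F T t K = solve words
 e2 : ∀ K B b t -> (K ++ B) ++ (b ++ t) == K ++ ((B ++ b) ++ t)
 e2 K B b t = solve words

module Lift {A : Chn} (φ : ℕ -> Frm) (G : Good A) where
 V : Chn
 V = lftd φ A

 ch : IsCh A
 ch = Good.chain G

 img : Frm -> Word
 img w = ⟦ im φ w ⟧ A

 imageBand : Kind -> ℕ -> ℕ -> Word
 imageBand κ k = bandOf (img (sh k (start κ))) (img (sh k up)) (img (sh k (end κ))) (img (sh k down))

 fromImage : ∀ κ k n -> Disk (imageBand κ k n) -> Disk (band V κ k n)
 fromImage κ k n = tp Disk (ap2 _++_ (e (start κ)) (ap2 _++_ (ap (pow n) (e up)) (ap2 _++_ (e (end κ)) (ap (pow n) (e down)))))
  where
  e : ∀ w -> img (sh k w) == ⟦ sh k w ⟧ V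
  e w = ⟦image⟧ φ A (sh k w)

 single : ∀ κ k -> Disk (img (sh k (start κ) ++ sh k (end κ))) -> Disk (band V κ k 0)
 single κ k d = fromImage κ k 0 (tp Disk (ap (\ z -> ⟦ z ⟧ A) (image-++ (sh k (start κ)) _) ∙ (⟦++⟧ A (im φ (sh k (start κ))) _) ∙ ap (img (sh k (start κ)) ++_) (! (++-id _))) d)
  where
  image-++ : ∀ u v -> im φ (u ++ v) == im φ u ++ im φ v
  image-++ [] v = refl
  image-++ (n ⁺ :: u) v = ap (φ n ++_) (image-++ u v) ∙ ! (++-as (φ n) _ _)
  image-++ (n ⁻ :: u) v = ap (oppo (φ n) ++_) (image-++ u v) ∙ ! (++-as (oppo (φ n)) _ _)

 join : ∀ u v -> Disk (⟦ u ++ v ⟧ A) -> Disk (⟦ u ⟧ A ++ ⟦ v ⟧ A)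
 join u v = tp Disk (⟦++⟧ A u v)

 join↝ : ∀ {x} u v -> x ↝ ⟦ u ++ v ⟧ A -> x ↝ (⟦ u ⟧ A ++ ⟦ v ⟧ A)
 join↝ {x} u v h Q q d = tp (\ z -> Disk (z ++ Q)) (⟦++⟧ A u v) (h Q q d)

 join↝3 : ∀ {x} u v t -> x ↝ ⟦ u ++ (v ++ t) ⟧ A -> x ↝ (⟦ u ⟧ A ++ (⟦ v ⟧ A ++ ⟦ t ⟧ A))
 join↝3 {x} u v t h Q q d = tp (\ z -> Disk ((⟦ u ⟧ A ++ z) ++ Q)) (⟦++⟧ A v t) (join↝ {x} u (v ++ t) h Q q d)

 chainOf : (∀ n -> ⟦ φ n ⟧ A != []) -> Perio V -> (∀ n -> ⟦ im φ (n ⁺ :: (1 N.+ n) ⁺ :: []) ⟧ A == ⟦ im φ ((5 N.+ n) ⁻ :: (4 N.+ n) ⁻ :: []) ⟧ A) -> IsCh V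
 chainOf ne per h = record { perio = per ; nonem = ne ; laced = \ n -> (ap (V n ++_) (! (++-id _)) ∙ ! (⟦image⟧ φ A (n ⁺ :: (1 N.+ n) ⁺ :: [])) ∙ h n ∙ ⟦image⟧ φ A ((5 N.+ n) ⁻ :: (4 N.+ n) ⁻ :: []) ∙ ap (rev (V (5 N.+ n)) ++_) (++-id _) ∙ ! (rev-++ (V (4 N.+ n)) (V (5 N.+ n)))) }

 wholeOf : Disk (img oct) -> Disk (⟦ oct ⟧ V)
 wholeOf = tp Disk (⟦image⟧ φ A oct)

arcs≢ : ∀ {A} -> IsCh A -> ∀ w -> neᵇ w == true -> ⟦ w ⟧ A != []
arcs≢ ch (x :: w) _ = ⟦⟧-nonem (IsCh.nonem ch) x w

module FLift {A : Chn} (G : Good A) where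
 open Lift fSub G public

 f-chain : IsCh V
 f-chain = chainOf (\ n -> ne (n N.% 8)) (\ n -> refl) inter
  where
  ne : ∀ m -> ⟦ fT m ⟧ A != []
  ne 0 = arcs≢ ch (fT 0) refl
  ne 1 = arcs≢ ch (fT 1) refl
  ne 2 = arcs≢ ch (fT 2) refl
  ne 3 = arcs≢ ch (fT 3) refl
  ne 4 = arcs≢ ch (fT 4) refl
  ne (suc (suc (suc (suc (suc m))))) = arcs≢ ch ((5 N.+ m) ⁺ :: []) refl
  eq : ∀ n i -> reaches (swaps ch (i :: []) (im fSub (n ⁺ :: (1 N.+ n) ⁺ :: []))) (im fSub ((5 N.+ n) ⁻ :: (4 N.+ n) ⁻ :: [])) == true ->
     ⟦ im fSub (n ⁺ :: (1 N.+ n) ⁺ :: []) ⟧ A == ⟦ im fSub ((5 N.+ n) ⁻ :: (4 N.+ n) ⁻ :: []) ⟧ A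
  eq n i = swaps-≡ ch (i :: []) (im fSub (n ⁺ :: (1 N.+ n) ⁺ :: [])) (im fSub ((5 N.+ n) ⁻ :: (4 N.+ n) ⁻ :: []))
  inter : ∀ n -> ⟦ im fSub (n ⁺ :: (1 N.+ n) ⁺ :: []) ⟧ A == ⟦ im fSub ((5 N.+ n) ⁻ :: (4 N.+ n) ⁻ :: []) ⟧ A
  inter 0 = eq 0 1 refl
  inter 1 = eq 1 0 refl
  inter 2 = eq 2 0 refl
  inter 3 = eq 3 1 refl
  inter 4 = eq 4 1 refl
  inter 5 = eq 5 0 refl
  inter 6 = eq 6 0 refl
  inter 7 = eq 7 1 refl
  inter (suc (suc (suc (suc (suc (suc (suc (suc n)))))))) = inter n

 f-whole : Disk (⟦ oct ⟧ V)
 f-whole = wholeOf (deriveClosed G whole 0 ((0 , swap 3) :: (0 , swap 0) :: (0 , paste 2 (plain hex 1) 0 5) :: []) (im fSub oct) refl)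

 f-bands-unaffected : ∀ κ -> Bands V κ 1
 f-bands-unaffected hex n = fromImage hex 1 n (Good.bands G hex 1 n)
 f-bands-unaffected left n = fromImage left 1 n (Good.bands G left 1 n)
 f-bands-unaffected right n = fromImage right 1 n (Good.bands G right 1 n)

 -- Lifting the middle word turns the n-th band into the (n+1)-st.
 f-bands-middle : ∀ κ -> Bands V κ 3
 f-bands-middle κ n = fromImage κ 3 n (case κ)
  where
  advance : ∀ {K K' B B' F F' T T'} -> K == K' -> B == B' -> T == T' -> B ++ (F ++ T) == F' -> Disk (bandOf K B F T (suc n)) -> Disk (bandOf K' B' F' T' n)
  advance {K} {_} {B} {_} {F} {_} {T} refl refl refl refl = tp Disk (ap (\ z -> K ++ (z ++ (F ++ (T ++ pow n T)))) (! (pow-comm n B)) ∙ e K B (pow n B) F T (pow n T))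
   where
   e : ∀ K B b F T t -> K ++ ((b ++ B) ++ (F ++ (T ++ t))) == K ++ (b ++ ((B ++ (F ++ T)) ++ t))
   e K B b F T t = solve words
  sm : ∀ u v -> sames u v == true -> ⟦ u ⟧ A == ⟦ v ⟧ A
  sm = sames-sound (IsCh.perio ch)
  mid-≡ : ∀ κ is -> reaches (swaps ch is (sh 3 up ++ (sh 3 (end κ) ++ sh 3 down))) (im fSub (sh 3 (end κ))) == true ->
      ⟦ sh 3 up ⟧ A ++ (⟦ sh 3 (end κ) ⟧ A ++ ⟦ sh 3 down ⟧ A) == img (sh 3 (end κ))
  mid-≡ κ is c = ap (⟦ sh 3 up ⟧ A ++_) (! (⟦++⟧ A (sh 3 (end κ)) (sh 3 down))) ∙
   ! (⟦++⟧ A (sh 3 up) (sh 3 (end κ) ++ sh 3 down)) ∙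
    swaps-≡ ch is (sh 3 up ++ (sh 3 (end κ) ++ sh 3 down)) (im fSub (sh 3 (end κ))) c
  case : ∀ κ -> Disk (imageBand κ 3 n)
  case hex = advance {⟦ sh 3 (start hex) ⟧ A} {_} {⟦ sh 3 up ⟧ A} {_} {⟦ sh 3 (end hex) ⟧ A} {_} {⟦ sh 3 down ⟧ A} (sm (sh 3 (start hex)) (im fSub (sh 3 (start hex))) refl) (sm (sh 3 up) (im fSub (sh 3 up)) refl) (sm (sh 3 down) (im fSub (sh 3 down)) refl) (mid-≡ hex (6 :: 2 :: []) refl) (Good.bands G hex 3 (suc n))
  case left = advance {⟦ sh 3 (start left) ⟧ A} {_} {⟦ sh 3 up ⟧ A} {_} {⟦ sh 3 (end left) ⟧ A} {_} {⟦ sh 3 down ⟧ A} (sm (sh 3 (start left)) (im fSub (sh 3 (start left))) refl) (sm (sh 3 up) (im fSub (sh 3 up)) refl) (sm (sh 3 down) (im fSub (sh 3 down)) refl) (mid-≡ left (4 :: 1 :: []) refl) (Good.bands G left 3 (suc n))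
  case right = advance {⟦ sh 3 (start right) ⟧ A} {_} {⟦ sh 3 up ⟧ A} {_} {⟦ sh 3 (end right) ⟧ A} {_} {⟦ sh 3 down ⟧ A} (sm (sh 3 (start right)) (im fSub (sh 3 (start right))) refl) (sm (sh 3 up) (im fSub (sh 3 up)) refl) (sm (sh 3 down) (im fSub (sh 3 down)) refl) (mid-≡ right (4 :: 1 :: []) refl) (Good.bands G right 3 (suc n))

 private
  F≢ : ∀ κ -> img (end κ) != []
  F≢ hex = arcs≢ ch (im fSub (end hex)) refl
  F≢ left = arcs≢ ch (im fSub (end left)) refl
  F≢ right = arcs≢ ch (im fSub (end right)) refl
  y : Frm
  y = 0 ⁻ :: 6 ⁺ :: 2 ⁻ :: 0 ⁺ :: 6 ⁻ :: []
  y-step : ⟦ y ⟧ A ↝ (img down ++ (⟦ y ⟧ A ++ img up))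
  y-step = join↝3 {⟦ y ⟧ A} (im fSub down) y (im fSub up) (derive G y (paste 1 (plain left 1) 2 3 :: swap 3 :: swap 4 :: swap 0 :: paste 3 (wide left 0) 5 7 :: swap 2 :: []) (im fSub down ++ (y ++ im fSub up)) refl)
  y-last : ⟦ y ⟧ A ↝ (img down ++ (⟦ 2 ⁻ :: [] ⟧ A ++ img up))
  y-last = join↝3 {⟦ y ⟧ A} (im fSub down) (2 ⁻ :: []) (im fSub up)
   (derive G y (paste 1 (plain left 1) 2 3 :: swap 3 :: swap 4 :: swap 0 :: paste 3 (plain left 0) 3 3 :: swap 2 :: []) (im fSub down ++ ((2 ⁻ :: []) ++ im fSub up)) refl)
  end-step : ∀ κ -> κ != right -> ⟦ end κ ⟧ A ↝ img (end κ)
  end-step hex _ = derive G (end hex) (swap 0 :: paste 2 (plain hex 1) 0 5 :: swap 6 :: []) (im fSub (end hex)) refl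
  end-step left _ = ↝-refl _
  end-step right r = !! (r refl)
  initial : ∀ κ -> κ != right -> Disk (⟦ y ⟧ A ++ ⟦ end κ ⟧ A)
  initial κ r = tp Disk (ap (_++ ⟦ end κ ⟧ A) (ap (⟦ down ⟧ A ++_) (! (⟦++⟧ A (2 ⁻ :: []) up)) ∙ ! (⟦++⟧ A down ((2 ⁻ :: []) ++ up))))
   (tp Disk (e (⟦ down ⟧ A) (⟦ 2 ⁻ :: [] ⟧ A) (⟦ up ⟧ A) (⟦ end κ ⟧ A)) (rotate (⟦ 2 ⁻ :: [] ⟧ A ++ (⟦ up ⟧ A ++ ⟦ end κ ⟧ A)) (⟦ down ⟧ A) (tp Disk (e' κ r) (Good.bands G κ 0 1))))
   where
   e : ∀ d k u f -> d ++ (k ++ (u ++ f)) == (d ++ (k ++ u)) ++ f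
   e d k u f = solve words
   f1 : ∀ d k u f -> k ++ ((u ++ []) ++ (f ++ (d ++ []))) == (k ++ (u ++ f)) ++ d
   f1 d k u f = solve words
   e' : ∀ κ -> κ != right -> band A κ 0 1 == (⟦ 2 ⁻ :: [] ⟧ A ++ (⟦ up ⟧ A ++ ⟦ end κ ⟧ A)) ++ ⟦ down ⟧ A
   e' hex _ = f1 (⟦ down ⟧ A) (⟦ 2 ⁻ :: [] ⟧ A) (⟦ up ⟧ A) (⟦ end hex ⟧ A)
   e' left _ = f1 (⟦ down ⟧ A) (⟦ 2 ⁻ :: [] ⟧ A) (⟦ up ⟧ A) (⟦ end left ⟧ A)
   e' right r = !! (r refl)
  grown : ∀ κ -> κ != right -> ∀ n -> Disk (bandOf (⟦ 2 ⁻ :: [] ⟧ A) (img up) (img (end κ)) (img down) n)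
  grown κ r (suc n) = close1 {⟦ 2 ⁻ :: [] ⟧ A} {img up} {img (end κ)} {img down} {⟦ y ⟧ A} y-step y-last (F≢ κ) (rotate (img (end κ)) (⟦ y ⟧ A) (end-step κ r (⟦ y ⟧ A) (arcs≢ ch y refl) (rotate (⟦ y ⟧ A) _ (initial κ r)))) n
  grown κ r zero = rotate (img (end κ) ++ []) (⟦ 2 ⁻ :: [] ⟧ A) (tp Disk (ap (_++ ⟦ 2 ⁻ :: [] ⟧ A) (! (++-id (img (end κ)))))
   (end-step κ r (⟦ 2 ⁻ :: [] ⟧ A) (arcs≢ ch (2 ⁻ :: []) refl) (rotate (⟦ 2 ⁻ :: [] ⟧ A) (⟦ end κ ⟧ A) (first κ r))))
   where
   first : ∀ κ -> κ != right -> Disk (⟦ 2 ⁻ :: [] ⟧ A ++ ⟦ end κ ⟧ A)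
   first hex _ = tp Disk (ap (⟦ 2 ⁻ :: [] ⟧ A ++_) (++-id _)) (Good.bands G hex 0 0)
   first left _ = tp Disk (ap (⟦ 2 ⁻ :: [] ⟧ A ++_) (++-id _)) (Good.bands G left 0 0)
   first right r = !! (r refl)

 f-bands-next : ∀ κ -> Bands V κ 0
 f-bands-next hex n = fromImage hex 0 n (grown hex (\ ()) n)
 f-bands-next left n = fromImage left 0 n (grown left (\ ()) n)
 f-bands-next right zero = single right 0 (deriveClosed G (wide left 3) 5 ((0 , swap 5) :: (0 , swap 0) :: []) (im fSub (start right ++ end right)) refl)
 f-bands-next right (suc n) = fromImage right 0 (suc n) (tp Disk (e2 (img down) (img (start right)) (pow n (img up)) (img up) (img (end right)) (pow n (img down)) ∙
    ap (\ z -> img (start right) ++ ((img up ++ pow n (img up)) ++ (img (end right) ++ z))) (pow-comm n (img down)))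
     (rotate (img down) _ (tp Disk (e1 (img down) (img (start right)) (pow n (img up)) (img up) (img (end right)) (pow n (img down)) ∙
    ap (\ z -> img down ++ (img (start right) ++ (z ++ (img (end right) ++ pow n (img down))))) (pow-comm n (img up)))
     (↝-within {⟦ 5 ⁻ :: 6 ⁻ :: 1 ⁻ :: [] ⟧ A} endʳ ((img down ++ img (start right)) ++ pow n (img up)) (pow n (img down))
     (++-≢[]ˡ ((img down ++ img (start right)) ++ pow n (img up)) (++-≢[]ˡ (img down ++ img (start right)) (++-≢[]ˡ (img down) (arcs≢ ch (im fSub down) refl))))
     (tp Disk (! (++-as (img down ++ img (start right)) (pow n (img up)) _)) (startʳ _ (++-≢[]ʳ (pow n (img up)) (++-≢[]ˡ (img (end left)) (arcs≢ ch (im fSub (end left)) refl))) (grown left (\ ()) n)))))))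
  where
  startʳ : ⟦ 2 ⁻ :: [] ⟧ A ↝ (img down ++ img (start right))
  startʳ = join↝ {⟦ 2 ⁻ :: [] ⟧ A} (im fSub down) (im fSub (start right)) (derive G (2 ⁻ :: []) (paste 0 whole 3 7 :: []) (im fSub down ++ im fSub (start right)) refl)
  endʳ : ⟦ 5 ⁻ :: 6 ⁻ :: 1 ⁻ :: [] ⟧ A ↝ (img up ++ img (end right))
  endʳ = join↝ {⟦ 5 ⁻ :: 6 ⁻ :: 1 ⁻ :: [] ⟧ A} (im fSub up) (im fSub (end right)) (derive G (5 ⁻ :: 6 ⁻ :: 1 ⁻ :: []) (paste 1 whole 7 7 :: swap 3 :: swap 1 :: []) (im fSub up ++ im fSub (end right)) refl)
  e1 : ∀ T K b B F t -> ((T ++ K) ++ b) ++ ((B ++ F) ++ t) == T ++ (K ++ ((b ++ B) ++ (F ++ t)))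
  e1 T K b B F t = solve words
  e2 : ∀ T K b B F t -> (K ++ ((B ++ b) ++ (F ++ t))) ++ T == K ++ ((B ++ b) ++ (F ++ (t ++ T)))
  e2 T K b B F t = solve words

f-trl : ∀ {A} -> Perio A -> ∀ n -> trl 4 (lftd fSub A) n == lftd fSub (trl 4 A) n
f-trl {A} per = agree {trl 4 (lftd fSub A)} {lftd fSub (trl 4 A)} (\ n -> refl) (\ n -> refl) (translated per 4 (fT 4) (fT 0) refl) (translated per 4 (fT 5) (fT 1) refl) (translated per 4 (fT 6) (fT 2) refl) (translated per 4 (fT 7) (fT 3) refl) (translated per 4 (fT 0) (fT 4) refl) (translated per 4 (fT 1) (fT 5) refl) (translated per 4 (fT 2) (fT 6) refl) (translated per 4 (fT 3) (fT 7) refl)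

g-trl : ∀ {A} -> Perio A -> ∀ n -> trl 2 (lftd gSub A) n == lftd gSub (trl 2 A) n
g-trl {A} per = agree {trl 2 (lftd gSub A)} {lftd gSub (trl 2 A)} (\ n -> refl) (\ n -> refl) (translated per 2 (gT 2) (gT 0) refl) (translated per 2 (gT 3) (gT 1) refl) (translated per 2 (gT 4) (gT 2) refl) (translated per 2 (gT 5) (gT 3) refl) (translated per 2 (gT 6) (gT 4) refl) (translated per 2 (gT 7) (gT 5) refl) (translated per 2 (gT 0) (gT 6) refl) (translated per 2 (gT 1) (gT 7) refl)

mird-lftd : ∀ {A} -> Perio A -> ∀ (t : ℕ -> Frm) (j : ℕ) -> sames (reflected (t (7 N.* j N.% 8))) (t (j N.% 8)) == true ->
         mird (lftd (\ n -> t (n N.% 8)) (mird A)) j == lftd (\ n -> t (n N.% 8)) A j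
mird-lftd {A} per t j c = ap mir (⟦mirrored⟧ A (t (7 N.* j N.% 8))) ∙ (mir-mir _) ∙ sames-sound per (reflected (t (7 N.* j N.% 8))) (t (j N.% 8)) c

f-mird : ∀ {A} -> Perio A -> ∀ n -> mird (lftd fSub (mird A)) n == lftd fSub A n
f-mird {A} per = agree {mird (lftd fSub (mird A))} {lftd fSub A} (Perio-mird {lftd fSub (mird A)} (\ n -> refl)) (\ n -> refl) (mird-lftd per fT 0 refl) (mird-lftd per fT 1 refl) (mird-lftd per fT 2 refl) (mird-lftd per fT 3 refl) (mird-lftd per fT 4 refl) (mird-lftd per fT 5 refl) (mird-lftd per fT 6 refl) (mird-lftd per fT 7 refl)

g-mird : ∀ {A} -> Perio A -> ∀ n -> mird (lftd gSub (mird A)) n == lftd gSub A n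
g-mird {A} per = agree {mird (lftd gSub (mird A))} {lftd gSub A} (Perio-mird {lftd gSub (mird A)} (\ n -> refl)) (\ n -> refl) (mird-lftd per gT 0 refl) (mird-lftd per gT 1 refl) (mird-lftd per gT 2 refl) (mird-lftd per gT 3 refl) (mird-lftd per gT 4 refl) (mird-lftd per gT 5 refl) (mird-lftd per gT 6 refl) (mird-lftd per gT 7 refl)

Bands-resp : ∀ {V W} κ k -> (∀ n -> V n == W n) -> Bands V κ k -> Bands W κ k
Bands-resp κ k e = Bands-≡ {κ = κ} \ w -> ⟦⟧-cong e (sh k w)

Good-f : ∀ {A} -> Good A -> Good (lftd fSub A)
Good-f {A} G = record { chain = FLift.f-chain G ; whole = FLift.f-whole G ; bands = bands G }
 where
 last : ∀ {A} -> Good A -> ∀ κ -> Bands (lftd fSub A) κ 2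
 last {A} G κ = Bands-resp κ 2 (f-mird (IsCh.perio (Good.chain G))) (reflectBands κ)
  where
  M : Good (mird A)
  M = Good-mird G
  at4 : ∀ κ -> Bands (lftd fSub (mird A)) κ 4
  at4 κ = Bands-trl κ 0 4 (f-trl (IsCh.perio (Good.chain M))) (FLift.f-bands-next (Good-trl 4 M) κ)
  reflectBands : ∀ κ -> Bands (mird (lftd fSub (mird A))) κ 2
  reflectBands hex = Bands-mird (FLift.f-chain M) hex 2 4 refl refl refl refl refl refl (at4 hex)
  reflectBands left = Bands-mird (FLift.f-chain M) right 2 4 refl refl refl refl refl refl (at4 right)
  reflectBands right = Bands-mird (FLift.f-chain M) left 2 4 refl refl refl refl refl refl (at4 left)
 bands : ∀ {A} -> Good A -> ∀ κ k -> Bands (lftd fSub A) κ k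
 bands G κ 0 = FLift.f-bands-next G κ
 bands G κ 1 = FLift.f-bands-unaffected G κ
 bands G κ 2 = last G κ
 bands G κ 3 = FLift.f-bands-middle G κ
 bands G κ (suc (suc (suc (suc k)))) = Bands-trl κ k 4 (f-trl (IsCh.perio (Good.chain G))) (bands (Good-trl 4 G) κ k)

module GLift {A : Chn} (G : Good A) where
 open Lift gSub G public

 g-chain : IsCh V
 g-chain = chainOf (\ n -> ne (n N.% 8)) (\ n -> refl) inter
  where
  ne : ∀ m -> ⟦ gT m ⟧ A != []
  ne 0 = arcs≢ ch (gT 0) refl
  ne 1 = arcs≢ ch (gT 1) refl
  ne 2 = arcs≢ ch (gT 2) refl
  ne 3 = arcs≢ ch (gT 3) refl
  ne 4 = arcs≢ ch (gT 4) refl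
  ne 5 = arcs≢ ch (gT 5) refl
  ne 6 = arcs≢ ch (gT 6) refl
  ne (suc (suc (suc (suc (suc (suc (suc m))))))) = arcs≢ ch (2 ⁺ :: 3 ⁺ :: 4 ⁺ :: []) refl
  Pair : ℕ -> Set
  Pair n = ⟦ im gSub (n ⁺ :: (1 N.+ n) ⁺ :: []) ⟧ A == ⟦ im gSub ((5 N.+ n) ⁻ :: (4 N.+ n) ⁻ :: []) ⟧ A
  eq : ∀ n -> reaches (swaps ch (3 :: []) (im gSub (n ⁺ :: (1 N.+ n) ⁺ :: []))) (im gSub ((5 N.+ n) ⁻ :: (4 N.+ n) ⁻ :: [])) == true -> Pair n
  eq n = swaps-≡ ch (3 :: []) (im gSub (n ⁺ :: (1 N.+ n) ⁺ :: [])) (im gSub ((5 N.+ n) ⁻ :: (4 N.+ n) ⁻ :: []))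
  inter : ∀ n -> Pair n
  inter 0 = eq 0 refl
  inter 1 = eq 1 refl
  inter 2 = eq 2 refl
  inter 3 = eq 3 refl
  inter 4 = eq 4 refl
  inter 5 = eq 5 refl
  inter 6 = eq 6 refl
  inter 7 = eq 7 refl
  inter (suc (suc (suc (suc (suc (suc (suc (suc n)))))))) = inter n

 g-whole : Disk (⟦ oct ⟧ V)
 g-whole = wholeOf (deriveClosed G (wide hex 5) 7 ((0 , swap 6) :: (5 , paste 0 whole 7 6) :: (0 , swap 12) :: (0 , swap 9) :: (1 , paste 0 (plain hex 3) 0 4) :: (0 , swap 1) :: (16 , paste 0 (plain hex 2) 0 5) :: (20 , paste 0 (plain hex 0) 0 5) :: (24 , paste 0 (plain hex 6) 0 5) :: (28 , paste 0 (plain hex 4) 0 5) :: []) (im gSub oct) refl)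

 closedBand : ∀ κ k c r ms -> reaches (runClosed ms (rotateBy r (pieceWord c))) (im gSub (sh k (start κ) ++ sh k (end κ))) == true -> Disk (band V κ k 0)
 closedBand κ k c r ms e = single κ k (deriveClosed G c r ms (im gSub (sh k (start κ) ++ sh k (end κ))) e)

 module Even where
  y T2 B2 K : Frm
  K = sh 0 (start hex)
  y = 7 ⁻ :: 0 ⁻ :: 1 ⁻ :: []
  T2 = 5 ⁻ :: 6 ⁻ :: 5 ⁻ :: 4 ⁻ :: []
  B2 = 2 ⁻ :: 1 ⁻ :: 0 ⁻ :: 1 ⁻ :: []
  y-step : ⟦ y ⟧ A ↝ (⟦ T2 ⟧ A ++ (⟦ y ⟧ A ++ ⟦ B2 ⟧ A))
  y-step = join↝3 {⟦ y ⟧ A} T2 y B2 (derive G y (paste 0 (wide right 1) 0 7 :: swap 2 :: swap 1 :: paste 3 (plain left 2) 0 3 :: []) (T2 ++ (y ++ B2)) refl)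
  y-last : ⟦ y ⟧ A ↝ (img K ++ ⟦ B2 ⟧ A)
  y-last = join↝ {⟦ y ⟧ A} (im gSub K) B2 (derive G (7 ⁻ :: 0 ⁻ :: 1 ⁻ :: []) (paste 0 whole 0 7 :: swap 5 :: []) (im gSub K ++ B2) refl)
  B-step : ⟦ B2 ⟧ A ↝ img (sh 0 up)
  B-step = derive G (2 ⁻ :: 1 ⁻ :: 0 ⁻ :: 1 ⁻ :: []) (paste 3 whole 2 7 :: swap 3 :: []) (im gSub (sh 0 up)) refl
  T-step : ⟦ T2 ⟧ A ↝ img (sh 0 down)
  T-step = derive G (5 ⁻ :: 6 ⁻ :: 5 ⁻ :: 4 ⁻ :: []) (paste 0 whole 6 7 :: swap 5 :: []) (im gSub (sh 0 down)) refl
  many : ∀ κ c r ms -> reaches (runClosed ms (rotateBy r (pieceWord c))) (T2 ++ (y ++ im gSub (sh 0 (end κ)))) == true ->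
      neᵇ (im gSub (sh 0 (end κ))) == true -> ∀ n -> Disk (bandOf (img K) (img (sh 0 up)) (img (sh 0 (end κ))) (img (sh 0 down)) (suc n))
  many κ c r ms e ne = close2 {img K} {⟦ B2 ⟧ A} {img (sh 0 up)} {img (sh 0 (end κ))} {⟦ T2 ⟧ A} {img (sh 0 down)} {⟦ y ⟧ A} (arcs≢ ch (im gSub K) refl) (arcs≢ ch (im gSub (sh 0 (end κ))) ne) y-step y-last B-step T-step
   (tp Disk (⟦++⟧ A T2 (y ++ im gSub (sh 0 (end κ))) ∙ ap (⟦ T2 ⟧ A ++_) (⟦++⟧ A y (im gSub (sh 0 (end κ))))) (deriveClosed G c r ms (T2 ++ (y ++ im gSub (sh 0 (end κ)))) e))
  hexagons : Bands V hex 0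
  hexagons zero = closedBand hex 0 (plain left 2) 3 (((0 , paste 0 (plain hex 1) 4 5) :: (2 , swap 3) :: (0 , paste 0 whole 4 7) :: (10 , swap 0) :: (0 , paste 0 whole 0 7) :: (8 , swap 5) :: (0 , paste 0 whole 2 7) :: (0 , swap 5) :: (18 , swap 0) :: [])) refl
  hexagons (suc n) = fromImage hex 0 (suc n) (many hex (plain left 2) 3 (((0 , paste 0 (plain hex 1) 4 5) :: (2 , swap 3) :: (0 , paste 0 (plain hex 3) 2 5) :: (2 , swap 0) :: (0 , paste 0 (plain hex 1) 4 5) :: (2 , swap 3) :: (0 , paste 0 whole 4 7) :: (20 , swap 0) :: (0 , paste 0 whole 2 7) :: (0 , swap 5) :: (18 , swap 0) :: [])) refl refl n)
  lefts : Bands V left 0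
  lefts zero = closedBand left 0 whole 3 (((0 , swap 6) :: (2 , paste 0 (plain hex 3) 5 5) :: (0 , swap 1) :: (15 , paste 0 (plain hex 2) 0 5) :: (0 , swap 0) :: [])) refl
  lefts (suc n) = fromImage left 0 (suc n) (many left (wide right 1) 7 (((0 , swap 3) :: (0 , swap 2) :: (2 , paste 0 (plain hex 7) 5 5) :: (0 , swap 1) :: (10 , paste 0 (plain hex 6) 0 5) :: (0 , swap 5) :: (15 , paste 0 (plain left 2) 0 3) :: [])) refl refl n)

 module Odd where
  K1 X B1 : Frm
  K1 = 6 ⁻ :: 7 ⁻ :: 0 ⁻ :: []
  X = 6 ⁺ :: 4 ⁻ :: 3 ⁻ :: []
  B1 = 4 ⁺ :: 3 ⁺ :: 1 ⁻ :: 0 ⁻ :: []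
  K B Tᵒ : Frm
  K = im gSub (sh 7 (start hex))
  B = im gSub (sh 7 up)
  Tᵒ = im gSub (sh 7 down)
  X-step : ⟦ X ⟧ A ↝ (⟦ B1 ⟧ A ++ (⟦ X ⟧ A ++ ⟦ Tᵒ ⟧ A))
  X-step = join↝3 {⟦ X ⟧ A} B1 X Tᵒ (derive G (6 ⁺ :: 4 ⁻ :: 3 ⁻ :: []) (swap 1 :: swap 0 :: paste 0 whole 4 6 :: swap 3 :: swap 1 :: paste 1 whole 3 6 :: swap 5 :: swap 2 :: paste 9 (plain hex 0) 0 4 :: []) (B1 ++ (X ++ Tᵒ)) refl)
  K-step : ⟦ K1 ⟧ A ↝ (⟦ K ⟧ A ++ ⟦ B ⟧ A)
  K-step = join↝ {⟦ K1 ⟧ A} K B (derive G (6 ⁻ :: 7 ⁻ :: 0 ⁻ :: []) (paste 1 whole 0 7 :: swap 6 :: swap 1 :: []) (K ++ B) refl)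
  B-step : ⟦ B1 ⟧ A ↝ ⟦ B ⟧ A
  B-step = derive G (4 ⁺ :: 3 ⁺ :: 1 ⁻ :: 0 ⁻ :: []) (paste 0 (plain hex 2) 1 4 :: []) (B) refl
  base-word : Disk (⟦ K1 ⟧ A ++ ⟦ X ⟧ A)
  base-word = join K1 X (deriveClosed G (plain hex 6) 4 ((0 , swap 4) :: []) (K1 ++ X) refl)
  many : ∀ κ ms -> reaches (run ms X) (im gSub (sh 7 (end κ)) ++ Tᵒ) == true -> neᵇ (im gSub (sh 7 (end κ))) == true ->
      ∀ n -> Disk (bandOf (img (sh 7 (start hex))) (img (sh 7 up)) (img (sh 7 (end κ))) (img (sh 7 down)) (suc n))
  many κ ms e ne = close3 {⟦ K1 ⟧ A} {⟦ K ⟧ A} {⟦ B1 ⟧ A} {⟦ B ⟧ A} {img (sh 7 (end κ))} {⟦ Tᵒ ⟧ A} {⟦ X ⟧ A} (arcs≢ ch K1 refl) (arcs≢ ch (im gSub (sh 7 (end κ))) ne) X-step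
   (join↝ {⟦ X ⟧ A} (im gSub (sh 7 (end κ))) Tᵒ (derive G X ms (im gSub (sh 7 (end κ)) ++ Tᵒ) e)) K-step B-step base-word
  hexagons : Bands V hex 7
  hexagons zero = closedBand hex 7 whole 7 (((0 , swap 5) :: (0 , swap 2) :: (0 , swap 0) :: (11 , paste 0 whole 5 6) :: (1 , paste 0 (plain hex 5) 0 4) :: (0 , swap 1) :: (14 , paste 0 (plain hex 4) 0 5) :: (20 , paste 0 (plain hex 2) 0 5) :: [])) refl
  hexagons (suc n) = fromImage hex 7 (suc n) (many hex (swap 1 :: swap 0 :: paste 0 whole 4 6 :: swap 3 :: paste 1 (wide right 5) 7 6 :: swap 4 :: paste 4 (wide right 6) 7 6 :: swap 9 :: swap 7 :: paste 3 (plain hex 3) 1 4 :: swap 3 :: paste 15 (plain hex 0) 0 4 :: paste 0 (plain hex 2) 1 4 :: paste 7 (plain hex 4) 0 5 :: []) refl refl n)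
  lefts : Bands V left 7
  lefts zero = closedBand left 7 whole 3 (((0 , swap 1) :: (1 , paste 0 (plain left 1) 1 3) :: (15 , paste 0 whole 0 7) :: (0 , swap 1) :: [])) refl
  lefts (suc n) = fromImage left 7 (suc n) (many left (swap 1 :: paste 0 (wide left 1) 4 6 :: swap 1 :: swap 2 :: paste 2 (plain hex 2) 3 4 :: paste 4 whole 4 7 :: swap 4 :: paste 1 (plain hex 4) 0 4 :: swap 0 :: paste 15 (plain hex 0) 0 4 :: []) refl refl n)

Good-g : ∀ {A} -> Good A -> Good (lftd gSub A)
Good-g {A} G = record { chain = GLift.g-chain G ; whole = GLift.g-whole G ; bands = bands G }
 where
 step2 : ∀ {A} -> Good A -> ∀ κ k -> (∀ {B} -> Good B -> Bands (lftd gSub B) κ k) -> Bands (lftd gSub A) κ (2 N.+ k)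
 step2 G κ k h = Bands-trl κ k 2 (g-trl (IsCh.perio (Good.chain G))) (h (Good-trl 2 G))
 rights0 : ∀ {A} -> Good A -> Bands (lftd gSub A) right 0
 rights0 {A} G = Bands-resp right 0 (g-mird (IsCh.perio (Good.chain G))) (Bands-mird (GLift.g-chain M) left 0 6 refl refl refl refl refl refl at6)
  where
  M : Good (mird A)
  M = Good-mird G
  at6 : Bands (lftd gSub (mird A)) left 6
  at6 = step2 M left 4 \ M -> step2 M left 2 \ M -> step2 M left 0 \ M -> GLift.Even.lefts M
 rights7 : ∀ {A} -> Good A -> Bands (lftd gSub A) right 7
 rights7 {A} G = Bands-resp right 7 (g-mird (IsCh.perio (Good.chain G))) (Bands-mird (GLift.g-chain M) left 7 7 refl refl refl refl refl refl (GLift.Odd.lefts M))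
  where
  M : Good (mird A)
  M = Good-mird G
 even : ∀ {A} -> Good A -> ∀ κ -> Bands (lftd gSub A) κ 0
 even G hex = GLift.Even.hexagons G
 even G left = GLift.Even.lefts G
 even G right = rights0 G
 odd : ∀ {A} -> Good A -> ∀ κ -> Bands (lftd gSub A) κ 7
 odd G hex = GLift.Odd.hexagons G
 odd G left = GLift.Odd.lefts G
 odd G right = rights7 G
 bands : ∀ {A} -> Good A -> ∀ κ k -> Bands (lftd gSub A) κ k
 bands G κ 0 = even G κ
 bands {A} G κ 1 = Bands-≡ {κ = κ} (⟦⟧-perio (\ n -> refl) 1) (step2 G κ 7 \ G -> odd G κ)
 bands G κ (suc (suc k)) = step2 G κ k \ G -> bands G κ k

trght : Ltr -> Ltr
trght R = D
trght D = L
trght L = U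
trght U = R

sprout : ∀ l -> (l :: []) ↝ (trght l :: l :: tleft l :: [])
sprout l [] Q≢ _ = !! (Q≢ refl)
sprout l (a :: p) _ d = rotate (a :: p) (trght l :: l :: tleft l :: []) (glue a p l [] (trght l) (l :: tleft l :: []) (rotate (l :: []) (a :: p) d) (square l))
 where
 square : ∀ l -> Disk (inv l :: trght l :: l :: tleft l :: [])
 square R = rotate (R :: U :: []) (L :: D :: []) cell
 square U = rotate (R :: U :: L :: []) (D :: []) cell
 square L = cell
 square D = rotate (R :: []) (U :: L :: D :: []) cell

cut : ℕ -> Word -> Word
cut n w = drop n w ++ take n w

sproutHead : Word -> Word
sproutHead (l :: m :: w) = trght l :: l :: tleft l :: m :: w
sproutHead w = w

sprouts : List ℕ -> Word -> Word
sprouts [] w = w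
sprouts (r :: []) w = cut r w
sprouts (r :: rs) w = sprouts rs (sproutHead (cut r w))

Disk-cut : ∀ n w -> Disk w -> Disk (cut n w)
Disk-cut n w d = rotate (take n w) (drop n w) (tp Disk (! (I.take++drop≡id n w)) d)

Disk-sprouts : ∀ rs w -> Disk w -> Disk (sprouts rs w)
Disk-sprouts [] w d = d
Disk-sprouts (r :: []) w d = Disk-cut r w d
Disk-sprouts (r :: r' :: rs) w d = Disk-sprouts (r' :: rs) _ (head (cut r w) (Disk-cut r w d))
 where
 head : ∀ w -> Disk w -> Disk (sproutHead w)
 head [] d = d
 head (l :: []) d = d
 head (l :: m :: w) d = sprout l (m :: w) (\ ()) d

planted : ∀ rs -> Disk (sprouts rs (R :: U :: L :: D :: []))
planted rs = Disk-sprouts rs _ cell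

grk : Chn
grk n = greek (n mod 8)

greek-chain : IsCh grk
greek-chain = record { perio = \ n -> refl ; laced = inter ; nonem = ne }
 where
 inter : ∀ n -> grk n ++ grk (1 N.+ n) == rev (grk (4 N.+ n) ++ grk (5 N.+ n))
 inter 0 = refl
 inter 1 = refl
 inter 2 = refl
 inter 3 = refl
 inter 4 = refl
 inter 5 = refl
 inter 6 = refl
 inter 7 = refl
 inter (suc (suc (suc (suc (suc (suc (suc (suc n)))))))) = inter n
 ne : ∀ n -> grk n != []
 ne 0 ()
 ne 1 ()
 ne 2 ()
 ne 3 ()
 ne 4 ()
 ne 5 ()
 ne 6 ()
 ne 7 ()
 ne (suc (suc (suc (suc (suc (suc (suc (suc n)))))))) e = ne n e

greek-turn : ∀ n -> trl 2 grk n == map tleft (grk n)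
greek-turn = agree (\ n -> refl) (\ n -> refl) refl refl refl refl refl refl refl refl

greek-mird : ∀ n -> mird grk n == grk n
greek-mird = agree (Perio-mird {grk} (\ n -> refl)) (\ n -> refl) refl refl refl refl refl refl refl refl

⟦⟧-turn : ∀ A w -> ⟦ w ⟧ (\ n -> map tleft (A n)) == map tleft (⟦ w ⟧ A)
⟦⟧-turn A [] = refl
⟦⟧-turn A (n ⁺ :: w) = ap (map tleft (A n) ++_) (⟦⟧-turn A w) ∙ ! (I.map-++ tleft (A n) _)
⟦⟧-turn A (n ⁻ :: w) = (ap2 _++_ (! (map-rev tleft inv-tleft (A n))) (⟦⟧-turn A w)) ∙ ! (I.map-++ tleft (rev (A n)) _)

pow-map : ∀ n w -> pow n (map tleft w) == map tleft (pow n w)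
pow-map zero w = refl
pow-map (suc n) w = ap (map tleft w ++_) (pow-map n w) ∙ ! (I.map-++ tleft w (pow n w))

Bands-turn : ∀ {A} κ k -> Bands A κ k -> Bands (\ n -> map tleft (A n)) κ k
Bands-turn {A} κ k h n = tp Disk (! ((ap2 _++_ (e (start κ)) (ap2 _++_ (p up) (ap2 _++_ (e (end κ)) (p down)))) ∙
  ap (\ z -> map tleft (⟦ sh k (start κ) ⟧ A) ++ (map tleft (pow n (⟦ sh k up ⟧ A)) ++ z)) (! (I.map-++ tleft (⟦ sh k (end κ) ⟧ A) (pow n (⟦ sh k down ⟧ A)))) ∙
   ap (map tleft (⟦ sh k (start κ) ⟧ A) ++_) (! (I.map-++ tleft (pow n (⟦ sh k up ⟧ A)) (⟦ sh k (end κ) ⟧ A ++ pow n (⟦ sh k down ⟧ A)))) ∙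
    ! (I.map-++ tleft (⟦ sh k (start κ) ⟧ A) (pow n (⟦ sh k up ⟧ A) ++ (⟦ sh k (end κ) ⟧ A ++ pow n (⟦ sh k down ⟧ A)))))) (Disk-tleft (h n))
 where
 e : ∀ w -> ⟦ sh k w ⟧ (\ n -> map tleft (A n)) == map tleft (⟦ sh k w ⟧ A)
 e w = ⟦⟧-turn A (sh k w)
 p : ∀ w -> pow n (⟦ sh k w ⟧ (\ n -> map tleft (A n))) == map tleft (pow n (⟦ sh k w ⟧ A))
 p w = ap (pow n) (e w) ∙ pow-map n (⟦ sh k w ⟧ A)

private
 D↝LDDRU : (D :: []) ↝ (L :: D :: D :: R :: U :: [])
 D↝LDDRU = ↝-trans {D :: []} {L :: D :: R :: []} {L :: D :: D :: R :: U :: []} (sprout D) (++-↝ {L :: D :: []} {L :: D :: []} {R :: []} {D :: R :: U :: []} (↝-refl (L :: D :: [])) (sprout R))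
 D↝ULDDR : (D :: []) ↝ (U :: L :: D :: D :: R :: [])
 D↝ULDDR = ↝-trans {D :: []} {L :: D :: R :: []} {U :: L :: D :: D :: R :: []} (sprout D) (++-↝ {L :: []} {U :: L :: D :: []} {D :: R :: []} {D :: R :: []} (sprout L) (↝-refl (D :: R :: [])))
 replace : ∀ u v {x y} -> x ↝ y -> (u ++ (x ++ v)) ↝ (u ++ (y ++ v))
 replace u v {x} {y} h = ++-↝ {u} {u} {x ++ v} {y ++ v} (↝-refl u) (++-↝ {x} {y} {v} {v} h (↝-refl v))

 wide-band : ∀ {K B F T} -> F != [] -> K ↝ (T ++ (K ++ B)) -> Disk (K ++ F) -> ∀ n -> Disk (bandOf K B F T n)
 wide-band {K} {B} {F} {T} F≢ h d n = tp Disk (e K (pow n B) F (pow n T)) (rotate (pow n T) _ (iterate {K} {T} {B} {F} h F≢ d n))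
  where
  e : ∀ K b F t -> (K ++ (b ++ F)) ++ t == K ++ (b ++ (F ++ t))
  e K b F t = solve words

 y-step : (U :: L :: D :: D :: []) ↝ (U :: L :: D :: L :: U :: L :: D :: D :: R :: D :: R :: U :: [])
 y-step = ↝-trans {U :: L :: D :: D :: []} {U :: L :: D :: L :: D :: D :: R :: U :: []} {U :: L :: D :: L :: U :: L :: D :: D :: R :: D :: R :: U :: []}
  (replace (U :: L :: D :: []) [] D↝LDDRU) (replace (U :: L :: D :: L :: []) (D :: R :: U :: []) D↝ULDDR)
 y-last : (U :: L :: D :: D :: []) ↝ (U :: L :: D :: L :: L :: D :: R :: D :: R :: U :: [])
 y-last = ↝-trans {U :: L :: D :: D :: []} {U :: L :: D :: L :: D :: D :: R :: U :: []} {U :: L :: D :: L :: L :: D :: R :: D :: R :: U :: []}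
  (replace (U :: L :: D :: []) [] D↝LDDRU) (replace (U :: L :: D :: L :: []) (D :: R :: U :: []) (sprout D))

 greek-hexagon0 : Bands grk hex 0
 greek-hexagon0 = wide-band {D :: []} {R :: U :: []} {R :: U :: R :: U :: L :: L :: D :: []} {L :: D :: []} (\ ()) D↝LDDRU (planted (1 :: 5 :: 0 :: []))
 greek-left0 : Bands grk left 0
 greek-left0 = wide-band {D :: []} {R :: U :: []} {R :: U :: U :: L :: D :: []} {L :: D :: []} (\ ()) D↝LDDRU (planted (0 :: 0 :: []))
 greek-hexagon7 : Bands grk hex 7
 greek-hexagon7 zero = planted (1 :: 1 :: 7 :: 7 :: [])
 greek-hexagon7 (suc n) = close1 {L :: D :: []} {R :: D :: R :: U :: []} {R :: D :: R :: U :: R :: U :: L :: L :: []} {U :: L :: D :: L :: []} {U :: L :: D :: D :: []}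
  y-step y-last (\ ()) (planted (0 :: 2 :: 1 :: 9 :: 7 :: [])) n
 greek-left7 : Bands grk left 7
 greek-left7 zero = planted (1 :: 3 :: [])
 greek-left7 (suc n) = close1 {L :: D :: []} {R :: D :: R :: U :: []} {R :: R :: U :: L :: []} {U :: L :: D :: L :: []} {U :: L :: D :: D :: []}
  y-step y-last (\ ()) (planted (0 :: 2 :: 3 :: [])) n

greek-step : ∀ κ k -> Bands grk κ k -> Bands grk κ (2 N.+ k)
greek-step κ k h = Bands-trl κ k 2 greek-turn (Bands-turn {grk} κ k h)

greek-right0 : Bands grk right 0
greek-right0 = Bands-resp right 0 greek-mird (Bands-mird greek-chain left 0 6 refl refl refl refl refl refl (greek-step left 4 (greek-step left 2 (greek-step left 0 greek-left0))))

greek-right7 : Bands grk right 7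
greek-right7 = Bands-resp right 7 greek-mird (Bands-mird greek-chain left 7 7 refl refl refl refl refl refl greek-left7)

Good-greek : Good grk
Good-greek = record { chain = greek-chain ; whole = planted (0 :: 2 :: 7 :: 9 :: 4 :: []) ; bands = bands }
 where
 bands : ∀ κ k -> Bands grk κ k
 bands hex 0 = greek-hexagon0
 bands left 0 = greek-left0
 bands right 0 = greek-right0
 bands hex 1 = Bands-≡ {grk} {grk} {hex} {9} {1} (⟦⟧-perio {grk} (\ n -> refl) 1) (greek-step hex 7 greek-hexagon7)
 bands left 1 = Bands-≡ {grk} {grk} {left} {9} {1} (⟦⟧-perio {grk} (\ n -> refl) 1) (greek-step left 7 greek-left7)
 bands right 1 = Bands-≡ {grk} {grk} {right} {9} {1} (⟦⟧-perio {grk} (\ n -> refl) 1) (greek-step right 7 greek-right7)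
 bands κ (suc (suc k)) = greek-step κ k (bands κ k)

chn : Chain -> Chn
chn V n = V (n mod 8)

rev-3 : ∀ a b c -> rev (a ++ b ++ c) == rev c ++ rev b ++ rev a ++ []
rev-3 a b c = rev-++ a (b ++ c) ∙ ap (_++ rev a) (rev-++ b c) ∙ e (rev c) (rev b) (rev a)
 where
 e : ∀ c b a -> (c ++ b) ++ a == c ++ b ++ a ++ []
 e c b a = solve words

rev-5 : ∀ a b c d e -> rev (a ++ b ++ c ++ d ++ e) == rev e ++ rev d ++ rev c ++ rev b ++ rev a ++ []
rev-5 a b c d e = (rev-++ a _) ∙ ap (_++ rev a) ((rev-++ b _) ∙ ap (_++ rev b) (rev-3 c d e)) ∙ alg (rev e) (rev d) (rev c) (rev b) (rev a)
 where
 alg : ∀ e d c b a -> ((e ++ d ++ c ++ []) ++ b) ++ a == e ++ d ++ c ++ b ++ a ++ []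
 alg e d c b a = solve words

ext-3 : ∀ (a b c : Word) -> a ++ b ++ c == a ++ b ++ c ++ []
ext-3 a b c = solve words

Good-untranslate : ∀ {A} r r' -> (∀ n -> trl r' (trl r A) n == A n) -> Good (trl r A) -> Good A
Good-untranslate r r' e G = Good-resp e (Good-trl r' G)

f-lifted0 : ∀ V n -> trl 0 (chn (f i0 V)) n == lftd fSub (trl 0 (chn V)) n
f-lifted0 V = agree (\ n -> refl) (\ n -> refl) (rev-3 (V (3 mod 8)) (V (4 mod 8)) (V (5 mod 8))) (! (++-id (V (1 mod 8)))) (! (++-id (V (2 mod 8)))) (! (++-id (V (3 mod 8)))) (rev-3 (V (7 mod 8)) (V (0 mod 8)) (V (1 mod 8)))
 (! (++-id (V (5 mod 8)))) (! (++-id (V (6 mod 8)))) (! (++-id (V (7 mod 8))))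

f-lifted1 : ∀ V n -> trl 1 (chn (f i1 V)) n == lftd fSub (trl 1 (chn V)) n
f-lifted1 V = agree (\ n -> refl) (\ n -> refl) (rev-3 (V (4 mod 8)) (V (5 mod 8)) (V (6 mod 8))) (! (++-id (V (2 mod 8)))) (! (++-id (V (3 mod 8)))) (! (++-id (V (4 mod 8)))) (rev-3 (V (0 mod 8)) (V (1 mod 8)) (V (2 mod 8)))
 (! (++-id (V (6 mod 8)))) (! (++-id (V (7 mod 8)))) (! (++-id (V (0 mod 8))))

f-lifted2 : ∀ V n -> trl 2 (chn (f i2 V)) n == lftd fSub (trl 2 (chn V)) n
f-lifted2 V = agree (\ n -> refl) (\ n -> refl) (rev-3 (V (5 mod 8)) (V (6 mod 8)) (V (7 mod 8))) (! (++-id (V (3 mod 8)))) (! (++-id (V (4 mod 8)))) (! (++-id (V (5 mod 8)))) (rev-3 (V (1 mod 8)) (V (2 mod 8)) (V (3 mod 8)))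
 (! (++-id (V (7 mod 8)))) (! (++-id (V (0 mod 8)))) (! (++-id (V (1 mod 8))))

f-lifted3 : ∀ V n -> trl 3 (chn (f i3 V)) n == lftd fSub (trl 3 (chn V)) n
f-lifted3 V = agree (\ n -> refl) (\ n -> refl) (rev-3 (V (6 mod 8)) (V (7 mod 8)) (V (0 mod 8))) (! (++-id (V (4 mod 8)))) (! (++-id (V (5 mod 8)))) (! (++-id (V (6 mod 8)))) (rev-3 (V (2 mod 8)) (V (3 mod 8)) (V (4 mod 8)))
 (! (++-id (V (0 mod 8)))) (! (++-id (V (1 mod 8)))) (! (++-id (V (2 mod 8))))

gOdd-lftd : ∀ V n -> trl 0 (chn (gOdd V)) n == lftd gSub (trl 0 (chn V)) n
gOdd-lftd V = agree (\ n -> refl) (\ n -> refl) (rev-5 (V (6 mod 8)) (V (7 mod 8)) (V (0 mod 8)) (V (1 mod 8)) (V (2 mod 8))) (ext-3 (V (4 mod 8)) (V (5 mod 8)) (V (6 mod 8)))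
 (rev-5 (V (0 mod 8)) (V (1 mod 8)) (V (2 mod 8)) (V (3 mod 8)) (V (4 mod 8))) (ext-3 (V (6 mod 8)) (V (7 mod 8)) (V (0 mod 8))) (rev-5 (V (2 mod 8)) (V (3 mod 8)) (V (4 mod 8)) (V (5 mod 8)) (V (6 mod 8)))
 (ext-3 (V (0 mod 8)) (V (1 mod 8)) (V (2 mod 8))) (rev-5 (V (4 mod 8)) (V (5 mod 8)) (V (6 mod 8)) (V (7 mod 8)) (V (0 mod 8))) (ext-3 (V (2 mod 8)) (V (3 mod 8)) (V (4 mod 8)))

gEven-lftd : ∀ V n -> trl 1 (chn (gEven V)) n == lftd gSub (trl 1 (chn V)) n
gEven-lftd V = agree (\ n -> refl) (\ n -> refl) (rev-5 (V (7 mod 8)) (V (0 mod 8)) (V (1 mod 8)) (V (2 mod 8)) (V (3 mod 8))) (ext-3 (V (5 mod 8)) (V (6 mod 8)) (V (7 mod 8)))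
 (rev-5 (V (1 mod 8)) (V (2 mod 8)) (V (3 mod 8)) (V (4 mod 8)) (V (5 mod 8))) (ext-3 (V (7 mod 8)) (V (0 mod 8)) (V (1 mod 8))) (rev-5 (V (3 mod 8)) (V (4 mod 8)) (V (5 mod 8)) (V (6 mod 8)) (V (7 mod 8)))
 (ext-3 (V (1 mod 8)) (V (2 mod 8)) (V (3 mod 8))) (rev-5 (V (5 mod 8)) (V (6 mod 8)) (V (7 mod 8)) (V (0 mod 8)) (V (1 mod 8))) (ext-3 (V (3 mod 8)) (V (4 mod 8)) (V (5 mod 8)))

Good-descendant : ∀ {V} -> Descendant V -> Good (chn V)
Good-descendant base = Good-greek
Good-descendant (byF {V} i0 d) = Good-untranslate 0 8 (\ n -> refl) (Good-resp (\ n -> ! (f-lifted0 V n)) (Good-f (Good-trl 0 (Good-descendant d))))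
Good-descendant (byF {V} i1 d) = Good-untranslate 1 7 (\ n -> refl) (Good-resp (\ n -> ! (f-lifted1 V n)) (Good-f (Good-trl 1 (Good-descendant d))))
Good-descendant (byF {V} i2 d) = Good-untranslate 2 6 (\ n -> refl) (Good-resp (\ n -> ! (f-lifted2 V n)) (Good-f (Good-trl 2 (Good-descendant d))))
Good-descendant (byF {V} i3 d) = Good-untranslate 3 5 (\ n -> refl) (Good-resp (\ n -> ! (f-lifted3 V n)) (Good-f (Good-trl 3 (Good-descendant d))))
Good-descendant (byOdd {V} d) = Good-untranslate 0 8 (\ n -> refl) (Good-resp (\ n -> ! (gOdd-lftd V n)) (Good-g (Good-trl 0 (Good-descendant d))))
Good-descendant (byEven {V} d) = Good-untranslate 1 7 (\ n -> refl) (Good-resp (\ n -> ! (gEven-lftd V n)) (Good-g (Good-trl 1 (Good-descendant d))))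

oct-concat : ∀ V -> ⟦ oct ⟧ (chn V) == concat8 V
oct-concat V = e (V (0 mod 8)) (V (1 mod 8)) (V (2 mod 8)) (V (3 mod 8)) (V (4 mod 8)) (V (5 mod 8)) (V (6 mod 8)) (V (7 mod 8))
 where
 e : ∀ a b c d e f g h -> a ++ b ++ c ++ d ++ e ++ f ++ g ++ h ++ [] == a ++ b ++ c ++ d ++ e ++ f ++ g ++ h
 e a b c d e f g h = solve words

⊕-assoc : ∀ p q r -> (p <> q) <> r == p <> (q <> r)
⊕-assoc (a , b) (c , d) (e , f) = ap2 _,_ (Y.+-assoc a c e) (Y.+-assoc b d f)

⊕-comm : ∀ p q -> p <> q == q <> p
⊕-comm (a , b) (c , d) = ap2 _,_ (Y.+-comm a c) (Y.+-comm b d)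

org : Cell
org = (+ 0 , + 0)

⊕-idʳ : ∀ p -> p <> org == p
⊕-idʳ (a , b) = ap2 _,_ (+0 a) (+0 b)

⊕-idˡ : ∀ p -> org <> p == p
⊕-idˡ p = ⊕-comm org p ∙ ⊕-idʳ p

neg : Cell -> Cell
neg (a , b) = (Z.- a , Z.- b)

⊕-invʳ : ∀ p -> p <> neg p == org
⊕-invʳ (a , b) = ap2 _,_ (Y.+-inverseʳ a) (Y.+-inverseʳ b)

⊕-can : ∀ p q -> (p <> q) <> neg q == p
⊕-can p q = ⊕-assoc p q (neg q) ∙ ap (p <>_) (⊕-invʳ q) ∙ ⊕-idʳ p

⊕-swap : ∀ p q r -> (p <> q) <> r == (p <> r) <> q
⊕-swap p q r = ⊕-assoc p q r ∙ ap (p <>_) (⊕-comm q r) ∙ ! (⊕-assoc p r q)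

step-inv : ∀ l -> step (inv l) == neg (step l)
step-inv R = refl
step-inv L = refl
step-inv U = refl
step-inv D = refl

step-back : ∀ p l -> (p <> step l) <> step (inv l) == p
step-back p l = ap ((p <> step l) <>_) (step-inv l) ∙ ⊕-can p (step l)

vec : Word -> Cell
vec w = tip org w

tip-++ : ∀ p u v -> tip p (u ++ v) == tip (tip p u) v
tip-++ p [] v = refl
tip-++ p (x :: u) v = tip-++ (p <> step x) u v

tip-⊕ : ∀ p q w -> tip (p <> q) w == tip p w <> q
tip-⊕ p q [] = refl
tip-⊕ p q (x :: w) = ap (\ z -> tip z w) (⊕-swap p q (step x)) ∙ tip-⊕ (p <> step x) q w

tip-vec : ∀ p w -> tip p w == p <> vec w
tip-vec p w = ap (\ z -> tip z w) (! (⊕-idˡ p)) ∙ tip-⊕ org p w ∙ ⊕-comm (vec w) p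

tip-rev : ∀ p w -> tip (tip p w) (rev w) == p
tip-rev p [] = refl
tip-rev p (x :: w) = (tip-++ _ (rev w) (inv x :: [])) ∙
 ap (_<> step (inv x)) (tip-rev (p <> step x) w) ∙ step-back p x

vec-++ : ∀ u v -> vec (u ++ v) == vec u <> vec v
vec-++ u v = tip-++ org u v ∙ tip-vec (vec u) v

vec-rev : ∀ w -> vec (rev w) == neg (vec w)
vec-rev w = (! (⊕-can (vec (rev w)) (vec w)) ∙ ap (_<> neg (vec w)) (⊕-comm (vec (rev w)) (vec w) ∙ ! (tip-vec (vec w) (rev w)) ∙ tip-rev org w) ∙ (⊕-idˡ _))

edge : (Cell -> ℤ) -> Cell -> Ltr -> ℤ
edge ρ p R = + 0
edge ρ p L = + 0
edge ρ p U = ρ p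
edge ρ p D = Z.- ρ (p <> step D)

flux : (Cell -> ℤ) -> Cell -> Word -> ℤ
flux ρ p [] = + 0
flux ρ p (l :: w) = edge ρ p l + flux ρ (p <> step l) w

edge-inv : ∀ ρ p l -> edge ρ (p <> step l) (inv l) == Z.- edge ρ p l
edge-inv ρ p R = refl
edge-inv ρ p L = refl
edge-inv ρ p U = ap (\ z -> Z.- ρ z) (step-back p U)
edge-inv ρ p D = ! (Y.neg-involutive _)

flux-++ : ∀ ρ p u v -> flux ρ p (u ++ v) == flux ρ p u + flux ρ (tip p u) v
flux-++ ρ p [] v = ! (0+ _)
flux-++ ρ p (x :: u) v = ap (\ z -> edge ρ p x + z) (flux-++ ρ (p <> step x) u v) ∙ ! (Y.+-assoc (edge ρ p x) _ _)

flux-rev : ∀ ρ p w -> flux ρ (tip p w) (rev w) == Z.- flux ρ p w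
flux-rev ρ p [] = refl
flux-rev ρ p (x :: w) = (flux-++ ρ q (rev w) (inv x :: []) ∙ (ap2 Z._+_ (flux-rev ρ p' w) (ap (\ z -> edge ρ z (inv x) + + 0) (tip-rev p' w))) ∙ ap (\ z -> Z.- flux ρ p' w + (z + + 0)) (edge-inv ρ p x) ∙ e (flux ρ p' w) (edge ρ p x))
 where
 p' q : Cell
 p' = p <> step x
 q = tip p' w
 e : ∀ f d -> Z.- f + (Z.- d + + 0) == Z.- (d + f)
 e = ring

edge-cong : ∀ {ρ σ} -> (∀ p -> ρ p == σ p) -> ∀ p l -> edge ρ p l == edge σ p l
edge-cong e p R = refl
edge-cong e p L = refl
edge-cong e p U = e p
edge-cong e p D = ap (\ z -> Z.- z) (e _)

flux-cong : ∀ {ρ σ} -> (∀ p -> ρ p == σ p) -> ∀ p w -> flux ρ p w == flux σ p w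
flux-cong e p [] = refl
flux-cong e p (l :: w) = ap2 Z._+_ (edge-cong e p l) (flux-cong e (p <> step l) w)

flux-⊕ : ∀ ρ p t w -> flux ρ (p <> t) w == flux (\ q -> ρ (q <> t)) p w
flux-⊕ ρ p t [] = refl
flux-⊕ ρ p t (l :: w) = ap2 Z._+_ (e l) (ap (\ z -> flux ρ z w) (⊕-swap p t (step l)) ∙ flux-⊕ ρ (p <> step l) t w)
 where
 e : ∀ l -> edge ρ (p <> t) l == edge (\ q -> ρ (q <> t)) p l
 e R = refl
 e L = refl
 e U = refl
 e D = ap (\ z -> Z.- ρ z) (⊕-swap p t (step D))

flux-+ : ∀ ρ σ p w -> flux (\ q -> ρ q + σ q) p w == flux ρ p w + flux σ p w
flux-+ ρ σ p [] = refl
flux-+ ρ σ p (l :: w) = (ap2 Z._+_ (e l) (flux-+ ρ σ (p <> step l) w)) ∙ (alg (edge ρ p l) (edge σ p l) _ _)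
 where
 alg : ∀ a b c d -> (a + b) + (c + d) == (a + c) + (b + d)
 alg = ring
 e : ∀ l -> edge (\ q -> ρ q + σ q) p l == edge ρ p l + edge σ p l
 e R = refl
 e L = refl
 e U = refl
 e D = Y.neg-distrib-+ (ρ (p <> step D)) (σ (p <> step D))

flux-poten : ∀ ρ (g : ℤ -> ℤ) -> (∀ x y -> ρ (x , y) == g (y + + 1) Z.- g y) -> ∀ p w ->
         flux ρ p w == g (snd (tip p w)) Z.- g (snd p)
flux-poten ρ g h (x , y) [] = ! (Y.+-inverseʳ (g y))
flux-poten ρ g h (x , y) (l :: w) = (ap2 Z._+_ (e l) (flux-poten ρ g h ((x , y) <> step l) w)) ∙
  alg (g (snd (tip ((x , y) <> step l) w))) (g (y + snd (step l))) (g y)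
 where
 alg : ∀ a b c -> (b Z.- c) + (a Z.- b) == a Z.- c
 alg = ring
 k : ∀ y -> (y + -[1+ 0 ]) + + 1 == y
 k = ring
 n : ∀ a b -> Z.- (a Z.- b) == b Z.- a
 n = ring
 e : ∀ l -> edge ρ (x , y) l == g (y + snd (step l)) Z.- g y
 e R = ! (ap (\ z -> g z Z.- g y) (+0 y) ∙ Y.+-inverseʳ (g y))
 e L = ! (ap (\ z -> g z Z.- g y) (+0 y) ∙ Y.+-inverseʳ (g y))
 e U = h x y
 e D = ap (\ z -> Z.- z) (h (x + + 0) (y + -[1+ 0 ])) ∙ ap (\ z -> Z.- (g z Z.- g (y + -[1+ 0 ]))) (k y) ∙ (n (g y) _)

loop : Word -> Word -> Word
loop A B = A ++ B ++ rev A ++ rev B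

bracket : (Cell -> ℤ) -> Word -> Word -> Cell -> ℤ
bracket ρ A B p = (flux ρ p A Z.- flux ρ (p <> vec B) A) + (flux ρ (p <> vec A) B Z.- flux ρ p B)

flux-loop : ∀ ρ A B p -> flux ρ p (loop A B) == bracket ρ A B p
flux-loop ρ A B p = (((flux-++ ρ p A _) ∙ ap (\ z -> flux ρ p A + z) ((flux-++ ρ (tip p A) B _) ∙ ap (\ z -> flux ρ (tip p A) B + z) (flux-++ ρ q (rev A) (rev B)))) ∙ ap2 (\ a b -> flux ρ p A + (a + b)) (ap (\ z -> flux ρ z B) (tip-vec p A)) (ap2 Z._+_ fA fB) ∙ alg (flux ρ p A) (flux ρ (p <> vec A) B) (flux ρ (p <> vec B) A) (flux ρ p B))
 where
 alg : ∀ a b c d -> a + (b + (Z.- c + Z.- d)) == (a Z.- c) + (b Z.- d)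
 alg = ring
 q : Cell
 q = tip (tip p A) B
 qA : q == tip (p <> vec B) A
 qA = tip-vec (tip p A) B ∙ ! (tip-⊕ p (vec B) A) ∙ refl
 fA : flux ρ q (rev A) == Z.- flux ρ (p <> vec B) A
 fA = ap (\ z -> flux ρ z (rev A)) qA ∙ flux-rev ρ (p <> vec B) A
 fB : flux ρ (tip q (rev A)) (rev B) == Z.- flux ρ p B
 fB = ap (\ z -> flux ρ z (rev B)) (ap (\ z -> tip z (rev A)) qA ∙ tip-rev (p <> vec B) A ∙ ! (tip-vec p B)) ∙
     flux-rev ρ p B

module Floor (d : ℕ) .{{_ : N.NonZero d}} where
 private
  close : ∀ r r' q q' -> r < d -> q Z.< q' -> + r + q * + d != + r' + q' * + d
  close r r' q q' r<d q<q' e = Y.<-irrefl e (begin-strict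
   + r + q * + d       <⟨ Y.+-monoˡ-< (q * + d) (Z.+<+ r<d) ⟩
   + d + q * + d       ≡⟨ alg (+ d) q ⟩ (Z.suc q) * + d       ≤⟨ Y.*-monoʳ-≤-nonNeg (+ d) (Y.i<j⇒suc[i]≤j q<q') ⟩
   q' * + d              ≡⟨ ! (0+ _) ⟩
   + 0 + q' * + d      ≤⟨ Y.+-monoˡ-≤ (q' * + d) (Z.+≤+ N.z≤n) ⟩
   + r' + q' * + d ∎)
   where
   open Y.≤-Reasoning
   alg : ∀ d q -> d + q * d == (+ 1 + q) * d
   alg = ring

 floor : ℤ -> ℤ
 floor n = n ZD./ℕ d

 floor-uniq : ∀ n r q -> r < d -> n == + r + q * + d -> floor n == q
 floor-uniq n r q r<d e with Y.<-cmp (floor n) q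
 ... | tri< l _ _ = !! (close (n ZD.%ℕ d) r (floor n) q (ZD.n%ℕd<d n d) l (! (ZD.a≡a%ℕn+[a/ℕn]*n n d) ∙ e))
 ... | tri≈ _ e' _ = e'
 ... | tri> _ _ g = !! (close r (n ZD.%ℕ d) q (floor n) r<d g (! e ∙ ZD.a≡a%ℕn+[a/ℕn]*n n d))

 floor-+ : ∀ n -> floor (n + + d) == floor n + + 1
 floor-+ n = floor-uniq (n + + d) (n ZD.%ℕ d) (floor n + + 1) (ZD.n%ℕd<d n d) (ap (Z._+ + d) (ZD.a≡a%ℕn+[a/ℕn]*n n d) ∙ alg (+ (n ZD.%ℕ d)) (floor n) (+ d))
  where
  alg : ∀ r q d -> (r + q * d) + d == r + (q + + 1) * d
  alg = ring

 δ : ℤ -> ℤ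
 δ n = floor n Z.- floor (n Z.- + 1)

 δ-+ : ∀ n -> δ (n + + d) == δ n
 δ-+ n = (ap2 Z._-_ (floor-+ n) (ap floor (alg n (+ d)) ∙ floor-+ (n Z.- + 1))) ∙ g (floor n) (floor (n Z.- + 1))
  where
  alg : ∀ n d -> (n + d) Z.- + 1 == (n Z.- + 1) + d
  alg = ring
  g : ∀ a b -> (a + + 1) Z.- (b + + 1) == a Z.- b
  g = ring

 δ-cases : ∀ n -> (δ n == + 1 × n == floor n * + d) ⊎ δ n == + 0
 δ-cases n with n ZD.%ℕ d | ZD.a≡a%ℕn+[a/ℕn]*n n d | ZD.n%ℕd<d n d
 ... | zero | e | lt  = inl (ap (\ z -> floor n Z.- z) (pred-floor d refl) ∙ h (floor n) , e ∙ (0+ _))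
  where
  h : ∀ q -> q Z.- (q Z.- + 1) == + 1
  h = ring
  k : ∀ q m -> (q * (+ 1 + m)) Z.- + 1 == m + (q Z.- + 1) * (+ 1 + m)
  k = ring
  pred-floor : ∀ m -> m == d -> floor (n Z.- + 1) == floor n Z.- + 1
  pred-floor zero refl = !! (Q.<⇒≱ lt N.z≤n)
  pred-floor (suc m) refl = floor-uniq (n Z.- + 1) m (floor n Z.- + 1) (Q.n<1+n m) (ap (Z._- + 1) (e ∙ 0+ (floor n * + suc m)) ∙ k (floor n) (+ m))
 ... | suc r | e | lt  = inr (ap (\ z -> floor n Z.- z) (floor-uniq (n Z.- + 1) r (floor n) (Q.<-trans (Q.n<1+n r) lt) (ap (Z._- + 1) e ∙ k (+ r) (floor n * + d))) ∙ Y.+-inverseʳ (floor n))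
  where
  k : ∀ r q -> ((+ 1 + r) + q) Z.- + 1 == r + q
  k = ring

 floor-* : ∀ q -> floor (q * + d) == q
 floor-* q = floor-uniq (q * + d) 0 q (Q.n≢0⇒n>0 (N.≢-nonZero⁻¹ d)) (! (0+ _))

 δ-* : ∀ q -> δ (q * + d) == + 1
 δ-* q with δ-cases (q * + d)
 ... | inl (e , _) = e
 ... | inr e = !! (jump d refl)
  where
  k : ∀ q m -> (q * (+ 1 + m)) Z.- + 1 == m + (q Z.- + 1) * (+ 1 + m)
  k = ring
  h : ∀ q -> q Z.- (q Z.- + 1) == + 1
  h = ring
  jump : ∀ m -> m == d -> ⊥
  jump zero e' = N.≢-nonZero⁻¹ d (! e')
  jump (suc m) refl with _∙_ (! e) ((ap2 Z._-_ (floor-* q) (floor-uniq (q * + suc m Z.- + 1) m (q Z.- + 1) (Q.n<1+n m) (k q (+ m)))) ∙ h q)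
  ... | ()

-- A word pair is counted if some indicator ρ of its lattice has a row potential whose flux around the loop is ±1.
record Counted (A B : Word) : Set where
 field
  ρ         : Cell -> ℤ
  poten : Cell -> ℤ
  ε         : ℤ
  gradient  : ∀ p -> poten (p <> step R) == poten p + ρ p
  cases     : ∀ p -> (ρ p == + 1 × InL (vec A) (vec B) p) ⊎ ρ p == + 0
  one       : ∀ p -> InL (vec A) (vec B) p -> ρ p == + 1
  sign      : ε == + 1 ⊎ ε == -[1+ 0 ]
  total     : ∀ p -> bracket poten A B p == ε

Counted-resp : ∀ {A B A' B'} (s : ℤ -> ℤ) (t : Cell) -> (∀ {ε} -> ε == + 1 ⊎ ε == -[1+ 0 ] -> s ε == + 1 ⊎ s ε == -[1+ 0 ]) ->
 (∀ v -> InL (vec A) (vec B) v -> InL (vec A') (vec B') v) -> (∀ v -> InL (vec A') (vec B') v -> InL (vec A) (vec B) v) -> (∀ σ p -> bracket σ A' B' p == s (bracket σ A B (p <> t))) -> Counted A B -> Counted A' B'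
Counted-resp s t hs to from h c = record
 { ρ = ρ ; poten = poten ; ε = s ε ; gradient = gradient ; cases = \ p -> Data.Sum.map (\ { (e , i) -> e , to p i }) (\ e -> e) (cases p) ; one = \ p i -> one p (from p i) ; sign = hs sign
  ; total = \ p -> h poten p ∙ ap s (total (p <> t)) }
 where open Counted c

neg-sign : ∀ {ε} -> ε == + 1 ⊎ ε == -[1+ 0 ] -> Z.- ε == + 1 ⊎ Z.- ε == -[1+ 0 ]
neg-sign (inl refl) = inr refl
neg-sign (inr refl) = inl refl

Counted-swap : ∀ {A B} -> Counted B A -> Counted A B
Counted-swap {A} {B} = Counted-resp (\ z -> Z.- z) org neg-sign (\ _ -> sw) (\ _ -> sw) (\ σ p -> alg (flux σ p A) (flux σ (p <> vec B) A) (flux σ (p <> vec A) B) (flux σ p B) ∙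
   ap (\ z -> Z.- bracket σ B A z) (! (⊕-idʳ p)))
 where
 alg : ∀ a b c d -> (a Z.- b) + (c Z.- d) == Z.- ((d Z.- c) + (b Z.- a))
 alg = ring
 sw : ∀ {a b v} -> InL a b v -> InL b a v
 sw {a} {b} (m , n , e) = n , m , e ∙ ⊕-comm (m · a) (n · b)

neg-lattice : ∀ a b v -> InL (neg a) b v -> InL a b v
neg-lattice (a₁ , a₂) b v (m , n , e) = Z.- m , n , e ∙ ap (_<> n · b) (ap2 _,_ (alg m a₁) (alg m a₂))
 where
 alg : ∀ m a -> m * (Z.- a) == (Z.- m) * a
 alg = ring

neg-neg : ∀ a -> neg (neg a) == a
neg-neg (a , b) = ap2 _,_ (Y.neg-involutive a) (Y.neg-involutive b)

flux-rev' : ∀ ρ p w -> flux ρ p (rev w) == Z.- flux ρ (p <> neg (vec w)) w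
flux-rev' ρ p w = ap (\ z -> flux ρ z (rev w)) (! e) ∙ flux-rev ρ (p <> neg (vec w)) w
 where
 e : tip (p <> neg (vec w)) w == p
 e = (tip-vec _ w) ∙ ⊕-swap p (neg (vec w)) (vec w) ∙ ⊕-can p (vec w)

Counted-rev : ∀ {A B} -> Counted (rev A) B -> Counted A B
Counted-rev {A} {B} = Counted-resp (\ z -> Z.- z) (vec A) neg-sign (\ v i -> neg-lattice (vec A) (vec B) v (tp (\ z -> InL z (vec B) v) (vec-rev A) i))
 (\ v i -> tp (\ z -> InL z (vec B) v) (! (vec-rev A)) (neg-lattice (neg (vec A)) (vec B) v (tp (\ z -> InL z (vec B) v) (! (neg-neg (vec A))) i)))
  \ σ p -> alg (flux σ p A) (flux σ (p <> vec B) A) (flux σ (p <> vec A) B) (flux σ p B) ∙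
   ap2 (\ x y -> Z.- (x + y)) (ap2 (\ x y -> x Z.- y) (ap (\ z -> Z.- flux σ z A) (! (⊕-can p (vec A))) ∙ ! (flux-rev' σ (p <> vec A) A))
    (ap (\ z -> Z.- flux σ z A) (! (ap (_<> neg (vec A)) (⊕-swap p (vec A) (vec B)) ∙ ⊕-can (p <> vec B) (vec A))) ∙ ! (flux-rev' σ ((p <> vec A) <> vec B) A)))
    (ap2 (\ x y -> flux σ x B Z.- flux σ y B) (! (ap ((p <> vec A) <>_) (vec-rev A) ∙ ⊕-can p (vec A))) refl)
 where
 alg : ∀ a b c d -> (a Z.- b) + (c Z.- d) == Z.- ((Z.- a Z.- Z.- b) + (d Z.- c))
 alg = ring

Counted-add : ∀ {A B} -> Counted A (B ++ A) -> Counted A B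
Counted-add {A} {B} = Counted-resp (\ z -> z) org (\ h -> h) (\ v i -> shear (vec A) (vec B) v (tp (\ z -> InL (vec A) z v) (vec-++ B A) i)) (\ v i -> tp (\ z -> InL (vec A) z v) (! (vec-++ B A)) (shear' (vec A) (vec B) v i))
  \ σ p -> alg (flux σ p A) (flux σ (p <> vec B) A) (flux σ (p <> vec A) B) (flux σ p B) (flux σ ((p <> vec A) <> vec B) A) ∙
   (ap2 Z._+_ (ap (\ z -> flux σ p A Z.- flux σ z A) (⊕-assoc p (vec A) (vec B) ∙ ap (p <>_) (⊕-comm (vec A) (vec B) ∙ ! (vec-++ B A))))
   (! (ap2 Z._-_ (flux-++ σ (p <> vec A) B A ∙ ap (\ z -> flux σ (p <> vec A) B + flux σ z A) (tip-vec (p <> vec A) B)) (flux-++ σ p B A ∙ ap (\ z -> flux σ p B + flux σ z A) (tip-vec p B))))) ∙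
   ap (bracket σ A (B ++ A)) (! (⊕-idʳ p))
 where
 alg : ∀ a b c d e -> (a Z.- b) + (c Z.- d) == (a Z.- e) + ((c + e) Z.- (d + b))
 alg = ring
 l1 : ∀ m n a b -> m * a + n * (b + a) == (m + n) * a + n * b
 l1 = ring
 l2 : ∀ m n a b -> m * a + n * b == (m Z.- n) * a + n * (b + a)
 l2 = ring
 shear : ∀ a b v -> InL a (b <> a) v -> InL a b v
 shear (a₁ , a₂) (b₁ , b₂) v (m , n , e) = m + n , n , e ∙ (ap2 _,_ (l1 m n a₁ b₁) (l1 m n a₂ b₂))
 shear' : ∀ a b v -> InL a b v -> InL a (b <> a) v
 shear' (a₁ , a₂) (b₁ , b₂) v (m , n , e) = m Z.- n , n , e ∙ (ap2 _,_ (l2 m n a₁ b₁) (l2 m n a₂ b₂))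

Counted-sub : ∀ {A B} -> Counted A (B ++ rev A) -> Counted A B
Counted-sub {A} {B} c = Counted-rev (Counted-add (Counted-rev (tp (\ z -> Counted z (B ++ rev A)) (! (rr A)) c)))

Counted-flat : ∀ A B h s g -> vec A == (+ suc h , + 0) -> vec B == (s , + suc g) -> Counted A B
Counted-flat A B h s g eA eB = record
 { ρ = ρ ; poten = pot ; ε = + 1 ; gradient = grad ; cases = cas ; one = on ; sign = inl refl ; total = tot }
 where
 module H = Floor (suc h)
 module G = Floor (suc g)
 pot ρ : Cell -> ℤ
 pot (x , y) = G.δ y * H.floor (x Z.- + 1 Z.- s * G.floor y)
 ρ (x , y) = G.δ y * H.δ (x Z.- s * G.floor y)
 grad : ∀ p -> pot (p <> step R) == pot p + ρ p
 grad (x , y) = ap2 (\ u v -> G.δ v * H.floor (u Z.- s * G.floor v)) (l1 x) (+0 y) ∙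
   l2 (G.δ y) (H.floor (x Z.- s * G.floor y)) (H.floor (x Z.- + 1 Z.- s * G.floor y)) ∙
    ap (\ z -> G.δ y * H.floor (x Z.- + 1 Z.- s * G.floor y) + G.δ y * (H.floor (x Z.- s * G.floor y) Z.- H.floor z)) (l3 x (s * G.floor y))
  where
  l1 : ∀ x -> (x + + 1) Z.- + 1 == x
  l1 = ring
  l2 : ∀ d a b -> d * a == d * b + d * (a Z.- b)
  l2 = ring
  l3 : ∀ x y -> x Z.- + 1 Z.- y == x Z.- y Z.- + 1
  l3 = ring
 inj : ∀ {v} -> InL (+ suc h , + 0) (s , + suc g) v -> InL (vec A) (vec B) v
 inj {v} = tp (\ z -> z) (ap2 (\ a b -> InL a b v) (! eA) (! eB))
 cas : ∀ p -> (ρ p == + 1 × InL (vec A) (vec B) p) ⊎ ρ p == + 0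
 cas (x , y) with G.δ-cases y
 ... | inr e = inr (ap (Z._* H.δ (x Z.- s * G.floor y)) e)
 ... | inl (e , ey) with H.δ-cases (x Z.- s * G.floor y)
 ... | inr e' = inr (ap (G.δ y Z.*_) e' ∙ Y.*-zeroʳ (G.δ y))
 ... | inl (e' , ex) = inl (ap2 Z._*_ e e' , inj (H.floor (x Z.- s * G.floor y) , G.floor y ,
     ap2 _,_ (l x (s * G.floor y) ∙ (ap2 Z._+_ ex (Y.*-comm s (G.floor y)))) (ey ∙ (l' (H.floor (x Z.- s * G.floor y)) _))))
  where
  l : ∀ x y -> x == (x Z.- y) + y
  l = ring
  l' : ∀ m n -> n == m * + 0 + n
  l' = ring
 on : ∀ p -> InL (vec A) (vec B) p -> ρ p == + 1
 on p i with tp (\ z -> z) (ap2 (\ a b -> InL a b p) eA eB) i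
 ... | m , n , refl = ap2 Z._*_ (ap G.δ e2 ∙ G.δ-* n) (ap H.δ (ap (\ z -> m * + suc h + n * s Z.- s * z) (ap G.floor e2 ∙ G.floor-* n) ∙ l1 (m * + suc h) n s) ∙ H.δ-* m)
  where
  e2 : m * + 0 + n * + suc g == n * + suc g
  e2 = ap (Z._+ n * + suc g) (Y.*-zeroʳ m) ∙ (0+ _)
  l1 : ∀ m n s -> m + n * s Z.- s * n == m
  l1 = ring
 tot : ∀ p -> bracket pot A B p == + 1
 tot p = (ap2 Z._+_ eqA eqB) ∙ refl
  where
  l1 : ∀ x s k -> (x + s) Z.- + 1 Z.- s * (k + + 1) == x Z.- + 1 Z.- s * k
  l1 = ring
  l2 : ∀ x h k -> (x + h) Z.- + 1 Z.- k == (x Z.- + 1 Z.- k) + h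
  l2 = ring
  l3 : ∀ d a -> d * (a + + 1) == d * a + d
  l3 = ring
  l4 : ∀ a b -> (a + b) Z.- a == b
  l4 = ring
  l5 : ∀ y -> y == (y + + 1) Z.- + 1
  l5 = ring
  l6 : ∀ y k -> (y + k) Z.- + 1 == (y Z.- + 1) + k
  l6 = ring
  perB : ∀ q -> pot (q <> (s , + suc g)) == pot q
  perB (x , y) = ap2 Z._*_ (G.δ-+ y) (ap H.floor (ap (\ z -> x + s Z.- + 1 Z.- s * z) (G.floor-+ y) ∙ l1 x s (G.floor y)))
  perA : ∀ q -> pot (q <> (+ suc h , + 0)) == pot q + G.δ (snd q)
  perA (x , y) = ap (\ v -> G.δ v * H.floor (x + + suc h Z.- + 1 Z.- s * G.floor v)) (+0 y) ∙
   ap (G.δ y Z.*_) (ap H.floor (l2 x (+ suc h) (s * G.floor y)) ∙ H.floor-+ (x Z.- + 1 Z.- s * G.floor y)) ∙ l3 (G.δ y) (H.floor (x Z.- + 1 Z.- s * G.floor y))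
  eqA : flux pot p A Z.- flux pot (p <> vec B) A == + 0
  eqA = ap (\ z -> flux pot p A Z.- z) (flux-⊕ pot p (vec B) A ∙ flux-cong (\ q -> ap (\ z -> pot (q <> z)) eB ∙ perB q) p A) ∙
      Y.+-inverseʳ (flux pot p A)
  g' : ℤ -> ℤ
  g' y = G.floor (y Z.- + 1)
  eqB : flux pot (p <> vec A) B Z.- flux pot p B == + 1
  eqB = (ap (\ z -> z Z.- flux pot p B) (flux-⊕ pot p (vec A) B ∙ flux-cong (\ q -> ap (\ z -> pot (q <> z)) eA ∙ perA q) p B ∙ flux-+ pot (\ q -> G.δ (snd q)) p B) ∙ (l4 (flux pot p B) _) ∙ (flux-poten _ g' (\ x y -> ap (\ z -> G.floor z Z.- G.floor (y Z.- + 1)) (l5 y)) p B) ∙ ap (\ z -> g' z Z.- g' (snd p)) (ap snd (tip-vec p B) ∙ ap (\ z -> snd p + snd z) eB) ∙ ap (\ z -> z Z.- g' (snd p)) (ap G.floor (l6 (snd p) (+ suc g)) ∙ G.floor-+ (snd p Z.- + 1)) ∙ l4 (g' (snd p)) (+ 1))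

det-swap : ∀ a b -> det b a == Z.- det a b
det-swap (a₁ , a₂) (b₁ , b₂) = alg a₁ a₂ b₁ b₂
 where
 alg : ∀ a b c d -> c * b Z.- d * a == Z.- (a * d Z.- b * c)
 alg = ring

det-add : ∀ a b -> det a (b <> a) == det a b
det-add (a₁ , a₂) (b₁ , b₂) = alg a₁ a₂ b₁ b₂
 where
 alg : ∀ a b c d -> a * (d + b) Z.- b * (c + a) == a * d Z.- b * c
 alg = ring

neg≢0 : ∀ {z} -> z != + 0 -> Z.- z != + 0
neg≢0 {z} h e = h (! (Y.neg-involutive z) ∙ ap (\ w -> Z.- w) e)

Counted-level : ∀ A B -> snd (vec A) == + 0 -> det (vec A) (vec B) != + 0 -> Counted A B
Counted-level A B lev nz = split (vec A) (vec B) refl refl lev nz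
 where
 split : ∀ a b -> vec A == a -> vec B == b -> snd a == + 0 -> det a b != + 0 -> Counted A B
 split (+ 0 , .(+ 0)) (s , t) eA eB refl nz = !! (nz refl)
 split (x , .(+ 0)) (s , + 0) eA eB refl nz = !! (nz (ap (\ z -> z Z.- + 0) (Y.*-zeroʳ x) ∙ refl))
 split (+ suc h , .(+ 0)) (s , + suc g) eA eB refl nz = Counted-flat A B h s g eA eB
 split (-[1+ h ] , .(+ 0)) (s , + suc g) eA eB refl nz = Counted-rev (Counted-flat (rev A) B h s g (vec-rev A ∙ ap neg eA) eB)
 split (+ suc h , .(+ 0)) (s , -[1+ g ]) eA eB refl nz =
  Counted-swap (Counted-rev (Counted-swap (Counted-flat A (rev B) h (Z.- s) g eA (vec-rev B ∙ ap neg eB))))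
 split (-[1+ h ] , .(+ 0)) (s , -[1+ g ]) eA eB refl nz =
  Counted-rev (Counted-swap (Counted-rev (Counted-swap (Counted-flat (rev A) (rev B) h (Z.- s) g (vec-rev A ∙ ap neg eA) (vec-rev B ∙ ap neg eB)))))

closer : ∀ y t -> y != + 0 -> Z.∣ y ∣ ≤ Z.∣ t ∣ -> (Z.∣ t Z.- y ∣ < Z.∣ t ∣) ⊎ (Z.∣ t + y ∣ < Z.∣ t ∣)
closer (+ 0) t y≢ le = !! (y≢ refl)
closer (+ suc m) (+ suc n) y≢ le = inl (tp (N._< suc n) (! (ap Z.∣_∣ (Y.⊖-≥ le))) (N.s≤s (Q.m∸n≤m n m)))
closer -[1+ m ] (+ suc n) y≢ le = inr (tp (N._< suc n) (! (ap Z.∣_∣ (Y.⊖-≥ le))) (N.s≤s (Q.m∸n≤m n m)))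
closer (+ suc m) -[1+ n ] y≢ le = inr (tp (N._< suc n) (! (Y.∣m⊖n∣≡∣n⊖m∣ (suc m) (suc n) ∙ ap Z.∣_∣ (Y.⊖-≥ le))) (N.s≤s (Q.m∸n≤m n m)))
closer -[1+ m ] -[1+ n ] y≢ le = inl (tp (N._< suc n) (! (Y.∣m⊖n∣≡∣n⊖m∣ (suc m) (suc n) ∙ ap Z.∣_∣ (Y.⊖-≥ le))) (N.s≤s (Q.m∸n≤m n m)))

ht : Word -> ℕ
ht A = Z.∣ snd (vec A) ∣

reduce : ∀ n -> (∀ A B -> ht A N.+ ht B ≤ n -> det (vec A) (vec B) != + 0 -> Counted A B) -> ∀ A B -> snd (vec A) != + 0 -> ht A ≤ ht B -> ht A N.+ ht B ≤ suc n -> det (vec A) (vec B) != + 0 -> Counted A B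
reduce n rec A B y≢ h le nz with closer (snd (vec A)) (snd (vec B)) y≢ h
... | inl lt = Counted-sub {A} {B} (rec A (B ++ rev A) (Q.≤-pred (≤-tr (Q.+-monoʳ-< (ht A) (tp (N._< ht B) (ap Z.∣_∣ (! e)) lt)) le)) nz')
 where
 e : snd (vec (B ++ rev A)) == snd (vec B) Z.- snd (vec A)
 e = ap snd (vec-++ B (rev A) ∙ ap (vec B <>_) (vec-rev A))
 nz' : det (vec A) (vec (B ++ rev A)) != + 0
 nz' z = nz ((! (det-add (vec A) (vec B)) ∙ alg (vec A) (vec B) ∙ ! (ap (det (vec A)) (vec-++ B (rev A) ∙ ap (vec B <>_) (vec-rev A)))) ∙ z)
  where
  alg : ∀ a b -> det a (b <> a) == det a (b <> neg a)
  alg (a₁ , a₂) (b₁ , b₂) = alg' a₁ a₂ b₁ b₂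
   where
   alg' : ∀ a b c d -> a * (d + b) Z.- b * (c + a) == a * (d + (Z.- b)) Z.- b * (c + (Z.- a))
   alg' = ring
... | inr lt = Counted-add {A} {B} (rec A (B ++ A) (Q.≤-pred (≤-tr (Q.+-monoʳ-< (ht A) (tp (N._< ht B) (ap (\ z -> Z.∣ snd z ∣) (! (vec-++ B A))) lt)) le))
    \ z -> nz ((! (det-add (vec A) (vec B)) ∙ ! (ap (det (vec A)) (vec-++ B A))) ∙ z))

counted : ∀ n A B -> ht A N.+ ht B ≤ n -> det (vec A) (vec B) != + 0 -> Counted A B
counted n A B le nz with snd (vec A) Y.≟ + 0 | snd (vec B) Y.≟ + 0
... | yes e | _ = Counted-level A B e nz
... | no _ | yes e = Counted-swap (Counted-level B A e \ z -> neg≢0 nz (! (det-swap (vec A) (vec B)) ∙ z))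
counted zero A B le nz | no y≢ | no _ = !! (y≢ (Y.∣i∣≡0⇒i≡0 (Q.n≤0⇒n≡0 (≤-tr (Q.m≤m+n (ht A) (ht B)) le))))
counted (suc n) A B le nz | no y≢ | no t≢ with Q.≤-total (ht A) (ht B)
... | inl h = reduce n (counted n) A B y≢ h le nz
... | inr h = Counted-swap (reduce n (counted n) B A t≢ h (tp (N._≤ suc n) (Q.+-comm (ht A) (ht B)) le)
         \ z -> neg≢0 nz (! (det-swap (vec A) (vec B)) ∙ z))

-- Turning costs.  Around a vertex the cost of a turn counts the unit angles on its left.

code : Ltr -> ℕ
code R = 0
code U = 1
code L = 2
code D = 3

θ : Ltr -> Ltr -> ℕ
θ x y = suc ((5 N.+ code x N.∸ code y) N.% 4)

allᵇ : (Ltr -> Bool) -> Bool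
allᵇ P = P R ∧ P U ∧ P L ∧ P D

allᵇ-sound : ∀ P -> allᵇ P == true -> ∀ l -> P l == true
allᵇ-sound P e l with P R in r | P U in u | P L in ℓ | P D in d
allᵇ-sound P e R | true | true | true | true = r
allᵇ-sound P e U | true | true | true | true = u
allᵇ-sound P e L | true | true | true | true = ℓ
allᵇ-sound P e D | true | true | true | true = d

≤ᵇ-sound : ∀ m n -> (m N.≤ᵇ n) == true -> m ≤ n
≤ᵇ-sound m n e = Q.≤ᵇ⇒≤ m n (tp T (! e) tt)

θ-triangle : ∀ x y z -> θ x z ≤ θ x y N.+ θ (inv y) z
θ-triangle x y z = ≤ᵇ-sound (θ x z) _ (allᵇ-sound (\ z -> θ x z N.≤ᵇ θ x y N.+ θ (inv y) z) (allᵇ-sound (\ y -> allᵇ (\ z -> θ x z N.≤ᵇ θ x y N.+ θ (inv y) z))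
 (allᵇ-sound (\ x -> allᵇ (\ y -> allᵇ (\ z -> θ x z N.≤ᵇ θ x y N.+ θ (inv y) z))) refl x) y) z)

θ-reverse : ∀ x y -> 4 ≤ θ x y N.+ θ (inv y) (inv x)
θ-reverse x y = ≤ᵇ-sound 4 _ (allᵇ-sound (\ y -> 4 N.≤ᵇ θ x y N.+ θ (inv y) (inv x)) (allᵇ-sound (\ x -> allᵇ (\ y -> 4 N.≤ᵇ θ x y N.+ θ (inv y) (inv x))) refl x) y)

lst : Ltr -> Word -> Ltr
lst x [] = x
lst x (l :: w) = lst l w

lst-++ : ∀ x u v -> lst x (u ++ v) == lst (lst x u) v
lst-++ x [] v = refl
lst-++ x (l :: u) v = lst-++ l u v

rev-head : ∀ b q -> Σ Word \ r -> rev (b :: q) == inv (lst b q) :: r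
rev-head b [] = [] , refl
rev-head b (c :: q) with rev-head c q
... | r , e = r ++ (inv b :: []) , ap (_++ (inv b :: [])) e

module Turning (ρ : Cell -> ℤ) (ρ≥0 : ∀ p -> + 0 Z.≤ ρ p) where

 turns : Ltr -> Cell -> Word -> ℤ
 turns x p [] = + 0
 turns x p (l :: w) = ρ p * + θ x l + turns l (p <> step l) w

 inner : Cell -> Word -> ℤ
 inner p [] = + 0
 inner p (l :: w) = turns l (p <> step l) w

 cyc : Cell -> Word -> ℤ
 cyc p [] = + 0
 cyc p (l :: w) = turns (lst l w) p (l :: w)

 weigh : ∀ p {m n} -> m ≤ n -> ρ p * + m Z.≤ ρ p * + n
 weigh p le = Y.*-monoˡ-≤-nonNeg (ρ p) {{Z.nonNegative (ρ≥0 p)}} (Z.+≤+ le)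

 weigh≥0 : ∀ p n -> + 0 Z.≤ ρ p * + n
 weigh≥0 p n = tp (Z._≤ ρ p * + n) (Y.*-zeroʳ (ρ p)) (weigh p {0} {n} N.z≤n)

 turns≥0 : ∀ x p w -> + 0 Z.≤ turns x p w
 turns≥0 x p [] = Y.≤-refl
 turns≥0 x p (l :: w) = Y.+-mono-≤ (weigh≥0 p (θ x l)) (turns≥0 l (p <> step l) w)

 inner≥0 : ∀ p w -> + 0 Z.≤ inner p w
 inner≥0 p [] = Y.≤-refl
 inner≥0 p (l :: w) = turns≥0 l (p <> step l) w

 turns-++ : ∀ x p u v -> turns x p (u ++ v) == turns x p u + turns (lst x u) (tip p u) v
 turns-++ x p [] v = ! (0+ _)
 turns-++ x p (l :: u) v = ap (\ z -> ρ p * + θ x l + z) (turns-++ l (p <> step l) u v) ∙ ! (Y.+-assoc (ρ p * + θ x l) _ _)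

 cyc-++ : ∀ p a u b v -> cyc p ((a :: u) ++ (b :: v)) == turns (lst b v) p (a :: u) + turns (lst a u) (tip p (a :: u)) (b :: v)
 cyc-++ p a u b v = ap (\ z -> turns z p ((a :: u) ++ (b :: v))) (lst-++ a u (b :: v)) ∙ turns-++ (lst b v) p (a :: u) (b :: v)

 cyc-rot : ∀ p u v -> tip p (u ++ v) == p -> cyc p (u ++ v) == cyc (tip p u) (v ++ u)
 cyc-rot p [] v e = ap (cyc p) (! (++-id v))
 cyc-rot p (a :: u) [] e = ap (cyc p) (++-id (a :: u)) ∙ ap (\ z -> cyc z (a :: u)) (! e ∙ ap (tip p) (++-id (a :: u)))
 cyc-rot p (a :: u) (b :: v) e = (cyc-++ p a u b v ∙ (Y.+-comm (turns (lst b v) p (a :: u)) _) ∙ ap (\ z -> turns (lst a u) q (b :: v) + turns (lst b v) z (a :: u)) (! e ∙ tip-++ p (a :: u) (b :: v)) ∙ ! (cyc-++ q b v a u))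
  where
  open ≡-Reasoning
  q : Cell
  q = tip p (a :: u)

 cyc-glue : ∀ p a u b v c w -> let P = a :: u ; Q = b :: v ; S = c :: w in
  tip (tip p P) Q == p ->
  cyc p (P ++ S) Z.≤ cyc p (P ++ Q) + cyc p (rev Q ++ S)
 cyc-glue p a u b v c w closed with rev-head b v
 ... | r , er = begin
   cyc p (P ++ S)                                        ≡⟨ cyc-++ p a u c w ⟩ (ρ p * + θ (lst c w) a + iP) + (ρ e * + θ (lst a u) c + iS)
    ≤⟨ Y.+-mono-≤ (Y.+-monoˡ-≤ iP (weigh p (θ-triangle (lst c w) (inv (lst b v)) a))) (Y.+-monoˡ-≤ iS (weigh e (θ-triangle (lst a u) b c))) ⟩ (ρ p * + (t1 N.+ t2') + iP) + (ρ e * + (t3 N.+ t4) + iS)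
    ≡⟨ ap (\ z -> (ρ p * + (t1 N.+ θ z a) + iP) + (ρ e * + (t3 N.+ t4) + iS)) (inv-inv (lst b v)) ⟩ (ρ p * (+ t1 + + t2) + iP) + (ρ e * (+ t3 + + t4) + iS)
    ≡⟨ ! (+0 _) ⟩ ((ρ p * (+ t1 + + t2) + iP) + (ρ e * (+ t3 + + t4) + iS)) + + 0
    ≤⟨ Y.+-monoʳ-≤ ((ρ p * (+ t1 + + t2) + iP) + (ρ e * (+ t3 + + t4) + iS)) (Y.+-mono-≤ (inner≥0 e Q) (inner≥0 p (inv (lst b v) :: r))) ⟩ ((ρ p * (+ t1 + + t2) + iP) + (ρ e * (+ t3 + + t4) + iS)) + (iQ + iR)
    ≡⟨ alg (ρ p) (ρ e) (+ t1) (+ t2) (+ t3) (+ t4) iP iQ iR iS ⟩ ((ρ p * + t2 + iP) + (ρ e * + t3 + iQ)) + ((ρ p * + t1 + iR) + (ρ e * + t4 + iS))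
    ≡⟨ ap2 Z._+_ (! (cyc-++ p a u b v)) (! eq) ⟩
   cyc p (P ++ Q) + cyc p (rev Q ++ S) ∎
  where
  open Y.≤-Reasoning
  P Q S : Word
  P = a :: u
  Q = b :: v
  S = c :: w
  e : Cell
  e = tip p P
  t1 t2 t2' t3 t4 : ℕ
  t1 = θ (lst c w) (inv (lst b v))
  t2 = θ (lst b v) a
  t2' = θ (inv (inv (lst b v))) a
  t3 = θ (lst a u) b
  t4 = θ (inv b) c
  iP iQ iR iS : ℤ
  iP = inner p P
  iQ = inner e Q
  iR = inner p (inv (lst b v) :: r)
  iS = inner e S
  alg : ∀ x y a b c d i j k l -> ((x * (a + b) + i) + (y * (c + d) + l)) + (j + k) == ((x * b + i) + (y * c + j)) + ((x * a + k) + (y * d + l))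
  alg = ring
  eq : cyc p (rev Q ++ S) == (ρ p * + t1 + iR) + (ρ e * + t4 + iS)
  eq = ==.begin
   cyc p (rev Q ++ S) ==.≡⟨ ap (\ z -> cyc p (z ++ S)) er ⟩
   cyc p ((inv (lst b v) :: r) ++ S) ==.≡⟨ cyc-++ p (inv (lst b v)) r c w ⟩
   turns (lst c w) p (inv (lst b v) :: r) + turns (lst (inv (lst b v)) r) (tip p (inv (lst b v) :: r)) S
    ==.≡⟨ ap2 (\ x y -> turns (lst c w) p (inv (lst b v) :: r) + turns x y S) (ap (lst (lst b v)) (! er) ∙ lst-++ (lst b v) (rev v) (inv b :: [])) (ap (tip p) (! er) ∙ ap (\ z -> tip z (rev Q)) (! closed) ∙ tip-rev e Q) ⟩
   turns (lst c w) p (inv (lst b v) :: r) + turns (inv b) e S ==.∎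
   where module == = ≡-Reasoning

 module Positive (φ : Cell -> ℤ) (gradient : ∀ p -> φ (p <> step R) == φ p + ρ p) where

  quad : Cell -> Word -> ℤ
  quad p w = (flux φ p w + flux φ (p <> step R) w) + (flux φ (p <> step U) w + flux φ ((p <> step R) <> step U) w)

  flux-cell : ∀ p -> flux φ p (R :: U :: L :: D :: []) == ρ p
  flux-cell p = ap2 (\ x y -> + 0 + (x + (+ 0 + (Z.- φ y + + 0)))) (gradient p) (ap (_<> step D) (⊕-swap (p <> step R) (step U) (step L) ∙ ap (_<> step U) (step-back p R)) ∙ step-back p U) ∙
   alg (φ p) (ρ p)
   where
   alg : ∀ a b -> + 0 + ((a + b) + (+ 0 + (Z.- a + + 0))) == b
   alg = ring

  flux-rotate : ∀ p u v -> tip p (u ++ v) == p -> flux φ p (u ++ v) == flux φ (tip p u) (v ++ u)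
  flux-rotate p u v e = flux-++ φ p u v ∙ (Y.+-comm (flux φ p u) _) ∙ ap (\ z -> flux φ (tip p u) v + flux φ z u) (! e ∙ tip-++ p u v) ∙ ! (flux-++ φ (tip p u) v u)

  closed-at : ∀ {w} -> vec w == org -> ∀ p -> tip p w == p
  closed-at {w} c p = tip-vec p w ∙ ap (p <>_) c ∙ ⊕-idʳ p

  vec-rot : ∀ u v -> vec (u ++ v) == org -> vec (v ++ u) == org
  vec-rot u v c = vec-++ v u ∙ ⊕-comm (vec v) (vec u) ∙ ! (vec-++ u v) ∙ c

  Disk-closed : ∀ {w} -> Disk w -> vec w == org
  Disk-closed cell = refl
  Disk-closed (rotate u v d) = vec-rot u v (Disk-closed d)
  Disk-closed (glue a p b q c s d1 d2) = (tip-++ org (a :: p) (c :: s) ∙ ap (\ z -> tip z (c :: s)) (! e') ∙ ! (tip-++ org (rev (b :: q)) (c :: s)) ∙ Disk-closed d2)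
   where
   open ≡-Reasoning
   e : Cell
   e = vec (a :: p)
   e' : vec (rev (b :: q)) == e
   e' = ap (\ z -> tip z (rev (b :: q))) (! (! (tip-++ org (a :: p) (b :: q)) ∙ Disk-closed d1)) ∙ tip-rev e (b :: q)

  Disk-turns : ∀ {w} -> Disk w -> ∀ p -> cyc p w Z.≤ quad p w
  Disk-turns cell p = Y.≤-reflexive (ap2 (\ x y -> ρ p * + 1 + (ρ (p <> step R) * + 1 + (ρ ((p <> step R) <> step U) * + 1 + (ρ x * + 1 + y)))) (⊕-swap (p <> step R) (step U) (step L) ∙ ap (_<> step U) (step-back p R)) refl ∙
   alg (ρ p) (ρ (p <> step R)) (ρ ((p <> step R) <> step U)) (ρ (p <> step U)) ∙
    ! (ap2 Z._+_ (ap2 Z._+_ (flux-cell p) (flux-cell (p <> step R))) (ap2 Z._+_ (flux-cell (p <> step U)) (flux-cell ((p <> step R) <> step U)))))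
   where
   alg : ∀ a b c d -> a * + 1 + (b * + 1 + (c * + 1 + (d * + 1 + + 0))) == (a + b) + (d + c)
   alg = ring
  Disk-turns (rotate u v d) p = tp (\ z -> cyc z (v ++ u) Z.≤ quad z (v ++ u)) back (transport2 (cyc-rot p' u v cl) quad-rot (Disk-turns d p'))
   where
   transport2 : ∀ {a b c d} -> a == c -> b == d -> a Z.≤ b -> c Z.≤ d
   transport2 refl refl h = h
   p' : Cell
   p' = p <> neg (vec u)
   back : tip p' u == p
   back = tip-vec p' u ∙ ⊕-swap p (neg (vec u)) (vec u) ∙ ⊕-can p (vec u)
   cl : ∀ {q} -> tip q (u ++ v) == q
   cl {q} = closed-at {u ++ v} (Disk-closed d) q
   rot : ∀ t -> flux φ (p' <> t) (u ++ v) == flux φ (tip p' u <> t) (v ++ u)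
   rot t = flux-rotate (p' <> t) u v cl ∙ ap (\ z -> flux φ z (v ++ u)) (tip-⊕ p' t u)
   quad-rot : quad p' (u ++ v) == quad (tip p' u) (v ++ u)
   quad-rot = ap2 Z._+_ (ap2 Z._+_ (flux-rotate p' u v cl) (rot (step R))) (ap2 Z._+_ (rot (step U)) (ap (\ z -> flux φ z (u ++ v)) (⊕-assoc p' (step R) (step U)) ∙
     rot (step R <> step U) ∙ ap (\ z -> flux φ z (v ++ u)) (! (⊕-assoc (tip p' u) (step R) (step U)))))
  Disk-turns (glue a p b q c s d1 d2) o = Y.≤-trans (cyc-glue o a p b q c s cl) (Y.≤-trans (Y.+-mono-≤ (Disk-turns d1 o) (Disk-turns d2 o)) (Y.≤-reflexive quad-glue))
   where
   P Q S : Word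
   P = a :: p
   Q = b :: q
   S = c :: s
   cl : ∀ {o} -> tip (tip o P) Q == o
   cl {o} = ! (tip-++ o P Q) ∙ closed-at {P ++ Q} (Disk-closed d1) o
   fg : ∀ o -> flux φ o (P ++ Q) + flux φ o (rev Q ++ S) == flux φ o (P ++ S)
   fg o = ((ap2 Z._+_ (flux-++ φ o P Q) (flux-++ φ o (rev Q) S)) ∙ ap2 (\ x y -> (flux φ o P + flux φ e Q) + (x + flux φ y S)) (ap (\ z -> flux φ z (rev Q)) (! cl) ∙ flux-rev φ e Q) (ap (\ z -> tip z (rev Q)) (! cl) ∙ tip-rev e Q) ∙ alg (flux φ o P) (flux φ e Q) (flux φ e S) ∙ ! (flux-++ φ o P S))
    where
    open ≡-Reasoning
    e : Cell
    e = tip o P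
    alg : ∀ a b c -> (a + b) + (Z.- b + c) == a + c
    alg = ring
   quad-glue : quad o (P ++ Q) + quad o (rev Q ++ S) == quad o (P ++ S)
   quad-glue = alg (flux φ o (P ++ Q)) (flux φ (o <> step R) (P ++ Q)) (flux φ (o <> step U) (P ++ Q)) (flux φ ((o <> step R) <> step U) (P ++ Q)) (flux φ o (rev Q ++ S)) (flux φ (o <> step R) (rev Q ++ S)) (flux φ (o <> step U) (rev Q ++ S)) (flux φ ((o <> step R) <> step U) (rev Q ++ S)) ∙
    (ap2 Z._+_ (ap2 Z._+_ (fg o) (fg (o <> step R))) (ap2 Z._+_ (fg (o <> step U)) (fg ((o <> step R) <> step U))))
    where
    alg : ∀ a b c d a' b' c' d' -> ((a + b) + (c + d)) + ((a' + b') + (c' + d')) == ((a + a') + (b + b')) + ((c + c') + (d + d'))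
    alg = ring

-- A loop A B A⁻¹ B⁻¹ bounding a disk is simple: the turning costs in one class modulo the lattice of A and B
-- add up to at most 4, and both a corner class and an inner vertex with its partner already cost 4.

InL-⊕ : ∀ {a b v w} -> InL a b v -> InL a b w -> InL a b (v <> w)
InL-⊕ {a₁ , a₂} {b₁ , b₂} (m , n , refl) (k , l , refl) = m + k , n + l , ap2 _,_ (alg m n k l a₁ b₁) (alg m n k l a₂ b₂)
 where
 alg : ∀ m n k l a b -> (m * a + n * b) + (k * a + l * b) == (m + k) * a + (n + l) * b
 alg = ring

InL-neg : ∀ {a b v} -> InL a b v -> InL a b (neg v)
InL-neg {a₁ , a₂} {b₁ , b₂} (m , n , refl) = Z.- m , Z.- n , ap2 _,_ (alg m n a₁ b₁) (alg m n a₂ b₂)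
 where
 alg : ∀ m n a b -> Z.- (m * a + n * b) == (Z.- m) * a + (Z.- n) * b
 alg = ring

InL-org : ∀ {a b} -> InL a b org
InL-org = + 0 , + 0 , refl

InL-fst : ∀ {a b} -> InL a b a
InL-fst {a₁ , a₂} {b₁ , b₂} = + 1 , + 0 , ap2 _,_ (alg a₁ b₁) (alg a₂ b₂)
 where
 alg : ∀ a b -> a == + 1 * a + + 0 * b
 alg = ring

InL-snd : ∀ {a b} -> InL a b b
InL-snd {a₁ , a₂} {b₁ , b₂} = + 0 , + 1 , ap2 _,_ (alg a₁ b₁) (alg a₂ b₂)
 where
 alg : ∀ a b -> b == + 0 * a + + 1 * b
 alg = ring

vsum : (Cell -> ℤ) -> Cell -> Word -> ℤ
vsum χ p [] = + 0
vsum χ p (l :: w) = χ p + vsum χ (p <> step l) w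

isum : (Cell -> ℤ) -> Cell -> Word -> ℤ
isum χ p [] = + 0
isum χ p (l :: w) = vsum χ (p <> step l) w

vsum-++ : ∀ χ p u v -> vsum χ p (u ++ v) == vsum χ p u + vsum χ (tip p u) v
vsum-++ χ p [] v = ! (0+ _)
vsum-++ χ p (x :: u) v = ap (\ z -> χ p + z) (vsum-++ χ (p <> step x) u v) ∙ ! (Y.+-assoc (χ p) _ _)

vsum-rev : ∀ χ p w -> vsum χ (tip p w) (rev w) + χ p == vsum χ p w + χ (tip p w)
vsum-rev χ p [] = refl
vsum-rev χ p (x :: w) = (ap (Z._+ χ p) (vsum-++ χ e (rev w) (inv x :: [])) ∙ ap (\ z -> (vsum χ e (rev w) + (χ z + + 0)) + χ p) (tip-rev p' w) ∙ alg (vsum χ e (rev w)) (χ p') (χ p) ∙ ap (\ z -> χ p + z) (vsum-rev χ p' w) ∙ ! (Y.+-assoc (χ p) (vsum χ p' w) (χ e)))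
 where
 p' e : Cell
 p' = p <> step x
 e = tip p' w
 alg : ∀ a b c -> (a + (b + + 0)) + c == c + (a + b)
 alg = ring

vsum-⊕ : ∀ χ p t w -> vsum χ (p <> t) w == vsum (\ q -> χ (q <> t)) p w
vsum-⊕ χ p t [] = refl
vsum-⊕ χ p t (l :: w) = ap (\ z -> χ (p <> t) + z) (ap (\ z -> vsum χ z w) (⊕-swap p t (step l)) ∙ vsum-⊕ χ (p <> step l) t w)

vsum-+ : ∀ χ ψ p w -> vsum χ p w + vsum ψ p w == vsum (\ q -> χ q + ψ q) p w
vsum-+ χ ψ p [] = refl
vsum-+ χ ψ p (l :: w) = alg (χ p) (ψ p) (vsum χ (p <> step l) w) (vsum ψ (p <> step l) w) ∙ ap (\ z -> (χ p + ψ p) + z) (vsum-+ χ ψ (p <> step l) w)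
 where
 alg : ∀ a b c d -> (a + c) + (b + d) == (a + b) + (c + d)
 alg = ring

vsum-mono : ∀ {χ ψ} -> (∀ q -> χ q Z.≤ ψ q) -> ∀ p w -> vsum χ p w Z.≤ vsum ψ p w
vsum-mono h p [] = Y.≤-refl
vsum-mono h p (l :: w) = Y.+-mono-≤ (h p) (vsum-mono h (p <> step l) w)

isum-⊕ : ∀ χ p t w -> isum χ (p <> t) w == isum (\ q -> χ (q <> t)) p w
isum-⊕ χ p t [] = refl
isum-⊕ χ p t (l :: w) = ap (\ z -> vsum χ z w) (⊕-swap p t (step l)) ∙ vsum-⊕ χ (p <> step l) t w

isum-+ : ∀ χ ψ p w -> isum χ p w + isum ψ p w == isum (\ q -> χ q + ψ q) p w
isum-+ χ ψ p [] = refl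
isum-+ χ ψ p (l :: w) = vsum-+ χ ψ (p <> step l) w

isum-mono : ∀ {χ ψ} -> (∀ q -> χ q Z.≤ ψ q) -> ∀ p w -> isum χ p w Z.≤ isum ψ p w
isum-mono h p [] = Y.≤-refl
isum-mono h p (l :: w) = vsum-mono h (p <> step l) w

_≟ᶜ_ : (p q : Cell) -> Dec (p == q)
_≟ᶜ_ = DP.≡-dec Y._≟_ Y._≟_

at : Cell -> Cell -> ℤ
at q v with v ≟ᶜ q
... | yes _ = + 1
... | no _ = + 0

at-≥0 : ∀ q v -> + 0 Z.≤ at q v
at-≥0 q v with v ≟ᶜ q
... | yes _ = Z.+≤+ N.z≤n
... | no _ = Y.≤-refl

at-self : ∀ q -> at q q == + 1
at-self q with q ≟ᶜ q
... | yes _ = refl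
... | no n = !! (n refl)

vsum≥0 : ∀ q p w -> + 0 Z.≤ vsum (at q) p w
vsum≥0 q p [] = Y.≤-refl
vsum≥0 q p (l :: w) = Y.+-mono-≤ (at-≥0 q p) (vsum≥0 q (p <> step l) w)

absent : ∀ q p w -> vsum (at q) p w Z.≤ + 0 -> All (q !=_) (verts p w)
absent q p [] h = []
absent q p (l :: w) h = here :: absent q (p <> step l) w (Y.≤-trans (Y.≤-trans (Y.≤-reflexive (! (0+ _))) (Y.+-monoˡ-≤ (vsum (at q) (p <> step l) w) (at-≥0 q p))) h)
 where
 here : q != p
 here refl with Y.≤-trans (Y.≤-trans (Y.≤-reflexive (! (ap (Z._+ + 0) (at-self q)))) (Y.+-monoʳ-≤ (at q q) (vsum≥0 q (q <> step l) w))) h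
 ... | Z.+≤+ ()

uniq : ∀ p w -> (∀ q -> vsum (at q) p w Z.≤ + 1) -> Unique (verts p w)
uniq p [] h = []
uniq p (l :: w) h = absent p (p <> step l) w (Y.≤-trans (Y.≤-reflexive (alg (vsum (at p) (p <> step l) w))) (Y.+-monoˡ-≤ -[1+ 0 ] (Y.≤-trans (Y.≤-reflexive (ap (Z._+ vsum (at p) (p <> step l) w) (! (at-self p)))) (h p))))
  :: uniq (p <> step l) w \ q -> Y.≤-trans (Y.≤-trans (Y.≤-reflexive (! (0+ _))) (Y.+-monoˡ-≤ (vsum (at q) (p <> step l) w) (at-≥0 q p))) (h q)
 where
 alg : ∀ a -> a == (+ 1 + a) + -[1+ 0 ]
 alg = ring

⊕-canˡ : ∀ p {q r} -> p <> q == p <> r -> q == r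
⊕-canˡ p {q} {r} e = ! (⊕-can q p) ∙ ap (_<> neg p) (⊕-comm q p ∙ e ∙ ⊕-comm p r) ∙ ⊕-can r p

flux-abscissa : ∀ A B p -> bracket fst A B p == det (vec A) (vec B)
flux-abscissa A B p = ap2 (\ x y -> (flux fst p A Z.- x) + (y Z.- flux fst p B)) (shifted (vec B) A) (shifted (vec A) B) ∙
  alg (flux fst p A) (flux fst p B) (fst (vec A)) (snd (vec A)) (fst (vec B)) (snd (vec B))
 where
 alg : ∀ f g a b c d -> (f Z.- (f + c * b)) + ((g + a * d) Z.- g) == a * d Z.- b * c
 alg = ring
 constant : ∀ c w -> flux (\ _ -> c) p w == c * snd (vec w)
 constant c w = flux-poten (\ _ -> c) (c Z.*_) (\ _ y -> k c y) p w ∙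
   ap (\ z -> c * snd z Z.- c * snd p) (tip-vec p w) ∙ l c (snd p) (snd (vec w))
  where
  k : ∀ c y -> c == c * (y + + 1) Z.- c * y
  k = ring
  l : ∀ c y v -> c * (y + v) Z.- c * y == c * v
  l = ring
 shifted : ∀ t w -> flux fst (p <> t) w == flux fst p w + fst t * snd (vec w)
 shifted t w = flux-⊕ fst p t w ∙ flux-+ fst (\ _ -> fst t) p w ∙ ap (\ z -> flux fst p w + z) (constant (fst t) w)

module _ (a : Ltr) (u : Word) (b : Ltr) (v : Word) (disk : Disk (loop (a :: u) (b :: v))) where
 private
  A B W : Word
  A = a :: u
  B = b :: v
  W = loop A B
  α β : Cell
  α = vec A
  β = vec B

 det-positive : + 0 Z.< det α β
 det-positive = Y.*-cancelˡ-<-nonNeg (+ 4) (Y.<-≤-trans positive (Y.≤-trans (T.Disk-turns disk org) (Y.≤-reflexive quad-det)))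
  where
  module T1 = Turning (\ _ -> + 1) (\ _ -> Z.+≤+ N.z≤n)
  module T = T1.Positive fst (\ _ -> refl)
  fl : ∀ p -> flux fst p W == det α β
  fl p = flux-loop fst A B p ∙ flux-abscissa A B p
  quad-det : T.quad org W == + 4 * det α β
  quad-det = (ap2 Z._+_ (ap2 Z._+_ (fl org) (fl (org <> step R))) (ap2 Z._+_ (fl (org <> step U)) (fl ((org <> step R) <> step U)))) ∙ alg (det α β)
   where
   alg : ∀ d -> (d + d) + (d + d) == + 4 * d
   alg = ring
  positive : + 4 * + 0 Z.< T1.cyc org W
  positive = Y.<-≤-trans {j = + 1} (Z.+<+ (N.s≤s N.z≤n)) (Y.≤-trans {j = + 1 + + 0} Y.≤-refl
   (Y.+-mono-≤ (Y.≤-trans {j = + 1 * + θ x a} (Y.≤-trans (Z.+≤+ (N.s≤s N.z≤n)) (Y.≤-reflexive (! (Y.*-identityˡ (+ θ x a))))) Y.≤-refl) (T1.turns≥0 a (org <> step a) (u ++ B ++ rev A ++ rev B))))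
   where
   x : Ltr
   x = lst a (u ++ B ++ rev A ++ rev B)

 det≢0 : det α β != + 0
 det≢0 e = Y.<-irrefl (! e) det-positive

 abstract
  counting : Counted A B
  counting = counted (ht A N.+ ht B) A B Q.≤-refl det≢0

 open Counted counting

 ρ-perio : ∀ t -> InL α β t -> ∀ p -> ρ (p <> t) == ρ p
 ρ-perio t i p with cases p
 ... | inl (e , j) = one (p <> t) (InL-⊕ j i) ∙ ! e
 ... | inr e with cases (p <> t)
 ... | inr e' = e' ∙ ! e
 ... | inl (_ , j) = !! (absurd (! e ∙ one p (tp (InL α β) (⊕-can p t) (InL-⊕ j (InL-neg i)))))
  where
  absurd : + 0 != + 1
  absurd ()

 ρ≥0 : ∀ p -> + 0 Z.≤ ρ p
 ρ≥0 p with cases p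
 ... | inl (e , _) = Y.≤-trans (Z.+≤+ N.z≤n) (Y.≤-reflexive (! e))
 ... | inr e = Y.≤-reflexive (! e)

 open Turning ρ ρ≥0
 open Positive poten gradient

 private
  turns-pair : ∀ t -> InL α β t -> ∀ x p w -> + 4 * vsum ρ p w Z.≤ turns x p w + inner (tip (p <> t) w) (rev (x :: w))
  turns-pair t i x p [] = Y.≤-refl
  turns-pair t i x p (y :: w) with rev-head y w
  ... | r , er = begin
    + 4 * (ρ p + vsum ρ p' w) ≡⟨ Y.*-distribˡ-+ (+ 4) (ρ p) (vsum ρ p' w) ⟩
    + 4 * ρ p + + 4 * vsum ρ p' w ≤⟨ Y.+-mono-≤ four (turns-pair t i y p' w) ⟩
    ρ p * (+ θ x y + + θ (inv y) (inv x)) + (turns y p' w + inner (tip (p' <> t) w) (rev (y :: w)))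
     ≡⟨ alg (ρ p) (+ θ x y) (+ θ (inv y) (inv x)) (turns y p' w) _ ⟩ (ρ p * + θ x y + turns y p' w) + (inner (tip (p' <> t) w) (rev (y :: w)) + ρ p * + θ (inv y) (inv x))
     ≡⟨ ap (\ z -> (ρ p * + θ x y + turns y p' w) + z) (! tail-eq) ⟩ (ρ p * + θ x y + turns y p' w) + inner (tip (p <> t) (y :: w)) (rev (y :: w) ++ (inv x :: [])) ∎
   where
   open Y.≤-Reasoning
   p' e : Cell
   p' = p <> step y
   e = tip (p' <> t) w
   alg : ∀ c m n k j -> c * (m + n) + (k + j) == (c * m + k) + (j + c * n)
   alg = ring
   four : + 4 * ρ p Z.≤ ρ p * (+ θ x y + + θ (inv y) (inv x))
   four = Y.≤-trans (Y.≤-reflexive (Y.*-comm (+ 4) (ρ p))) (weigh p (θ-reverse x y))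
   e≡ : tip (p <> t) (y :: w) == e
   e≡ = ap (\ z -> tip z w) (⊕-swap p t (step y))
   tail-eq : inner (tip (p <> t) (y :: w)) (rev (y :: w) ++ (inv x :: [])) == inner e (rev (y :: w)) + ρ p * + θ (inv y) (inv x)
   tail-eq = ap2 (\ q z -> inner q (z ++ (inv x :: []))) e≡ er ∙
    turns-++ (inv (lst y w)) (e <> step (inv (lst y w))) r (inv x :: []) ∙ (ap2 Z._+_ (ap (inner e) (! er)) (ap2 (\ q z -> ρ q * + θ z (inv x) + + 0) back last-eq ∙ (+0 _) ∙ ap (Z._* + θ (inv y) (inv x)) (ρ-perio t i p)))
    where
    back : tip e (inv (lst y w) :: r) == p <> t
    back = ap (tip e) (! er) ∙ ap (\ z -> tip z (rev (y :: w))) (! e≡) ∙ tip-rev (p <> t) (y :: w)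
    last-eq : lst (inv (lst y w)) r == inv y
    last-eq = ap (lst y) (! er) ∙ lst-++ y (rev w) (inv y :: [])

  head-bound : ∀ x q l w -> ρ q + inner q (l :: w) Z.≤ turns x q (l :: w)
  head-bound x q l w = Y.+-monoˡ-≤ (inner q (l :: w)) (Y.≤-trans (Y.≤-reflexive (! (Y.*-identityʳ (ρ q)))) (weigh q {1} {θ x l} (N.s≤s N.z≤n)))

  head-bound-rev : ∀ x q l w -> ρ q + inner q (rev (l :: w)) Z.≤ turns x q (rev (l :: w))
  head-bound-rev x q l w with rev-head l w
  ... | r , er = tp (\ z -> ρ q + inner q z Z.≤ turns x q z) (! er) (head-bound x q _ r)

 load : ∀ p -> ρ p + (isum ρ p A + isum ρ (p <> α) B) Z.≤ + 1
 load p = Y.*-cancelˡ-≤-pos (ρ p + (isum ρ p A + isum ρ (p <> α) B)) (+ 1) (+ 4) (begin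
   + 4 * (ρ p + (isum ρ p A + isum ρ (p <> α) B)) ≡⟨ alg1 (ρ p) (isum ρ p A) (isum ρ (p <> α) B) ⟩ (ρ p + ρ p + ρ p + ρ p) + (+ 4 * isum ρ p A + + 4 * isum ρ (p <> α) B)
    ≤⟨ Y.+-monoʳ-≤ (ρ p + ρ p + ρ p + ρ p) (Y.+-mono-≤ (turns-pair β InL-snd a (p <> step a) u) (turns-pair (neg α) (InL-neg InL-fst) b ((p <> α) <> step b) v)) ⟩
     (ρ p + ρ p + ρ p + ρ p) + ((inner p A + inner (tip ((p <> step a) <> β) u) (rev A)) + (inner (p <> α) B + inner (tip (((p <> α) <> step b) <> neg α) v) (rev B)))
    ≡⟨ ap2 (\ x y -> (ρ p + ρ p + ρ p + ρ p) + ((inner p A + inner x (rev A)) + (inner (p <> α) B + inner y (rev B)))) e2≡ e3≡ ⟩ (ρ p + ρ p + ρ p + ρ p) + ((inner p A + inner e2 (rev A)) + (inner (p <> α) B + inner e3 (rev B)))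
    ≡⟨ alg2 (ρ p) (inner p A) (inner e2 (rev A)) (inner (p <> α) B) (inner e3 (rev B)) ⟩ (ρ p + inner p A) + ((ρ p + inner (p <> α) B) + ((ρ p + inner e2 (rev A)) + (ρ p + inner e3 (rev B))))
    ≡⟨ ap (\ z -> (ρ p + inner p A) + z) (ap2 Z._+_ (ap (Z._+ inner (p <> α) B) (! (ρ-perio α InL-fst p))) (ap2 Z._+_ (ap (Z._+ inner e2 (rev A)) (! ρ2)) (ap (Z._+ inner e3 (rev B)) (! ρ3)))) ⟩
     (ρ p + inner p A) + ((ρ (p <> α) + inner (p <> α) B) + ((ρ e2 + inner e2 (rev A)) + (ρ e3 + inner e3 (rev B))))
    ≤⟨ Y.+-mono-≤ (head-bound x0 p a u) (Y.+-mono-≤ (head-bound (lst a u) (p <> α) b v) (Y.+-mono-≤ (head-bound-rev (lst b v) e2 a u) (head-bound-rev (lst (lst b v) (rev A)) e3 b v))) ⟩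
   turns x0 p A + (turns (lst a u) (p <> α) B + (turns (lst b v) e2 (rev A) + turns (lst (lst b v) (rev A)) e3 (rev B))) ≡⟨ ! whole-eq ⟩
   cyc p W ≤⟨ Disk-turns disk p ⟩
   quad p W ≡⟨ ap2 Z._+_ (ap2 Z._+_ (fl p) (fl (p <> step R))) (ap2 Z._+_ (fl (p <> step U)) (fl ((p <> step R) <> step U))) ⟩ (ε + ε) + (ε + ε) ≤⟨ Y.+-mono-≤ (Y.+-mono-≤ ε≤1 ε≤1) (Y.+-mono-≤ ε≤1 ε≤1) ⟩
   + 4 ∎)
  where
  open Y.≤-Reasoning
  e2 e3 : Cell
  e2 = tip (p <> β) A
  e3 = tip p B
  x0 : Ltr
  x0 = lst a (u ++ B ++ rev A ++ rev B)
  ε≤1 : ε Z.≤ + 1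
  ε≤1 with sign
  ... | inl e = Y.≤-reflexive e
  ... | inr e = Y.≤-trans (Y.≤-reflexive e) Z.-≤+
  fl : ∀ q -> flux poten q W == ε
  fl q = flux-loop poten A B q ∙ total q
  alg1 : ∀ r x y -> + 4 * (r + (x + y)) == (r + r + r + r) + (+ 4 * x + + 4 * y)
  alg1 = ring
  alg2 : ∀ r i j k l -> (r + r + r + r) + ((i + j) + (k + l)) == (r + i) + ((r + k) + ((r + j) + (r + l)))
  alg2 = ring
  e2≡ : tip ((p <> step a) <> β) u == e2
  e2≡ = ap (\ z -> tip z u) (⊕-swap p (step a) β)
  e3≡ : tip (((p <> α) <> step b) <> neg α) v == e3
  e3≡ = ap (\ z -> tip z v) (⊕-swap (p <> α) (step b) (neg α) ∙ ap (_<> step b) (⊕-can p α))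
  ρ3 : ρ e3 == ρ p
  ρ3 = ap ρ (tip-vec p B) ∙ ρ-perio β InL-snd p
  ρ2 : ρ e2 == ρ p
  ρ2 = ap ρ (tip-vec (p <> β) A) ∙ ρ-perio α InL-fst (p <> β) ∙ ρ-perio β InL-snd p
  q2 : tip (tip p A) B == e2
  q2 = tip-vec (tip p A) B ∙ ! (tip-⊕ p β A)
  whole-eq : cyc p W == turns x0 p A + (turns (lst a u) (p <> α) B + (turns (lst b v) e2 (rev A) + turns (lst (lst b v) (rev A)) e3 (rev B)))
  whole-eq = turns-++ x0 p A (B ++ rev A ++ rev B) ∙ ap (\ z -> turns x0 p A + z) (turns-++ (lst a u) (tip p A) B (rev A ++ rev B) ∙ (ap2 Z._+_ (ap (\ z -> turns (lst a u) z B) (tip-vec p A))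
   (ap (\ z -> turns (lst b v) z (rev A ++ rev B)) q2 ∙ turns-++ (lst b v) e2 (rev A) (rev B) ∙
     ap (\ z -> turns (lst b v) e2 (rev A) + turns (lst (lst b v) (rev A)) z (rev B)) (tip-rev (p <> β) A ∙ ! (tip-vec p B)))))

 private
  hits : Cell -> List Cell -> Cell -> ℤ
  hits q [] w = + 0
  hits q (t :: ts) w = at q (w <> t) + hits q ts w

  hits-none : ∀ q t ts w -> w <> t == q -> All (t !=_) ts -> hits q ts w == + 0
  hits-none q t [] w e [] = refl
  hits-none q t (s :: ts) w e (n :: ns) with (w <> s) ≟ᶜ q
  ... | yes e' = !! (n (⊕-canˡ w (e ∙ ! e')))
  ... | no _ = (0+ _) ∙ hits-none q t ts w e ns

  hits-bound : ∀ q ts w -> All (InL α β) ts -> Unique ts -> hits q ts w Z.≤ ρ (w <> neg q)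
  hits-bound q [] w _ _ = ρ≥0 _
  hits-bound q (t :: ts) w (i :: is) (n :: ns) with (w <> t) ≟ᶜ q
  ... | no _ = Y.≤-trans (Y.≤-reflexive (0+ _)) (hits-bound q ts w is ns)
  ... | yes refl = Y.≤-reflexive (ap (\ z -> + 1 + z) (hits-none q t ts w refl n) ∙ ! (one (w <> neg (w <> t)) (tp (InL α β) (! (e w t)) (InL-neg i))))
   where
   e : ∀ w t -> w <> neg (w <> t) == neg t
   e (x , y) (x' , y') = ap2 _,_ (alg x x') (alg y y')
    where
    alg : ∀ x t -> x + (Z.- (x + t)) == Z.- t
    alg = ring

  α≢0 : org != α
  α≢0 e = det≢0 (tp (\ z -> det z β == + 0) e refl)
  β≢0 : org != β
  β≢0 e = det≢0 (tp (\ z -> det α z == + 0) e (alg (fst α) (snd α)))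
   where
   alg : ∀ a b -> a * + 0 Z.- b * + 0 == + 0
   alg = ring
  α≢β : α != β
  α≢β e = det≢0 (tp (\ z -> det α z == + 0) e (alg (fst α) (snd α)))
   where
   alg : ∀ a b -> a * b Z.- b * a == + 0
   alg = ring
  αβ≢0 : org != α <> β
  αβ≢0 e = det≢0 (tp (\ z -> det α z == + 0) (⊕-canˡ α (⊕-invʳ α ∙ e)) (alg (fst α) (snd α)))
   where
   alg : ∀ a b -> a * (Z.- b) Z.- b * (Z.- a) == + 0
   alg = ring

  corners : List Cell
  corners = org :: α :: (α <> β) :: β :: []

  corners-uniq : Unique corners
  corners-uniq = (α≢0 :: αβ≢0 :: β≢0 :: []) :: ((\ e -> β≢0 (⊕-canˡ α (⊕-idʳ α ∙ e))) :: α≢β :: []) :: ((\ e -> α≢0 (! (⊕-canˡ β (⊕-comm β α ∙ e ∙ ! (⊕-idʳ β))))) :: []) :: [] :: []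

 once : ∀ q -> vsum (at q) org W Z.≤ + 1
 once q = begin
   vsum χ org W
    ≡⟨ (vsum-++ χ org A _) ∙ ap (\ z -> vsum χ org A + z) (vsum-++ χ α B (rev A ++ rev B) ∙ ap (\ z -> vsum χ α B + z) (ap (\ z -> vsum χ z (rev A ++ rev B)) q2 ∙ vsum-++ χ (tip β A) (rev A) (rev B) ∙
        ap (\ z -> vsum χ (tip β A) (rev A) + vsum χ z (rev B)) (tip-rev β A))) ⟩
   vsum χ org A + (vsum χ α B + (vsum χ (tip β A) (rev A) + vsum χ β (rev B)))
    ≡⟨ ap2 (\ x y -> vsum χ org A + (vsum χ α B + (x + y))) (reversed β a u) (reversed org b v) ⟩
   vsum χ org A + (vsum χ α B + ((isum χ β A + χ (tip β A)) + (isum χ org B + χ β)))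
    ≡⟨ alg (χ org) (isum χ org A) (χ α) (isum χ α B) (isum χ β A) (χ (tip β A)) (isum χ org B) (χ β) ⟩ (χ org + (χ α + (χ (tip β A) + (χ β + + 0)))) + ((isum χ org A + isum χ β A) + (isum χ α B + isum χ org B))
    ≤⟨ Y.+-mono-≤ cornerBound (Y.+-mono-≤ boundA boundB) ⟩
   ρ' org + (isum ρ' org A + isum ρ' α B)
    ≡⟨ ap2 (\ x y -> x + y) (ap ρ (⊕-idˡ (neg q))) (ap2 Z._+_ (! (isum-⊕ ρ org (neg q) A) ∙ ap (\ z -> isum ρ z A) (⊕-idˡ (neg q))) (! (isum-⊕ ρ α (neg q) B) ∙ ap (\ z -> isum ρ z B) (⊕-comm α (neg q)))) ⟩
   ρ (neg q) + (isum ρ (neg q) A + isum ρ (neg q <> α) B) ≤⟨ load (neg q) ⟩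
   + 1 ∎
  where
  open Y.≤-Reasoning
  χ ρ' : Cell -> ℤ
  χ = at q
  ρ' w = ρ (w <> neg q)
  alg : ∀ a b c d e f g h -> (a + b) + ((c + d) + ((e + f) + (g + h))) == (a + (c + (f + (h + + 0)))) + ((b + e) + (d + g))
  alg = ring
  q2 : tip α B == tip β A
  q2 = tip-vec α B ∙ ⊕-comm α β ∙ ! (tip-vec β A)
  reversed : ∀ p l w -> vsum χ (tip p (l :: w)) (rev (l :: w)) == isum χ p (l :: w) + χ (tip p (l :: w))
  reversed p l w = alg' (vsum χ (tip p (l :: w)) (rev (l :: w))) (χ p) ∙
    ap (Z._- χ p) (vsum-rev χ p (l :: w)) ∙ alg'' (χ p) (vsum χ (p <> step l) w) (χ (tip p (l :: w)))
   where
   alg' : ∀ x y -> x == (x + y) Z.- y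
   alg' = ring
   alg'' : ∀ x y z -> ((x + y) + z) Z.- x == y + z
   alg'' = ring
  hit-corners : hits q corners org == χ org + (χ α + (χ (tip β A) + (χ β + + 0)))
  hit-corners = ap2 (\ x y -> χ org + (χ x + y)) (⊕-idˡ α) (ap2 (\ x y -> χ x + (χ y + + 0)) (⊕-idˡ (α <> β) ∙ ⊕-comm α β ∙ ! (tip-vec β A)) (⊕-idˡ β))
  cornerBound : χ org + (χ α + (χ (tip β A) + (χ β + + 0))) Z.≤ ρ' org
  cornerBound = Y.≤-trans (Y.≤-reflexive (! hit-corners)) (hits-bound q corners org (InL-org :: InL-fst :: InL-⊕ InL-fst InL-snd :: InL-snd :: []) corners-uniq)
  pairBound : ∀ t -> InL α β t -> org != t -> ∀ w -> χ w + χ (w <> t) Z.≤ ρ' w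
  pairBound t i n w = Y.≤-trans (Y.≤-reflexive (! (ap2 Z._+_ (ap χ (⊕-idʳ w)) (+0 _)))) (hits-bound q (org :: t :: []) w (InL-org :: i :: []) ((n :: []) :: [] :: []))
  boundA : isum χ org A + isum χ β A Z.≤ isum ρ' org A
  boundA = Y.≤-trans (Y.≤-reflexive (ap (\ z -> isum χ org A + z) (ap (\ z -> isum χ z A) (! (⊕-idˡ β)) ∙ isum-⊕ χ org β A) ∙ (isum-+ χ _ org A))) (isum-mono (pairBound β InL-snd β≢0) org A)
  boundB : isum χ α B + isum χ org B Z.≤ isum ρ' α B
  boundB = Y.≤-trans (Y.≤-reflexive (ap (\ z -> isum χ α B + z) (ap (\ z -> isum χ z B) (! (⊕-invʳ α)) ∙ isum-⊕ χ α (neg α) B) ∙ (isum-+ χ _ α B)))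
   (isum-mono (pairBound (neg α) (InL-neg InL-fst) (\ e -> α≢0 (ap neg e ∙ neg-neg α))) α B)

 simple-loop : IsSimpleClosed W
 simple-loop = Disk-closed disk , long , uniq org W once
  where
  long : 3 ≤ # W
  long = N.s≤s (tp (2 N.≤_) (! (#-++ u ∙ ap (# u N.+_) refl)) (≤-tr two (Q.m≤n+m _ (# u))))
   where
   two : 2 ≤ # (B ++ rev A ++ rev B)
   two with rev-head a u
   ... | r , er = N.s≤s (tp (1 N.≤_) (! (#-++ v)) (≤-tr (tp (\ z -> 1 ≤ # (z ++ rev B)) (! er) (N.s≤s N.z≤n)) (Q.m≤n+m _ (# v))))

pair-loop : ∀ {A} -> IsCh A -> ⟦ oct ⟧ A == loop (A 0 ++ A 1) (A 2 ++ A 3)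
pair-loop {A} ch = e (A 0) (A 1) (A 2) (A 3) (A 4) (A 5) (A 6) (A 7) ∙
  ap2 (\ x y -> (A 0 ++ A 1) ++ (A 2 ++ A 3) ++ x ++ y) (antipode 0) (antipode 2)
 where
 open IsCh ch
 e : ∀ a b c d e f g h -> a ++ b ++ c ++ d ++ e ++ f ++ g ++ h ++ [] == (a ++ b) ++ (c ++ d) ++ (e ++ f) ++ (g ++ h)
 e a b c d e f g h = solve words
 antipode : ∀ n -> A (4 N.+ n) ++ A (5 N.+ n) == rev (A n ++ A (1 N.+ n))
 antipode n = ! (rr _) ∙ ap rev (! (laced n))

uncons : ∀ {w : Word} -> w != [] -> Σ Ltr \ l -> Σ Word \ v -> w == l :: v
uncons {[]} n = !! (n refl)
uncons {l :: v} n = l , v , refl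

Good-simple : ∀ {A} -> Good A -> IsSimpleClosed (⟦ oct ⟧ A)
Good-simple {A} G with uncons {A 0 ++ A 1} (++-≢[]ˡ (A 0) (IsCh.nonem (Good.chain G) 0)) | uncons {A 2 ++ A 3} (++-≢[]ˡ (A 2) (IsCh.nonem (Good.chain G) 2))
... | a , u , eA | b , v , eB = tp IsSimpleClosed (! eq) (simple-loop a u b v (tp Disk eq (Good.whole G)))
 where
 eq : ⟦ oct ⟧ A == loop (a :: u) (b :: v)
 eq = pair-loop (Good.chain G) ∙ ap2 loop eA eB

descendant-simple : ∀ V -> Descendant V -> IsSimpleClosed (concat8 V)
descendant-simple V d = tp IsSimpleClosed (oct-concat V) (Good-simple (Good-descendant d))

ind : Bool -> ℤ
ind true = + 1
ind false = + 0

lt eq : ℤ -> ℤ -> ℤ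
lt x a = ind ⌊ x Z.<? a ⌋
eq a b = ind ⌊ a Y.≟ b ⌋

eq-refl : ∀ a -> eq a a == + 1
eq-refl a with a Y.≟ a
... | yes _ = refl
... | no n = !! (n refl)

eq-≢ : ∀ {a b} -> a != b -> eq a b == + 0
eq-≢ {a} {b} n with a Y.≟ b
... | yes e = !! (n e)
... | no _ = refl

eq-shift : ∀ a b c -> eq (a + c) (b + c) == eq a b
eq-shift a b c with a Y.≟ b
... | yes refl = eq-refl (a + c)
... | no n = eq-≢ \ e -> n (alg a c ∙ ap (Z._- c) e ∙ ! (alg b c))
 where
 alg : ∀ a c -> a == (a + c) Z.- c
 alg = ring

lt-yes : ∀ {x a} -> x Z.< a -> lt x a == + 1
lt-yes {x} {a} h with x Z.<? a
... | yes _ = refl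
... | no n = !! (n h)

lt-no : ∀ {x a} -> a Z.≤ x -> lt x a == + 0
lt-no {x} {a} h with x Z.<? a
... | yes l = !! (Y.<⇒≱ l h)
... | no n = refl

next : ∀ a -> a Z.< a + + 1
next a = Y.suc[i]≤j⇒i<j (Y.≤-reflexive (Y.+-comm (+ 1) a))

lt-suc : ∀ x a -> lt x (a + + 1) == lt x a + eq a x
lt-suc x a with Y.<-cmp x a
... | tri< l n _ = lt-yes (Y.<-trans l (next a)) ∙ ! (ap2 Z._+_ (lt-yes l) (eq-≢ \ e -> n (! e)))
... | tri≈ _ refl _ = lt-yes (next x) ∙ ! (ap2 Z._+_ (lt-no {x} Y.≤-refl) (eq-refl x))
... | tri> _ n g = lt-no (tp (Z._≤ x) (Y.+-comm (+ 1) a) (Y.i<j⇒suc[i]≤j g)) ∙ ! (ap2 Z._+_ (lt-no (Y.<⇒≤ g)) (eq-≢ \ e -> n (! e)))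

lt-shift : ∀ x a c -> lt (x + c) (a + c) == lt x a
lt-shift x a c with x Z.<? a
... | yes l = lt-yes (Y.+-monoˡ-< c l)
... | no n = lt-no (Y.+-monoˡ-≤ c (Y.≮⇒≥ n))

lt-pred : ∀ x a -> lt (x Z.- + 1) a == lt x a + eq a x
lt-pred x a = (! (lt-shift (x Z.- + 1) a (+ 1)) ∙ ap (\ z -> lt z (a + + 1)) (alg x)) ∙ lt-suc x a
 where
 alg : ∀ x -> (x Z.- + 1) + + 1 == x
 alg = ring

ray : Cell -> Cell -> ℤ
ray (x , y) (a , b) = lt x a * eq b y

wind : Cell -> Word -> Cell -> ℤ
wind p w c = flux (ray c) p w

esum : (Cell -> Ltr -> ℤ) -> Cell -> Word -> ℤ
esum E p [] = + 0
esum E p (l :: w) = E p l + esum E (p <> step l) w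

le : Ltr -> Ltr -> ℤ
le l d = ind (code l ≡ᵇ code d)

pt : Cell -> Cell -> ℤ
pt (a , b) (x , y) = eq x a * eq y b

net : Cell -> Ltr -> Cell -> Ltr -> ℤ
net v d p l = pt v p * le l d Z.- pt v (p <> step l) * le l (inv d)

lcell : Cell -> Ltr -> Cell
lcell (a , b) R = (a , b)
lcell (a , b) U = (a Z.- + 1 , b)
lcell (a , b) L = (a Z.- + 1 , b Z.- + 1)
lcell (a , b) D = (a , b Z.- + 1)

lcell-next : ∀ p l -> lcell (p <> step l) (tleft l) == lcell p l
lcell-next (a , b) R = ap2 _,_ (alg a) (+0 b)
 where
 alg : ∀ a -> (a + + 1) Z.- + 1 == a
 alg = ring
lcell-next (a , b) U = ap2 _,_ (ap (Z._- + 1) (+0 a)) (alg b)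
 where
 alg : ∀ a -> (a + + 1) Z.- + 1 == a
 alg = ring
lcell-next (a , b) L = ap2 _,_ refl (ap (Z._- + 1) (+0 b))
lcell-next (a , b) D = ap2 _,_ (+0 a) refl

pt-shift : ∀ v p t -> pt (v <> t) (p <> t) == pt v p
pt-shift (a , b) (x , y) (s , t) = ap2 Z._*_ (eq-shift x a s) (eq-shift y b t)

le-sound : ∀ l d -> le l d == + 0 ⊎ l == d
le-sound R R = inr refl
le-sound R L = inl refl
le-sound R U = inl refl
le-sound R D = inl refl
le-sound L R = inl refl
le-sound L L = inr refl
le-sound L U = inl refl
le-sound L D = inl refl
le-sound U R = inl refl
le-sound U L = inl refl
le-sound U U = inr refl
le-sound U D = inl refl
le-sound D R = inl refl
le-sound D L = inl refl
le-sound D U = inl refl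
le-sound D D = inr refl

net-inv : ∀ v d p l -> net v d p l == Z.- net (v <> step d) (inv d) p l
net-inv v d p l with le-sound l d | le-sound l (inv d)
... | inl e | inl e' = ap2 (\ x y -> pt v p * x Z.- pt v (p <> step l) * y) e e' ∙
   alg (pt v p) (pt v (p <> step l)) (pt (v <> step d) p) (pt (v <> step d) (p <> step l)) ∙
    ! (ap2 (\ x y -> Z.- (pt (v <> step d) p * x Z.- pt (v <> step d) (p <> step l) * y)) e' (ap (le l) (inv-inv d) ∙ e))
 where
 alg : ∀ a b c d -> a * + 0 Z.- b * + 0 == Z.- (c * + 0 Z.- d * + 0)
 alg = ring
... | inr refl | _ = alg (pt v p) (pt v (p <> step l)) (pt (v <> step l) p) (le l l) (le l (inv l)) (neither l) ∙
    ap2 (\ x y -> Z.- (pt (v <> step l) p * le l (inv l) Z.- x * y)) (! (pt-shift v p (step l))) (! (ap (le l) (inv-inv l)))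
 where
 neither : ∀ l -> le l (inv l) == + 0
 neither R = refl
 neither L = refl
 neither U = refl
 neither D = refl
 alg : ∀ a b c m z -> z == + 0 -> a * m Z.- b * z == Z.- (c * z Z.- a * m)
 alg a b c m _ refl = alg' a b c m
  where
  alg' : ∀ a b c m -> a * m Z.- b * + 0 == Z.- (c * + 0 Z.- a * m)
  alg' = ring
... | inl e | inr refl = ap (\ z -> pt v p * z Z.- pt v (p <> step (inv d)) * le (inv d) (inv d)) e ∙
   alg (pt v p) (pt v (p <> step (inv d))) (pt (v <> step d) (p <> step (inv d))) (le (inv d) (inv d)) ∙
    ! (ap2 (\ x y -> Z.- (x * le (inv d) (inv d) Z.- pt (v <> step d) (p <> step (inv d)) * y))
     (! (pt-shift (v <> step d) p (step (inv d))) ∙ ap (\ z -> pt z (p <> step (inv d))) (step-back v d)) (ap (le (inv d)) (inv-inv d) ∙ e))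
 where
 alg : ∀ a b c m -> a * + 0 Z.- b * m == Z.- (b * m Z.- c * + 0)
 alg = ring

esum-cong : ∀ {E F} -> (∀ p l -> E p l == F p l) -> ∀ p w -> esum E p w == esum F p w
esum-cong h p [] = refl
esum-cong h p (l :: w) = ap2 Z._+_ (h p l) (esum-cong h (p <> step l) w)

esum-neg : ∀ E p w -> esum (\ q l -> Z.- E q l) p w == Z.- esum E p w
esum-neg E p [] = refl
esum-neg E p (l :: w) = ap (\ z -> Z.- E p l + z) (esum-neg E (p <> step l) w) ∙ ! (Y.neg-distrib-+ (E p l) _)

flux-diff : ∀ ρ σ E (g : Cell -> ℤ) -> (∀ p l -> edge ρ p l Z.- edge σ p l == E p l + (g p Z.- g (p <> step l))) -> ∀ p w ->
         flux ρ p w Z.- flux σ p w == esum E p w + (g p Z.- g (tip p w))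
flux-diff ρ σ E g h p [] = ! ((0+ _) ∙ Y.+-inverseʳ (g p))
flux-diff ρ σ E g h p (l :: w) = alg1 (edge ρ p l) (flux ρ p' w) (edge σ p l) (flux σ p' w) ∙ (ap2 Z._+_ (h p l) (flux-diff ρ σ E g h p' w)) ∙ alg2 (E p l) (g p) (g p') (esum E p' w) (g (tip p' w))
 where
 p' : Cell
 p' = p <> step l
 alg1 : ∀ a b c d -> (a + b) Z.- (c + d) == (a Z.- c) + (b Z.- d)
 alg1 = ring
 alg2 : ∀ e a b s c -> (e + (a Z.- b)) + (s + (b Z.- c)) == (e + s) + (a Z.- c)
 alg2 = ring

private
 across-U : ∀ v p l -> edge (ray (lcell v U)) p l Z.- edge (ray (lcell v R)) p l == net v U p l + (+ 0 Z.- + 0)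
 across-U (a , b) (x , y) R = alg (pt (a , b) (x , y)) (pt (a , b) ((x , y) <> step R))
  where
  alg : ∀ a b -> + 0 Z.- + 0 == (a * + 0 Z.- b * + 0) + (+ 0 Z.- + 0)
  alg = ring
 across-U (a , b) (x , y) L = alg (pt (a , b) (x , y)) (pt (a , b) ((x , y) <> step L))
  where
  alg : ∀ a b -> + 0 Z.- + 0 == (a * + 0 Z.- b * + 0) + (+ 0 Z.- + 0)
  alg = ring
 across-U (a , b) (x , y) U = ap (\ z -> z * eq y b Z.- lt a x * eq y b) (lt-pred a x) ∙ alg (lt a x) (eq x a) (eq y b) (pt (a , b) ((x , y) <> step U))
  where
  alg : ∀ l e f z -> (l + e) * f Z.- l * f == ((e * f) * + 1 Z.- z * + 0) + (+ 0 Z.- + 0)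
  alg = ring
 across-U (a , b) (x , y) D = ap (\ z -> Z.- (z * eq y' b) Z.- Z.- (lt a x' * eq y' b)) (lt-pred a x') ∙ alg (lt a x') (eq x' a) (eq y' b) (pt (a , b) (x , y))
  where
  x' y' : ℤ
  x' = x + + 0
  y' = y + -[1+ 0 ]
  alg : ∀ l e f z -> Z.- ((l + e) * f) Z.- Z.- (l * f) == (z * + 0 Z.- (e * f) * + 1) + (+ 0 Z.- + 0)
  alg = ring

 above : Cell -> Cell -> ℤ
 above (a , b) (x , y) = lt a x * eq y b

 eq-pred : ∀ y b -> eq y (b Z.- + 1) == eq (y + + 1) b
 eq-pred y b = ! (eq-shift y (b Z.- + 1) (+ 1)) ∙ ap (eq (y + + 1)) (alg b)
  where
  alg : ∀ b -> (b Z.- + 1) + + 1 == b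
  alg = ring

 across-R : ∀ v p l -> edge (ray (lcell v R)) p l Z.- edge (ray (lcell v D)) p l == net v R p l + (above v p Z.- above v (p <> step l))
 across-R (a , b) (x , y) R = ! (ap2 (\ s t -> (pt (a , b) (x , y) * + 1 Z.- pt (a , b) ((x , y) <> step R) * + 0) + (lt a x * eq y b Z.- s * eq t b)) (lt-suc a x) (+0 y) ∙
   alg (lt a x) (eq x a) (eq y b) (pt (a , b) ((x , y) <> step R)))
  where
  alg : ∀ l e f z -> ((e * f) * + 1 Z.- z * + 0) + (l * f Z.- (l + e) * f) == + 0
  alg = ring
 across-R (a , b) (x , y) L = ! (ap2 (\ s t -> (pt (a , b) (x , y) * + 0 Z.- (eq x' a * eq t b) * + 1) + (s * eq y b Z.- lt a x' * eq t b)) (ap (lt a) (alg' x) ∙ lt-suc a x') (+0 y) ∙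
   alg (lt a x') (eq x' a) (eq y b) (pt (a , b) (x , y)))
  where
  x' : ℤ
  x' = x + -[1+ 0 ]
  alg' : ∀ x -> x == (x + -[1+ 0 ]) + + 1
  alg' = ring
  alg : ∀ l e f z -> (z * + 0 Z.- (e * f) * + 1) + ((l + e) * f Z.- l * f) == + 0
  alg = ring
 across-R (a , b) (x , y) U = ap2 (\ s t -> lt a x * eq y b Z.- lt a s * t) (! (+0 x)) (eq-pred y b) ∙
   ap (\ s -> lt a x * eq y b Z.- s) refl ∙ alg (lt a x * eq y b) (lt a (x + + 0) * eq (y + + 1) b) (pt (a , b) (x , y)) (pt (a , b) ((x , y) <> step U))
  where
  alg : ∀ f g z w -> f Z.- g == (z * + 0 Z.- w * + 0) + (f Z.- g)
  alg = ring
 across-R (a , b) (x , y) D = ap2 (\ s t -> Z.- (lt a (x + + 0) * eq (y + -[1+ 0 ]) b) Z.- Z.- (lt a s * t)) (+0 x) (eq-pred (y + -[1+ 0 ]) b ∙ ap (\ z -> eq z b) (alg' y)) ∙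
   alg (lt a x * eq y b) (lt a (x + + 0) * eq (y + -[1+ 0 ]) b) (pt (a , b) (x , y)) (pt (a , b) ((x , y) <> step D))
  where
  alg' : ∀ y -> (y + -[1+ 0 ]) + + 1 == y
  alg' = ring
  alg : ∀ f g z w -> Z.- g Z.- Z.- f == (z * + 0 Z.- w * + 0) + (f Z.- g)
  alg = ring

across : ∀ p w -> tip p w == p -> ∀ v d -> wind p w (lcell v d) Z.- wind p w (lcell v (trght d)) == esum (net v d) p w
across p w cl v U = flux-diff (ray (lcell v U)) (ray (lcell v R)) (net v U) (\ _ -> + 0) (across-U v) p w ∙ (+0 _)
across p w cl v R = flux-diff (ray (lcell v R)) (ray (lcell v D)) (net v R) (above v) (across-R v) p w ∙
 ap (\ z -> esum (net v R) p w + (above v p Z.- above v z)) cl ∙ ap (\ z -> esum (net v R) p w + z) (Y.+-inverseʳ (above v p)) ∙ (+0 _)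
across p w cl v D = ap2 (\ s t -> wind p w s Z.- wind p w t) (! (lcell-next v D)) (ap (\ z -> (z Z.- + 1 , snd v Z.- + 1)) (! (+0 (fst v)))) ∙
 alg (wind p w (lcell (v <> step D) R)) (wind p w (lcell (v <> step D) U)) ∙
  ap (\ z -> Z.- z) (across p w cl (v <> step D) U) ∙ ! (esum-neg (net (v <> step D) U) p w) ∙ esum-cong (\ q l -> ! (net-inv v D q l)) p w
 where
 alg : ∀ a b -> a Z.- b == Z.- (b Z.- a)
 alg = ring
across p w cl v L = ap2 (\ s t -> wind p w s Z.- wind p w t) (! (lcell-next v L)) (ap (\ z -> (fst v Z.- + 1 , z)) (! (+0 (snd v)))) ∙
 alg (wind p w (lcell (v <> step L) D)) (wind p w (lcell (v <> step L) R)) ∙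
  ap (\ z -> Z.- z) (across p w cl (v <> step L) R) ∙ ! (esum-neg (net (v <> step L) R) p w) ∙ esum-cong (\ q l -> ! (net-inv v L q l)) p w
 where
 alg : ∀ a b -> a Z.- b == Z.- (b Z.- a)
 alg = ring

record Smp (p : Cell) (W : Word) : Set where
 constructor simple
 field
  closed   : tip p W == p
  long     : 3 ≤ # W
  distinct : Unique (verts p W)

verts-++ : ∀ p u v -> verts p (u ++ v) == verts p u ++ verts (tip p u) v
verts-++ p [] v = refl
verts-++ p (x :: u) v = ap (p ::_) (verts-++ (p <> step x) u v)

verts-⊕ : ∀ p t w -> verts (p <> t) w == map (_<> t) (verts p w)
verts-⊕ p t [] = refl
verts-⊕ p t (l :: w) = ap ((p <> t) ::_) (ap (\ z -> verts z w) (⊕-swap p t (step l)) ∙ verts-⊕ (p <> step l) t w)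

Simple-⊕ : ∀ {p W} t -> Smp p W -> Smp (p <> t) W
Simple-⊕ {p} {W} t (simple c l d) = simple (tip-⊕ p t W ∙ ap (_<> t) c) l (tp Unique (! (verts-⊕ p t W)) (UP.map⁺ (\ {x} {y} e -> ! (⊕-can x t) ∙ ap (_<> neg t) e ∙ ⊕-can y t) d))

Simple-at : ∀ {W} -> IsSimpleClosed W -> ∀ p -> Smp p W
Simple-at {W} (c , l , d) p = tp (\ z -> Smp z W) (⊕-idˡ p) (Simple-⊕ p (simple c l d))

Simple-step : ∀ {p y w} -> Smp p (y :: w) -> Smp (p <> step y) (w ++ (y :: []))
Simple-step {p} {y} {w} (simple c l (n :: ns)) = simple (tip-++ (p <> step y) w (y :: []) ∙ ap (_<> step y) c) (tp (3 N.≤_) (! (#-++ w ∙ Q.+-comm (# w) 1)) l)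
 (tp Unique (! (verts-++ (p <> step y) w (y :: []) ∙ ap (\ z -> verts (p <> step y) w ++ (z :: [])) c)) (APP.++⁺ ns ([] :: []) (All.map (\ m -> (\ e -> m (! e)) :: []) n)))

Simple-rot : ∀ {p} u v -> Smp p (u ++ v) -> Smp (tip p u) (v ++ u)
Simple-rot {p} [] v s = tp (Smp p) (! (++-id v)) s
Simple-rot {p} (y :: u) v s = tp (Smp (tip (p <> step y) u)) (++-as v (y :: []) u) (Simple-rot u (v ++ (y :: [])) (tp (Smp (p <> step y)) (++-as u v (y :: [])) (Simple-step s)))

flux-rot : ∀ ρ p u v -> tip p (u ++ v) == p -> flux ρ p (u ++ v) == flux ρ (tip p u) (v ++ u)
flux-rot ρ p u v e = flux-++ ρ p u v ∙ (Y.+-comm (flux ρ p u) _) ∙ ap (\ z -> flux ρ (tip p u) v + flux ρ z u) (! e ∙ tip-++ p u v) ∙ ! (flux-++ ρ (tip p u) v u)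

pt-self : ∀ v -> pt v v == + 1
pt-self (a , b) = ap2 Z._*_ (eq-refl a) (eq-refl b)

pt-≢ : ∀ {v p} -> v != p -> pt v p == + 0
pt-≢ {a , b} {x , y} n with x Y.≟ a
... | no _ = refl
... | yes refl = (Y.*-identityˡ _) ∙ (eq-≢ \ e -> n (ap (a ,_) (! e)))

out inn : Cell -> Ltr -> Cell -> Ltr -> ℤ
out v d p l = pt v p * le l d
inn v d p l = pt v (p <> step l) * le l d

esum-net : ∀ v d p w -> esum (net v d) p w == esum (out v d) p w Z.- esum (inn v (inv d)) p w
esum-net v d p [] = refl
esum-net v d p (l :: w) = ap (\ z -> net v d p l + z) (esum-net v d (p <> step l) w) ∙
  alg (out v d p l) (inn v (inv d) p l) (esum (out v d) (p <> step l) w) (esum (inn v (inv d)) (p <> step l) w)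
 where
 alg : ∀ a b c d -> (a Z.- b) + (c Z.- d) == (a + c) Z.- (b + d)
 alg = ring

esum-out-none : ∀ v d p w -> All (v !=_) (verts p w) -> esum (out v d) p w == + 0
esum-out-none v d p [] [] = refl
esum-out-none v d p (l :: w) (n :: ns) = ap2 Z._+_ (ap (Z._* le l d) (pt-≢ n)) (esum-out-none v d (p <> step l) w ns)

esum-inn-last : ∀ v d p l w -> All (v !=_) (verts (p <> step l) w) -> tip (p <> step l) w == v -> esum (inn v d) p (l :: w) == le (lst l w) d
esum-inn-last v d p l [] ns refl = (+0 _) ∙ ap (Z._* le l d) (pt-self v) ∙ (Y.*-identityˡ _)
esum-inn-last v d p l (m :: w) (n :: ns) e = (ap2 Z._+_ (ap (Z._* le l d) (pt-≢ n)) (esum-inn-last v d (p <> step l) m w ns e)) ∙ (0+ _)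

esum-pass : ∀ {p y w} -> Smp p (y :: w) -> ∀ d -> esum (net p d) p (y :: w) == le y d Z.- le (lst y w) (inv d)
esum-pass {p} {y} {w} (simple c _ (n :: ns)) d = esum-net p d p (y :: w) ∙ (ap2 Z._-_ ((ap2 Z._+_ (ap (Z._* le y d) (pt-self p) ∙ Y.*-identityˡ (le y d)) (esum-out-none p d (p <> step y) w n)) ∙ +0 (le y d))
 (esum-inn-last p (inv d) p y w n c))

snoc : ∀ m w -> Σ Word \ v -> m :: w == v ++ (lst m w :: [])
snoc m [] = [] , refl
snoc m (k :: w) with snoc k w
... | v , e = m :: v , ap (m ::_) e

step-can : ∀ {q} x -> q <> step x == q -> ⊥
step-can {a , b} R e = Y.<-irrefl (! (ap fst e)) (next a)
step-can {a , b} U e = Y.<-irrefl (! (ap snd e)) (next b)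
step-can {q} L e = step-can {q} R (ap (_<> step R) (! e) ∙ step-back q L)
step-can {q} D e = step-can {q} U (ap (_<> step U) (! e) ∙ step-back q D)

no-backtrack : ∀ {p y w} -> Smp p (y :: w) -> y != inv (lst y w)
no-backtrack {p} {y} {[]} s e = step-can y (Smp.closed s)
no-backtrack {p} {y} {m :: w} s e with snoc m w
... | [] , e' with I.∷-injectiveʳ e'
no-backtrack {p} {y} {m :: []} (simple _ (N.s≤s (N.s≤s ())) _) e | [] , e' | refl
no-backtrack {p} {y} {m :: w} s e | k :: v , e' with Smp.distinct s
... | _ :: d with tp Unique (ap (verts (p <> step y)) e' ∙ verts-++ (p <> step y) (k :: v) (lst m w :: [])) d
... | n :: _ with AllP.++⁻ʳ (verts ((p <> step y) <> step k) v) n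
... | h :: [] = h (ap (\ z -> p <> step z) e ∙ ap (_<> step (inv (lst m w))) (! c) ∙ (step-back _ (lst m w)))
 where
 c : tip (p <> step y) (k :: v) <> step (lst m w) == p
 c = ! (tip-++ (p <> step y) (k :: v) (lst m w :: [])) ∙ ap (tip (p <> step y)) (! e') ∙ Smp.closed s

turn-cases : ∀ x y -> y == tleft x ⊎ y == x ⊎ y == trght x ⊎ y == inv x
turn-cases R R = inr (inl refl)
turn-cases R U = inl refl
turn-cases R L = inr (inr (inr refl))
turn-cases R D = inr (inr (inl refl))
turn-cases U R = inr (inr (inl refl))
turn-cases U U = inr (inl refl)
turn-cases U L = inl refl
turn-cases U D = inr (inr (inr refl))
turn-cases L R = inr (inr (inr refl))
turn-cases L U = inr (inr (inl refl))
turn-cases L L = inr (inl refl)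
turn-cases L D = inl refl
turn-cases D R = inl refl
turn-cases D U = inr (inr (inr refl))
turn-cases D L = inr (inr (inl refl))
turn-cases D D = inr (inl refl)

module _ {p y w} (s : Smp p (y :: w)) where
 private
  x : Ltr
  x = lst y w
  W : Word
  W = y :: w
  cross : ∀ d {n} -> le y d Z.- le x (inv d) == n -> wind p W (lcell p d) == wind p W (lcell p (trght d)) + n
  cross d e = alg (wind p W (lcell p d)) (wind p W (lcell p (trght d))) ∙
   ap (\ z -> wind p W (lcell p (trght d)) + z) (across p W (Smp.closed s) p d ∙ esum-pass s d ∙ e)
   where
   alg : ∀ a b -> a == b + (a Z.- b)
   alg = ring
  cross0 : ∀ d -> le y d Z.- le x (inv d) == + 0 -> wind p W (lcell p d) == wind p W (lcell p (trght d))
  cross0 d e = cross d e ∙ (+0 _)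
  trght-tleft : ∀ l -> trght (tleft l) == l
  trght-tleft R = refl
  trght-tleft L = refl
  trght-tleft U = refl
  trght-tleft D = refl
  n1 : ∀ l -> le l (tleft l) Z.- le l (inv (tleft l)) == + 0
  n1 R = refl
  n1 L = refl
  n1 U = refl
  n1 D = refl
  n2 : ∀ l -> le (trght l) (tleft l) Z.- le l (inv (tleft l)) == + 0
  n2 R = refl
  n2 L = refl
  n2 U = refl
  n2 D = refl
  n3 : ∀ l -> le (trght l) l Z.- le l (inv l) == + 0
  n3 R = refl
  n3 L = refl
  n3 U = refl
  n3 D = refl

 left-constant : wind p W (lcell p (tleft x)) == wind p W (lcell p y)
 left-constant with turn-cases x y
 ... | inl e = ap (\ z -> wind p W (lcell p z)) (! e)
 ... | inr (inl e) = cross0 (tleft x) (ap (\ z -> le z (tleft x) Z.- le x (inv (tleft x))) e ∙ n1 x) ∙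
     ap (\ z -> wind p W (lcell p z)) (trght-tleft x ∙ ! e)
 ... | inr (inr (inl e)) = cross0 (tleft x) (ap (\ z -> le z (tleft x) Z.- le x (inv (tleft x))) e ∙ n2 x) ∙
     ap (\ z -> wind p W (lcell p z)) (trght-tleft x) ∙
      cross0 x (ap (\ z -> le z x Z.- le x (inv x)) e ∙ n3 x) ∙ ap (\ z -> wind p W (lcell p z)) (! e)
 ... | inr (inr (inr e)) = !! (no-backtrack s e)

 left-right : wind p W (lcell p y) == wind p W (lcell p (trght y)) + + 1
 left-right = cross y (one (le-sound x (inv y)))
  where
  self : ∀ l -> le l l == + 1
  self R = refl
  self L = refl
  self U = refl
  self D = refl
  one : le x (inv y) == + 0 ⊎ x == inv y -> le y y Z.- le x (inv y) == + 1
  one (inl e) = ap2 Z._-_ (self y) e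
  one (inr e) = !! (no-backtrack s (! (inv-inv y) ∙ ap inv (! e)))

EOf : Cell -> Word -> Cell -> Ltr -> Set
EOf p W q l = Σ Word \ u -> Σ Word \ v -> W == u ++ (l :: v) × tip p u == q

wind-rot : ∀ {p} u v -> Smp p (u ++ v) -> ∀ c -> wind p (u ++ v) c == wind (tip p u) (v ++ u) c
wind-rot {p} u v s c = flux-rot (ray c) p u v (Smp.closed s)

left-all : ∀ u {p y w l v} -> Smp p (y :: w) -> y :: w == u ++ (l :: v) ->
      wind p (y :: w) (lcell (tip p u) l) == wind p (y :: w) (lcell p y)
left-all [] s refl = refl
left-all (y :: u) {p} {_} {_} {l} {v} s refl = go u refl
 where
 p1 : Cell
 p1 = p <> step y
 c1 : ∀ c -> wind p (y :: (u ++ l :: v)) c == wind p1 ((u ++ l :: v) ++ (y :: [])) c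
 c1 = wind-rot (y :: []) (u ++ l :: v) s
 go : ∀ u' -> u' == u -> wind p (y :: (u ++ l :: v)) (lcell (tip p1 u) l) == wind p (y :: (u ++ l :: v)) (lcell p y)
 go [] refl = c1 (lcell p1 l) ∙ ! (tp (\ z -> wind p1 (l :: (v ++ (y :: []))) (lcell p1 (tleft z)) == wind p1 (l :: (v ++ (y :: []))) (lcell p1 l))
  (lst-++ l v (y :: [])) (left-constant (Simple-step s))) ∙ ap (wind p1 (l :: (v ++ (y :: [])))) (lcell-next p y) ∙ ! (c1 (lcell p y))
 go (h :: u') refl = c1 (lcell (tip p1 (h :: u')) l) ∙ left-all (h :: u') (Simple-step s) (++-as (h :: u') (l :: v) (y :: [])) ∙
   ! (tp (\ z -> wind p1 (h :: t) (lcell p1 (tleft z)) == wind p1 (h :: t) (lcell p1 h)) (lst-++ h (u' ++ l :: v) (y :: [])) (left-constant (Simple-step s))) ∙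
    ap (wind p1 (h :: t)) (lcell-next p y) ∙ ! (c1 (lcell p y))
  where
  t : Word
  t = (u' ++ l :: v) ++ (y :: [])

right-all : ∀ {p W q l} -> Smp p W -> EOf p W q l -> wind p W (lcell q l) == wind p W (lcell q (trght l)) + + 1
right-all {p} {_} {_} {l} s (u , v , refl , refl) = wind-rot u (l :: v) s (lcell (tip p u) l) ∙ left-right (Simple-rot u (l :: v) s) ∙
 ap (Z._+ + 1) (! (wind-rot u (l :: v) s (lcell (tip p u) (trght l))))

pt-le : ∀ v p l d -> (v == p × l == d) ⊎ pt v p * le l d == + 0
pt-le v p l d with v ≟ᶜ p | le-sound l d
... | yes e | inr e' = inl (e , e')
... | no n | _ = inr (ap (Z._* le l d) (pt-≢ n))
... | yes _ | inl e = inr (ap (pt v p Z.*_) e ∙ Y.*-zeroʳ (pt v p))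

find-edge : ∀ v d p W -> EOf p W v d ⊎ EOf p W (v <> step d) (inv d) ⊎ esum (net v d) p W == + 0
find-edge v d p [] = inr (inr refl)
find-edge v d p (l :: w) with find-edge v d (p <> step l) w
... | inl (u , u' , e , e') = inl (l :: u , u' , ap (l ::_) e , e')
... | inr (inl (u , u' , e , e')) = inr (inl (l :: u , u' , ap (l ::_) e , e'))
... | inr (inr z) with pt-le v p l d
... | inl (refl , refl) = inl ([] , w , refl , refl)
... | inr a with pt-le v (p <> step l) l (inv d)
... | inl (refl , refl) = inr (inl ([] , w , refl , ! (ap (\ z -> (p <> step (inv d)) <> step z) (! (inv-inv d)) ∙ step-back p (inv d))))
... | inr b = inr (inr (ap2 (\ x y -> (x Z.- y) + esum (net v d) (p <> step l) w) a b ∙ (0+ _) ∙ z))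

far-right : ∀ p w x y -> fst p + + # w Z.≤ x -> wind p w (x , y) == + 0
far-right p [] x y h = refl
far-right (a , b) (l :: w) x y h = ap2 Z._+_ (e l) (far-right ((a , b) <> step l) w x y (Y.≤-trans (Y.≤-trans (Y.+-monoˡ-≤ (+ # w) (s≤ l)) (Y.≤-reflexive (alg a (+ # w)))) h))
 where
 alg : ∀ a n -> (a + + 1) + n == a + (+ 1 + n)
 alg = ring
 s≤ : ∀ l -> a + fst (step l) Z.≤ a + + 1
 s≤ R = Y.≤-refl
 s≤ L = Y.+-monoʳ-≤ a Z.-≤+
 s≤ U = Y.+-monoʳ-≤ a (Z.+≤+ N.z≤n)
 s≤ D = Y.+-monoʳ-≤ a (Z.+≤+ N.z≤n)
 a≤ : a Z.≤ x
 a≤ = Y.≤-trans (Y.≤-trans (Y.≤-reflexive (! (+0 a))) (Y.+-monoʳ-≤ a (Z.+≤+ N.z≤n))) h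
 e : ∀ l -> edge (ray (x , y)) (a , b) l == + 0
 e R = refl
 e L = refl
 e U = ap (Z._* eq b y) (lt-no a≤)
 e D = ap (\ z -> Z.- (z * eq (b + -[1+ 0 ]) y)) (lt-no (Y.≤-trans (Y.≤-reflexive (+0 a)) a≤))

module Jordan {p y w} (s : Smp p (y :: w)) where
 W : Word
 W = y :: w

 -- The common winding number of the cells on the left of the boundary.
 side : ℤ
 side = wind p W (lcell p y)

 left-side : ∀ {q l} -> EOf p W q l -> wind p W (lcell q l) == side
 left-side (u , v , e , refl) = left-all u s e

 right-side : ∀ {q l} -> EOf p W q l -> wind p W (lcell q (trght l)) == side Z.- + 1
 right-side {q} {l} e = alg (wind p W (lcell q (trght l))) ∙ ap (Z._- + 1) (! (right-all s e) ∙ left-side e)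
  where
  alg : ∀ a -> a == (a + + 1) Z.- + 1
  alg = ring

 private
  m : ℤ
  m = fst p + + # W

  data Column (x b : ℤ) : Set where
   usedU  : wind p W (x Z.- + 1 , b) == side -> wind p W (x , b) == side Z.- + 1 -> Column x b
   usedD  : wind p W (x Z.- + 1 , b) == side Z.- + 1 -> wind p W (x , b) == side -> Column x b
   unused : wind p W (x Z.- + 1 , b) == wind p W (x , b) -> Column x b

  column : ∀ x b -> Column x b
  column x b with find-edge (x , b) U p W
  ... | inl e = usedU (left-side e) (right-side e)
  ... | inr (inl e) = usedD (ap (wind p W) (ap2 _,_ (ap (Z._- + 1) (! (+0 x))) (alg b)) ∙ right-side e) (ap (wind p W) (ap2 _,_ (! (+0 x)) (alg b)) ∙ left-side e)
   where
   alg : ∀ b -> b == (b + + 1) Z.- + 1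
   alg = ring
  ... | inr (inr z) = unused (Y.i-j≡0⇒i≡j _ _ (across p W (Smp.closed s) (x , b) U ∙ z))

  Resolved : Set
  Resolved = side == + 1 ⊎ side == + 0

  column-pred : ∀ k -> m Z.- + suc k == (m Z.- + k) Z.- + 1
  column-pred k = alg m (+ k)
   where
   alg : ∀ m k -> m Z.- (+ 1 + k) == (m Z.- k) Z.- + 1
   alg = ring

  Values : ℤ -> Set
  Values z = z == + 0 ⊎ z == side ⊎ z == side Z.- + 1

  scan : ∀ k b -> Values (wind p W (m Z.- + k , b)) × (wind p W (m Z.- + k , b) == + 0 ⊎ Resolved)
  scan zero b = inl z , inl z
   where
   z : wind p W (m Z.- + 0 , b) == + 0
   z = far-right p W (m Z.- + 0) b (Y.≤-reflexive (! (+0 m)))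
  scan (suc k) b with scan k b | column (m Z.- + k) b
  ... | v , r | usedU l r' = inr (inl (c ∙ l)) , inr (Data.Sum.[ (\ z -> inl (alg side ∙ ap (Z._+ + 1) (! r' ∙ z))) , (\ z -> z) ] r)
   where
   c = ap (\ z -> wind p W (z , b)) (column-pred k)
   alg : ∀ a -> a == (a Z.- + 1) + + 1
   alg = ring
  ... | v , r | usedD l r' = inr (inr (c ∙ l)) , inr (Data.Sum.[ (\ z -> inr (! r' ∙ z)) , (\ z -> z) ] r)
   where
   c = ap (\ z -> wind p W (z , b)) (column-pred k)
  ... | v , r | unused e = tp Values (! (c ∙ e)) v , Data.Sum.map (\ z -> (c ∙ e) ∙ z) (\ z -> z) r
   where
   c = ap (\ z -> wind p W (z , b)) (column-pred k)

  scan-any : ∀ x b -> Values (wind p W (x , b)) × (wind p W (x , b) == + 0 ⊎ Resolved)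
  scan-any x b with Y.≤-total m x
  ... | inl h = inl (far-right p W x b h) , inl (far-right p W x b h)
  ... | inr h = tp (\ z -> Values (wind p W (z , b)) × (wind p W (z , b) == + 0 ⊎ Resolved)) (ap (\ z -> m Z.- z) (Y.0≤i⇒+∣i∣≡i (Y.i≤j⇒0≤j-i h)) ∙ alg m x) (scan Z.∣ m Z.- x ∣ b)
   where
   alg : ∀ m x -> m Z.- (m Z.- x) == x
   alg = ring

 abstract
  resolved : side == + 1 ⊎ side == + 0
  resolved with snd (scan-any (fst (lcell p y)) (snd (lcell p y)))
  ... | inl e = inr e
  ... | inr r = r

 -- +1 for anticlockwise, −1 for clockwise boundaries.
 orien : ℤ
 orien = side + (side Z.- + 1)

 abstract
  orien-sign : orien == + 1 ⊎ orien == -[1+ 0 ]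
  orien-sign with resolved
  ... | inl e = inl (ap (\ z -> z + (z Z.- + 1)) e)
  ... | inr e = inr (ap (\ z -> z + (z Z.- + 1)) e)

  wind-cases : ∀ c -> wind p W c == + 0 ⊎ wind p W c == orien
  wind-cases (x , b) with resolved | fst (scan-any x b)
  ... | _ | inl e = inl e
  ... | inl r | inr (inl e) = inr ((e ∙ r) ∙ ap (\ z -> z + (z Z.- + 1)) (! r))
  ... | inl r | inr (inr e) = inl (e ∙ ap (Z._- + 1) r)
  ... | inr r | inr (inl e) = inl (e ∙ r)
  ... | inr r | inr (inr e) = inr (e ∙ ap (Z._- + 1) r ∙ ap (\ z -> z + (z Z.- + 1)) (! r))

ind-∧ : ∀ a b -> ind (a ∧ b) == ind a * ind b
ind-∧ true true = refl
ind-∧ true false = refl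
ind-∧ false b = refl

ind-xor : ∀ a b -> ind a + ind b == ind (a xor b) + + 2 * (ind a * ind b)
ind-xor true true = refl
ind-xor true false = refl
ind-xor false true = refl
ind-xor false false = refl

wind-parity : ∀ p w c -> Σ ℤ \ k -> wind p w c == ind (inside p w c) + + 2 * k
wind-parity p [] c = + 0 , refl
wind-parity (a , b) (l :: w) (x , y) with wind-parity ((a , b) <> step l) w (x , y) | first l
 where
 first : ∀ l -> Σ ℤ \ k -> edge (ray (x , y)) (a , b) l == ind (crosses x y (a , b) l) + + 2 * k
 first R = + 0 , refl
 first L = + 0 , refl
 first U = + 0 , ! ((+0 _) ∙ ind-∧ ⌊ x Z.<? a ⌋ ⌊ b Y.≟ y ⌋)
 first D = Z.- (lt x a * eq b (y + + 1)) , ap2 (\ s t -> Z.- (lt x s * t)) (+0 a) (! (eq-shift (b + -[1+ 0 ]) y (+ 1)) ∙ ap (\ z -> eq z (y + + 1)) (alg b)) ∙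
   alg' (lt x a * eq b (y + + 1)) ∙ ap (\ z -> z + + 2 * (Z.- (lt x a * eq b (y + + 1)))) (! (ind-∧ ⌊ x Z.<? a ⌋ ⌊ b Y.≟ (y + + 1) ⌋))
  where
  alg : ∀ b -> (b + -[1+ 0 ]) + + 1 == b
  alg = ring
  alg' : ∀ z -> Z.- z == z + + 2 * (Z.- z)
  alg' = ring
... | k , e | k' , e' = k' + k + i * j , (ap2 Z._+_ e' e) ∙ alg i k' j k ∙
   ap (\ z -> z + + 2 * (k' + k)) (ind-xor (crosses x y (a , b) l) (inside ((a , b) <> step l) w (x , y))) ∙ alg' (ind (crosses x y (a , b) l xor inside ((a , b) <> step l) w (x , y))) (i * j) (k' + k)
 where
 i j : ℤ
 i = ind (crosses x y (a , b) l)
 j = ind (inside ((a , b) <> step l) w (x , y))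
 alg : ∀ i k' j k -> (i + + 2 * k') + (j + + 2 * k) == (i + j) + + 2 * (k' + k)
 alg = ring
 alg' : ∀ z m n -> (z + + 2 * m) + + 2 * n == z + + 2 * (n + m)
 alg' = ring

inside-zero : ∀ p w c -> wind p w c == + 0 -> inside p w c == false
inside-zero p w c z with inside p w c | wind-parity p w c
... | false | _ = refl
... | true | k , e = !! (odd k (! e ∙ z))
 where
 odd : ∀ k -> + 1 + + 2 * k != + 0
 odd (+ zero) ()
 odd (+ suc n) ()
 odd -[1+ zero ] ()
 odd -[1+ suc n ] ()

inside-one : ∀ p w c -> wind p w c == + 1 ⊎ wind p w c == -[1+ 0 ] -> inside p w c == true
inside-one p w c z with inside p w c | wind-parity p w c
... | true | _ = refl
... | false | k , e = !! (odd k (Data.Sum.map (_∙_ (! e)) (_∙_ (! e)) z))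
 where
 odd : ∀ k -> + 0 + + 2 * k == + 1 ⊎ + 0 + + 2 * k == -[1+ 0 ] -> ⊥
 odd (+ zero) (inl ())
 odd (+ zero) (inr ())
 odd (+ suc n) (inl e) = two n (Y.+-injective e)
  where
  two : ∀ n -> 2 N.* suc n != 1
  two zero ()
  two (suc n) ()
 odd (+ suc n) (inr ())
 odd -[1+ n ] (inl ())
 odd -[1+ zero ] (inr ())
 odd -[1+ suc n ] (inr ())

-- The flux of a potential is the sum of its gradient over the enclosed cells

sumN : ℕ -> (ℕ -> ℤ) -> ℤ
sumN zero h = + 0
sumN (suc n) h = sumN n h + h n

sumN-cong : ∀ n {h k : ℕ -> ℤ} -> (∀ i -> i < n -> h i == k i) -> sumN n h == sumN n k
sumN-cong zero e = refl
sumN-cong (suc n) e = ap2 Z._+_ (sumN-cong n \ i l -> e i (Q.m<n⇒m<1+n l)) (e n (Q.n<1+n n))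

sumN-*ʳ : ∀ n h c -> sumN n h * c == sumN n (\ i -> h i * c)
sumN-*ʳ zero h c = refl
sumN-*ʳ (suc n) h c = Y.*-distribʳ-+ c (sumN n h) (h n) ∙ ap (Z._+ h n * c) (sumN-*ʳ n h c)

sumN-zero : ∀ n {h : ℕ -> ℤ} -> (∀ i -> i < n -> h i == + 0) -> sumN n h == + 0
sumN-zero zero e = refl
sumN-zero (suc n) e = ap2 Z._+_ (sumN-zero n \ i l -> e i (Q.m<n⇒m<1+n l)) (e n (Q.n<1+n n))

sumN-single : ∀ n h k -> k < n -> (∀ i -> i != k -> h i == + 0) -> sumN n h == h k
sumN-single (suc n) h k lt' e with k Q.≟ n
... | yes refl = ap (Z._+ h n) (sumN-zero n \ i l -> e i (Q.<⇒≢ l)) ∙ (0+ _)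
... | no ne = (ap2 Z._+_ (sumN-single n h k (Q.≤∧≢⇒< (Q.≤-pred lt') ne) e) (e n \ z -> ne (! z))) ∙ (+0 _)

sumN-≥0 : ∀ n {h : ℕ -> ℤ} -> (∀ i -> + 0 Z.≤ h i) -> + 0 Z.≤ sumN n h
sumN-≥0 zero e = Y.≤-refl
sumN-≥0 (suc n) e = Y.+-mono-≤ (sumN-≥0 n e) (e n)

sumN-term : ∀ n {h : ℕ -> ℤ} -> (∀ i -> + 0 Z.≤ h i) -> ∀ k -> k < n -> h k Z.≤ sumN n h
sumN-term (suc n) {h} e k l with k Q.≟ n
... | yes refl = Y.≤-trans (Y.≤-reflexive (! (0+ _))) (Y.+-monoˡ-≤ (h n) (sumN-≥0 n e))
... | no ne = Y.≤-trans (Y.≤-trans (sumN-term n e k (Q.≤∧≢⇒< (Q.≤-pred l) ne)) (Y.≤-reflexive (! (+0 _)))) (Y.+-monoʳ-≤ (sumN n h) (e n))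

sumN-terms : ∀ n {h : ℕ -> ℤ} -> (∀ i -> + 0 Z.≤ h i) -> ∀ j k -> j != k -> j < n -> k < n -> h j + h k Z.≤ sumN n h
sumN-terms (suc n) {h} e j k j≢k lj lk with j Q.≟ n | k Q.≟ n
... | yes refl | yes refl = !! (j≢k refl)
... | yes refl | no k≢n = Y.≤-trans (Y.≤-reflexive (Y.+-comm (h n) (h k))) (Y.+-monoˡ-≤ (h n) (sumN-term n e k (Q.≤∧≢⇒< (Q.≤-pred lk) k≢n)))
... | no j≢n | yes refl = Y.+-monoˡ-≤ (h n) (sumN-term n e j (Q.≤∧≢⇒< (Q.≤-pred lj) j≢n))
... | no j≢n | no k≢n = Y.≤-trans (Y.≤-trans (sumN-terms n e j k j≢k (Q.≤∧≢⇒< (Q.≤-pred lj) j≢n) (Q.≤∧≢⇒< (Q.≤-pred lk) k≢n)) (Y.≤-reflexive (! (+0 _)))) (Y.+-monoʳ-≤ (sumN n h) (e n))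

sumN-nonzero : ∀ n (h : ℕ -> ℤ) -> sumN n h != + 0 -> Σ ℕ \ i -> h i != + 0
sumN-nonzero zero h ne = !! (ne refl)
sumN-nonzero (suc n) h ne with h n Y.≟ + 0
... | no z = n , z
... | yes z = sumN-nonzero n h \ z' -> ne (ap2 Z._+_ z' z)

flux-* : ∀ ρ c p w -> flux (\ q -> c * ρ q) p w == c * flux ρ p w
flux-* ρ c p [] = ! (Y.*-zeroʳ c)
flux-* ρ c p (l :: w) = (ap2 Z._+_ (e l) (flux-* ρ c (p <> step l) w)) ∙ ! (Y.*-distribˡ-+ c (edge ρ p l) _)
 where
 e : ∀ l -> edge (\ q -> c * ρ q) p l == c * edge ρ p l
 e R = ! (Y.*-zeroʳ c)
 e L = ! (Y.*-zeroʳ c)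
 e U = refl
 e D = Y.neg-distribʳ-* c (ρ (p <> step D))

flux-zero : ∀ p w -> flux (\ _ -> + 0) p w == + 0
flux-zero p w = flux-poten (\ _ -> + 0) (\ _ -> + 0) (\ _ _ -> refl) p w ∙ refl

flux-sum : ∀ n (ρ : ℕ -> Cell -> ℤ) p w -> flux (\ q -> sumN n (\ i -> ρ i q)) p w == sumN n (\ i -> flux (ρ i) p w)
flux-sum zero ρ p w = flux-zero p w
flux-sum (suc n) ρ p w = flux-+ (\ q -> sumN n (\ i -> ρ i q)) (ρ n) p w ∙ ap (Z._+ flux (ρ n) p w) (flux-sum n ρ p w)

prim : (ℤ -> ℤ) -> ℤ -> ℤ
prim h (+ n) = sumN n (\ i -> h (+ i))
prim h -[1+ n ] = Z.- sumN (suc n) (\ i -> h -[1+ i ])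

prim-step : ∀ h y -> h y == prim h (y + + 1) Z.- prim h y
prim-step h (+ n) = alg (sumN n (\ i -> h (+ i))) (h (+ n)) ∙ ap (\ z -> prim h (+ z) Z.- prim h (+ n)) (Q.+-comm 1 n)
 where
 alg : ∀ s a -> a == (s + a) Z.- s
 alg = ring
prim-step h -[1+ zero ] = alg (h -[1+ 0 ])
 where
 alg : ∀ a -> a == + 0 Z.- Z.- (+ 0 + a)
 alg = ring
prim-step h -[1+ suc n ] = alg (sumN (suc n) (\ i -> h -[1+ i ])) (h -[1+ suc n ])
 where
 alg : ∀ s a -> a == Z.- s Z.- Z.- (s + a)
 alg = ring

flux-row : ∀ h p w -> tip p w == p -> flux (\ q -> h (snd q)) p w == + 0
flux-row h p w e = flux-poten (\ q -> h (snd q)) (prim h) (\ _ y -> prim-step h y) p w ∙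
 ap (\ z -> prim h (snd z) Z.- prim h (snd p)) e ∙ Y.+-inverseʳ (prim h (snd p))

module Box (ρ φ : Cell -> ℤ) (gradient : ∀ p -> φ (p <> step R) == φ p + ρ p) (x0 y0 : ℤ) (m : ℕ) where

 cAt : ℕ -> ℕ -> Cell
 cAt j i = (x0 + + i , y0 + + j)

 raySum : Cell -> ℤ
 raySum q = sumN m \ j -> sumN m \ i -> ρ (cAt j i) * ray (cAt j i) q

 private
  row : ∀ b k n -> k ≤ n -> sumN n (\ i -> ρ (x0 + + i , b) * lt (x0 + + i) (x0 + + k)) == φ (x0 + + k , b) Z.- φ (x0 , b)
  row b zero zero _ = ! (ap (\ z -> φ (z , b) Z.- φ (x0 , b)) (+0 x0) ∙ Y.+-inverseʳ (φ (x0 , b)))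
  row b k (suc n) le' with k Q.≟ suc n
  ... | no ne = (ap2 Z._+_ (row b k n k≤n) (ap (ρ (x0 + + n , b) Z.*_) (lt-no (Y.+-monoʳ-≤ x0 (Z.+≤+ k≤n))) ∙ Y.*-zeroʳ (ρ (x0 + + n , b)))) ∙ +0 (φ (x0 + + k , b) Z.- φ (x0 , b))
   where
   k≤n : k ≤ n
   k≤n = Q.≤-pred (Q.≤∧≢⇒< le' ne)
  ... | yes refl = (ap2 Z._+_ (sumN-cong n (\ i l -> ap (ρ (x0 + + i , b) Z.*_) (lt-yes (Y.+-monoʳ-< x0 (Z.+<+ (Q.m<n⇒m<1+n l))) ∙ ! (lt-yes (Y.+-monoʳ-< x0 (Z.+<+ l))))) ∙ row b n n Q.≤-refl)
   (ap (ρ (x0 + + n , b) Z.*_) (lt-yes (Y.+-monoʳ-< x0 (Z.+<+ (Q.n<1+n n)))) ∙ (Y.*-identityʳ _))) ∙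
    alg (φ (x0 + + n , b)) (φ (x0 , b)) (ρ (x0 + + n , b)) ∙
     ap (Z._- φ (x0 , b)) (! (gradient (x0 + + n , b)) ∙ ap2 (\ s t -> φ (s , t)) (Y.+-assoc x0 (+ n) (+ 1) ∙ ap (\ z -> x0 + + z) (Q.+-comm n 1)) (+0 b))
   where
   alg : ∀ a c r -> (a Z.- c) + r == (a + r) Z.- c
   alg = ring

  Offset : ℤ -> ℤ -> Set
  Offset z z0 = Σ ℕ \ k -> k < m × z == z0 + + k

  raySum-inside : ∀ {a b} -> Offset a x0 -> Offset b y0 -> raySum (a , b) == φ (a , b) Z.- φ (x0 , b)
  raySum-inside {a} {b} (k , lk , refl) (l , ll , refl) = (sumN-cong m \ j _ -> (sumN-cong m \ i _ -> ! (Y.*-assoc (ρ (cAt j i)) (lt (x0 + + i) a) (eq b (y0 + + j)))) ∙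
     ! (sumN-*ʳ m (\ i -> ρ (cAt j i) * lt (x0 + + i) a) (eq b (y0 + + j)))) ∙
    sumN-single m (\ j -> sumN m (\ i -> ρ (cAt j i) * lt (x0 + + i) a) * eq b (y0 + + j)) l ll
     (\ j ne -> ap (sumN m (\ i -> ρ (cAt j i) * lt (x0 + + i) a) Z.*_) (eq-≢ \ e -> ne (! (Y.+-injective (can e)))) ∙ Y.*-zeroʳ (sumN m (\ i -> ρ (cAt j i) * lt (x0 + + i) a))) ∙
     ap (sumN m (\ i -> ρ (cAt l i) * lt (x0 + + i) a) Z.*_) (eq-refl b) ∙ Y.*-identityʳ (sumN m (\ i -> ρ (cAt l i) * lt (x0 + + i) a)) ∙ row b k m (Q.<⇒≤ lk)
   where
   can : ∀ {s t} -> y0 + s == y0 + t -> s == t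
   can {s} {t} e = alg y0 s ∙ ap (\ z -> Z.- y0 + z) e ∙ ! (alg y0 t)
    where
    alg : ∀ y s -> s == Z.- y + (y + s)
    alg = ring

 Near : ℕ -> Cell -> Set
 Near k (a , b) = (x0 + + k Z.≤ a × a + + k Z.< x0 + + m) × (y0 + + k Z.≤ b × b + + k Z.< y0 + + m)

 private
  near-1 : ∀ z z0 k d -> d == + 1 ⊎ d == + 0 ⊎ d == -[1+ 0 ] -> z0 + + suc k Z.≤ z × z + + suc k Z.< z0 + + m ->
       z0 + + k Z.≤ z + d × z + d + + k Z.< z0 + + m
  near-1 z z0 k d c (lo , hi) = Y.≤-trans (Y.≤-trans (Y.≤-reflexive (a₁ z0 (+ k))) (Y.+-mono-≤ lo (d≥ c))) Y.≤-refl ,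
    Y.≤-<-trans (Y.≤-trans (Y.≤-reflexive (a₂ z d (+ k))) (Y.+-monoʳ-≤ z (Y.+-monoˡ-≤ (+ k) (d≤ c)))) hi
   where
   a₁ : ∀ z k -> z + k == (z + (+ 1 + k)) + -[1+ 0 ]
   a₁ = ring
   a₂ : ∀ z d k -> z + d + k == z + (d + k)
   a₂ = ring
   d≥ : ∀ {d} -> d == + 1 ⊎ d == + 0 ⊎ d == -[1+ 0 ] -> -[1+ 0 ] Z.≤ d
   d≥ (inl refl) = Z.-≤+
   d≥ (inr (inl refl)) = Z.-≤+
   d≥ (inr (inr refl)) = Y.≤-refl
   d≤ : ∀ {d} -> d == + 1 ⊎ d == + 0 ⊎ d == -[1+ 0 ] -> d Z.≤ + 1
   d≤ (inl refl) = Y.≤-refl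
   d≤ (inr (inl refl)) = Z.+≤+ N.z≤n
   d≤ (inr (inr refl)) = Z.-≤+

  stepx : ∀ l -> fst (step l) == + 1 ⊎ fst (step l) == + 0 ⊎ fst (step l) == -[1+ 0 ]
  stepx R = inl refl
  stepx L = inr (inr refl)
  stepx U = inr (inl refl)
  stepx D = inr (inl refl)
  stepy : ∀ l -> snd (step l) == + 1 ⊎ snd (step l) == + 0 ⊎ snd (step l) == -[1+ 0 ]
  stepy U = inl refl
  stepy D = inr (inr refl)
  stepy R = inr (inl refl)
  stepy L = inr (inl refl)

  near-step : ∀ {k q} l -> Near (suc k) q -> Near k (q <> step l)
  near-step {k} {a , b} l (hx , hy) = near-1 a x0 k (fst (step l)) (stepx l) hx , near-1 b y0 k (snd (step l)) (stepy l) hy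

  offset : ∀ z z0 k -> z0 + + k Z.≤ z × z + + k Z.< z0 + + m -> Offset z z0
  offset z z0 k (lo , hi) = Z.∣ z Z.- z0 ∣ , Y.drop‿+<+ (Y.≤-<-trans (Y.≤-reflexive ab) (Y.<-≤-trans {j = (z0 + + m) Z.- z0} (Y.+-monoˡ-< (Z.- z0) (Y.≤-<-trans upˡ hi)) (Y.≤-reflexive (a₂ z0 (+ m))))) ,
    a₁ z z0 ∙ ap (\ t -> z0 + t) (! ab)
   where
   a₁ : ∀ z z0 -> z == z0 + (z Z.- z0)
   a₁ = ring
   a₂ : ∀ z m -> (z + m) Z.- z == m
   a₂ = ring
   upˡ : z Z.≤ z + + k
   upˡ = Y.≤-trans (Y.≤-reflexive (! (+0 z))) (Y.+-monoʳ-≤ z (Z.+≤+ N.z≤n))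
   downˡ : z0 Z.≤ z
   downˡ = Y.≤-trans (Y.≤-trans (Y.≤-reflexive (! (+0 z0))) (Y.+-monoʳ-≤ z0 (Z.+≤+ N.z≤n))) lo
   ab : + Z.∣ z Z.- z0 ∣ == z Z.- z0
   ab = Y.0≤i⇒+∣i∣≡i (Y.i≤j⇒0≤j-i downˡ)

  near-raySum : ∀ {k q} -> Near k q -> φ q == raySum q + φ (x0 , snd q)
  near-raySum {k} {a , b} (hx , hy) = alg (φ (a , b)) (φ (x0 , b)) ∙ ap (Z._+ φ (x0 , b)) (! (raySum-inside (offset a x0 k hx) (offset b y0 k hy)))
   where
   alg : ∀ s t -> s == (s Z.- t) + t
   alg = ring

  flux-near : ∀ {ψ χ : Cell -> ℤ} -> (∀ {k q} -> Near k q -> ψ q == χ q) -> ∀ w q -> Near (# w) q -> flux ψ q w == flux χ q w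
  flux-near h [] q n = refl
  flux-near {ψ} {χ} h (l :: w) q n = ap2 Z._+_ (e l) (flux-near h w (q <> step l) (near-step l n))
   where
   e : ∀ l -> edge ψ q l == edge χ q l
   e R = refl
   e L = refl
   e U = h n
   e D = ap (\ z -> Z.- z) (h (near-step D n))

 flux-box : ∀ p w -> tip p w == p -> Near (# w) p ->
       flux φ p w == sumN m (\ j -> sumN m (\ i -> ρ (cAt j i) * wind p w (cAt j i)))
 flux-box p w cl n = (flux-near near-raySum w p n ∙ flux-+ raySum (\ q -> φ (x0 , snd q)) p w ∙ ap (\ z -> flux raySum p w + z) (flux-row (\ y -> φ (x0 , y)) p w cl) ∙ (+0 _) ∙ flux-sum m (\ j q -> sumN m \ i -> ρ (cAt j i) * ray (cAt j i) q) p w ∙ sumN-cong m (\ j _ -> flux-sum m (\ i q -> ρ (cAt j i) * ray (cAt j i) q) p w ∙ (sumN-cong m \ i _ -> flux-* (ray (cAt j i)) (ρ (cAt j i)) p w)))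

-- If the enclosed cells are weighted by an indicator with total ±1, exactly one of them has weight one.
module Exact {p y w} (s : Smp p (y :: w)) (ρ φ : Cell -> ℤ) (gradient : ∀ q -> φ (q <> step R) == φ q + ρ q) (ρ-cases : ∀ q -> ρ q == + 1 ⊎ ρ q == + 0) where
 open Jordan s

 mass : Cell -> ℤ
 mass c = ρ c * (orien * wind p W c)

 mass-cases : ∀ c -> (mass c == + 1 × ρ c == + 1 × wind p W c != + 0) ⊎ mass c == + 0
 mass-cases c with ρ-cases c | wind-cases c
 ... | inr e | _ = inr (ap (Z._* (orien * wind p W c)) e)
 ... | inl _ | inl e = inr (ap (\ z -> ρ c * (orien * z)) e ∙ ap (ρ c Z.*_) (Y.*-zeroʳ orien) ∙ Y.*-zeroʳ (ρ c))
 ... | inl e | inr e' with orien-sign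
 ... | inl o = inl (ap2 Z._*_ e (ap2 Z._*_ o (e' ∙ o)) , e , \ z -> absurd (! (e' ∙ o) ∙ z))
  where
  absurd : + 1 != + 0
  absurd ()
 ... | inr o = inl (ap2 Z._*_ e (ap2 Z._*_ o (e' ∙ o)) , e , \ z -> absurd (! (e' ∙ o) ∙ z))
  where
  absurd : -[1+ 0 ] != + 0
  absurd ()

 mass-≥0 : ∀ c -> + 0 Z.≤ mass c
 mass-≥0 c with mass-cases c
 ... | inl (e , _) = Y.≤-trans (Z.+≤+ N.z≤n) (Y.≤-reflexive (! e))
 ... | inr e = Y.≤-reflexive (! e)

 mass-one : ∀ c -> ρ c == + 1 -> wind p W c != + 0 -> mass c == + 1
 mass-one c e ne with mass-cases c | wind-cases c
 ... | inl (m , _) | _ = m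
 ... | inr _ | inl z = !! (ne z)
 ... | inr _ | inr z with orien-sign
 ... | inl o = ap2 Z._*_ e (ap2 Z._*_ o (z ∙ o))
 ... | inr o = ap2 Z._*_ e (ap2 Z._*_ o (z ∙ o))

 module _ (n : ℕ) (big : # W ≤ n) where
  private
   x0 y0 : ℤ
   x0 = fst p Z.- + n
   y0 = snd p Z.- + n
   m : ℕ
   m = suc (n N.+ n)
   open Box ρ φ gradient x0 y0 m

   near : Near (# W) p
   near = bounds (fst p) , bounds (snd p)
    where
    bounds : ∀ z -> (z Z.- + n) + + # W Z.≤ z × z + + # W Z.< (z Z.- + n) + + m
    bounds z = Y.≤-trans (Y.+-monoʳ-≤ (z Z.- + n) (Z.+≤+ big)) (Y.≤-reflexive (a₁ z (+ n))) ,
      Y.<-≤-trans (Y.+-monoʳ-< z (Z.+<+ (N.s≤s big))) (Y.≤-reflexive (a₂ z (+ n)))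
     where
     a₁ : ∀ z n -> (z Z.- n) + n == z
     a₁ = ring
     a₂ : ∀ z n -> z + (+ 1 + n) == (z Z.- n) + (+ 1 + (n + n))
     a₂ = ring

  massSum : ℤ
  massSum = sumN m (\ j -> sumN m (\ i -> mass (cAt j i)))

  mass-total : massSum == orien * flux φ p W
  mass-total = sumN-cong m (\ j _ -> sumN-cong m (\ i _ -> alg (ρ (cAt j i)) orien (wind p W (cAt j i))) ∙ ! (sumN-*ʳ m (\ i -> ρ (cAt j i) * wind p W (cAt j i)) orien)) ∙
   ! (sumN-*ʳ m (\ j -> sumN m (\ i -> ρ (cAt j i) * wind p W (cAt j i))) orien) ∙ Y.*-comm (sumN m (\ j -> sumN m (\ i -> ρ (cAt j i) * wind p W (cAt j i)))) orien ∙ ap (orien Z.*_) (! (flux-box p W (Smp.closed s) near))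
   where
   alg : ∀ a o c -> a * (o * c) == (a * c) * o
   alg = ring

  mass-exists : massSum != + 0 -> Σ Cell \ c -> ρ c == + 1 × wind p W c != + 0
  mass-exists ne with sumN-nonzero m (\ j -> sumN m (\ i -> mass (cAt j i))) ne
  ... | j , ne' with sumN-nonzero m (\ i -> mass (cAt j i)) ne'
  ... | i , ne'' with mass-cases (cAt j i)
  ... | inl (_ , h) = cAt j i , h
  ... | inr z = !! (ne'' z)

  In : Cell -> Set
  In c = Σ ℕ \ j -> Σ ℕ \ i -> j < m × i < m × c == cAt j i

  mass-bound : ∀ c -> In c -> mass c Z.≤ massSum
  mass-bound _ (j , i , lj , li , refl) = Y.≤-trans (sumN-term m {\ i -> mass (cAt j i)} (\ i -> mass-≥0 (cAt j i)) i li) (sumN-term m {\ j -> sumN m (\ i -> mass (cAt j i))} (\ j -> sumN-≥0 m \ i -> mass-≥0 (cAt j i)) j lj)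

  mass-pair : ∀ c c' -> c != c' -> In c -> In c' -> mass c + mass c' Z.≤ massSum
  mass-pair _ _ ne (j , i , lj , li , refl) (j' , i' , lj' , li' , refl) with j Q.≟ j'
  ... | yes refl = Y.≤-trans (sumN-terms m {\ i -> mass (cAt j i)} (\ i -> mass-≥0 (cAt j i)) i i' (\ e -> ne (ap (cAt j) e)) li li') (sumN-term m {\ j -> sumN m (\ i -> mass (cAt j i))} (\ j -> sumN-≥0 m \ i -> mass-≥0 (cAt j i)) j lj)
  ... | no ne' = Y.≤-trans (Y.+-mono-≤ (sumN-term m {\ i -> mass (cAt j i)} (\ i -> mass-≥0 (cAt j i)) i li) (sumN-term m {\ i -> mass (cAt j' i)} (\ i -> mass-≥0 (cAt j' i)) i' li'))
   (sumN-terms m {\ j -> sumN m (\ i -> mass (cAt j i))} (\ j -> sumN-≥0 m \ i -> mass-≥0 (cAt j i)) j j' ne' lj lj')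

  in-box : ∀ c -> Z.∣ fst c Z.- fst p ∣ ≤ n -> Z.∣ snd c Z.- snd p ∣ ≤ n -> In c
  in-box (a , b) hx hy with offsets a (fst p) hx | offsets b (snd p) hy
   where
   offsets : ∀ z z1 -> Z.∣ z Z.- z1 ∣ ≤ n -> Σ ℕ \ k -> k < m × z == (z1 Z.- + n) + + k
   offsets z z1 h with z Z.- z1 in e
   ... | + k = n N.+ k , N.s≤s (Q.+-monoʳ-≤ n h) , a₁ z z1 (+ n) ∙ ap (\ t -> (z1 Z.- + n) + (+ n + t)) e
    where
    a₁ : ∀ z y n -> z == (y Z.- n) + (n + (z Z.- y))
    a₁ = ring
   ... | -[1+ k ] = n N.∸ suc k , N.s≤s (≤-tr (Q.m∸n≤m n (suc k)) (Q.m≤m+n n n)) ,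
      a₁ z z1 (+ n) ∙ ap (\ t -> (z1 Z.- + n) + t) (ap (\ t -> + n + t) e ∙ Y.⊖-≥ h)
    where
    a₁ : ∀ z y n -> z == (y Z.- n) + (n + (z Z.- y))
    a₁ = ring
  ... | i , li , refl | j , lj , refl = j , i , lj , li , refl

 private
  size : Cell -> ℕ
  size c = Z.∣ fst c Z.- fst p ∣ N.+ Z.∣ snd c Z.- snd p ∣

  in-size : ∀ n big c -> size c ≤ n -> In n big c
  in-size n big c h = in-box n big c (≤-tr (Q.m≤m+n _ _) h) (≤-tr (Q.m≤n+m _ Z.∣ fst c Z.- fst p ∣) h)

  Sign : ℤ -> Set
  Sign z = z == + 1 ⊎ z == -[1+ 0 ]

  sign-* : ∀ {y z} -> Sign y -> Sign z -> Sign (y * z)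
  sign-* (inl refl) (inl refl) = inl refl
  sign-* (inl refl) (inr refl) = inr refl
  sign-* (inr refl) (inl refl) = inr refl
  sign-* (inr refl) (inr refl) = inl refl

  sign≢0 : ∀ {z} -> Sign z -> z != + 0
  sign≢0 (inl refl) ()
  sign≢0 (inr refl) ()

  sum-sign : ∀ n big -> Sign (flux φ p W) -> Sign (massSum n big)
  sum-sign n big h = tp Sign (! (mass-total n big)) (sign-* orien-sign h)

  too-big : ∀ {z} -> Sign z -> + 2 Z.≤ z -> ⊥
  too-big (inl refl) (Z.+≤+ (N.s≤s ()))
  too-big (inr refl) ()

 abstract
  exists-one : flux φ p W == + 1 ⊎ flux φ p W == -[1+ 0 ] -> Σ Cell \ c -> ρ c == + 1 × wind p W c != + 0
  exists-one h = mass-exists (# W) Q.≤-refl (sign≢0 (sum-sign (# W) Q.≤-refl h))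

  uniq-one : flux φ p W == + 1 ⊎ flux φ p W == -[1+ 0 ] -> ∀ c c' -> ρ c == + 1 -> ρ c' == + 1 -> wind p W c != + 0 -> wind p W c' != + 0 -> c == c'
  uniq-one h c c' e e' w w' with c ≟ᶜ c'
  ... | yes z = z
  ... | no ne = !! (too-big (sum-sign n big h) (Y.≤-trans (Y.≤-reflexive (! (ap2 Z._+_ (mass-one c e w) (mass-one c' e' w'))))
   (mass-pair n big c c' ne (in-size n big c (≤-tr (Q.m≤m+n (size c) (size c')) (Q.m≤n+m (size c N.+ size c') (# W)))) (in-size n big c' (≤-tr (Q.m≤n+m (size c') (size c)) (Q.m≤n+m (size c N.+ size c') (# W)))))))
   where
   n : ℕ
   n = # W N.+ (size c N.+ size c')
   big : # W ≤ n
   big = Q.m≤m+n (# W) (size c N.+ size c')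

  flux-nonzero : ∀ c -> ρ c == + 1 -> wind p W c != + 0 -> flux φ p W != + 0
  flux-nonzero c e w z = Y.<⇒≱ (Z.+<+ (N.s≤s N.z≤n)) (Y.≤-trans (Y.≤-reflexive (! (mass-one c e w)))
   (Y.≤-trans (mass-bound n big c (in-size n big c (Q.m≤n+m (size c) (# W)))) (Y.≤-reflexive (mass-total n big ∙ ap (orien Z.*_) z ∙ Y.*-zeroʳ orien))))
   where
   n : ℕ
   n = # W N.+ size c
   big : # W ≤ n
   big = Q.m≤m+n (# W) (size c)

rcell : Cell -> Ltr -> Cell
rcell q l = lcell q (trght l)

lcell-⊕ : ∀ q t l -> lcell (q <> t) l == lcell q l <> t
lcell-⊕ (a , b) (s , t) l = go l
 where
 alg : ∀ a s -> (a + s) Z.- + 1 == (a Z.- + 1) + s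
 alg = ring
 go : ∀ l -> lcell ((a , b) <> (s , t)) l == lcell (a , b) l <> (s , t)
 go R = refl
 go U = ap2 _,_ (alg a s) refl
 go L = ap2 _,_ (alg a s) (alg b t)
 go D = ap2 _,_ refl (alg b t)

lcell-inv : ∀ q l -> lcell (q <> step l) (inv l) == rcell q l
lcell-inv (a , b) R = ap2 _,_ (alg a) (ap (Z._- + 1) (+0 b))
 where
 alg : ∀ a -> (a + + 1) Z.- + 1 == a
 alg = ring
lcell-inv (a , b) U = ap2 _,_ (+0 a) (alg b)
 where
 alg : ∀ a -> (a + + 1) Z.- + 1 == a
 alg = ring
lcell-inv (a , b) L = ap2 _,_ refl (+0 b)
lcell-inv (a , b) D = ap2 _,_ (ap (Z._- + 1) (+0 a)) refl

rcell-inv : ∀ q l -> rcell (q <> step l) (inv l) == lcell q l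
rcell-inv q l = ! (lcell-inv (q <> step l) (inv l)) ∙ ap2 lcell (step-back q l) (inv-inv l)

Bd : Shape -> Cell -> Ltr -> Set
Bd A q l = A (lcell q l) xor A (rcell q l) == true

edgeAt : Cell -> Ltr -> Edge
edgeAt q R = horiz q
edgeAt q L = horiz (q <> step L)
edgeAt q U = vert q
edgeAt q D = vert (q <> step D)

xor-swap : ∀ a b -> a xor b == true -> b xor a == true
xor-swap true false _ = refl
xor-swap false true _ = refl

Bd-bdary : ∀ A q l -> Bd A q l -> OnBoundary A (edgeAt q l)
Bd-bdary A q R h = xor-swap (A (lcell q R)) _ h
Bd-bdary A q U h = h
Bd-bdary A (a , b) L h = tp (\ z -> A (a + -[1+ 0 ] , z Z.- + 1) xor A (a + -[1+ 0 ] , z) == true) (! (+0 b)) h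
Bd-bdary A (a , b) D h = tp (\ z -> A (z Z.- + 1 , b + -[1+ 0 ]) xor A (z , b + -[1+ 0 ]) == true) (! (+0 a)) (xor-swap (A (lcell (a , b) D)) _ h)

bdary-Bd : ∀ A B e -> OnBoundary A e -> OnBoundary B e -> Σ Cell \ q -> Σ Ltr \ l -> Bd A q l × Bd B q l
bdary-Bd A B (horiz q) h k = q , R , xor-swap (A (side₁ (horiz q))) _ h , xor-swap (B (side₁ (horiz q))) _ k
bdary-Bd A B (vert q) h k = q , U , h , k

split-++ : ∀ (A B u : Word) {l v} -> A ++ B == u ++ (l :: v) -> (Σ Word \ v1 -> A == u ++ (l :: v1) × v == v1 ++ B) ⊎ (Σ Word \ u1 -> u == A ++ u1 × B == u1 ++ (l :: v))
split-++ [] B u e = inr (u , refl , e)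
split-++ (x :: A) B [] refl = inl (A , refl , refl)
split-++ (x :: A) B (y :: u) e with I.∷-injective e
... | refl , e' with split-++ A B u e'
... | inl (v1 , e1 , e2) = inl (v1 , ap (x ::_) e1 , e2)
... | inr (u1 , e1 , e2) = inr (u1 , ap (x ::_) e1 , e2)

rev-split : ∀ u l v -> rev (u ++ (l :: v)) == rev v ++ (inv l :: rev u)
rev-split u l v = rev-++ u (l :: v) ∙ ++-as (rev v) (inv l :: []) (rev u)

module LoopTiling {p : Cell} (a : Ltr) (u : Word) (b : Ltr) (v : Word) (s : Smp p (loop (a :: u) (b :: v))) (P : Shape) (P≡ : ∀ c -> P c == inside p (loop (a :: u) (b :: v)) c) where
 A B : Word
 A = a :: u
 B = b :: v
 α β : Cell
 α = vec A
 β = vec B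

 open Jordan s public

 filled : Bool -> Cell -> Set
 filled t c = P c == t

 wind-filled : ∀ c -> wind p W c != + 0 -> P c == true
 wind-filled c ne with wind-cases c
 ... | inl z = !! (ne z)
 ... | inr z = P≡ c ∙ inside-one p W c (Data.Sum.map (_∙_ z) (_∙_ z) orien-sign)

 wind-empty : ∀ c -> wind p W c == + 0 -> P c == false
 wind-empty c z = P≡ c ∙ inside-zero p W c z

 filled-wind : ∀ c -> P c == true -> wind p W c != + 0
 filled-wind c t z with _∙_ (! t) (wind-empty c z)
 ... | ()

 private
  ±-nonzero : ∀ {z} -> z == + 1 ⊎ z == -[1+ 0 ] -> z != + 0
  ±-nonzero (inl refl) ()
  ±-nonzero (inr refl) ()

  some-inside : Σ Cell \ c -> wind p W c != + 0
  some-inside with resolved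
  ... | inl e = lcell p a , \ z -> ±-nonzero (inl e) (refl ∙ z)
  ... | inr e = rcell p a , \ z -> ±-nonzero {side Z.- + 1} (inr (ap (Z._- + 1) e)) (! (right-side ([] , u ++ B ++ rev A ++ rev B , refl , refl)) ∙ z)

 abstract
  det-nonzero : det α β != + 0
  det-nonzero e = Exact.flux-nonzero s (\ _ -> + 1) fst (\ _ -> refl) (\ _ -> inl refl) (fst some-inside) refl (snd some-inside) (flux-loop fst A B p ∙ flux-abscissa A B p ∙ e)

  class-count : Counted A B
  class-count = counted (ht A N.+ ht B) A B Q.≤-refl det-nonzero

 private
  module C = Counted class-count

  indicator row-poten : Cell -> Cell -> ℤ
  indicator c q = C.ρ (q <> neg c)
  row-poten c q = C.poten (q <> neg c)

  row-gradient : ∀ c q -> row-poten c (q <> step R) == row-poten c q + indicator c q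
  row-gradient c q = ap C.poten (⊕-swap q (step R) (neg c)) ∙ C.gradient (q <> neg c)

  indicator-cases : ∀ c q -> indicator c q == + 1 ⊎ indicator c q == + 0
  indicator-cases c q = Data.Sum.map fst (\ z -> z) (C.cases (q <> neg c))

  class-total : ∀ c -> flux (row-poten c) p W == + 1 ⊎ flux (row-poten c) p W == -[1+ 0 ]
  class-total c = Data.Sum.map (_∙_ e) (_∙_ e) C.sign
   where
   e : flux (row-poten c) p W == C.ε
   e = ! (flux-⊕ C.poten p (neg c) W) ∙ flux-loop C.poten A B (p <> neg c) ∙ C.total (p <> neg c)

 class-exists : ∀ c -> Σ Cell \ w -> InL α β (w <> neg c) × P w == true
 class-exists c = convert' (Exact.exists-one s (indicator c) (row-poten c) (row-gradient c) (indicator-cases c) (class-total c))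
  where
  convert' : (Σ Cell \ w -> indicator c w == + 1 × wind p W w != + 0) -> Σ Cell \ w -> InL α β (w <> neg c) × P w == true
  convert' (w , e , ne) = w , lattice (C.cases (w <> neg c)) , wind-filled w ne
   where
   lattice : (C.ρ (w <> neg c) == + 1 × InL α β (w <> neg c)) ⊎ C.ρ (w <> neg c) == + 0 -> InL α β (w <> neg c)
   lattice (inl (_ , i)) = i
   lattice (inr z) = !! (±-nonzero (inl e) z)

 class-uniq : ∀ c w w' -> InL α β (w <> neg c) -> InL α β (w' <> neg c) -> P w == true -> P w' == true -> w == w'
 class-uniq c w w' i i' t t' = Exact.uniq-one s (indicator c) (row-poten c) (row-gradient c) (indicator-cases c) (class-total c) w w' (C.one (w <> neg c) i) (C.one (w' <> neg c) i') (filled-wind w t) (filled-wind w' t')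

 -- Translates of the two class statements to tiles.
 tile-uniq : ∀ c w w' -> InL α β w -> InL α β w' -> Tile P w c == true -> Tile P w' c == true -> w == w'
 tile-uniq c w w' i i' t t' = ! (neg-neg w) ∙ ap neg (⊕-canˡ c (class-uniq c (c <> neg w) (c <> neg w') (l w i) (l w' i') t t')) ∙ neg-neg w'
  where
  e : ∀ c w -> neg w == (c <> neg w) <> neg c
  e c w = ! (⊕-swap c (neg w) (neg c) ∙ ap (_<> neg w) (⊕-invʳ c) ∙ ⊕-idˡ (neg w))
  l : ∀ w -> InL α β w -> InL α β ((c <> neg w) <> neg c)
  l w i = tp (InL α β) (e c w) (InL-neg i)

 tile-exists : ∀ c -> Σ Cell \ w -> InL α β w × Tile P w c == true
 tile-exists c = cover (class-exists c)
  where
  cover : (Σ Cell \ w -> InL α β (w <> neg c) × P w == true) -> Σ Cell \ w -> InL α β w × Tile P w c == true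
  cover (w , i , t) = neg (w <> neg c) , InL-neg i , ap P e ∙ t
   where
   e : c <> neg (neg (w <> neg c)) == w
   e = ap (c <>_) (neg-neg (w <> neg c)) ∙ ⊕-comm c (w <> neg c) ∙ ⊕-swap w (neg c) c ∙ ⊕-can w c

 tiling : IsLatticeTiling P α β
 tiling = det-nonzero , tile-exists , tile-uniq

 -- Every boundary edge has a partner, translated by ±α or ±β and reversed.
 shiftOf : Fin 4 -> Cell
 shiftOf i0 = β
 shiftOf i1 = neg β
 shiftOf i2 = α
 shiftOf i3 = neg α

 Partn : Cell -> Ltr -> Cell -> Set
 Partn q l t = EOf p W q l × EOf p W ((q <> step l) <> t) (inv l)

 Partn-flip : ∀ {q l t} -> Partn q l t -> Partn ((q <> step l) <> t) (inv l) (neg t)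
 Partn-flip {q} {l} {t} (e , e') = e' , transport2 (! (ap (_<> neg t) (⊕-swap (q <> step l) t (step (inv l))) ∙ (⊕-can _ t) ∙ step-back q l)) (! (inv-inv l)) e
  where
  transport2 : ∀ {q q' l l'} -> q == q' -> l == l' -> EOf p W q l -> EOf p W q' l'
  transport2 refl refl h = h

 partnersA : ∀ {u1 l v1} -> A == u1 ++ (l :: v1) -> tip p (A ++ (B ++ rev v1)) == (tip p u1 <> step l) <> β × Partn (tip p u1) l β
 partnersA {u1} {l} {v1} e = endˡ , (u1 , v1 ++ (B ++ rev A ++ rev B) , ap (_++ (B ++ rev A ++ rev B)) e ∙ (++-as u1 (l :: v1) _) , refl) ,
  (A ++ (B ++ rev v1) , rev u1 ++ rev B , ap (\ z -> A ++ (B ++ (z ++ rev B))) (ap rev e ∙ rev-split u1 l v1) ∙ asc A B (rev v1) (inv l :: rev u1) (rev B) , endˡ)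
  where
  asc : ∀ a b c d e -> a ++ (b ++ ((c ++ d) ++ e)) == (a ++ (b ++ c)) ++ (d ++ e)
  asc a b c d e = solve words
  endˡ : tip p (A ++ (B ++ rev v1)) == (tip p u1 <> step l) <> β
  endˡ = ((tip-++ p A (B ++ rev v1) ∙ tip-++ (tip p A) B (rev v1)) ∙ ap (\ z -> tip z (rev v1)) (tip-vec (tip p A) B ∙ ! (tip-⊕ p β A)) ∙ ap (\ z -> tip z (rev v1)) (ap (tip (p <> β)) e ∙ tip-++ (p <> β) u1 (l :: v1)) ∙ (tip-rev _ v1) ∙ ap (_<> step l) (tip-⊕ p β u1) ∙ ⊕-swap (tip p u1) β (step l))

 partnersB : ∀ {u1 l v1} -> B == u1 ++ (l :: v1) -> tip p (A ++ (B ++ (rev A ++ rev v1))) == (tip p (A ++ u1) <> step l) <> neg α × Partn (tip p (A ++ u1)) l (neg α)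
 partnersB {u1} {l} {v1} e = endˡ , (A ++ u1 , v1 ++ (rev A ++ rev B) , ap (\ z -> A ++ (z ++ (rev A ++ rev B))) e ∙ assoc1 A u1 (l :: v1) (rev A ++ rev B) , refl) ,
  (A ++ (B ++ (rev A ++ rev v1)) , rev u1 , ap (\ z -> A ++ (B ++ (rev A ++ z))) (ap rev e ∙ rev-split u1 l v1) ∙ assoc2 A B (rev A) (rev v1) (inv l :: rev u1) , endˡ)
  where
  assoc1 : ∀ a b c d -> a ++ ((b ++ c) ++ d) == (a ++ b) ++ (c ++ d)
  assoc1 a b c d = solve words
  assoc2 : ∀ a b c d e -> a ++ (b ++ (c ++ (d ++ e))) == (a ++ (b ++ (c ++ d))) ++ e
  assoc2 a b c d e = solve words
  endˡ : tip p (A ++ (B ++ (rev A ++ rev v1))) == (tip p (A ++ u1) <> step l) <> neg α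
  endˡ = (((tip-++ p A _) ∙ (tip-++ (tip p A) B _) ∙ tip-++ (tip (tip p A) B) (rev A) (rev v1)) ∙ ap (\ z -> tip z (rev v1)) (ap (\ z -> tip z (rev A)) (tip-vec (tip p A) B ∙ ! (tip-⊕ p β A)) ∙ tip-rev (p <> β) A ∙ ! (tip-vec p B)) ∙ ap (\ z -> tip z (rev v1)) (ap (tip p) e ∙ tip-++ p u1 (l :: v1)) ∙ (tip-rev _ v1) ∙ ! (⊕-swap (tip p (A ++ u1)) (step l) (neg α) ∙ ap (_<> step l) (ap (_<> neg α) (tip-++ p A u1 ∙ ap (\ z -> tip z u1) (tip-vec p A) ∙ tip-⊕ p α u1) ∙ ⊕-can (tip p u1) α)))

 partner : ∀ {q l} -> EOf p W q l -> Σ (Fin 4) \ i -> Partn q l (shiftOf i)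
 partner {q} {l} (u0 , v0 , e , refl) with split-++ A (B ++ rev A ++ rev B) u0 e
 ... | inl (v1 , e1 , _) = i0 , snd (partnersA e1)
 ... | inr (u1 , refl , e1) with split-++ B (rev A ++ rev B) u1 e1
 ... | inl (v1 , e2 , _) = i3 , snd (partnersB e2)
 ... | inr (u2 , refl , e2) with split-++ (rev A) (rev B) u2 e2
 ... | inl (v1 , e3 , _) = i1 , result
  where
  pair : tip p (A ++ (B ++ rev (rev u2))) == (tip p (rev v1) <> step (inv l)) <> β × Partn (tip p (rev v1)) (inv l) β
  pair = partnersA (! (rr A) ∙ ap rev e3 ∙ rev-split u2 l v1)
  q≡ : tip p (A ++ (B ++ u2)) == (tip p (rev v1) <> step (inv l)) <> β
  q≡ = ap (\ z -> tip p (A ++ (B ++ z))) (! (rr u2)) ∙ fst pair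
  result : Partn (tip p (A ++ (B ++ u2))) l (neg β)
  result = tp (\ z -> Partn (tip p (A ++ (B ++ u2))) z (neg β)) (inv-inv l) (tp (\ z -> Partn z (inv (inv l)) (neg β)) (! q≡) (Partn-flip {_} {_} {β} (snd pair)))
 ... | inr (u3 , refl , e3) = i2 , result
  where
  pair : tip p (A ++ (B ++ (rev A ++ rev (rev u3)))) == (tip p (A ++ rev v0) <> step (inv l)) <> neg α × Partn (tip p (A ++ rev v0)) (inv l) (neg α)
  pair = partnersB (! (rr B) ∙ ap rev e3 ∙ rev-split u3 l v0)
  q≡ : tip p (A ++ (B ++ (rev A ++ u3))) == (tip p (A ++ rev v0) <> step (inv l)) <> neg α
  q≡ = ap (\ z -> tip p (A ++ (B ++ (rev A ++ z)))) (! (rr u3)) ∙ fst pair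
  result : Partn (tip p (A ++ (B ++ (rev A ++ u3)))) l α
  result = tp (\ z -> Partn (tip p (A ++ (B ++ (rev A ++ u3)))) l z) (neg-neg α) (tp (\ z -> Partn (tip p (A ++ (B ++ (rev A ++ u3)))) z (neg (neg α))) (inv-inv l)
   (tp (\ z -> Partn z (inv (inv l)) (neg (neg α))) (! q≡) (Partn-flip {_} {_} {neg α} (snd pair))))

 inner-side : Bool
 inner-side with resolved
 ... | inl _ = true
 ... | inr _ = false

 left-filled : ∀ {q l} -> EOf p W q l -> P (lcell q l) == inner-side
 left-filled e with resolved
 ... | inl r = wind-filled _ \ z -> ±-nonzero (inl r) (! (left-side e) ∙ z)
 ... | inr r = wind-empty _ (left-side e ∙ r)

 right-filled : ∀ {q l} -> EOf p W q l -> P (rcell q l) == not inner-side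
 right-filled e with resolved
 ... | inl r = wind-empty _ (right-side e ∙ ap (Z._- + 1) r)
 ... | inr r = wind-filled _ \ z -> ±-nonzero {side Z.- + 1} (inr (ap (Z._- + 1) r)) (! (right-side e) ∙ z)

 right-partner : ∀ {q l t} -> Partn q l t -> P (rcell q l <> t) == inner-side
 right-partner {q} {l} {t} (_ , e) = ap P (! (lcell-⊕ (q <> step l) t (inv l) ∙ ap (_<> t) (lcell-inv q l))) ∙ left-filled e

 left-partner : ∀ {q l t} -> Partn q l t -> P (lcell q l <> t) == not inner-side
 left-partner {q} {l} {t} (_ , e) = ap P (! (lcell-⊕ (q <> step l) t (trght (inv l)) ∙ ap (_<> t) (rcell-inv q l))) ∙ right-filled e

 -- Of the two cells along a boundary edge one lies in P and the other in the neighbour across the edge.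
 data Along (q : Cell) (l : Ltr) (t : Cell) : Set where
  along : (c o : Cell) -> P c == true -> P (o <> t) == true -> (∀ w -> Bd (Tile P w) q l -> Tile P w c == true ⊎ Tile P w o == true) -> Along q l t

 along-partn : ∀ {q l t} -> Partn q l t -> Along q l t
 along-partn {q} {l} {t} h with inner-side in e
 ... | true = along (lcell q l) (rcell q l) (left-filled (fst h) ∙ e) (right-partner {q} {l} {t} h ∙ e) \ w -> either (Tile P w (lcell q l)) (Tile P w (rcell q l))
  where
  either : ∀ x y -> x xor y == true -> x == true ⊎ y == true
  either true _ _ = inl refl
  either false true _ = inr refl
 ... | false = along (rcell q l) (lcell q l) (right-filled (fst h) ∙ ap not e) (left-partner {q} {l} {t} h ∙ ap not e) \ w -> either (Tile P w (lcell q l)) (Tile P w (rcell q l))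
  where
  either : ∀ x y -> x xor y == true -> y == true ⊎ x == true
  either true _ _ = inr refl
  either false true _ = inl refl

 neg-⊕ : ∀ w t -> neg (w <> neg t) == neg w <> t
 neg-⊕ (x , y) (s , t) = ap2 _,_ (alg x s) (alg y t)
  where
  alg : ∀ x s -> Z.- (x + (Z.- s)) == Z.- x + s
  alg = ring

 xor-not : ∀ x y z -> x == z -> y == not z -> x xor y == true
 xor-not _ _ true refl refl = refl
 xor-not _ _ false refl refl = refl

 tile-cell : ∀ q w l -> (lcell (q <> w) l) ⊖ w == lcell q l
 tile-cell q w l = ap (_<> neg w) (lcell-⊕ q w l) ∙ ⊕-can (lcell q l) w

 tile-cell' : ∀ q w t l -> (lcell (q <> w) l) ⊖ (w <> neg t) == lcell q l <> t
 tile-cell' q w t l = (ap2 _<>_ (lcell-⊕ q w l) (neg-⊕ w t)) ∙ ! (⊕-assoc (lcell q l <> w) (neg w) t) ∙ ap (_<> t) (⊕-can (lcell q l) w)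

 partn-neighb : ∀ {q l t} -> Partn q l t -> ∀ w -> Neighbours (Tile P w) (Tile P (w <> neg t))
 partn-neighb {q} {l} {t} h w = edgeAt (q <> w) l ,
   Bd-bdary (Tile P w) (q <> w) l (xor-not (Tile P w (lcell (q <> w) l)) (Tile P w (rcell (q <> w) l)) inner-side (ap P (tile-cell q w l) ∙ left-filled (fst h)) (ap P (tile-cell q w (trght l)) ∙ right-filled (fst h))) ,
   Bd-bdary (Tile P (w <> neg t)) (q <> w) l (xor-swap (Tile P (w <> neg t) (rcell (q <> w) l)) (Tile P (w <> neg t) (lcell (q <> w) l)) (xor-not (Tile P (w <> neg t) (rcell (q <> w) l)) (Tile P (w <> neg t) (lcell (q <> w) l)) inner-side
    (ap P (tile-cell' q w t (trght l)) ∙ right-partner {q} {l} {t} h) (ap P (tile-cell' q w t l) ∙ left-partner {q} {l} {t} h)))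

 sample : ∀ i -> Σ Cell \ q -> Σ Ltr \ l -> Partn q l (shiftOf i)
 sample i0 = p , a , snd (partnersA {[]} refl)
 sample i1 = (p <> step a) <> β , inv a , Partn-flip {p} {a} {β} (snd (partnersA {[]} refl))
 sample i2 = (q <> step b) <> neg α , inv b , tp (Partn ((q <> step b) <> neg α) (inv b)) (neg-neg α) (Partn-flip {q} {b} {neg α} (snd (partnersB {[]} refl)))
  where
  q : Cell
  q = tip p (A ++ [])
 sample i3 = tip p (A ++ []) , b , snd (partnersB {[]} refl)

 shift-lattice : ∀ i -> InL α β (shiftOf i)
 shift-lattice i0 = InL-snd
 shift-lattice i1 = InL-neg InL-snd
 shift-lattice i2 = InL-fst
 shift-lattice i3 = InL-neg InL-fst

 private
  det-0ˡ : org != α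
  det-0ˡ e = det-nonzero (tp (\ z -> det z β == + 0) e refl)
  det-0ʳ : org != β
  det-0ʳ e = det-nonzero (tp (\ z -> det α z == + 0) e (alg (fst α) (snd α)))
   where
   alg : ∀ a b -> a * + 0 Z.- b * + 0 == + 0
   alg = ring
  α≢β : β != α
  α≢β e = det-nonzero (tp (\ z -> det α z == + 0) (! e) (alg (fst α) (snd α)))
   where
   alg : ∀ a b -> a * b Z.- b * a == + 0
   alg = ring
  α≢-β : β != neg α
  α≢-β e = det-nonzero (tp (\ z -> det α z == + 0) (! e) (alg (fst α) (snd α)))
   where
   alg : ∀ a b -> a * (Z.- b) Z.- b * (Z.- a) == + 0
   alg = ring
  self-neg : ∀ q -> q == neg q -> org == q
  self-neg (x , y) e = ap2 _,_ (zero' x (ap fst e)) (zero' y (ap snd e))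
   where
   zero' : ∀ z -> z == Z.- z -> + 0 == z
   zero' (+ zero) _ = refl
   zero' (+ suc n) ()
   zero' -[1+ n ] ()
  neg-injective : ∀ {x y} -> neg x == neg y -> x == y
  neg-injective {x} {y} e = ! (neg-neg x) ∙ ap neg e ∙ neg-neg y

 shift-inj : ∀ i j -> shiftOf i == shiftOf j -> i == j
 shift-inj i0 i0 e = refl
 shift-inj i0 i1 e = !! (det-0ʳ (self-neg β e))
 shift-inj i0 i2 e = !! (α≢β e)
 shift-inj i0 i3 e = !! (α≢-β e)
 shift-inj i1 i0 e = !! (det-0ʳ (self-neg β (! e)))
 shift-inj i1 i1 e = refl
 shift-inj i1 i2 e = !! (α≢-β (! (neg-neg β) ∙ ap neg e))
 shift-inj i1 i3 e = !! (α≢β (neg-injective e))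
 shift-inj i2 i0 e = !! (α≢β (! e))
 shift-inj i2 i1 e = !! (α≢-β (! (neg-neg β) ∙ ap neg (! e)))
 shift-inj i2 i2 e = refl
 shift-inj i2 i3 e = !! (det-0ˡ (self-neg α e))
 shift-inj i3 i0 e = !! (α≢-β (! e))
 shift-inj i3 i1 e = !! (α≢β (neg-injective (! e)))
 shift-inj i3 i2 e = !! (det-0ˡ (self-neg α (! e)))
 shift-inj i3 i3 e = refl

 shift≢0 : ∀ i -> shiftOf i != org
 shift≢0 i0 e = det-0ʳ (! e)
 shift≢0 i1 e = det-0ʳ (! (! (neg-neg β) ∙ ap neg e))
 shift≢0 i2 e = det-0ˡ (! e)
 shift≢0 i3 e = det-0ˡ (! (! (neg-neg α) ∙ ap neg e))

 bdary-edge : ∀ q l -> Bd P q l -> EOf p W q l ⊎ EOf p W (q <> step l) (inv l)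
 bdary-edge q l h with find-edge q l p W
 ... | inl e = inl e
 ... | inr (inl e) = inr e
 ... | inr (inr z) = !! (equal (same-status) h)
  where
  equal : ∀ {x y} -> x == y -> x xor y != true
  equal {true} refl ()
  equal {false} refl ()
  we : wind p W (lcell q l) == wind p W (rcell q l)
  we = Y.i-j≡0⇒i≡j _ _ (across p W (Smp.closed s) q l ∙ z)
  same-status : P (lcell q l) == P (rcell q l)
  same-status with wind-cases (rcell q l)
  ... | inl e = (wind-empty _ (we ∙ e)) ∙ ! (wind-empty _ e)
  ... | inr e = (wind-filled _ (\ y -> ±-nonzero orien-sign (! e ∙ ! we ∙ y))) ∙ ! (wind-filled _ (\ y -> ±-nonzero orien-sign (! e ∙ y)))

 along-edge : ∀ {q l} -> EOf p W q l -> Σ (Fin 4) \ i -> Along q l (shiftOf i)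
 along-edge e with partner e
 ... | i , h = i , along-partn h

 along-bdary : ∀ q l -> Bd P q l -> Σ (Fin 4) \ i -> Along q l (shiftOf i)
 along-bdary q l h with bdary-edge q l h
 ... | inl e = along-edge e
 ... | inr e with along-edge e
 ... | i , along c o t t' k = i , along c o t t' \ w bd -> k w (xor-swap (Tile P w (rcell (q <> step l) (inv l))) _ (tp (\ z -> Tile P w (rcell (q <> step l) (inv l)) xor Tile P w z == true) (! (lcell-inv q l))
  (tp (\ z -> Tile P w z xor Tile P w (rcell q l) == true) (! (rcell-inv q l)) bd)))

 only-neighb : ∀ w x -> InL α β w -> InL α β x -> x != w -> Neighbours (Tile P w) (Tile P x) -> Σ (Fin 4) \ i -> w <> neg (shiftOf i) == x
 only-neighb w x iw ix ne (e , h , k) with bdary-Bd (Tile P w) (Tile P x) e h k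
 ... | q , l , hb , kb with along-bdary (q <> neg w) l (tp (\ z -> z xor P (rcell (q <> neg w) l) == true) (ap P (! (lcell-⊕ q (neg w) l)))
  (tp (\ z -> P (lcell q l <> neg w) xor z == true) (ap P (! (lcell-⊕ q (neg w) (trght l)))) hb))
 ... | i , along c o t t' choose with choose (x <> neg w) (tp (\ z -> P (lcell (q <> neg w) l ⊖ (x <> neg w)) xor z == true) (ap P (! (moveˡ (trght l)))) (tp (\ z -> z xor P (rcell q l ⊖ x) == true) (ap P (! (moveˡ l))) kb))
  where
  moveˡ : ∀ l -> lcell (q <> neg w) l ⊖ (x <> neg w) == lcell q l ⊖ x
  moveˡ l = (ap2 _<>_ (lcell-⊕ q (neg w) l) (neg-⊕ x w)) ∙ alg (lcell q l) w x
   where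
   alg : ∀ c w x -> (c <> neg w) <> (neg x <> w) == c <> neg x
   alg (a , b) (c , d) (e , f') = ap2 _,_ (alg' a c e) (alg' b d f')
    where
    alg' : ∀ a c e -> (a + (Z.- c)) + ((Z.- e) + c) == a + (Z.- e)
    alg' = ring
 ... | inl tc = !! (ne (! (can x w) ∙ ap (_<> w) (tile-uniq c (x <> neg w) org (InL-⊕ ix (InL-neg iw)) InL-org tc (ap P (⊕-idʳ c) ∙ t)) ∙ ⊕-idˡ w))
  where
  can : ∀ x w -> (x <> neg w) <> w == x
  can x w = ⊕-swap x (neg w) w ∙ ⊕-can x w
 ... | inr to = i , ap (w <>_) (tile-uniq o (neg (shiftOf i)) (x <> neg w) (InL-neg (shift-lattice i)) (InL-⊕ ix (InL-neg iw)) (ap (\ z -> P (o <> z)) (neg-neg (shiftOf i)) ∙ t') to) ∙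
    ⊕-comm w (x <> neg w) ∙ ⊕-swap x (neg w) w ∙ ⊕-can x w

 four-neighb : IsFourNeighbourLatticeTiling P α β
 four-neighb = tiling , \ w iw -> (\ i -> w <> neg (shiftOf i)) , (\ i -> InL-⊕ iw (InL-neg (shift-lattice i)) , (\ e -> shift≢0 i (! (! (neg-neg org) ∙ ap neg (! (⊕-canˡ w (e ∙ ! (⊕-idʳ w)))) ∙ neg-neg (shiftOf i)))) ,
      partn-neighb {_} {_} {shiftOf i} (snd (snd (sample i))) w) , (\ i j e -> shift-inj i j (neg-injective (⊕-canˡ w e))) ,
  \ x ix ne n -> only-neighb w x iw ix ne n

parity-uniq : ∀ a b k l -> ind a + + 2 * k == ind b + + 2 * l -> a == b
parity-uniq true true k l e = refl
parity-uniq false false k l e = refl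
parity-uniq true false k l e = !! (odd (k Z.- l) (alg k l ∙ ap (Z._- + 2 * l) e ∙ alg' l))
 where
 alg : ∀ k l -> + 1 + + 2 * (k Z.- l) == (+ 1 + + 2 * k) Z.- + 2 * l
 alg = ring
 alg' : ∀ l -> (+ 0 + + 2 * l) Z.- + 2 * l == + 0
 alg' = ring
 odd : ∀ k -> + 1 + + 2 * k != + 0
 odd (+ zero) ()
 odd (+ suc n) ()
 odd -[1+ zero ] ()
 odd -[1+ suc n ] ()
parity-uniq false true k l e = ! (parity-uniq true false l k (! e))

inside-wind : ∀ {p w p' w' c} -> wind p w c == wind p' w' c -> inside p w c == inside p' w' c
inside-wind {p} {w} {p'} {w'} {c} e with wind-parity p w c | wind-parity p' w' c
... | k , h | k' , h' = parity-uniq _ _ k k' (! h ∙ e ∙ h')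

inside-rot : ∀ {p} u v -> Smp p (u ++ v) -> ∀ c -> inside p (u ++ v) c == inside (tip p u) (v ++ u) c
inside-rot {p} u v s c = inside-wind {p} {u ++ v} {tip p u} {v ++ u} (wind-rot u v s c)

module TwoTilings {p : Cell} (a0 : Ltr) (u0 : Word) (a₁ : Ltr) (u1 : Word) (a₂ : Ltr) (u2 : Word) (a3 : Ltr) (u3 x4 x5 x6 x7 : Word)
 (e1 : x5 ++ x6 == rev ((a₁ :: u1) ++ (a₂ :: u2))) (e0 : x4 ++ x5 == rev ((a0 :: u0) ++ (a₁ :: u1))) (e2 : x6 ++ x7 == rev ((a₂ :: u2) ++ (a3 :: u3))) (e3 : x7 ++ (a0 :: u0) == rev ((a3 :: u3) ++ x4))
 (s : Smp p (loop ((a0 :: u0) ++ (a₁ :: u1)) ((a₂ :: u2) ++ (a3 :: u3)))) (P : Shape) (P≡ : ∀ c -> P c == inside p (loop ((a0 :: u0) ++ (a₁ :: u1)) ((a₂ :: u2) ++ (a3 :: u3))) c) where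
 private
  x0 x1 x2 x3 Y : Word
  x0 = a0 :: u0
  x1 = a₁ :: u1
  x2 = a₂ :: u2
  x3 = a3 :: u3
  Y = x1 ++ (x2 ++ (x3 ++ (x4 ++ (x5 ++ (x6 ++ x7)))))

  first-≡ : loop (x0 ++ x1) (x2 ++ x3) == x0 ++ Y
  first-≡ = ap2 (\ y z -> (x0 ++ x1) ++ ((x2 ++ x3) ++ (y ++ z))) (! e0) (! e2) ∙ alg x0 x1 x2 x3 x4 x5 x6 x7
   where
   alg : ∀ a b c d e f' g h -> (a ++ b) ++ ((c ++ d) ++ ((e ++ f') ++ (g ++ h))) == a ++ (b ++ (c ++ (d ++ (e ++ (f' ++ (g ++ h))))))
   alg a b c d e f' g h = solve words

  second-≡ : loop (x1 ++ x2) (x3 ++ x4) == Y ++ x0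
  second-≡ = ap2 (\ y z -> (x1 ++ x2) ++ ((x3 ++ x4) ++ (y ++ z))) (! e1) (! e3) ∙ alg x1 x2 x3 x4 x5 x6 x7 x0
   where
   alg : ∀ a b c d e f' g h -> (a ++ b) ++ ((c ++ d) ++ ((e ++ f') ++ (g ++ h))) == (a ++ (b ++ (c ++ (d ++ (e ++ (f' ++ g)))))) ++ h
   alg a b c d e f' g h = solve words

  p' : Cell
  p' = tip p x0

  s' : Smp p' (loop (x1 ++ x2) (x3 ++ x4))
  s' = tp (Smp p') (! second-≡) (Simple-rot x0 Y (tp (Smp p) first-≡ s))

  P≡' : ∀ c -> P c == inside p' (loop (x1 ++ x2) (x3 ++ x4)) c
  P≡' c = P≡ c ∙ ap (\ z -> inside p z c) first-≡ ∙ inside-rot x0 Y (tp (Smp p) first-≡ s) c ∙ ap (\ z -> inside p' z c) (! second-≡)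

  module T1 = LoopTiling a0 (u0 ++ x1) a₂ (u2 ++ x3) s P P≡
  module T2 = LoopTiling a₁ (u1 ++ x2) a3 (u3 ++ x4) s' P P≡'

  common : ∀ {q l t t'} -> T1.Partn q l t -> T2.Partn q l t' -> Σ Cell \ o -> P (o <> t) == true × P (o <> t') == true
  common {q} {l} {t} {t'} h h' = choose (P (lcell q l)) refl
   where
   i₁ : T1.inner-side == P (lcell q l)
   i₁ = ! (T1.left-filled (fst h))
   i₂ : T2.inner-side == P (lcell q l)
   i₂ = ! (T2.left-filled (fst h'))
   choose : ∀ b -> P (lcell q l) == b -> Σ Cell \ o -> P (o <> t) == true × P (o <> t') == true
   choose true e = rcell q l , T1.right-partner {q} {l} {t} h ∙ i₁ ∙ e , T2.right-partner {q} {l} {t'} h' ∙ i₂ ∙ e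
   choose false e = lcell q l , T1.left-partner {q} {l} {t} h ∙ ap not (i₁ ∙ e) , T2.left-partner {q} {l} {t'} h' ∙ ap not (i₂ ∙ e)

  pair0 : T2.Partn p a0 T2.α
  pair0 = tp (\ z -> T2.Partn z a0 T2.α) at-p (transport2 (inv-inv a0) (neg-neg T2.α) (T2.Partn-flip {tip p' (T2.A ++ rev u0)} {inv a0} {neg T2.α} (snd b)))
   where
   transport2 : ∀ {q l l' t t'} -> l == l' -> t == t' -> T2.Partn q l t -> T2.Partn q l' t'
   transport2 refl refl h = h
   B≡ : T2.B == rev u0 ++ (inv a0 :: rev x7)
   B≡ = ! (rr T2.B) ∙ ap rev (! e3) ∙ rev-++ x7 x0 ∙ ++-as (rev u0) (inv a0 :: []) (rev x7)
   b : tip p' (T2.A ++ (T2.B ++ (rev T2.A ++ rev (rev x7)))) == (tip p' (T2.A ++ rev u0) <> step (inv a0)) <> neg T2.α × T2.Partn (tip p' (T2.A ++ rev u0)) (inv a0) (neg T2.α)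
   b = T2.partnersB B≡
   at-p : (tip p' (T2.A ++ rev u0) <> step (inv a0)) <> neg T2.α == p
   at-p = ! (fst b) ∙ ap (\ z -> tip p' (T2.A ++ (T2.B ++ (rev T2.A ++ z)))) (rr x7) ∙ can (! (tip-++ p' (T2.A ++ (T2.B ++ (rev T2.A ++ x7))) x0) ∙
     ap (tip p') entire ∙ Smp.closed s')
    where
    q : Cell
    q = tip p' (T2.A ++ (T2.B ++ (rev T2.A ++ x7)))
    entire : (T2.A ++ (T2.B ++ (rev T2.A ++ x7))) ++ x0 == loop (x1 ++ x2) (x3 ++ x4)
    entire = alg T2.A T2.B (rev T2.A) x7 x0 ∙ ap (\ z -> T2.A ++ (T2.B ++ (rev T2.A ++ z))) e3
     where
     alg : ∀ a b c d e -> (a ++ (b ++ (c ++ d))) ++ e == a ++ (b ++ (c ++ (d ++ e)))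
     alg a b c d e = solve words
    can : tip q x0 == p' -> q == p
    can e = ! (⊕-can q (vec x0)) ∙ ap (_<> neg (vec x0)) (! (tip-vec q x0) ∙ e ∙ tip-vec p x0) ∙ ⊕-can p (vec x0)

  cell0 : Σ Cell \ o -> P (o <> T1.β) == true × P (o <> T2.α) == true
  cell0 = common (snd (T1.partnersA {[]} refl)) pair0

  cell1 : Σ Cell \ o -> P (o <> T1.β) == true × P (o <> T2.β) == true
  cell1 = common (snd (T1.partnersA {x0} refl)) (snd (T2.partnersA {[]} refl))

  different : ¬ SameTiling P T1.α T1.β T2.α T2.β
  different (h , _) = contradict (h (neg T1.β) (InL-neg InL-snd))
   where
   tile-at : ∀ o t -> P (o <> t) == true -> Tile P (neg t) o == true
   tile-at o t e = ap (\ z -> P (o <> z)) (neg-neg t) ∙ e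
   contradict : (Σ Cell \ w -> InL T2.α T2.β w × (∀ c -> Tile P (neg T1.β) c == Tile P w c)) -> ⊥
   contradict (w , i , same) = T2.det-nonzero (ap (\ z -> det z T2.β) (neg-inj (! w≡α ∙ w≡β)) ∙ alg (fst T2.β) (snd T2.β))
    where
    alg : ∀ a b -> a * b Z.- b * a == + 0
    alg = ring
    neg-inj : ∀ {x y} -> neg x == neg y -> x == y
    neg-inj {x} {y} e = ! (neg-neg x) ∙ ap neg e ∙ neg-neg y
    w≡α : w == neg T2.α
    w≡α = T2.tile-uniq (fst cell0) w (neg T2.α) i (InL-neg InL-fst) (! (same (fst cell0)) ∙ tile-at (fst cell0) T1.β (fst (snd cell0))) (tile-at (fst cell0) T2.α (snd (snd cell0)))
    w≡β : w == neg T2.β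
    w≡β = T2.tile-uniq (fst cell1) w (neg T2.β) i (InL-neg InL-snd) (! (same (fst cell1)) ∙ tile-at (fst cell1) T1.β (fst (snd cell1))) (tile-at (fst cell1) T2.β (snd (snd cell1)))

 two-tilings : TwoFourNeighbourTilings P
 two-tilings = T1.α , T1.β , T2.α , T2.β , T1.four-neighb , T2.four-neighb , different

chain-two-tilings : ∀ {A p} -> IsCh A -> Smp p (⟦ oct ⟧ A) -> (P : Shape) -> (∀ c -> P c == inside p (⟦ oct ⟧ A) c) -> TwoFourNeighbourTilings P
chain-two-tilings {A} {p} ch s P P≡ = go (uncons (nonem 0)) (uncons (nonem 1)) (uncons (nonem 2)) (uncons (nonem 3))
 where
 open IsCh ch
 antipode : ∀ n -> A (4 N.+ n) ++ A (5 N.+ n) == rev (A n ++ A (1 N.+ n))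
 antipode n = ! (rr _) ∙ ap rev (! (laced n))
 go : (Σ Ltr \ l -> Σ Word \ v -> A 0 == l :: v) -> (Σ Ltr \ l -> Σ Word \ v -> A 1 == l :: v) -> (Σ Ltr \ l -> Σ Word \ v -> A 2 == l :: v) -> (Σ Ltr \ l -> Σ Word \ v -> A 3 == l :: v) -> TwoFourNeighbourTilings P
 go (a0 , u0 , h0) (a₁ , u1 , h1) (a₂ , u2 , h2) (a3 , u3 , h3) =
   TwoTilings.two-tilings a0 u0 a₁ u1 a₂ u2 a3 u3 (A 4) (A 5) (A 6) (A 7) (antipode 1 ∙ ap2 (\ x y -> rev (x ++ y)) h1 h2) (antipode 0 ∙ ap2 (\ x y -> rev (x ++ y)) h0 h1) (antipode 2 ∙ ap2 (\ x y -> rev (x ++ y)) h2 h3)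
    (ap (A 7 ++_) (! h0 ∙ ! (perio 0)) ∙ antipode 3 ∙ ap (\ x -> rev (x ++ A 4)) h3) (tp (Smp p) word-≡ s) P (\ c -> P≡ c ∙ ap (\ z -> inside p z c) word-≡)
  where
  word-≡ : ⟦ oct ⟧ A == loop ((a0 :: u0) ++ (a₁ :: u1)) ((a₂ :: u2) ++ (a3 :: u3))
  word-≡ = pair-loop ch ∙ ap2 loop (ap2 _++_ h0 h1) (ap2 _++_ h2 h3)

-- A simple closed word is determined by its interior up to rotation and reversal

uniq-count : ∀ q p w -> Unique (verts p w) -> vsum (at q) p w Z.≤ + 1
uniq-count q p [] _ = Z.+≤+ N.z≤n
uniq-count q p (l :: w) (n :: ns) with p ≟ᶜ q
... | no _ = Y.≤-trans (Y.≤-reflexive (0+ _)) (uniq-count q (p <> step l) w ns)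
... | yes refl = Y.≤-reflexive (ap (\ z -> + 1 + z) (none (p <> step l) w n))
 where
 none : ∀ r w -> All (p !=_) (verts r w) -> vsum (at p) r w == + 0
 none r [] _ = refl
 none r (m :: w) (k :: ks) with r ≟ᶜ p
 ... | yes e = !! (k (! e))
 ... | no _ = (0+ _) ∙ none (r <> step m) w ks

Simple-rev : ∀ {p W} -> Smp p W -> Smp p (rev W)
Simple-rev {p} {W} (simple c l d) = simple (ap (\ z -> tip z (rev W)) (! c) ∙ tip-rev p W) (tp (3 N.≤_) (! (len-rev W)) l) (uniq p (rev W) \ q -> Y.≤-trans (Y.≤-reflexive (same-count q)) (uniq-count q p W d))
 where
 same-count : ∀ q -> vsum (at q) p (rev W) == vsum (at q) p W
 same-count q = alg (vsum (at q) p (rev W)) (at q p) ∙ ap (Z._- at q p) (ap (\ z -> vsum (at q) z (rev W) + at q p) (! c) ∙ vsum-rev (at q) p W ∙ ap (\ z -> vsum (at q) p W + at q z) c) ∙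
   ! (alg (vsum (at q) p W) (at q p))
  where
  alg : ∀ x y -> x == (x + y) Z.- y
  alg = ring

inside-rev : ∀ {p W} -> Smp p W -> ∀ c -> inside p (rev W) c == inside p W c
inside-rev {p} {W} s c with wind-parity p (rev W) c | wind-parity p W c
... | k , h | k' , h' = parity-uniq _ _ (k + wind p W c) k' (alg (ind (inside p (rev W) c)) k (wind p W c) ∙ ap (\ z -> z + + 2 * wind p W c) (! h ∙ opposite') ∙ alg' (wind p W c) ∙ h')
 where
 opposite' : wind p (rev W) c == Z.- wind p W c
 opposite' = ap (\ z -> flux (ray c) z (rev W)) (! (Smp.closed s)) ∙ flux-rev (ray c) p W
 alg : ∀ i k w -> i + + 2 * (k + w) == (i + + 2 * k) + + 2 * w
 alg = ring
 alg' : ∀ w -> Z.- w + + 2 * w == w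
 alg' = ring

visited : ∀ {p} q u l v -> All (p !=_) (verts q (u ++ (l :: v))) -> p != tip q u
visited q [] l v (n :: _) = n
visited q (x :: u) l v (_ :: ns) = visited (q <> step x) u l v ns

pos-uniq : ∀ {p W} u1 {l1 v1} u2 {l2 v2} -> Unique (verts p W) -> W == u1 ++ (l1 :: v1) -> W == u2 ++ (l2 :: v2) -> tip p u1 == tip p u2 -> u1 == u2
pos-uniq [] [] d e1 e2 h = refl
pos-uniq {p} [] (x :: u2) (n :: _) refl refl h = !! (visited (p <> step x) u2 _ _ n h)
pos-uniq {p} (x :: u1) [] (n :: _) refl refl h = !! (visited (p <> step x) u1 _ _ n (! h))
pos-uniq (x :: u1) (y :: u2) (_ :: d) refl e2 h with I.∷-injective e2
... | refl , e = ap (x ::_) (pos-uniq u1 u2 d refl e h)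

EdgeOf± : Cell -> Word -> Cell -> Ltr -> Set
EdgeOf± p W q l = EOf p W q l ⊎ EOf p W (q <> step l) (inv l)

trace : ∀ {p X Y} -> Smp p X -> Smp p Y -> (∀ q l -> EOf p X q l -> EdgeOf± p Y q l) -> ∀ u x y -> u != [] -> X == u ++ x -> Y == u ++ y -> x == y
trace sX sY h u [] [] u≢ eX eY = refl
trace {p} sX sY h u [] (b :: y) u≢ eX eY = !! (stuck (uncons u≢))
 where
 stuck : (Σ Ltr \ l -> Σ Word \ v -> u == l :: v) -> ⊥
 stuck (l , v , refl) with pos-uniq [] u (Smp.distinct sY) eY eY (! (ap (tip p) (! (++-id u) ∙ ! eX) ∙ Smp.closed sX))
 ... | ()
trace {p} sX sY h u (c :: x) [] u≢ eX eY = !! (stuck (uncons u≢))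
 where
 stuck : (Σ Ltr \ l -> Σ Word \ v -> u == l :: v) -> ⊥
 stuck (l , v , refl) with pos-uniq [] u (Smp.distinct sX) eX eX (! (ap (tip p) (! (++-id u) ∙ ! eY) ∙ Smp.closed sY))
 ... | ()
trace {p} {X} {Y} sX sY h u (c :: x) (d :: y) u≢ eX eY = go (h (tip p u) c (u , x , eX , refl))
 where
 start≢ : tip p u != p
 start≢ e = stuck (uncons u≢)
  where
  stuck : (Σ Ltr \ l -> Σ Word \ v -> u == l :: v) -> ⊥
  stuck (l , v , refl) with pos-uniq [] u (Smp.distinct sX) eX eX (! e)
  ... | ()
 next-step : c == d -> c :: x == d :: y
 next-step refl = ap (c ::_) (trace sX sY h (u ++ (c :: [])) x y (\ e -> absurd u e) (eX ∙ ! (++-as u (c :: []) x)) (eY ∙ ! (++-as u (c :: []) y)))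
  where
  absurd : ∀ (u : Word) {c} -> u ++ (c :: []) != []
  absurd [] ()
  absurd (x :: u) ()
 go : EdgeOf± p Y (tip p u) c -> c :: x == d :: y
 go (inl (u1 , v1 , e , q)) with pos-uniq u1 u (Smp.distinct sY) e eY q
 ... | refl = next-step (I.∷-injectiveˡ (I.++-cancelˡ u _ _ (! e ∙ eY)))
 go (inr (u1 , [] , e , q)) = !! (start≢ (! (ap (_<> step (inv c)) q ∙ (step-back _ c)) ∙ ! (tip-++ p u1 (inv c :: [])) ∙ ap (tip p) (! e) ∙ Smp.closed sY))
 go (inr (u1 , g' :: v1 , e , q)) with pos-uniq (u1 ++ (inv c :: [])) u (Smp.distinct sY) (e ∙ ! (++-as u1 (inv c :: []) (g' :: v1))) eY (tip-++ p u1 (inv c :: []) ∙ ap (_<> step (inv c)) q ∙ (step-back _ c))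
 ... | refl = !! (back x eX)
  where
  eX' : ∀ x -> X == (u1 ++ (inv c :: [])) ++ (c :: x) -> X == u1 ++ (inv c :: c :: x)
  eX' x e = e ∙ ++-as u1 (inv c :: []) (c :: x)
  two : tip p (u1 ++ (inv c :: c :: [])) == tip p u1
  two = tip-++ p u1 (inv c :: c :: []) ∙ ap (\ z -> (tip p u1 <> step (inv c)) <> step z) (! (inv-inv c)) ∙ step-back (tip p u1) (inv c)
  back : ∀ x -> X == (u1 ++ (inv c :: [])) ++ (c :: x) -> ⊥
  back [] e' with pos-uniq [] u1 {v2 = c :: []} (Smp.distinct sX) (snd (snd (uncons' X))) (eX' [] e') (! (! two ∙ ap (tip p) (! (eX' [] e')) ∙ Smp.closed sX))
   where
   uncons' : ∀ w -> Σ Ltr \ l -> Σ Word \ v -> X == l :: v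
   uncons' w = uncons \ z -> Q.<⇒≱ (N.s≤s N.z≤n) (tp (\ w -> 3 ≤ # w) z (Smp.long sX))
  ... | refl = Q.<⇒≱ (N.s≤s (N.s≤s (N.s≤s N.z≤n))) (tp (\ w -> 3 ≤ # w) e' (Smp.long sX))
  back (k :: x) e' with pos-uniq u1 (u1 ++ (inv c :: c :: [])) (Smp.distinct sX) (eX' (k :: x) e') (eX' (k :: x) e' ∙ ! (++-as u1 (inv c :: c :: []) (k :: x))) (! two)
  ... | z with I.++-identityʳ-unique u1 z
  ... | ()

inside-edge : ∀ {p y w} (s : Smp p (y :: w)) {q l} -> EOf p (y :: w) q l -> Bd (inside p (y :: w)) q l
inside-edge {p} {y} {w} s {q} {l} e = go resolved
 where
 open Jordan s
 go : side == + 1 ⊎ side == + 0 -> inside p W (lcell q l) xor inside p W (rcell q l) == true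
 go (inl r) = ap2 _xor_ (inside-one p W _ (inl (left-side e ∙ r))) (inside-zero p W _ (right-side e ∙ ap (Z._- + 1) r))
 go (inr r) = ap2 _xor_ (inside-zero p W _ (left-side e ∙ r)) (inside-one p W _ (inr (right-side e ∙ ap (Z._- + 1) r)))

edge-inside : ∀ {p W} -> Smp p W -> ∀ q l -> Bd (inside p W) q l -> EdgeOf± p W q l
edge-inside {p} {W} s q l h with find-edge q l p W
... | inl e = inl e
... | inr (inl e) = inr e
... | inr (inr z) = !! (equal (inside-wind' (lcell q l) (rcell q l) (Y.i-j≡0⇒i≡j _ _ (across p W (Smp.closed s) q l ∙ z))) h)
 where
 equal : ∀ {x y} -> x == y -> x xor y != true
 equal {true} refl ()
 equal {false} refl ()
 inside-wind' : ∀ c c' -> wind p W c == wind p W c' -> inside p W c == inside p W c'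
 inside-wind' c c' e with wind-parity p W c | wind-parity p W c'
 ... | k , i | k' , i' = parity-uniq _ _ k k' (! i ∙ e ∙ i')

Rotation : Word -> Word -> Set
Rotation X Y = Σ Word \ u -> Σ Word \ v -> X == u ++ v × Y == v ++ u

bdary-uniq : ∀ {p W q C} -> Smp p W -> Smp q C -> (∀ c -> inside p W c == inside q C c) -> Rotation C W ⊎ Rotation (rev C) W
bdary-uniq {p} {[]} (simple _ () _) sC same
bdary-uniq {p} {a :: w} {q} {C} sW sC same = trace-from (edge-inside sC p a (same-Bd p a (inside-edge sW ([] , w , refl , refl))))
 where
 same-Bd : ∀ r l -> Bd (inside p (a :: w)) r l -> Bd (inside q C) r l
 same-Bd r l h = (ap2 _xor_ (! (same _)) (! (same _))) ∙ h
 finish : ∀ u v X -> Smp q X -> (∀ c -> inside q X c == inside q C c) -> X == u ++ (a :: v) -> tip q u == p -> Rotation X (a :: w)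
 finish u v X sX same' e refl = u , a :: v , e , ap (a ::_) (trace sW sY edges (a :: []) w (v ++ u) (\ ()) refl refl)
  where
  sX' : Smp q (u ++ (a :: v))
  sX' = tp (Smp q) e sX
  sY : Smp p ((a :: v) ++ u)
  sY = Simple-rot u (a :: v) sX'
  edges : ∀ r l -> EOf p (a :: w) r l -> EdgeOf± p ((a :: v) ++ u) r l
  edges r l h = edge-inside sY r l ((ap2 _xor_ (same-inside (lcell r l)) (same-inside (rcell r l))) ∙ inside-edge sW h)
   where
   same-inside : ∀ c -> inside p ((a :: v) ++ u) c == inside p (a :: w) c
   same-inside c = ! (inside-rot u (a :: v) sX' c) ∙ ap (\ z -> inside q z c) (! e) ∙ same' c ∙ ! (same c)
 trace-from : EdgeOf± q C p a -> Rotation C (a :: w) ⊎ Rotation (rev C) (a :: w)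
 trace-from (inl (u , v , e , h)) = inl (finish u v C sC (\ c -> refl) e h)
 trace-from (inr (u , v , e , h)) = inr (finish (rev v) (rev u) (rev C) (Simple-rev sC) (inside-rev sC) (ap rev e ∙ rev-split u (inv a) v ∙ ap (\ z -> rev v ++ (z :: rev u)) (inv-inv a))
  (ap (\ z -> tip z (rev v)) (! (Smp.closed sC) ∙ ap (tip q) e ∙ tip-++ q u (inv a :: v)) ∙
    tip-rev (tip q u <> step (inv a)) v ∙ ap (_<> step (inv a)) h ∙ step-back p a))

c0 : Cell
c0 = (+ 0 , -[1+ 0 ])

fl : Cell -> Word -> ℤ
fl = flux (ray c0)

ray-gradient : ∀ c p -> ray c (p <> step R) == ray c p + pt c p
ray-gradient (x , y) (a , b) = ap2 (\ s t -> s * eq t y) (lt-suc x a) (+0 b) ∙ Y.*-distribʳ-+ (eq b y) (lt x a) (eq a x)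

private
 pt-c0 : ∀ q -> q <> step U != org -> pt c0 q == + 0
 pt-c0 q n = pt-≢ {c0} {q} \ e -> n (ap (_<> step U) (! e) ∙ refl)

Avoids : Cell -> Ltr -> Ltr -> Set
Avoids v x y = v != org × v <> step x != org × v <> step y != org × (v <> step x) <> step y != org

Avoids-sym : ∀ {v x y} -> Avoids v x y -> Avoids v y x
Avoids-sym {v} {x} {y} (a , b , c , d) = a , c , b , \ e -> d (⊕-swap v (step x) (step y) ∙ e)

private
 RU : ∀ v -> Avoids v R U -> fl v (R :: U :: []) == fl v (U :: R :: [])
 RU v (_ , _ , c , _) = ap (\ z -> + 0 + (z + + 0)) (ray-gradient c0 v ∙ ap (\ z -> ray c0 v + z) (pt-c0 v c)) ∙ alg (ray c0 v)
  where
  alg : ∀ a -> + 0 + ((a + + 0) + + 0) == a + (+ 0 + + 0)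
  alg = ring
 RD : ∀ v -> Avoids v R D -> fl v (R :: D :: []) == fl v (D :: R :: [])
 RD v (a , _ , _ , _) = ap (\ z -> + 0 + (Z.- z + + 0)) (ap (ray c0) (⊕-swap v (step R) (step D)) ∙ ray-gradient c0 (v <> step D) ∙ ap (\ z -> ray c0 (v <> step D) + z) (pt-c0 (v <> step D) (\ e -> a (! (step-back v D) ∙ e)))) ∙ alg (ray c0 (v <> step D))
  where
  alg : ∀ a -> + 0 + (Z.- (a + + 0) + + 0) == Z.- a + (+ 0 + + 0)
  alg = ring
 LU : ∀ v -> Avoids v L U -> fl v (L :: U :: []) == fl v (U :: L :: [])
 LU v (_ , _ , _ , d) = alg (ray c0 (v <> step L)) ∙ ap (Z._+ (+ 0 + + 0)) (! (ap (\ z -> ray c0 (v <> step L) + z) (pt-c0 (v <> step L) d)) ∙ ! (ray-gradient c0 (v <> step L)) ∙ ap (ray c0) (step-back v L))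
  where
  alg : ∀ a -> + 0 + (a + + 0) == (a + + 0) + (+ 0 + + 0)
  alg = ring
 LD : ∀ v -> Avoids v L D -> fl v (L :: D :: []) == fl v (D :: L :: [])
 LD v (_ , b , _ , _) = alg (ray c0 ((v <> step L) <> step D)) ∙ ap (\ z -> Z.- z + (+ 0 + + 0)) (! (ap (\ z -> ray c0 ((v <> step L) <> step D) + z) (pt-c0 ((v <> step L) <> step D) (\ e -> b (! (step-back (v <> step L) D) ∙ e)))) ∙
   ! (ray-gradient c0 ((v <> step L) <> step D)) ∙ ap (ray c0) (⊕-swap (v <> step L) (step D) (step R) ∙ ap (_<> step D) (step-back v L)))
  where
  alg : ∀ a -> + 0 + (Z.- a + + 0) == Z.- (a + + 0) + (+ 0 + + 0)
  alg = ring

commute : ∀ v x y -> Avoids v x y -> fl v (x :: y :: []) == fl v (y :: x :: [])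
commute v R R a = refl
commute v L L a = refl
commute v U U a = refl
commute v D D a = refl
commute v R L a = refl
commute v L R a = refl
commute v U D a = ap (\ z -> ray c0 v + (Z.- ray c0 z + + 0)) (step-back v U) ∙ alg (ray c0 v) (ray c0 (v <> step D))
 where
 alg : ∀ a b -> a + (Z.- a + + 0) == Z.- b + (b + + 0)
 alg = ring
commute v D U a = ! (commute v U D (Avoids-sym {v} {D} {U} a))
commute v R U a = RU v a
commute v U R a = ! (RU v (Avoids-sym {v} {U} {R} a))
commute v R D a = RD v a
commute v D R a = ! (RD v (Avoids-sym {v} {D} {R} a))
commute v L U a = LU v a
commute v U L a = ! (LU v (Avoids-sym {v} {U} {L} a))
commute v L D a = LD v a
commute v D L a = ! (LD v (Avoids-sym {v} {D} {L} a))

Pts : (Cell -> Set) -> Cell -> Word -> Set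
Pts Q v [] = Q v
Pts Q v (l :: w) = Q v × Pts Q (v <> step l) w

Pts-start : ∀ {Q v} w -> Pts Q v w -> Q v
Pts-start [] h = h
Pts-start (l :: w) (h , _) = h

Pts-map : ∀ {Q Q' : Cell -> Set} t -> (∀ q -> Q (q <> t) -> Q' q) -> ∀ v w -> Pts Q (v <> t) w -> Pts Q' v w
Pts-map t h v [] k = h v k
Pts-map {Q} t h v (l :: w) (k , ks) = h v k , Pts-map {Q} t h (v <> step l) w (tp (\ z -> Pts Q z w) (⊕-swap v t (step l)) ks)

Pts-zip : ∀ {Q Q' : Cell -> Set} v w -> Pts Q v w -> Pts Q' v w -> Pts (\ q -> Q q × Q' q) v w
Pts-zip v [] h k = h , k
Pts-zip v (l :: w) (h , hs) (k , ks) = (h , k) , Pts-zip (v <> step l) w hs ks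

Pts-prefix : ∀ {Q} v u {w} -> Pts Q v (u ++ w) -> Pts Q v u
Pts-prefix v [] {w} h = Pts-start w h
Pts-prefix v (l :: u) (h , hs) = h , Pts-prefix (v <> step l) u hs

slide : ∀ i v w -> Pts (\ q -> q != org × q <> step i != org) v w -> ∀ r -> fl v (i :: (w ++ r)) == fl v (w ++ (i :: r))
slide i v [] h r = refl
slide i v (m :: w) ((h1 , h2) , hs) r = (flux-++ (ray c0) v (i :: m :: []) (w ++ r) ∙ (ap2 Z._+_ (commute v i m (h1 , h2 , fst h3 , \ e -> snd h3 (⊕-swap v (step m) (step i) ∙ e))) (ap (\ z -> fl z (w ++ r)) (⊕-swap v (step i) (step m)))) ∙ ! (flux-++ (ray c0) v (m :: i :: []) (w ++ r)) ∙ ap (\ z -> edge (ray c0) v m + z) (slide i (v <> step m) w hs r))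
 where
 h3 : (v <> step m) != org × (v <> step m) <> step i != org
 h3 = Pts-start w hs

-- diag traverses the secants between consecutive vertices, back the secants from the last vertex.
diag back : Ltr -> Word -> Word
diag l [] = []
diag l (m :: w) = m :: inv l :: diag m w
back l [] = []
back l (m :: w) = inv l :: back m w

Distinct : Cell -> Word -> Set
Distinct p [] = ⊤
Distinct p (l :: w) = Pts (p !=_) (p <> step l) w × Distinct (p <> step l) w

private
 relative : ∀ p v w -> Pts (p !=_) (v <> p) w -> Pts (_!= org) v w
 relative p v w = Pts-map {p !=_} {_!= org} p (\ q n e -> n (! (ap (_<> p) e ∙ ⊕-idˡ p))) v w

 relative' : ∀ p l v w -> Pts (p <> step l !=_) (v <> p) w -> Pts (\ q -> q <> step (inv l) != org) v w
 relative' p l v w = Pts-map {p <> step l !=_} {\ q -> q <> step (inv l) != org} p (\ q n e -> n (⊕-comm p (step l) ∙ ap (_<> p)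
  (! (⊕-idˡ (step l)) ∙ ap (_<> step l) (! e) ∙ ap (\ z -> (q <> step (inv l)) <> step z) (! (inv-inv l)) ∙ step-back q (inv l)))) v w

 turned-start : ∀ l m -> (step l <> step m) <> step (inv l) == step m
 turned-start l m = ap (_<> step (inv l)) (⊕-comm (step l) (step m)) ∙ step-back (step m) l

 past : ∀ p l m w -> Pts (p !=_) ((p <> step l) <> step m) w -> Pts (p <> step l !=_) ((p <> step l) <> step m) w ->
     Pts (\ q -> q != org × q <> step (inv l) != org) (step l <> step m) w
 past p l m w h k = Pts-zip (step l <> step m) w (relative p (step l <> step m) w (tp (\ z -> Pts (p !=_) z w) e h)) (relative' p l (step l <> step m) w (tp (\ z -> Pts (p <> step l !=_) z w) e k))
  where
  e : (p <> step l) <> step m == (step l <> step m) <> p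
  e = ⊕-assoc p (step l) (step m) ∙ ⊕-comm p (step l <> step m)

secants : ∀ p l w -> Distinct p (l :: w) -> fl (step l) (diag l w) == fl (step l) (w ++ back l w)
secants p l [] d = refl
secants p l (m :: w) ((_ , h) , d) = (flux-++ (ray c0) (step l) (m :: inv l :: []) (diag m w) ∙ ap (\ z -> fl (step l) (m :: inv l :: []) + z) (ap (\ z -> fl z (diag m w)) (turned-start l m) ∙ secants (p <> step l) m w d ∙ ap (\ z -> fl z (w ++ back m w)) (! (turned-start l m))) ∙ ! (flux-++ (ray c0) (step l) (m :: inv l :: []) (w ++ back m w)) ∙ ap (\ z -> edge (ray c0) (step l) m + z) (slide (inv l) (step l <> step m) w (past p l m w h (fst d)) (back m w)))

angle : Ltr -> ℤ
angle l = + code l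

turn : Ltr -> Ltr -> ℤ
turn x y = + 2 Z.- + θ x y

turnSum : Ltr -> Word -> ℤ
turnSum x [] = + 0
turnSum x (y :: w) = turn x y + turnSum y w

turn-flux : ∀ x y -> y != inv x -> turn x y == + 4 * fl (step x) (y :: inv x :: []) + (angle y Z.- angle x)
turn-flux R R _ = refl
turn-flux R U _ = refl
turn-flux R D _ = refl
turn-flux R L n = !! (n refl)
turn-flux U U _ = refl
turn-flux U L _ = refl
turn-flux U R _ = refl
turn-flux U D n = !! (n refl)
turn-flux L L _ = refl
turn-flux L D _ = refl
turn-flux L U _ = refl
turn-flux L R n = !! (n refl)
turn-flux D D _ = refl
turn-flux D R _ = refl
turn-flux D L _ = refl
turn-flux D U n = !! (n refl)

turnSum-flux : ∀ p l w -> Distinct p (l :: w) -> turnSum l w == + 4 * fl (step l) (diag l w) + (angle (lst l w) Z.- angle l)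
turnSum-flux p l [] d = ! ((0+ _) ∙ Y.+-inverseʳ (angle l))
turnSum-flux p l (m :: w) ((_ , h) , d) = ((ap2 Z._+_ (turn-flux l m \ e -> Pts-start w h (! (ap (\ z -> (p <> step l) <> step z) e ∙ step-back p l))) (turnSum-flux (p <> step l) m w d)) ∙ alg F1 F2 (angle l) (angle m) (angle (lst m w)) ∙ ap (\ z -> + 4 * z + (angle (lst m w) Z.- angle l)) (ap (\ z -> F1 + fl z (diag m w)) (! (turned-start l m)) ∙ ! (flux-++ (ray c0) (step l) (m :: inv l :: []) (diag m w))))
 where
 F1 F2 : ℤ
 F1 = fl (step l) (m :: inv l :: [])
 F2 = fl (step m) (diag m w)
 alg : ∀ a b l m e -> (+ 4 * a + (m Z.- l)) + (+ 4 * b + (e Z.- m)) == + 4 * (a + b) + (e Z.- l)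
 alg = ring

-- Paths in the upper half-plane, and paths in the lower half-plane leaving it only to the left, miss the ray.
Upper Lower : Cell -> Set
Upper (a , b) = + 0 Z.≤ b
Lower (a , b) = b == + 0 -> a Z.≤ + 0

private
 upper-ray : ∀ q -> Upper q -> ray c0 q == + 0
 upper-ray (a , b) h = ap (lt (+ 0) a Z.*_) (eq-≢ \ e -> neg' b e h) ∙ Y.*-zeroʳ (lt (+ 0) a)
  where
  neg' : ∀ b -> b == -[1+ 0 ] -> + 0 Z.≤ b -> ⊥
  neg' _ refl ()

 upper-flux : ∀ v w -> Pts Upper v w -> fl v w == + 0
 upper-flux v [] h = refl
 upper-flux v (l :: w) (h , hs) = ap2 Z._+_ (e l hs) (upper-flux (v <> step l) w hs)
  where
  e : ∀ l -> Pts Upper (v <> step l) w -> edge (ray c0) v l == + 0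
  e R _ = refl
  e L _ = refl
  e U _ = upper-ray v h
  e D hs = ap (\ z -> Z.- z) (upper-ray (v <> step D) (Pts-start w hs))

 lower-ray : ∀ q -> Lower (q <> step U) -> ray c0 q == + 0
 lower-ray (a , b) h with b Y.≟ -[1+ 0 ]
 ... | no n = Y.*-zeroʳ (lt (+ 0) a)
 ... | yes refl = ap (Z._* + 1) (lt-no {+ 0} {a} (Y.≤-trans (Y.≤-reflexive (! (+0 a))) (h refl)))

 lower-flux : ∀ v w -> Pts Lower v w -> fl v w == + 0
 lower-flux v [] h = refl
 lower-flux v (l :: w) (h , hs) = ap2 Z._+_ (e l hs) (lower-flux (v <> step l) w hs)
  where
  e : ∀ l -> Pts Lower (v <> step l) w -> edge (ray c0) v l == + 0
  e R _ = refl
  e L _ = refl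
  e U hs = lower-ray v (Pts-start w hs)
  e D _ = ap (\ z -> Z.- z) (lower-ray (v <> step D) (tp Lower (! (step-back v D)) h))

 reflected-path : ∀ v w -> Pts (\ q -> Upper q × (snd q == + 0 -> + 0 Z.≤ fst q)) v w -> Pts Lower (neg v) (map inv w)
 reflected-path v [] h = flip' v h
  where
  flip' : ∀ v -> Upper v × (snd v == + 0 -> + 0 Z.≤ fst v) -> Lower (neg v)
  flip' (a , b) (_ , k) e = Y.neg-mono-≤ (k (! (Y.neg-involutive b) ∙ ap (\ z -> Z.- z) e))
 reflected-path v (l :: w) (h , hs) = flip' v h , tp (\ z -> Pts Lower z (map inv w)) (neg-⊕' v (step l) ∙ ap (neg v <>_) (! (step-inv l))) (reflected-path (v <> step l) w hs)
  where
  flip' : ∀ v -> Upper v × (snd v == + 0 -> + 0 Z.≤ fst v) -> Lower (neg v)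
  flip' (a , b) (_ , k) e = Y.neg-mono-≤ (k (! (Y.neg-involutive b) ∙ ap (\ z -> Z.- z) e))
  neg-⊕' : ∀ v t -> neg (v <> t) == neg v <> neg t
  neg-⊕' (a , b) (c , d) = ap2 _,_ (Y.neg-distrib-+ a c) (Y.neg-distrib-+ b d)

 back-snoc : ∀ m u z -> back m (u ++ (z :: [])) == map inv (m :: u)
 back-snoc m [] z = refl
 back-snoc m (x :: u) z = ap (inv m ::_) (back-snoc x u z)

Above : Cell -> Cell -> Set
Above p q = snd p Z.≤ snd q × (snd q == snd p -> fst p Z.≤ fst q)

-- The start is the leftmost of the lowest vertices, so that the boundary leaves it to the right and arrives from above.
turning : ∀ {p m u} -> Pts (Above p) (p <> step R) (m :: u) -> Distinct p (R :: m :: u) -> Distinct (p <> step R) (m :: (u ++ (D :: []))) ->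
     tip p (R :: m :: (u ++ (D :: []))) == p -> turnSum R (m :: (u ++ (D :: []))) + turn D R == + 4
turning {p} {m} {u} ab d0 d1 cl = (ap (Z._+ turn D R) (ap2 Z._+_ (turn-flux R m \ e -> Pts-start u (snd (fst d0)) (! (ap (\ z -> (p <> step R) <> step z) e ∙ step-back p R))) (turnSum-flux (p <> step R) m w d1)) ∙ ap (\ z -> ((+ 4 * F1 + (angle m Z.- + 0)) + (+ 4 * F2 + (angle z Z.- angle m))) + + 1) (lst-++ m u (D :: [])) ∙ alg F1 F2 (angle m) ∙ ap (\ z -> + 4 * z + + 4) total)
 where
 w : Word
 w = u ++ (D :: [])
 F1 F2 : ℤ
 F1 = fl (step R) (m :: L :: [])
 F2 = fl (step m) (diag m w)
 alg : ∀ a b m -> ((+ 4 * a + (m Z.- + 0)) + (+ 4 * b + (+ 3 Z.- m))) + + 1 == + 4 * (a + b) + + 4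
 alg = ring
 rel-points : Pts (\ q -> Upper q × (snd q == + 0 -> + 0 Z.≤ fst q)) (step R) (m :: u)
 rel-points = Pts-map {Above p} p convert' (step R) (m :: u) (tp (\ z -> Pts (Above p) z (m :: u)) (⊕-comm p (step R)) ab)
  where
  strip : ∀ a b -> a Z.≤ b + a -> + 0 Z.≤ b
  strip a b h = Y.≤-trans (Y.≤-reflexive (! (Y.+-inverseʳ a))) (Y.≤-trans (Y.+-monoˡ-≤ (Z.- a) h) (Y.≤-reflexive (alg' b a)))
   where
   alg' : ∀ b a -> (b + a) Z.- a == b
   alg' = ring
  convert' : ∀ q -> Above p (q <> p) -> Upper q × (snd q == + 0 -> + 0 Z.≤ fst q)
  convert' (a , b) (h , k) = strip (snd p) b h , \ e -> strip (fst p) a (k (ap (Z._+ snd p) e ∙ (0+ _)))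
 end1 : tip (step R) (m :: u) == step U
 end1 = (! (⊕-can (tip (step R) (m :: u)) p) ∙ ap (_<> neg p) (! (tip-⊕ (step R) p (m :: u)) ∙ ap (\ z -> tip z (m :: u)) (⊕-comm (step R) p)) ∙ ap (_<> neg p) (! (step-back (tip (p <> step R) (m :: u)) D) ∙ ap (_<> step U) (! (tip-++ (p <> step R) (m :: u) (D :: [])) ∙ cl)) ∙ ap (_<> neg p) (⊕-comm p (step U)) ∙ ⊕-can (step U) p)
 total : F1 + F2 == + 0
 total = (ap (\ z -> F1 + z) (secants (p <> step R) m w d1 ∙ ap (\ z -> fl z (w ++ back m w)) (! (turned-start R m))) ∙ ! (flux-++ (ray c0) (step R) (m :: L :: []) (w ++ back m w)) ∙ ap (\ z -> fl (step R) (m :: L :: z)) (++-as u (D :: []) (back m w) ∙ ap (\ z -> u ++ (D :: z)) (back-snoc m u D)) ∙ ap (\ z -> edge (ray c0) (step R) m + z) (slide L (step R <> step m) u (past p R m u (snd (fst d0)) (Pts-prefix {p <> step R !=_} _ u (fst d1))) (D :: map inv (m :: u))) ∙ (flux-++ (ray c0) (step R) (m :: u) _) ∙ (ap2 Z._+_ (upper-flux (step R) (m :: u) (weaken (step R) (m :: u) rel-points)) (ap (\ z -> fl z (L :: D :: map inv (m :: u))) end1)) ∙ ap (\ z -> + 0 + (+ 0 + (+ 0 + z))) (lower-flux (neg (step R)) (map inv (m :: u)) (reflected-path (step R) (m :: u) rel-points)))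
  where
  weaken : ∀ v w -> Pts (\ q -> Upper q × (snd q == + 0 -> + 0 Z.≤ fst q)) v w -> Pts Upper v w
  weaken v [] h = fst h
  weaken v (l :: w) (h , hs) = fst h , weaken (v <> step l) w hs

-- Boundaries traversed anticlockwise, from the leftmost of their lowest vertices

record Orntd (P : Shape) (p : Cell) (W : Word) : Set where
 field
  bdary  : Smp p W
  fills     : ∀ c -> P c == inside p W c
  left-in   : ∀ {q l} -> EOf p W q l -> P (lcell q l) == true
  right-out : ∀ {q l} -> EOf p W q l -> P (rcell q l) == false

EOf-rot : ∀ {p} u v {q l} -> tip p (u ++ v) == p -> EOf (tip p u) (v ++ u) q l -> EOf p (u ++ v) q l
EOf-rot {p} u v cl (u0 , v0 , e , refl) with split-++ v u u0 e
... | inl (v1 , e1 , _) = u ++ u0 , v1 , ap (u ++_) e1 ∙ ! (++-as u u0 _) , tip-++ p u u0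
... | inr (u1 , refl , e1) = u1 , v0 ++ v , ap (_++ v) e1 ∙ (++-as u1 _ v) ,
   ! (tip-++ (tip p u) v u1 ∙ ap (\ z -> tip z u1) (! (tip-++ p u v) ∙ cl))

EOf-reverse : ∀ {p W q l} -> EOf (tip p W) (rev W) q l -> EOf p W (q <> step l) (inv l)
EOf-reverse {p} {W} {q} {l} (u , v , e , refl) = rev v , rev u , ! (rr W) ∙ ap rev e ∙ rev-split u l v ,
 ap (\ z -> tip z (rev v)) (! (tip-rev p W) ∙ ap (tip (tip p W)) e ∙ tip-++ (tip p W) u (l :: v)) ∙ tip-rev (tip (tip p W) u <> step l) v

EOf-rev : ∀ {p W q l} -> tip p W == p -> EOf p (rev W) q l -> EOf p W (q <> step l) (inv l)
EOf-rev {p} {W} {q} {l} cl e = EOf-reverse (tp (\ z -> EOf z (rev W) q l) (! cl) e)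

Orntd-rot : ∀ {P p} u v -> Orntd P p (u ++ v) -> Orntd P (tip p u) (v ++ u)
Orntd-rot {P} {p} u v o = record { bdary = Simple-rot u v bdary ; fills = \ c -> fills c ∙ inside-rot u v bdary c
 ; left-in = \ e -> left-in (EOf-rot u v (Smp.closed bdary) e) ; right-out = \ e -> right-out (EOf-rot u v (Smp.closed bdary) e) }
 where open Orntd o

orient : ∀ {P p W} -> Smp p W -> (∀ c -> P c == inside p W c) -> Σ Word \ W' -> Orntd P p W'
orient {W = []} (simple _ () _) h
orient {P} {p} {y :: w} s h = choose resolved
 where
 open Jordan s
 choose : side == + 1 ⊎ side == + 0 -> Σ Word \ W' -> Orntd P p W'
 choose (inl r) = W , record { bdary = s ; fills = h ; left-in = \ e -> (h _) ∙ (inside-one p W _ (inl (left-side e ∙ r))) ; right-out = \ e -> (h _) ∙ (inside-zero p W _ (right-side e ∙ ap (Z._- + 1) r)) }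
 choose (inr r) = rev W , record { bdary = Simple-rev s ; fills = \ c -> h c ∙ ! (inside-rev s c)
  ; left-in = \ {q} {l} e -> ap P (! (rcell-inv q l)) ∙ (h _) ∙ (inside-one p W _ (inr (right-side (EOf-rev (Smp.closed s) e) ∙ ap (Z._- + 1) r)))
  ; right-out = \ {q} {l} e -> ap P (! (lcell-inv q l)) ∙ (h _) ∙ (inside-zero p W _ (left-side (EOf-rev (Smp.closed s) e) ∙ r)) }

Above-refl : ∀ p -> Above p p
Above-refl p = Y.≤-refl , \ _ -> Y.≤-refl

Above-trans : ∀ {p q r} -> Above p q -> Above q r -> Above p r
Above-trans (h , k) (h' , k') = Y.≤-trans h h' , \ e -> let e' = Y.≤-antisym (Y.≤-trans h' (Y.≤-reflexive e)) h in Y.≤-trans (k e') (k' (e ∙ ! e'))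

Above-total : ∀ p q -> Above p q ⊎ Above q p
Above-total (a , b) (c , d) with Y.<-cmp b d
... | tri< l n _ = inl (Y.<⇒≤ l , \ e -> !! (n (! e)))
... | tri> _ n l = inr (Y.<⇒≤ l , \ e -> !! (n e))
... | tri≈ _ refl _ with Y.≤-total a c
... | inl l = inl (Y.≤-refl , \ _ -> l)
... | inr l = inr (Y.≤-refl , \ _ -> l)

lowest : ∀ p y w -> Σ Word \ u -> Σ Word \ v -> (y :: w == u ++ v) × v != [] × All (Above (tip p u)) (verts p (y :: w))
lowest p y [] = [] , y :: [] , refl , (\ ()) , Above-refl p :: []
lowest p y (z :: w) with lowest (p <> step y) z w
... | u , v , e , v≢ , h with Above-total p (tip (p <> step y) u)
... | inl k = [] , y :: z :: w , refl , (\ ()) , Above-refl p :: All.map (\ {r} -> Above-trans {p} {tip (p <> step y) u} {r} k) h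
... | inr k = y :: u , v , ap (y ::_) e , v≢ , k :: h

Pts-verts : ∀ {Q} v w z -> All Q (verts v (w ++ (z :: []))) -> Pts Q v w
Pts-verts v [] z (h :: _) = h
Pts-verts v (l :: w) z (h :: hs) = h , Pts-verts (v <> step l) w z hs

Pts-closed : ∀ {Q} v w -> All Q (verts v w) -> Q (tip v w) -> Pts Q v w
Pts-closed v [] _ h = h
Pts-closed v (l :: w) (h :: hs) k = h , Pts-closed (v <> step l) w hs k

Pts-end : ∀ {Q} v w -> Pts Q v w -> Q (tip v w)
Pts-end v [] h = h
Pts-end v (l :: w) (_ , hs) = Pts-end (v <> step l) w hs

Distinct-verts : ∀ v w z -> Unique (verts v (w ++ (z :: []))) -> Distinct v w
Distinct-verts v [] z _ = tt
Distinct-verts v (l :: w) z (n :: ns) = Pts-verts (v <> step l) w z n , Distinct-verts (v <> step l) w z ns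

low-flux : ∀ c v w -> Pts (\ q -> snd c Z.< snd q) v w -> flux (ray c) v w == + 0
low-flux c v [] h = refl
low-flux c v (l :: w) (h , hs) = ap2 Z._+_ (e l hs) (low-flux c (v <> step l) w hs)
 where
 low-ray : ∀ q -> snd c Z.< snd q -> ray c q == + 0
 low-ray q h = ap (lt (fst c) (fst q) Z.*_) (eq-≢ \ e -> Y.<-irrefl (! e) h) ∙ Y.*-zeroʳ (lt (fst c) (fst q))
 e : ∀ l -> Pts (\ q -> snd c Z.< snd q) (v <> step l) w -> edge (ray c) v l == + 0
 e R _ = refl
 e L _ = refl
 e U _ = low-ray v h
 e D hs = ap (\ z -> Z.- z) (low-ray (v <> step D) (Pts-start w hs))

cyclicTurns : Ltr -> Word -> ℤ
cyclicTurns y w = turnSum (lst y w) (y :: w)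

turnSum-++ : ∀ x u v -> turnSum x (u ++ v) == turnSum x u + turnSum (lst x u) v
turnSum-++ x [] v = ! (0+ (turnSum x v))
turnSum-++ x (y :: u) v = ap (\ z -> turn x y + z) (turnSum-++ y u v) ∙ ! (Y.+-assoc (turn x y) (turnSum y u) (turnSum (lst y u) v))

cyclicTurns-rot : ∀ y u z v -> cyclicTurns y (u ++ (z :: v)) == cyclicTurns z (v ++ (y :: u))
cyclicTurns-rot y u z v = e y u z v ∙ Y.+-comm (turnSum (lst z v) (y :: u)) (turnSum (lst y u) (z :: v)) ∙ ! (e z v y u)
 where
 e : ∀ y u z v -> cyclicTurns y (u ++ (z :: v)) == turnSum (lst z v) (y :: u) + turnSum (lst y u) (z :: v)
 e y u z v = ap (\ t -> turnSum t (y :: (u ++ (z :: v)))) (lst-++ y u (z :: v)) ∙ turnSum-++ (lst z v) (y :: u) (z :: v)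

module Lowest {P : Shape} {p : Cell} where
 private
  pred-< : ∀ a -> a Z.≤ a + -[1+ 0 ] -> ⊥
  pred-< a h = Y.<⇒≱ (tp (\ z -> a + -[1+ 0 ] Z.< z) (alg a) (next (a + -[1+ 0 ]))) h
   where
   alg : ∀ a -> (a + -[1+ 0 ]) + + 1 == a
   alg = ring
  suc-< : ∀ {a b} -> a + + 1 == b -> b Z.≤ a -> ⊥
  suc-< {a} refl h = Y.<⇒≱ (next a) h

  main : ∀ y m u z -> Orntd P p (y :: m :: (u ++ (z :: []))) -> All (Above p) (verts p (y :: m :: (u ++ (z :: [])))) -> cyclicTurns y (m :: (u ++ (z :: []))) == + 4
  main y m u z o h = go y z o h
   where
   before : ∀ y z -> Orntd P p (y :: m :: (u ++ (z :: []))) -> tip (p <> step y) (m :: u) <> step z == p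
   before y z o = ! (tip-++ (p <> step y) (m :: u) (z :: [])) ∙ Smp.closed (Orntd.bdary o)
   aboveˡ : ∀ y z -> All (Above p) (verts p (y :: m :: (u ++ (z :: [])))) -> Above p (tip (p <> step y) (m :: u))
   aboveˡ y z (_ :: h) = Pts-end (p <> step y) (m :: u) (Pts-verts (p <> step y) (m :: u) z h)
   reversal : ∀ y z -> Orntd P p (y :: m :: (u ++ (z :: []))) -> y != inv z
   reversal y z o e = no-backtrack (Orntd.bdary o) (e ∙ ap inv (! (lst-++ m u (z :: []))))
   go : ∀ y z -> Orntd P p (y :: m :: (u ++ (z :: []))) -> All (Above p) (verts p (y :: m :: (u ++ (z :: [])))) -> cyclicTurns y (m :: (u ++ (z :: []))) == + 4
   go R D o h@(_ :: h') = ap (\ t -> turn t R + turnSum R (m :: (u ++ (D :: [])))) (lst-++ m u (D :: [])) ∙ Y.+-comm (turn D R) (turnSum R (m :: (u ++ (D :: [])))) ∙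
    turning {p} {m} {u} (Pts-verts (p <> step R) (m :: u) D h') (Distinct-verts p (R :: m :: u) D (Smp.distinct (Orntd.bdary o)))
     (Distinct-verts (p <> step R) (m :: (u ++ (D :: []))) R (Smp.distinct (Simple-step (Orntd.bdary o)))) (Smp.closed (Orntd.bdary o))
   go L z o (_ :: h :: _) = !! (pred-< (fst p) (snd h (+0 (snd p))))
   go D z o (_ :: h :: _) = !! (pred-< (snd p) (fst h))
   go R R o h = !! (suc-< (ap fst (before R R o)) (snd (aboveˡ R R h) (! (+0 _) ∙ ap snd (before R R o))))
   go R U o h = !! (suc-< (ap snd (before R U o)) (fst (aboveˡ R U h)))
   go R L o h = !! (reversal R L o refl)
   go U R o h = !! (suc-< (ap fst (before U R o)) (snd (aboveˡ U R h) (! (+0 _) ∙ ap snd (before U R o))))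
   go U U o h = !! (suc-< (ap snd (before U U o)) (fst (aboveˡ U U h)))
   go U D o h = !! (reversal U D o refl)
   go U L o h = !! (contradict (! (Orntd.left-in o (U :: m :: u , [] , refl , refl)) ∙ Orntd.fills o (lcell r L) ∙ inside-zero p W (lcell r L) (low-flux (lcell r L) p W low)))
    where
    W : Word
    W = U :: m :: (u ++ (L :: []))
    r : Cell
    r = tip (p <> step U) (m :: u)
    contradict : true == false -> ⊥
    contradict ()
    level : snd r == snd p
    level = ! (+0 (snd r)) ∙ ap snd (before U L o)
    below : ∀ q -> Above p q -> snd (lcell r L) Z.< snd q
    below q k = Y.<-≤-trans (tp (\ z -> z Z.- + 1 Z.< snd p) (! level) (tp (\ z -> snd p Z.- + 1 Z.< z) (alg (snd p)) (next (snd p Z.- + 1)))) (fst k)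
     where
     alg : ∀ a -> (a Z.- + 1) + + 1 == a
     alg = ring
    low : Pts (\ q -> snd (lcell r L) Z.< snd q) p W
    low = Pts-closed p W (All.map (\ {q} -> below q) h) (tp (\ z -> snd (lcell r L) Z.< snd z) (! (Smp.closed (Orntd.bdary o))) (below p (Above-refl p)))

 cyclic-four : ∀ {y w} -> Orntd P p (y :: w) -> All (Above p) (verts p (y :: w)) -> cyclicTurns y w == + 4
 cyclic-four {y} {[]} o h = !! (Q.<⇒≱ (N.s≤s (N.s≤s N.z≤n)) (Smp.long (Orntd.bdary o)))
 cyclic-four {y} {m :: []} o h = !! (Q.<⇒≱ (N.s≤s (N.s≤s (N.s≤s N.z≤n))) (Smp.long (Orntd.bdary o)))
 cyclic-four {y} {m :: k :: w} o h with snoc k w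
 ... | u , e = ap (\ z -> cyclicTurns y (m :: z)) e ∙ main y m u (lst k w) (tp (\ z -> Orntd P p (y :: m :: z)) e o) (tp (\ z -> All (Above p) (verts p (y :: m :: z))) e h)

tangents : ∀ {P p y w} -> Orntd P p (y :: w) -> cyclicTurns y w == + 4
tangents {P} {p} {y} {w} o with lowest p y w
... | [] , v , e , v≢ , h = Lowest.cyclic-four o h
... | x :: u , [] , e , v≢ , h = !! (v≢ refl)
... | x :: u , z :: v , refl , v≢ , h = cyclicTurns-rot x u z v ∙ Lowest.cyclic-four (Orntd-rot (x :: u) (z :: v) o) moved
 where
 q : Cell
 q = tip p (x :: u)
 parts : All (Above q) (verts p (x :: u) ++ verts q (z :: v))
 parts = tp (All (Above q)) (verts-++ p (x :: u) (z :: v)) h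
 moved : All (Above q) (verts q ((z :: v) ++ (x :: u)))
 moved = tp (All (Above q)) (! (verts-++ q (z :: v) (x :: u) ∙ ap (\ t -> verts q (z :: v) ++ verts t (x :: u)) (! (tip-++ p (x :: u) (z :: v)) ∙ Smp.closed (Orntd.bdary o))))
  (AllP.++⁺ (AllP.++⁻ʳ (verts p (x :: u)) parts) (AllP.++⁻ˡ (verts p (x :: u)) parts))

olap : ∀ (u x : Word) {v y} -> u ++ v == x ++ y -> (Σ Word \ m -> x == u ++ m × v == m ++ y) ⊎ (Σ Word \ m -> m != [] × u == x ++ m × y == m ++ v)
olap [] x e = inl (x , refl , e)
olap (a :: u) [] e = inr (a :: u , (\ ()) , refl , ! e)
olap (a :: u) (b :: x) e with I.∷-injective e
... | refl , e' with olap u x e'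
... | inl (m , e1 , e2) = inl (m , ap (a ::_) e1 , e2)
... | inr (m , n , e1 , e2) = inr (m , n , ap (a ::_) e1 , e2)

nonem-len : ∀ {w : Word} -> w != [] -> 1 ≤ # w
nonem-len {[]} n = !! (n refl)
nonem-len {x :: w} n = N.s≤s N.z≤n

olap≤ : ∀ (u x : Word) {v y} -> u ++ v == x ++ y -> # u ≤ # x -> Σ Word \ m -> x == u ++ m × v == m ++ y
olap≤ u x e le with olap u x e
... | inl h = h
... | inr (m , n , e1 , _) = !! (Q.<⇒≱ (Q.m<m+n (# x) (nonem-len n)) (≤-tr (≤-re (! (ap # e1 ∙ #-++ x))) le))

align : ∀ (u x : Word) {v y} -> u ++ v == x ++ y -> # u == # x -> u == x × v == y
align [] [] e _ = refl , e
align (a :: u) (b :: x) e l with I.∷-injective e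
... | refl , e' with align u x e' (Q.suc-injective l)
... | e1 , e2 = ap (a ::_) e1 , e2

rev-≡ : ∀ {u v} -> rev u == rev v -> u == v
rev-≡ {u} {v} e = ! (rr u) ∙ ap rev e ∙ rr v

Open : Word -> Set
Open w = ∀ u f v -> w == u ++ (f ++ v) -> vec f == org -> f == []

Open-factor : ∀ a w b -> Open (a ++ (w ++ b)) -> Open w
Open-factor a w b o u f v refl = o (a ++ u) f (v ++ b) (e a u f v b)
 where
 e : ∀ a u f v b -> a ++ ((u ++ (f ++ v)) ++ b) == (a ++ u) ++ (f ++ (v ++ b))
 e a u f v b = solve words

Open-rev : ∀ w -> Open (rev w) -> Open w
Open-rev w o u f v refl c = rev-[] f (o (rev v) (rev f) (rev u) (rev-++ u (f ++ v) ∙ ap (_++ rev u) (rev-++ f v) ∙ ++-as (rev v) (rev f) (rev u)) (vec-rev f ∙ ap neg c))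

hd : Word -> Maybe Ltr
hd [] = nothing
hd (x :: w) = just x

hd-++ : ∀ u v -> u != [] -> hd (u ++ v) == hd u
hd-++ [] v n = !! (n refl)
hd-++ (x :: u) v n = refl

win : ℕ -> Frm
win j = j ⁺ :: (1 N.+ j) ⁺ :: (2 N.+ j) ⁺ :: (3 N.+ j) ⁺ :: []

record Redcd (A : Chn) : Set where
 field
  chain : IsCh A
  free  : ∀ j -> Open (⟦ win j ⟧ A)
  heads : ∀ j -> hd (A j) != hd (A (4 N.+ j))

Redcd-resp : ∀ {A B} -> (∀ n -> A n == B n) -> Redcd A -> Redcd B
Redcd-resp e r = record { chain = IsChain-resp e chain ; free = \ j -> tp Open (⟦⟧-cong e (win j)) (free j) ; heads = \ j h -> heads j (ap hd (e j) ∙ h ∙ ap hd (! (e (4 N.+ j)))) }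
 where open Redcd r

Redcd-trl : ∀ m {A} -> Redcd A -> Redcd (trl m A)
Redcd-trl m {A} r = record { chain = IsChain-trl m chain ; free = \ j -> tp Open (ap (\ z -> ⟦ z ⟧ A) (e m j) ∙ ! (⟦⟧-trl A m j (win 0)) ∙ ap (\ z -> ⟦ z ⟧ (trl m A)) (! (e0 j))) (free (m N.+ j))
 ; heads = \ j h -> heads (m N.+ j) (h ∙ ap (\ z -> hd (A z)) (swap4 m j)) }
 where
 open Redcd r
 swap4 : ∀ m j -> m N.+ (4 N.+ j) == 4 N.+ (m N.+ j)
 swap4 m j = ! (Q.+-assoc m 4 j) ∙ ap (N._+ j) (Q.+-comm m 4) ∙ Q.+-assoc 4 m j
 e0 : ∀ k -> win k == sh k (win 0)
 e0 k = ap2 _::_ (ap _⁺ (! (Q.+-identityʳ k))) (ap2 _::_ (ap _⁺ (Q.+-comm 1 k)) (ap2 _::_ (ap _⁺ (Q.+-comm 2 k)) (ap2 _::_ (ap _⁺ (Q.+-comm 3 k)) refl)))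
 e : ∀ m j -> win (m N.+ j) == sh (m N.+ j) (win 0)
 e m j = e0 (m N.+ j)

module ChainFacts {A : Chn} (ch : IsCh A) where
 open IsCh ch public

 bar : ℕ -> Word
 bar i = rev (A (4 N.+ i))

 rel : ∀ i -> A i ++ A (1 N.+ i) == bar (1 N.+ i) ++ bar i
 rel i = laced i ∙ rev-++ (A (4 N.+ i)) (A (5 N.+ i))

 rev-bar : ∀ i -> rev (bar i) == A (4 N.+ i)
 rev-bar i = rr (A (4 N.+ i))

 bar-4 : ∀ i -> bar (4 N.+ i) == rev (A i)
 bar-4 i = ap rev (perio i)

 len : ℕ -> ℕ
 len i = # (A i)

 private
  sums : ∀ i -> len i N.+ len (1 N.+ i) == len (4 N.+ i) N.+ len (5 N.+ i)
  sums i = ! (#-++ (A i)) ∙ ap # (laced i) ∙ len-rev (A (4 N.+ i) ++ A (5 N.+ i)) ∙ #-++ (A (4 N.+ i))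

  double : ∀ m n -> m N.+ m == n N.+ n -> m == n
  double zero zero e = refl
  double (suc m) (suc n) e = ap suc (double m n (Q.suc-injective (! (Q.+-suc m m) ∙ Q.suc-injective e ∙ Q.+-suc n n)))

  solve4 : ∀ a b c d a' b' c' d' -> a N.+ b == a' N.+ b' -> b N.+ c == b' N.+ c' -> c N.+ d == c' N.+ d' -> d N.+ a' == d' N.+ a -> a == a'
  solve4 a b c d a' b' c' d' e1 e2 e3 e4 = double a a' (Q.+-cancelʳ-≡ (b N.+ c N.+ d N.+ b' N.+ c' N.+ d') (a N.+ a) (a' N.+ a') ((l1 a b c d b' c' d' ∙ (ap2 N._+_ (ap2 N._+_ (ap2 N._+_ e1 e3) (! e2)) (! e4)) ∙ l2 a' b c d b' c' d')))
   where
   l1 : ∀ a b c d b' c' d' -> a N.+ a N.+ (b N.+ c N.+ d N.+ b' N.+ c' N.+ d') == (a N.+ b) N.+ (c N.+ d) N.+ (b' N.+ c') N.+ (d' N.+ a)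
   l1 = ringN
   l2 : ∀ a' b c d b' c' d' -> (a' N.+ b') N.+ (c' N.+ d') N.+ (b N.+ c) N.+ (d N.+ a') == a' N.+ a' N.+ (b N.+ c N.+ d N.+ b' N.+ c' N.+ d')
   l2 = ringN

 len-4 : ∀ i -> len (4 N.+ i) == len i
 len-4 i = ! (solve4 (len i) (len (1 N.+ i)) (len (2 N.+ i)) (len (3 N.+ i)) (len (4 N.+ i)) (len (5 N.+ i)) (len (6 N.+ i)) (len (7 N.+ i))
  (sums i) (sums (1 N.+ i)) (sums (2 N.+ i)) (sums (3 N.+ i) ∙ ap (\ z -> len (7 N.+ i) N.+ # z) (perio i)))

 len-bar : ∀ i -> # (bar i) == len i
 len-bar i = len-rev (A (4 N.+ i)) ∙ len-4 i

 -- The centre A (1 + i) conjugates the two products of its neighbours.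
 conjugate : ∀ i -> A (1 N.+ i) ++ (A (2 N.+ i) ++ bar i) == (bar (2 N.+ i) ++ A i) ++ A (1 N.+ i)
 conjugate i = (! (++-as (A (1 N.+ i)) _ _) ∙ ap (_++ bar i) (rel (1 N.+ i)) ∙ (++-as (bar (2 N.+ i)) _ _) ∙ ap (bar (2 N.+ i) ++_) (! (rel i)) ∙ ! (++-as (bar (2 N.+ i)) _ _))

 record Conj (i : ℕ) : Set where
  field
   N     : Word
   N≢    : N != []
   rightN : A (1 N.+ i) ++ N == bar (2 N.+ i) ++ A i
   leftN  : N ++ A (1 N.+ i) == A (2 N.+ i) ++ bar i

 Trim : ℕ -> Set
 Trim i = Σ Word \ t -> A (1 N.+ i) == bar (2 N.+ i) ++ (t ++ bar i)

 private
  long-trim : ∀ i -> len (2 N.+ i) N.+ len i ≤ len (1 N.+ i) -> Trim i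
  long-trim i h with olap≤ (A i) (bar (1 N.+ i)) (rel i) (≤-tr (≤-tr (Q.m≤n+m (len i) (len (2 N.+ i))) h) (≤-re (! (len-bar (1 N.+ i)))))
  ... | z , _ , eC with olap≤ (bar (2 N.+ i)) z (! (rel (1 N.+ i)) ∙ ap (_++ A (2 N.+ i)) eC ∙ ++-as z (bar i) (A (2 N.+ i)))
   (Q.+-cancelʳ-≤ (len i) _ _ (≤-tr (≤-re (ap (N._+ len i) (len-bar (2 N.+ i)))) (≤-tr h (≤-re (ap # eC ∙ #-++ z ∙ ap (# z N.+_) (len-bar i))))))
  ... | t , ez , _ = t , eC ∙ ap (_++ bar i) ez ∙ ++-as (bar (2 N.+ i)) t (bar i)

 trim-len : ∀ i (T : Trim i) -> len (1 N.+ i) == len (2 N.+ i) N.+ (# (fst T) N.+ len i)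
 trim-len i (t , e) = ap # e ∙ #-++ (bar (2 N.+ i)) ∙ (ap2 N._+_ (len-bar (2 N.+ i)) (#-++ t ∙ ap (# t N.+_) (len-bar i)))

 trim-oppo : ∀ i -> Trim i -> Trim (4 N.+ i)
 trim-oppo i T = long-trim (4 N.+ i) (≤-tr (≤-re (ap2 N._+_ (len-4 (2 N.+ i)) (len-4 i))) (≤-tr (Q.+-monoʳ-≤ (len (2 N.+ i)) (Q.m≤n+m (len i) _)) (≤-re (! (trim-len i T) ∙ ! (len-4 (1 N.+ i))))))

 trim-or-conjugator : ∀ i -> Trim i ⊎ Conj i
 trim-or-conjugator i with olap (A (1 N.+ i)) (bar (2 N.+ i) ++ A i) (conjugate i)
 ... | inl ([] , e1 , e2) = inl (long-trim i (≤-re (ap (N._+ len i) (! (len-bar (2 N.+ i))) ∙ ! (#-++ (bar (2 N.+ i))) ∙ ap # e1 ∙ ap # (++-id (A (1 N.+ i))))))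
 ... | inl (x :: m , e1 , e2) = inr (record { N = x :: m ; N≢ = \ () ; rightN = ! e1 ; leftN = ! e2 })
 ... | inr (m , _ , e1 , _) = inl (long-trim i (≤-tr (Q.m≤m+n _ (# m)) (≤-re (! (ap # e1 ∙ #-++ (bar (2 N.+ i) ++ A i) ∙ ap (N._+ # m) (#-++ (bar (2 N.+ i)) ∙ ap (N._+ len i) (len-bar (2 N.+ i))))))))

 trim-lengths : ∀ i (T : Trim i) (T' : Trim (4 N.+ i)) -> # (fst T') == # (fst T)
 trim-lengths i T T' = Q.+-cancelʳ-≡ (len i) _ _ (Q.+-cancelˡ-≡ (len (2 N.+ i)) _ _ ((! (ap2 (\ x y -> x N.+ (# (fst T') N.+ y)) (len-4 (2 N.+ i)) (len-4 i)) ∙ ! (trim-len (4 N.+ i) T') ∙ len-4 (1 N.+ i) ∙ trim-len i T)))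

 module Trimmed (i : ℕ) (T : Trim i) (T' : Trim (4 N.+ i)) where
  t t' : Word
  t = fst T
  t' = fst T'

  bar-centre : bar (1 N.+ i) == A i ++ (rev t' ++ A (2 N.+ i))
  bar-centre = (ap rev (snd T') ∙ (rev-++ (bar (6 N.+ i)) _) ∙ ap (_++ rev (bar (6 N.+ i))) (rev-++ t' (bar (4 N.+ i))) ∙ (++-as (rev (bar (4 N.+ i))) _ _) ∙ ap2 (\ x y -> x ++ (rev t' ++ y)) (rev-bar (4 N.+ i) ∙ perio i) (rev-bar (6 N.+ i) ∙ perio (2 N.+ i)))

  before : A i ++ rev t' == t ++ bar i
  before = ! (I.++-cancelʳ (A (2 N.+ i)) (t ++ bar i) (A i ++ rev t') (I.++-cancelˡ (bar (2 N.+ i)) _ _ ((! (++-as (bar (2 N.+ i)) _ _) ∙ ap (_++ A (2 N.+ i)) (! (snd T)) ∙ rel (1 N.+ i) ∙ ap (bar (2 N.+ i) ++_) (bar-centre ∙ ! (++-as (A i) _ _))))))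

  after : rev t' ++ A (2 N.+ i) == bar (2 N.+ i) ++ t
  after = ! (I.++-cancelʳ (bar i) (bar (2 N.+ i) ++ t) (rev t' ++ A (2 N.+ i)) (I.++-cancelˡ (A i) _ _ ((ap (A i ++_) (++-as (bar (2 N.+ i)) t (bar i) ∙ ! (snd T)) ∙ rel i ∙ ap (_++ bar i) bar-centre ∙ (++-as (A i) _ _)))))

  -- The chain whose f-lift is A, with the trimmed word atˡ index 0.
  private
   table' : ℕ -> Word
   table' 0 = rev t'
   table' 4 = rev t
   table' n = A (1 N.+ i N.+ n)

  trimmed : Chn
  trimmed n = table' (n N.% 8)

  private
   B : Chn
   B = trl (1 N.+ i) A
   atˡ : ∀ n -> A (1 N.+ i N.+ n) == A (1 N.+ n N.+ i)
   atˡ n = ap (\ z -> A (suc z)) (Q.+-comm i n)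
   chB : IsCh B
   chB = IsChain-trl (1 N.+ i) ch
   module B = IsCh chB
   B-7 : B 7 == A i
   B-7 = atˡ 7 ∙ perio i

  trimmed-chain : t != [] -> IsCh trimmed
  trimmed-chain t≢ = record { perio = \ n -> refl ; laced = inter ; nonem = ne }
   where
   t'≢ : t' != []
   t'≢ z = t≢ (empty t (! (trim-lengths i T T') ∙ ap # z))
    where
    empty : ∀ (w : Word) -> # w == 0 -> w == []
    empty [] _ = refl
   ne : ∀ n -> trimmed n != []
   ne n = go (n N.% 8)
    where
    go : ∀ m -> table' m != []
    go 0 z = t'≢ (rev-[] t' z)
    go 4 z = t≢ (rev-[] t z)
    go 1 = nonem _
    go 2 = nonem _
    go 3 = nonem _
    go (suc (suc (suc (suc (suc m))))) = nonem _
   e0 : rev t' ++ B 1 == rev (rev t ++ B 5)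
   e0 = ap (rev t' ++_) (atˡ 1) ∙ after ∙ ! (rev-++ (rev t) (B 5) ∙ (ap2 _++_ (ap rev (atˡ 5)) (rr t)))
   e7 : B 7 ++ rev t' == rev (B 3 ++ rev t)
   e7 = ap (_++ rev t') B-7 ∙ before ∙ ! (rev-++ (B 3) (rev t) ∙ (ap2 _++_ (rr t) (ap rev (atˡ 3))))
   inter : ∀ n -> trimmed n ++ trimmed (1 N.+ n) == rev (trimmed (4 N.+ n) ++ trimmed (5 N.+ n))
   inter 0 = e0
   inter 1 = B.laced 1
   inter 2 = B.laced 2
   inter 3 = ! (rr _) ∙ ap rev (! e7)
   inter 4 = ! (rr _) ∙ ap rev (! e0)
   inter 5 = B.laced 5 ∙ ap rev (ap2 _++_ (B.perio 1) (B.perio 2))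
   inter 6 = B.laced 6 ∙ ap rev (ap2 _++_ (B.perio 2) (B.perio 3))
   inter 7 = e7
   inter (suc (suc (suc (suc (suc (suc (suc (suc n)))))))) = inter n

  trimmed-lift : ∀ n -> lftd fSub trimmed n == B n
  trimmed-lift = agree (\ n -> refl) B.perio lift0 (++-id _) (++-id _) (++-id _) lift4 (++-id _) (++-id _) (++-id _)
   where
   lift0 : rev (B 5) ++ (rev (rev t) ++ (rev (B 3) ++ [])) == B 0
   lift0 = (ap2 _++_ (ap rev (atˡ 5)) (ap2 _++_ (rr t) ((++-id _) ∙ ap rev (atˡ 3)))) ∙ ! (snd T) ∙ ! (atˡ 0)
   lift4 : rev (B 1) ++ (rev (rev t') ++ (rev (B 7) ++ [])) == B 4
   lift4 = (ap2 _++_ (ap rev (atˡ 1) ∙ ! (bar-4 (2 N.+ i))) (ap2 _++_ (rr t') ((++-id _) ∙ ap rev B-7 ∙ ! (bar-4 i)))) ∙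
        ! (snd T') ∙ ! (atˡ 4)

win-mod : ∀ {A} -> Perio A -> ∀ j -> ⟦ win j ⟧ A == ⟦ win (j N.% 8) ⟧ A
win-mod {A} per j = ap2 _++_ (e 0) (ap2 _++_ (e 1) (ap2 _++_ (e 2) (ap2 _++_ (e 3) refl)))
 where
 e : ∀ k -> A (k N.+ j) == A (k N.+ j N.% 8)
 e k = mod8 (Perio-trl k per) j

module Descent {X : Chn} (ch : IsCh X) (φ : ℕ -> Frm) (r : Redcd (lftd φ X)) where
 open IsCh ch

 win-factor : ∀ i is pre j post -> reaches (swaps ch is (im φ (win i))) (pre ++ (win j ++ post)) == true -> Open (⟦ win j ⟧ X)
 win-factor i is pre j post c = Open-factor (⟦ pre ⟧ X) (⟦ win j ⟧ X) (⟦ post ⟧ X) (tp Open (! (⟦image⟧ φ X (win i)) ∙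
  swaps-≡ ch is (im φ (win i)) (pre ++ (win j ++ post)) c ∙ (⟦++⟧ X pre _) ∙ ap (⟦ pre ⟧ X ++_) (⟦++⟧ X (win j) post)) (Redcd.free r i))

 win-factor⁻ : ∀ i pre j post -> reaches (swaps ch [] (im φ (win i))) (pre ++ (oppo (win j) ++ post)) == true -> Open (⟦ win j ⟧ X)
 win-factor⁻ i pre j post c = Open-rev (⟦ win j ⟧ X) (tp Open (⟦opposite⟧ X (win j)) (Open-factor (⟦ pre ⟧ X) (⟦ oppo (win j) ⟧ X) (⟦ post ⟧ X)
  (tp Open (! (⟦image⟧ φ X (win i)) ∙ swaps-≡ ch [] (im φ (win i)) (pre ++ (oppo (win j) ++ post)) c ∙ (⟦++⟧ X pre _) ∙ ap (⟦ pre ⟧ X ++_) (⟦++⟧ X (oppo (win j)) post)) (Redcd.free r i))))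

 head-of : ∀ i is j rest -> reaches (swaps ch is (φ i)) (j ⁺ :: rest) == true -> hd (lftd φ X i) == hd (X j)
 head-of i is j rest c = ap hd (swaps-≡ ch is (φ i) (j ⁺ :: rest) c) ∙ hd-++ (X j) (⟦ rest ⟧ X) (nonem j)

 descend : (∀ j -> Open (⟦ win (j N.% 8) ⟧ X)) -> (∀ j -> hd (X (j N.% 8)) != hd (X (4 N.+ j N.% 8))) -> Redcd X
 descend o h = record { chain = ch ; free = \ j -> tp Open (! (win-mod perio j)) (o j) ; heads = \ j e -> h j (ap hd (! (mod8 perio j)) ∙ e ∙ ap hd (mod8 (Perio-trl 4 perio) j)) }

f-redcd : ∀ {X} -> IsCh X -> Redcd (lftd fSub X) -> Redcd X
f-redcd {X} ch r = descend (eight (\ m -> Open (⟦ win m ⟧ X)) (win-factor 0 (1 :: []) (5 ⁻ :: 7 ⁺ :: []) 0 [] refl) (win-factor 1 (3 :: []) [] 1 (5 ⁺ :: 7 ⁻ :: []) refl) (win-factor 1 (3 :: []) (1 ⁺ :: []) 2 (7 ⁻ :: []) refl)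
 (win-factor 4 (1 :: []) (1 ⁻ :: []) 3 (7 ⁺ :: []) refl) (win-factor 4 (1 :: []) (1 ⁻ :: 3 ⁺ :: []) 4 [] refl) (win-factor 5 (3 :: []) [] 5 (1 ⁺ :: 3 ⁻ :: []) refl) (win-factor 5 (3 :: []) (5 ⁺ :: []) 6 (3 ⁻ :: []) refl)
 (win-factor 0 (1 :: []) (5 ⁻ :: []) 7 (3 ⁺ :: []) refl))
 (eight (\ m -> hd (X m) != hd (X (4 N.+ m))) (idx 0 (head-of 0 (0 :: []) 0 (1 ⁺ :: 3 ⁻ :: []) refl) (head-of 4 (0 :: []) 4 (5 ⁺ :: 7 ⁻ :: []) refl)) (idx 1 (head-of 1 [] 1 [] refl) (head-of 5 [] 5 [] refl)) (idx 2 (head-of 2 [] 2 [] refl) (head-of 6 [] 6 [] refl)) (idx 3 (head-of 3 [] 3 [] refl) (head-of 7 [] 7 [] refl)) (idx 4 (head-of 4 (0 :: []) 4 (5 ⁺ :: 7 ⁻ :: []) refl) (head-of 8 (0 :: []) 8 (1 ⁺ :: 3 ⁻ :: []) refl)) (idx 5 (head-of 5 [] 5 [] refl) (head-of 9 [] 9 [] refl)) (idx 6 (head-of 6 [] 6 [] refl) (head-of 10 [] 10 [] refl)) (idx 7 (head-of 7 [] 7 [] refl) (head-of 11 [] 11 [] refl)))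
 where
 open Descent ch fSub r
 at' : ∀ i j -> hd (lftd fSub X i) == hd (X j) -> hd (lftd fSub X (4 N.+ i)) == hd (X (4 N.+ j)) -> hd (X j) != hd (X (4 N.+ j))
 at' i j e e' h = Redcd.heads r i (e ∙ h ∙ ! e')
 idx : ∀ j -> hd (lftd fSub X j) == hd (X j) -> hd (lftd fSub X (4 N.+ j)) == hd (X (4 N.+ j)) -> hd (X j) != hd (X (4 N.+ j))
 idx j = at' j j

g-redcd : ∀ {X} -> IsCh X -> Redcd (lftd gSub X) -> Redcd X
g-redcd {X} ch r = descend (eight (\ m -> Open (⟦ win m ⟧ X)) (win-factor⁻ 2 (4 ⁻ :: []) 0 (im gSub (3 ⁺ :: 4 ⁺ :: 5 ⁺ :: [])) refl) (win-factor⁻ 2 [] 1 (0 ⁻ :: im gSub (3 ⁺ :: 4 ⁺ :: 5 ⁺ :: [])) refl)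
 (win-factor⁻ 4 (6 ⁻ :: []) 2 (im gSub (5 ⁺ :: 6 ⁺ :: 7 ⁺ :: [])) refl) (win-factor⁻ 4 [] 3 (2 ⁻ :: im gSub (5 ⁺ :: 6 ⁺ :: 7 ⁺ :: [])) refl) (win-factor⁻ 6 (0 ⁻ :: []) 4 (im gSub (7 ⁺ :: 8 ⁺ :: 9 ⁺ :: [])) refl)
 (win-factor⁻ 6 [] 5 (4 ⁻ :: im gSub (7 ⁺ :: 8 ⁺ :: 9 ⁺ :: [])) refl) (win-factor⁻ 0 (2 ⁻ :: []) 6 (im gSub (1 ⁺ :: 2 ⁺ :: 3 ⁺ :: [])) refl) (win-factor⁻ 0 [] 7 (6 ⁻ :: im gSub (1 ⁺ :: 2 ⁺ :: 3 ⁺ :: [])) refl))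
 (eight (\ m -> hd (X m) != hd (X (4 N.+ m))) (idx 5 0 (head-of 5 [] 0 (1 ⁺ :: 2 ⁺ :: []) refl) (head-of 9 [] 4 (5 ⁺ :: 6 ⁺ :: []) refl)) (idx 4 1 (head-of 4 (0 :: []) 1 (2 ⁺ :: 4 ⁻ :: 3 ⁻ :: 2 ⁻ :: []) refl) (head-of 8 (0 :: []) 5 (6 ⁺ :: 0 ⁻ :: 7 ⁻ :: 6 ⁻ :: []) refl)) (idx 7 2 (head-of 7 [] 2 (3 ⁺ :: 4 ⁺ :: []) refl) (head-of 11 [] 6 (7 ⁺ :: 0 ⁺ :: []) refl)) (idx 6 3 (head-of 6 (0 :: []) 3 (4 ⁺ :: 6 ⁻ :: 5 ⁻ :: 4 ⁻ :: []) refl) (head-of 10 (0 :: []) 7 (0 ⁺ :: 2 ⁻ :: 1 ⁻ :: 0 ⁻ :: []) refl)) (idx 1 4 (head-of 1 [] 4 (5 ⁺ :: 6 ⁺ :: []) refl) (head-of 5 [] 8 (1 ⁺ :: 2 ⁺ :: []) refl)) (idx 0 5 (head-of 0 (0 :: []) 5 (6 ⁺ :: 0 ⁻ :: 7 ⁻ :: 6 ⁻ :: []) refl) (head-of 4 (0 :: []) 9 (2 ⁺ :: 4 ⁻ :: 3 ⁻ :: 2 ⁻ :: []) refl)) (idx 3 6 (head-of 3 [] 6 (7 ⁺ :: 0 ⁺ :: []) refl) (head-of 7 [] 10 (3 ⁺ :: 4 ⁺ :: []) refl)) (idx 2 7 (head-of 2 (0 :: []) 7 (0 ⁺ :: 2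 ⁻ :: 1 ⁻ :: 0 ⁻ :: []) refl) (head-of 6 (0 :: []) 11 (4 ⁺ :: 6 ⁻ :: 5 ⁻ :: 4 ⁻ :: []) refl)))
 where
 open Descent ch gSub r
 idx : ∀ i j -> hd (lftd gSub X i) == hd (X j) -> hd (lftd gSub X (4 N.+ i)) == hd (X (4 N.+ j)) -> hd (X j) != hd (X (4 N.+ j))
 idx i j e e' h = Redcd.heads r i (e ∙ h ∙ ! e')

reflectᶜ : Cell -> Cell
reflectᶜ (a , b) = (Z.- a , b)

vec-rflc : ∀ w -> vec (map rflc w) == reflectᶜ (vec w)
vec-rflc [] = refl
vec-rflc (l :: w) = vec-++ (rflc l :: []) (map rflc w) ∙ (ap2 _<>_ (one-step l) (vec-rflc w)) ∙ ! (additive (vec (l :: [])) (vec w)) ∙ ap reflectᶜ (! (vec-++ (l :: []) w))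
 where
 one-step : ∀ l -> vec (rflc l :: []) == reflectᶜ (vec (l :: []))
 one-step R = refl
 one-step L = refl
 one-step U = refl
 one-step D = refl
 additive : ∀ p q -> reflectᶜ (p <> q) == reflectᶜ p <> reflectᶜ q
 additive (a , b) (c , d) = ap (_, b + d) (Y.neg-distrib-+ a c)

Open-mir : ∀ {w} -> Open w -> Open (mir w)
Open-mir {w} o u f' v e c = ! (mir-mir f') ∙ ap mir (o (mir v) (mir f') (mir u) (! (mir-mir w) ∙ ap mir e ∙ mir-++ u (f' ++ v) ∙ ap (_++ mir u) (mir-++ f' v) ∙ ++-as (mir v) (mir f') (mir u))
 (vec-rev (map rflc f') ∙ ap neg (vec-rflc f' ∙ ap reflectᶜ c)))

module Reduce {A : Chn} (r : Redcd A) where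
 open Redcd r public
 open ChainFacts chain public

 tails : ∀ i -> hd (rev (A (1 N.+ i))) != hd (rev (A (5 N.+ i)))
 tails i e = heads i (head i ∙ ! e ∙ ap hd (ap rev (! (perio (1 N.+ i)))) ∙ ! (head (4 N.+ i)))
  where
  head : ∀ i -> hd (A i) == hd (rev (A (5 N.+ i)))
  head i = ! (hd-++ (A i) (A (1 N.+ i)) (nonem i)) ∙ ap hd (rel i) ∙ hd-++ (bar (1 N.+ i)) (bar i) (\ z -> nonem (5 N.+ i) (rev-[] (A (5 N.+ i)) z))

reflectᵐ : Maybe Ltr -> Maybe Ltr
reflectᵐ nothing = nothing
reflectᵐ (just l) = just (rflc l)

Redcd-mird : ∀ {A} -> Redcd A -> Redcd (mird A)
Redcd-mird {A} r = record { chain = M ; free = \ j -> tp Open (! (win-mod (IsCh.perio M) j)) (windows j) ; heads = \ j e -> heads' j e }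
 where
 open Reduce r
 M : IsCh (mird A)
 M = mird-chain chain
 one-win : ∀ j -> sames (reflected (win j)) (win (7 N.* (3 N.+ j))) == true -> Open (⟦ win j ⟧ (mird A))
 one-win j c = tp Open (! (⟦mirrored⟧ A (win j) ∙ ap mir (sames-sound perio (reflected (win j)) (win (7 N.* (3 N.+ j))) c))) (Open-mir (free (7 N.* (3 N.+ j))))
 windows : ∀ j -> Open (⟦ win (j N.% 8) ⟧ (mird A))
 windows = eight (\ m -> Open (⟦ win m ⟧ (mird A))) (one-win 0 refl) (one-win 1 refl) (one-win 2 refl) (one-win 3 refl) (one-win 4 refl) (one-win 5 refl) (one-win 6 refl) (one-win 7 refl)
 hd-mir : ∀ w -> hd (mir w) == reflectᵐ (hd (rev w))
 hd-mir w = ap hd (! (map-rev rflc inv-rflc w)) ∙ hd-map (rev w)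
  where
  hd-map : ∀ v -> hd (map rflc v) == reflectᵐ (hd v)
  hd-map [] = refl
  hd-map (x :: v) = refl
 rflc-inj : ∀ {a b} -> reflectᵐ a == reflectᵐ b -> a == b
 rflc-inj {nothing} {nothing} _ = refl
 rflc-inj {just a} {just b} e = ap just (! (rflc-rflc a) ∙ unjust (ap reflectᵐ e) ∙ rflc-rflc b)
  where
  unjust : ∀ {a b : Ltr} -> just a == just b -> a == b
  unjust refl = refl
 -- 7 j + 8 = 1 + (7 j + 7), so that every index is a successor.
 heads' : ∀ j -> hd (mird A j) != hd (mird A (4 N.+ j))
 heads' j e = tails (7 N.+ 7 N.* j) (ap (\ z -> hd (rev z)) (perio (7 N.* j)) ∙ rflc-inj (! (hd-mir (A (7 N.* j))) ∙ e ∙ hd-mir (A (7 N.* (4 N.+ j)))) ∙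
   ap (\ z -> hd (rev z)) (ap A (Q.*-distribˡ-+ 7 4 j) ∙ ! (ap A (alg (7 N.* j)) ∙ ! (perio _) ∙ ! (perio _) ∙ ap A (alg' (7 N.* j)))))
  where
  alg : ∀ m -> 5 N.+ (7 N.+ m) == 12 N.+ m
  alg m = refl
  alg' : ∀ m -> 8 N.+ (8 N.+ (12 N.+ m)) == 28 N.+ m
  alg' m = refl

-- A trim without remainder: either the chain is a deformed Greek cross, or there is a proper trim nearby.

closed-pair : ∀ {w} u x y v -> Open w -> w == u ++ (x ++ (rev y ++ v)) -> vec x == vec y -> x == []
closed-pair u x y v o e h = I.++-conicalˡ x (rev y) (o u (x ++ rev y) v (e ∙ ap (u ++_) (! (++-as x (rev y) v))) (vec-++ x (rev y) ∙ (ap2 _<>_ h (vec-rev y)) ∙ ⊕-invʳ (vec y)))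

conj-vec : ∀ x {y z} -> x ++ y == z ++ x -> vec z == vec y
conj-vec x {y} {z} e = ⊕-canˡ (vec x) (⊕-comm (vec x) (vec z) ∙ ! (vec-++ z x) ∙ ap vec (! e) ∙ vec-++ x y)

len-++-≡ : ∀ (u v x y : Word) -> u ++ v == x ++ y -> # u N.+ # v == # x N.+ # y
len-++-≡ u v x y e = ! (#-++ u) ∙ ap # e ∙ #-++ x

module Flat {A : Chn} (r : Redcd A) (i : ℕ) where
 open Reduce r

 module _ (T : Trim i) (T' : Trim (4 N.+ i)) (flat : fst T == []) where
  private
   module K = Trimmed i T T'
   empty : ∀ (w : Word) -> # w == 0 -> w == []
   empty [] _ = refl
   flat' : fst T' == []
   flat' = empty (fst T') (trim-lengths i T T' ∙ ap # flat)
   X Y Z Y' : Word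
   X = A (2 N.+ i)
   Y = A (3 N.+ i)
   Z = A (4 N.+ i)
   Y' = bar (3 N.+ i)
   A-0 : A i == rev Z
   A-0 = ! (++-id (A i)) ∙ ap (\ z -> A i ++ rev z) (! flat') ∙ K.before ∙ ap (_++ bar i) flat
   bar-2 : bar (2 N.+ i) == X
   bar-2 = ! (ap (\ z -> rev z ++ A (2 N.+ i)) (! flat') ∙ K.after ∙ ap (bar (2 N.+ i) ++_) flat ∙ (++-id _))
   bar-4' : bar (4 N.+ i) == Z
   bar-4' = bar-4 i ∙ ap rev A-0 ∙ rr Z
   A-6 : A (6 N.+ i) == rev X
   A-6 = ! (rr _) ∙ ap rev bar-2
   A-1 : A (1 N.+ i) == X ++ rev Z
   A-1 = snd T ∙ (ap2 _++_ bar-2 (ap (_++ bar i) flat))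
   A-5 : A (5 N.+ i) == rev X ++ Z
   A-5 = snd T' ∙ (ap2 _++_ (bar-4 (2 N.+ i)) (ap (_++ bar (4 N.+ i)) flat' ∙ bar-4'))
   A-7 : A (7 N.+ i) == rev Y'
   A-7 = ! (rev-bar (3 N.+ i))
   XY : X ++ Y == Y' ++ X
   XY = rel (2 N.+ i) ∙ ap (Y' ++_) bar-2
   YZ : Y ++ Z == Z ++ Y'
   YZ = rel (3 N.+ i) ∙ ap (_++ Y') bar-4'
   XYZ : X ++ (Y ++ Z) == (X ++ Z) ++ Y'
   XYZ = ap (X ++_) YZ ∙ ! (++-as X Z Y')
   XYZ' : X ++ (Y ++ Z) == Y' ++ (X ++ Z)
   XYZ' = ! (++-as X Y Z) ∙ ap (_++ Z) XY ∙ ++-as Y' X Z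
   commuting : Y ++ (Z ++ X) == (Z ++ X) ++ Y
   commuting = begin
    Y ++ (Z ++ X)  ≡⟨ ! (++-as Y Z X) ⟩ (Y ++ Z) ++ X  ≡⟨ ap (_++ X) YZ ⟩ (Z ++ Y') ++ X ≡⟨ ++-as Z Y' X ⟩
    Z ++ (Y' ++ X) ≡⟨ ap (Z ++_) (! XY) ⟩
    Z ++ (X ++ Y)  ≡⟨ ! (++-as Z X Y) ⟩ (Z ++ X) ++ Y ∎
    where open ≡-Reasoning
   Y'-len : # Y' == # Y
   Y'-len = len-bar (3 N.+ i)
   Y≢ : Y != []
   Y≢ = nonem (3 N.+ i)
   Y'≢ : Y' != []
   Y'≢ z = nonem (7 N.+ i) (rev-[] _ z)
   window2 : ⟦ win (2 N.+ i) ⟧ A == ((X ++ Z) ++ Y') ++ (rev X ++ Z)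
   window2 = ap (\ z -> X ++ (Y ++ (Z ++ z))) ((++-id _) ∙ A-5) ∙ e X Y Z (rev X ++ Z) ∙ ap (_++ (rev X ++ Z)) XYZ
    where
    e : ∀ a b c d -> a ++ (b ++ (c ++ d)) == (a ++ (b ++ c)) ++ d
    e a b c d = solve words

   -- Y shorter than Z X: the words overlap so much that a window closes up.
   short-Z : # Y ≤ # Z -> ⊥
   short-Z le with olap≤ Y Z YZ le
   ... | m , _ , eZ = Y'≢ (closed-pair (rev X ++ m) Y' Y (rev (Z ++ X)) (free (5 N.+ i)) (begin
     A (5 N.+ i) ++ (A (6 N.+ i) ++ (A (7 N.+ i) ++ (A (8 N.+ i) ++ []))) ≡⟨ ap2 _++_ A-5 (ap2 _++_ A-6 (ap2 _++_ A-7 ((++-id _) ∙ perio i ∙ A-0))) ⟩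
      (rev X ++ Z) ++ (rev X ++ (rev Y' ++ rev Z)) ≡⟨ ap ((rev X ++ Z) ++_) (ap (rev X ++_) (! (rev-++ Z Y')) ∙ ! (rev-++ (Z ++ Y') X) ∙ ap rev (ap (_++ X) (! YZ) ∙ ++-as Y Z X ∙ commuting)) ⟩
      (rev X ++ Z) ++ rev ((Z ++ X) ++ Y) ≡⟨ ap2 (\ a b -> (rev X ++ a) ++ b) eZ (rev-++ (Z ++ X) Y) ⟩ (rev X ++ (m ++ Y')) ++ (rev Y ++ rev (Z ++ X)) ≡⟨ e (rev X) m Y' (rev Y) (rev (Z ++ X)) ⟩
      (rev X ++ m) ++ (Y' ++ (rev Y ++ rev (Z ++ X))) ∎) (conj-vec X XY))
    where
    open ≡-Reasoning
    e : ∀ a b c d f' -> (a ++ (b ++ c)) ++ (d ++ f') == (a ++ b) ++ (c ++ (d ++ f'))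
    e a b c d f' = solve words

   long-both : ∀ Q -> Q != [] -> Z ++ X == Y ++ Q -> # Z ≤ # Y -> ⊥
   long-both Q Q≢ eQ le with olap≤ Y' (X ++ Z) (! XYZ' ∙ XYZ) (≤-tr (≤-re Y'-len) (≤-tr (Q.m≤m+n (# Y) (# Q)) (≤-re (! (len-++-≡ Z X Y Q eQ) ∙ Q.+-comm (# Z) (# X) ∙ ! (#-++ X)))))
   ... | Q' , eQ' , _ = finish (olap≤ Q' X (! XQ) Q'≤X)
    where
    XQ : X ++ Q == Q' ++ X
    XQ = I.++-cancelˡ Y' _ _ (begin
     Y' ++ (X ++ Q)  ≡⟨ ! (++-as Y' X Q) ∙ ap (_++ Q) (! XY) ∙ ++-as X Y Q ⟩
     X ++ (Y ++ Q)   ≡⟨ ap (X ++_) (! eQ) ⟩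
     X ++ (Z ++ X)   ≡⟨ ! (++-as X Z X) ⟩ (X ++ Z) ++ X   ≡⟨ ap (_++ X) eQ' ⟩ (Y' ++ Q') ++ X ≡⟨ ++-as Y' Q' X ⟩
     Y' ++ (Q' ++ X) ∎)
     where open ≡-Reasoning
    Q'-len : # Q' == # Q
    Q'-len = Q.+-cancelʳ-≡ (# X) _ _ (! (#-++ Q') ∙ ap # (! XQ) ∙ #-++ X ∙ Q.+-comm (# X) (# Q))
    Q'≤X : # Q' ≤ # X
    Q'≤X = Q.+-cancelˡ-≤ (# Y) _ _ (≤-tr (≤-re (ap (# Y N.+_) Q'-len ∙ ! (len-++-≡ Z X Y Q eQ))) (Q.+-monoˡ-≤ (# X) le))
    finish : (Σ Word \ m -> X == Q' ++ m × X == m ++ Q) -> ⊥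
    finish (m , _ , eX) = Q≢ (empty Q (! Q'-len ∙ ap # (closed-pair (Y' ++ Y') Q' Q (rev m ++ Z) (free (2 N.+ i))
     (window2 ∙ ap2 (\ a b -> a ++ (b ++ Z)) (! XYZ ∙ XYZ' ∙ ap (Y' ++_) eQ') (ap rev eX ∙ rev-++ m Q) ∙ e Y' Y' Q' (rev Q) (rev m) Z) (conj-vec X XQ))))
     where
     e : ∀ a b c d f' g' -> (a ++ (b ++ c)) ++ ((d ++ f') ++ g') == (a ++ b) ++ (c ++ (d ++ (f' ++ g')))
     e a b c d f' g' = solve words

   greek-case : Y == Z ++ X -> ∀ n -> trl (2 N.+ i) A n == subst X Z (grk n)
   greek-case eY = agree (Perio-trl {A} (2 N.+ i) perio) (\ n -> refl) (idx 0 ∙ ! (++-id X)) (idx 1 ∙ eY ∙ ap (Z ++_) (! (++-id X))) (idx 2 ∙ ! (++-id Z)) (idx 3 ∙ A-5 ∙ ap (rev X ++_) (! (++-id Z)))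
    (idx 4 ∙ A-6 ∙ ! (++-id (rev X))) (idx 5 ∙ A-7 ∙ ap rev Y'≡ ∙ rev-++ X Z ∙ ap (rev Z ++_) (! (++-id (rev X)))) (idx 6 ∙ perio i ∙ A-0 ∙ ! (++-id (rev Z))) (idx 7 ∙ perio (1 N.+ i) ∙ A-1 ∙ ap (X ++_) (! (++-id (rev Z))))
    where
    idx : ∀ n -> A (2 N.+ i N.+ n) == A (2 N.+ n N.+ i)
    idx n = ap (\ z -> A (2 N.+ z)) (Q.+-comm i n)
    Y'≡ : Y' == X ++ Z
    Y'≡ = I.++-cancelʳ X _ _ (! XY ∙ ap (X ++_) eY ∙ ! (++-as X Z X))

  flat-case : (∀ n -> trl (2 N.+ i) A n == subst (A (2 N.+ i)) (A (4 N.+ i)) (grk n)) ⊎ (Σ (Trim (2 N.+ i)) \ T -> fst T != [])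
  flat-case with olap Y (Z ++ X) commuting
  ... | inl ([] , e , _) = inl (greek-case (! (++-id Y) ∙ ! e))
  ... | inl (q :: Q , e , _) = !! (decide (Q.≤-total (# Y) (# Z)))
   where
   decide : # Y ≤ # Z ⊎ # Z ≤ # Y -> ⊥
   decide (inl le) = short-Z le
   decide (inr le) = long-both (q :: Q) (\ ()) e le
  ... | inr (m , m≢ , e , _) = inr (proper (trim-or-conjugator (2 N.+ i)))
   where
   lengths : # Y == (# Z N.+ # X) N.+ # m
   lengths = ap # e ∙ #-++ (Z ++ X) ∙ ap (N._+ # m) (#-++ Z)
   proper : Trim (2 N.+ i) ⊎ Conj (2 N.+ i) -> Σ (Trim (2 N.+ i)) \ T -> fst T != []
   proper (inl T2) = T2 , \ z -> m≢ (empty m (Q.+-cancelˡ-≡ (# Z N.+ # X) _ _ (! lengths ∙ trim-len (2 N.+ i) T2 ∙ ap (\ t -> # Z N.+ (# t N.+ # X)) z ∙ ! (Q.+-identityʳ _))))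
   proper (inr c) = !! (Q.<⇒≱ (Q.m<m+n (# Y) (nonem-len (Conj.N≢ c))) (≤-tr (≤-re (len-++-≡ Y (Conj.N c) Z X (Conj.rightN c ∙ ap (_++ X) bar-4') ∙ refl)) (≤-tr (Q.m≤m+n (# Z N.+ # X) (# m)) (≤-re (! lengths)))))

module Centre {A : Chn} (r : Redcd A) (short1 : # (A 1) < # (A 2) N.+ # (A 4)) (short3 : # (A 3) < # (A 2) N.+ # (A 4)) (even≤odd : # (A 2) N.+ # (A 4) ≤ # (A 1) N.+ # (A 3)) where
 open Reduce r

 conjugator : ∀ i -> len (1 N.+ i) < len (2 N.+ i) N.+ len i -> Conj i
 conjugator i h with trim-or-conjugator i
 ... | inr c = c
 ... | inl T = !! (Q.<⇒≱ h (≤-tr (Q.+-monoʳ-≤ (len (2 N.+ i)) (Q.m≤n+m (len i) (# (fst T)))) (≤-re (! (trim-len i T)))))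

 private
  empty : ∀ (w : Word) -> # w == 0 -> w == []
  empty [] _ = refl

  c1 : Conj 0
  c1 = conjugator 0 (tp (\ z -> len 1 < len 2 N.+ z) (len-4 0) short1)
  c3 : Conj 2
  c3 = conjugator 2 (≤-tr short3 (≤-re (Q.+-comm (len 2) (len 4))))
  c7 : Conj 6
  c7 = conjugator 6 (≤-tr (≤-re (ap suc (len-4 3))) (≤-tr short3 (≤-re (Q.+-comm (len 2) (len 4) ∙ (ap2 N._+_ (! (len-4 4)) (! (len-4 2)))))))
  open Conj c1 using () renaming (N to N1; rightN to right1; leftN to left1)
  open Conj c3 using () renaming (N to N3; rightN to right3; leftN to left3)
  open Conj c7 using () renaming (N to N7; leftN to left7)
  N3' : Word
  N3' = rev N7
  left3' : N3' ++ bar 3 == bar 2 ++ A 4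
  left3' = ! (rev-≡ (rev-++ (bar 2) (A 4) ∙ ap (rev (A 4) ++_) (rev-bar 2) ∙ ap (\ z -> rev z ++ A 6) (! (perio 4)) ∙ ap (rev (A 12) ++_) refl ∙ e))
   where
   e : rev (A 12) ++ A 6 == rev (N3' ++ bar 3)
   e = e' ∙ ! (rev-++ N3' (bar 3) ∙ (ap2 _++_ (rev-bar 3) (rr N7)))
    where
    e' : rev (A 12) ++ A 6 == A 7 ++ N7
    e' = ! (Conj.rightN c7)

 module _ (le43 : len 4 ≤ len 3) where
  private
   part3 : Σ Word \ s -> A 3 == bar 4 ++ s × bar 3 == s ++ A 4
   part3 = olap≤ (bar 4) (A 3) (! (rel 3)) (≤-tr (≤-re (len-bar 4)) le43)
   s : Word
   s = fst part3
   A-2 : A 2 == s ++ N3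
   A-2 = ! (I.++-cancelˡ (bar 4) _ _ (! (++-as (bar 4) s N3) ∙ ap (_++ N3) (! (fst (snd part3))) ∙ right3))
   bar-2 : bar 2 == N3' ++ s
   bar-2 = ! (I.++-cancelʳ (A 4) _ _ (++-as N3' s (A 4) ∙ ap (N3' ++_) (! (snd (snd part3))) ∙ left3'))
   N3'-len : # N3' N.+ len 3 == len 2 N.+ len 4
   N3'-len = (ap (# N3' N.+_) (! (len-bar 3) ∙ ap # (snd (snd part3)) ∙ #-++ s) ∙ ! (Q.+-assoc (# N3') (# s) (len 4)) ∙ ap (N._+ len 4) (! (#-++ N3') ∙ ap # (! bar-2) ∙ len-bar 2))
   part1 : Σ Word \ k -> A 1 == N3' ++ k × s ++ bar 1 == k ++ A 2
   part1 = olap≤ N3' (A 1) (! (++-as N3' s (bar 1)) ∙ ap (_++ bar 1) (! bar-2) ∙ ! (rel 1)) (Q.+-cancelʳ-≤ (len 3) _ _ (≤-tr (≤-re N3'-len) even≤odd))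
   k : Word
   k = fst part1
   ks : k ++ A 2 == s ++ bar 1
   ks = ! (snd (snd part1))

   k≢ : k != []
   k≢ z = heads 0 ((! (hd-++ (A 0) (A 1) (nonem 0)) ∙ ap hd (rel 0) ∙ hd-++ (bar 1) (bar 0) bar-1≢) ∙ ! (hd-++ (bar 1) (bar 4) bar-1≢) ∙ ap hd e ∙ hd-++ (A 4) N3' (nonem 4))
    where
    bar-1≢ : bar 1 != []
    bar-1≢ w = nonem 5 (rev-[] (A 5) w)
    bar-1 : bar 1 == N3
    bar-1 = I.++-cancelˡ s _ _ (! ks ∙ ap (_++ A 2) z ∙ A-2)
    e : bar 1 ++ bar 4 == A 4 ++ N3'
    e = I.++-cancelʳ s _ _ (++-as (bar 1) (bar 4) s ∙ (ap2 _++_ bar-1 (! (fst (snd part3)))) ∙ left3 ∙ ap (A 4 ++_) bar-2 ∙ ! (++-as (A 4) N3' s))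

   crossed : (Σ Word \ m -> N1 ++ N3' == A 2 ++ m × bar 0 == m ++ k) -> ⊥
   crossed (m , _ , e0) = impossible (olap≤ s (k ++ s) (! (++-as k s N3 ∙ ap (k ++_) (! A-2) ∙ ks)) (≤-tr (Q.m≤n+m (# s) (# k)) (≤-re (! (#-++ k)))))
    where
    A-4 : A 4 == rev k ++ rev m
    A-4 = ! (rev-bar 0) ∙ ap rev e0 ∙ rev-++ m k
    impossible : (Σ Word \ K -> k ++ s == s ++ K × bar 1 == K ++ N3) -> ⊥
    impossible (K , eK , _) = k≢ (empty k (Q.+-cancelʳ-≡ (# s) _ _ (len-++-≡ k s s K eK ∙ ap (\ z -> # s N.+ # z) K≡ ∙ Q.+-comm (# s) 0)))
     where
     K≡ : K == []
     K≡ = closed-pair (N3' ++ s) K k (rev m ++ (bar 2 ++ A 4)) (free 1) ((ap (A 1 ++_) (ap (\ z -> A 2 ++ (A 3 ++ z)) (++-id (A 4)) ∙ ! (++-as (A 2) (A 3) (A 4)) ∙ ap (_++ A 4) (rel 2) ∙ ++-as (bar 3) (bar 2) (A 4)) ∙ ap2 (\ a b -> a ++ (b ++ (bar 2 ++ A 4))) (fst (snd part1)) (snd (snd part3)) ∙ ap (\ z -> (N3' ++ k) ++ ((s ++ z) ++ (bar 2 ++ A 4))) A-4 ∙ e1 N3' k s (rev k) (rev m) (bar 2 ++ A 4) ∙ ap (\ z -> N3' ++ (z ++ (rev k ++ (rev m ++ (bar 2 ++ A 4))))) eK ∙ e2 N3' s K (rev k ++ (rev m ++ (bar 2 ++ A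 4))))) (! (conj-vec s (! eK)))
      where
      e1 : ∀ a b c d e f' -> (a ++ b) ++ ((c ++ (d ++ e)) ++ f') == a ++ ((b ++ c) ++ (d ++ (e ++ f')))
      e1 a b c d e f' = solve words
      e2 : ∀ a b c d -> a ++ ((b ++ c) ++ d) == (a ++ b) ++ (c ++ d)
      e2 a b c d = solve words

  centre-tail : (len 2 N.+ len 4) N.+ (len 2 N.+ len 4) < len 2 N.+ (len 1 N.+ len 3)
  centre-tail = settle (olap (A 2) (N1 ++ N3') (! left1 ∙ ap (N1 ++_) (fst (snd part1)) ∙ ! (++-as N1 N3' k)))
   where
   settle : (Σ Word \ m -> N1 ++ N3' == A 2 ++ m × bar 0 == m ++ k) ⊎ (Σ Word \ m -> m != [] × A 2 == (N1 ++ N3') ++ m × k == m ++ bar 0) -> (len 2 N.+ len 4) N.+ (len 2 N.+ len 4) < len 2 N.+ (len 1 N.+ len 3)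
   settle (inl h) = !! (crossed h)
   settle (inr (m , m≢ , e , _)) = ≤-tr (≤-re (ap suc (ap2 N._+_ (! N1-len) (! N3'-len))))
    (≤-tr (Q.m<m+n _ (nonem-len m≢)) (≤-re (alg (# N1) (len 1) (# N3') (len 3) (# m) ∙ ap (N._+ (len 1 N.+ len 3)) (! (ap # e ∙ #-++ (N1 ++ N3') ∙ ap (N._+ # m) (#-++ N1))))))
    where
    N1-len : # N1 N.+ len 1 == len 2 N.+ len 4
    N1-len = len-++-≡ N1 (A 1) (A 2) (bar 0) left1 ∙ ap (len 2 N.+_) (len-bar 0 ∙ ! (len-4 0))
    alg : ∀ a b c d e -> ((a N.+ b) N.+ (c N.+ d)) N.+ e == (a N.+ c N.+ e) N.+ (b N.+ d)
    alg = ringN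

 no-peak : len 3 < len 4 -> len 1 < len 4 -> ⊥
 no-peak lt34 lt14 = refute (olap≤ (A 3) (bar 4) (rel 3) (≤-tr (Q.<⇒≤ lt34) (≤-re (! (len-bar 4))))) (olap≤ (bar 1) (A 0) (! (rel 0)) (≤-tr (≤-re (len-bar 1)) (≤-tr (Q.<⇒≤ lt14) (≤-re (len-4 0)))))
  (olap≤ (bar 2) (A 1) (! (rel 1)) (≤-tr (≤-re (len-bar 2)) le21)) (olap≤ (A 2) (bar 3) (rel 2) (≤-tr le23 (≤-re (! (len-bar 3)))))
  where
  le21 : len 2 ≤ len 1
  le21 = Q.+-cancelʳ-≤ (len 3) _ _ (≤-tr (Q.+-monoʳ-≤ (len 2) (Q.<⇒≤ lt34)) even≤odd)
  le23 : len 2 ≤ len 3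
  le23 = Q.+-cancelʳ-≤ (len 1) _ _ (≤-tr (Q.+-monoʳ-≤ (len 2) (Q.<⇒≤ lt14)) (≤-tr even≤odd (≤-re (Q.+-comm (len 1) (len 3)))))
  refute : (Σ Word \ y -> bar 4 == A 3 ++ y × A 4 == y ++ bar 3) -> (Σ Word \ z -> A 0 == bar 1 ++ z × bar 0 == z ++ A 1) ->
   (Σ Word \ s -> A 1 == bar 2 ++ s × bar 1 == s ++ A 2) -> (Σ Word \ t -> bar 3 == A 2 ++ t × A 3 == t ++ bar 2) -> ⊥
  refute (y , y1 , y2) (z , z1 , z2) (s , s1 , s2) (t , t1 , t2) = meet (olap≤ y (rev s) ((! (y2 ∙ ap (y ++_) t1) ∙ A-4) ∙ refl) (≤-tr y≤s (≤-re (! (len-rev s)))))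
   (olap≤ (rev z ++ rev (A 2)) (t ++ bar 2) (! bar-4' ∙ y1 ∙ ap (_++ y) t2) (≤-tr (≤-re (#-++ (rev z) ∙ (ap2 N._+_ (len-rev z) (len-rev (A 2))))) (≤-tr z≤ (≤-re (ap # t2)))))
   where
   y-len : len 4 == len 3 N.+ # y
   y-len = ! (len-bar 4) ∙ ap # y1 ∙ #-++ (A 3)
   s-len : len 1 == len 2 N.+ # s
   s-len = ap # s1 ∙ #-++ (bar 2) ∙ ap (N._+ # s) (len-bar 2)
   z-len : len 4 == len 1 N.+ # z
   z-len = len-4 0 ∙ ap # z1 ∙ #-++ (bar 1) ∙ ap (N._+ # z) (len-bar 1)
   y≤s : # y ≤ # s
   y≤s = Q.+-cancelˡ-≤ (len 2 N.+ len 3) _ _ (≤-tr (≤-re ((Q.+-assoc (len 2) (len 3) _) ∙ ap (len 2 N.+_) (! y-len))) (≤-tr even≤odd (≤-re (ap (N._+ len 3) s-len ∙ alg (len 2) (# s) (len 3)))))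
    where
    alg : ∀ a b c -> (a N.+ b) N.+ c == (a N.+ c) N.+ b
    alg = ringN
   z≤ : # z N.+ len 2 ≤ len 3
   z≤ = Q.+-cancelˡ-≤ (len 1) _ _ (≤-tr (≤-re (alg (len 1) (# z) (len 2) ∙ ap (len 2 N.+_) (! z-len))) even≤odd)
    where
    alg : ∀ a b c -> a N.+ (b N.+ c) == c N.+ (a N.+ b)
    alg = ringN
   A-4 : A 4 == rev s ++ (A 6 ++ rev z)
   A-4 = ! (rev-bar 0) ∙ ap rev z2 ∙ rev-++ z (A 1) ∙ ap (_++ rev z) (ap rev s1 ∙ rev-++ (bar 2) s ∙ ap (rev s ++_) (rev-bar 2)) ∙ ++-as (rev s) (A 6) (rev z)
   bar-4' : bar 4 == (rev z ++ rev (A 2)) ++ rev s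
   bar-4' = bar-4 0 ∙ ap rev z1 ∙ rev-++ (bar 1) z ∙ ap (rev z ++_) (ap rev s2 ∙ rev-++ s (A 2)) ∙ ! (++-as (rev z) (rev (A 2)) (rev s))
   meet : (Σ Word \ e -> rev s == y ++ e × A 2 ++ t == e ++ (A 6 ++ rev z)) -> (Σ Word \ e' -> t ++ bar 2 == (rev z ++ rev (A 2)) ++ e' × rev s == e' ++ y) -> ⊥
   meet (e , e1 , e2) (e' , _ , e'2) = heads 2 (! (hd-++ (A 2) t (nonem 2)) ∙ ap hd (e2 ∙ ap (_++ (A 6 ++ rev z)) e≡) ∙ hd-++ (A 6) (rev z) (nonem 6))
    where
    conj : y ++ e == e' ++ y
    conj = ! e1 ∙ e'2
    e'≡ : rev e' == []
    e'≡ = closed-pair (bar 2 ++ rev y) (rev e') (rev e) ((A 6 ++ rev z) ++ (bar 2 ++ A 4)) (free 1) ((ap2 (\ a b -> a ++ (A 2 ++ (b ++ (A 4 ++ [])))) (s1 ∙ ap (bar 2 ++_) (! (rr s) ∙ ap rev e'2 ∙ rev-++ e' y)) t2 ∙ e0 (bar 2) (rev y) (rev e') (A 2) t (bar 2) (A 4) ∙ ap (\ z -> (bar 2 ++ rev y) ++ (rev e' ++ (z ++ (bar 2 ++ A 4)))) (e2 ∙ ap (_++ (A 6 ++ rev z)) (! (rr e))) ∙ ap (\ z -> (bar 2 ++ rev y) ++ (rev e' ++ z)) (++-as (rev (rev e)) (A 6 ++ rev z) (bar 2 ++ A 4))))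
     (vec-rev e' ∙ ap neg (conj-vec y conj) ∙ ! (vec-rev e))
     where
     e0 : ∀ a b c d f' g' h -> (a ++ (b ++ c)) ++ (d ++ ((f' ++ g') ++ (h ++ []))) == (a ++ b) ++ (c ++ ((d ++ f') ++ (g' ++ h)))
     e0 a b c d f' g' h = solve words
    e≡ : e == []
    e≡ = empty e (Q.+-cancelˡ-≡ (# y) _ _ (len-++-≡ y e e' y conj ∙ ap (\ z -> # z N.+ # y) (rev-[] e' e'≡) ∙ ! (Q.+-identityʳ (# y))))

centre-inequality : ∀ {A} -> Redcd A -> # (A 1) < # (A 2) N.+ # (A 4) -> # (A 3) < # (A 2) N.+ # (A 4) -> # (A 2) N.+ # (A 4) ≤ # (A 1) N.+ # (A 3) ->
 (# (A 2) N.+ # (A 4)) N.+ (# (A 2) N.+ # (A 4)) < # (A 2) N.+ (# (A 1) N.+ # (A 3))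
centre-inequality {A} r h1 h3 h = decide (Q.≤-total (len 4) (len 3)) (Q.≤-total (len 4) (len 1))
 where
 open Reduce r
 open Centre r h1 h3 h
 M : Chn
 M = mird (trl 4 A)
 rM : Redcd M
 rM = Redcd-mird (Redcd-trl 4 r)
 size : ∀ j k -> A (4 N.+ 7 N.* j) == A k -> # (M j) == len k
 size j k e = len-rev (map rflc (A (4 N.+ 7 N.* j))) ∙ I.length-map rflc (A (4 N.+ 7 N.* j)) ∙ ap # e
 s1 : # (M 1) == len 3
 s1 = size 1 3 (perio 3)
 s2 : # (M 2) == len 2
 s2 = size 2 2 (perio 10 ∙ perio 2)
 s3 : # (M 3) == len 1
 s3 = size 3 1 (perio 17 ∙ perio 9 ∙ perio 1)
 s4 : # (M 4) == len 4
 s4 = size 4 0 (perio 24 ∙ perio 16 ∙ perio 8 ∙ perio 0) ∙ ! (len-4 0)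
 s24 : # (M 2) N.+ # (M 4) == len 2 N.+ len 4
 s24 = ap2 N._+_ s2 s4
 s13 : # (M 1) N.+ # (M 3) == len 1 N.+ len 3
 s13 = (ap2 N._+_ s1 s3) ∙ Q.+-comm (len 3) (len 1)
 Goal : Set
 Goal = (len 2 N.+ len 4) N.+ (len 2 N.+ len 4) < len 2 N.+ (len 1 N.+ len 3)
 by-mir : len 4 ≤ len 1 -> Goal
 by-mir le41 = tp (\ z -> z) (ap2 N._<_ (ap2 N._+_ s24 s24) (ap2 N._+_ s2 s13)) (Centre.centre-tail rM (tp (\ z -> z) (! (ap2 N._<_ s1 s24)) h3) (tp (\ z -> z) (! (ap2 N._<_ s3 s24)) h1) (tp (\ z -> z) (! (ap2 N._≤_ s24 s13)) h)
  (tp (\ z -> z) (! (ap2 N._≤_ s4 s3)) le41))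
 peak : ∀ {a b} -> a == b ⊎ a < b -> b ≤ a ⊎ a < b
 peak (inl e) = inl (≤-re (! e))
 peak (inr l) = inr l
 decide : len 4 ≤ len 3 ⊎ len 3 ≤ len 4 -> len 4 ≤ len 1 ⊎ len 1 ≤ len 4 -> Goal
 decide (inl le43) _ = centre-tail le43
 decide (inr _) (inl le41) = by-mir le41
 decide (inr le34) (inr le14) with Q.m≤n⇒m<n∨m≡n le34 | Q.m≤n⇒m<n∨m≡n le14
 ... | inr e | _ = centre-tail (≤-re (! e))
 ... | inl _ | inr e = by-mir (≤-re (! e))
 ... | inl l3 | inl l1 = !! (no-peak l3 l1)

subst-++ : ∀ α β u v -> subst α β (u ++ v) == subst α β u ++ subst α β v
subst-++ α β u v = I.concatMap-++ _ u v

subst-rev : ∀ α β w -> subst α β (rev w) == rev (subst α β w)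
subst-rev α β [] = refl
subst-rev α β (l :: w) = (subst-++ α β (rev w) (inv l :: []) ∙ (ap2 _++_ (subst-rev α β w) (letter l)) ∙ ! (rev-++ (subst α β (l :: [])) (subst α β w)) ∙ ap rev (! (subst-++ α β (l :: []) w)))
 where
 letter : ∀ l -> subst α β (inv l :: []) == rev (subst α β (l :: []))
 letter R = (++-id _) ∙ ap rev (! (++-id α))
 letter L = (++-id _) ∙ ! (rr α) ∙ ap rev (! (++-id (rev α)))
 letter U = (++-id _) ∙ ap rev (! (++-id β))
 letter D = (++-id _) ∙ ! (rr β) ∙ ap rev (! (++-id (rev β)))

subst-[] : ∀ {α β} -> α != [] -> β != [] -> ∀ w -> subst α β w == [] -> w == []
subst-[] a b [] e = refl
subst-[] {α} {β} a b (R :: w) e = !! (a (I.++-conicalˡ α _ e))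
subst-[] {α} {β} a b (L :: w) e = !! (a (rev-[] α (I.++-conicalˡ (rev α) _ e)))
subst-[] {α} {β} a b (U :: w) e = !! (b (I.++-conicalˡ β _ e))
subst-[] {α} {β} a b (D :: w) e = !! (b (rev-[] β (I.++-conicalˡ (rev β) _ e)))

⟦⟧-subst : ∀ α β A w -> ⟦ w ⟧ (\ n -> subst α β (A n)) == subst α β (⟦ w ⟧ A)
⟦⟧-subst α β A [] = refl
⟦⟧-subst α β A (n ⁺ :: w) = ap (subst α β (A n) ++_) (⟦⟧-subst α β A w) ∙ ! (subst-++ α β (A n) (⟦ w ⟧ A))
⟦⟧-subst α β A (n ⁻ :: w) = (ap2 _++_ (! (subst-rev α β (A n))) (⟦⟧-subst α β A w)) ∙ ! (subst-++ α β (rev (A n)) (⟦ w ⟧ A))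

subst-chain : ∀ {α β A} -> α != [] -> β != [] -> IsCh A -> IsCh (\ n -> subst α β (A n))
subst-chain {α} {β} {A} a b ch = record { perio = \ n -> ap (subst α β) (perio n) ; nonem = \ n e -> nonem n (subst-[] a b (A n) e)
 ; laced = \ n -> ! (subst-++ α β (A n) (A (1 N.+ n))) ∙ ap (subst α β) (laced n) ∙ subst-rev α β (A (4 N.+ n) ++ A (5 N.+ n)) ∙ ap rev (subst-++ α β (A (4 N.+ n)) (A (5 N.+ n))) }
 where open IsCh ch

deform-two-tilings : (C : Chain) (Φ P : Shape) -> Descendant C -> Bounds (concat8 C) Φ -> IsDeformation P Φ -> TwoFourNeighbourTilings P
deform-two-tilings C Φ P d (sC , q , hC) (W , (sW , p , hW) , α , β , α≢ , β≢ , _ , (sP , o , hP)) =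
  compare (bdary-uniq (Simple-at sW p) (Simple-at sC q) (\ c -> ! (hW c) ∙ hC c))
 where
 σ : Word -> Word
 σ = subst α β
 conclude : ∀ {r} -> Smp r (σ (concat8 C)) -> (∀ c -> P c == inside r (σ (concat8 C)) c) -> TwoFourNeighbourTilings P
 conclude {r} s h = chain-two-tilings (subst-chain α≢ β≢ (Good.chain (Good-descendant d))) (tp (Smp r) e s) P (\ c -> h c ∙ ap (\ z -> inside r z c) e)
  where
  e : σ (concat8 C) == ⟦ oct ⟧ (\ n -> σ (chn C n))
  e = ! (⟦⟧-subst α β (chn C) oct ∙ ap σ (oct-concat C))
 rotated : ∀ u v -> W == v ++ u -> Σ Cell \ r -> Smp r (σ (u ++ v)) × (∀ c -> P c == inside r (σ (u ++ v)) c)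
 rotated u v refl = r , tp (Smp r) (! (subst-++ α β u v)) (Simple-rot (σ v) (σ u) s) , \ c -> hP c ∙ ap (\ z -> inside o z c) (subst-++ α β v u) ∙ inside-rot (σ v) (σ u) s c ∙ ap (\ z -> inside r z c) (! (subst-++ α β u v))
  where
  r : Cell
  r = tip o (σ v)
  s : Smp o (σ v ++ σ u)
  s = tp (Smp o) (subst-++ α β v u) (Simple-at sP o)
 compare : Rotation (concat8 C) W ⊎ Rotation (rev (concat8 C)) W -> TwoFourNeighbourTilings P
 compare (inl (u , v , e , e')) with rotated u v e'
 ... | r , s , h = conclude (tp (\ z -> Smp r (σ z)) (! e) s) (\ c -> h c ∙ ap (\ z -> inside r (σ z) c) (! e))
 compare (inr (u , v , e , e')) with rotated u v e'
 ... | r , s , h = conclude (tp (Smp r) f' (Simple-rev s)) (\ c -> h c ∙ ! (inside-rev s c) ∙ ap (\ z -> inside r z c) f')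
  where
  f' : rev (σ (u ++ v)) == σ (concat8 C)
  f' = ap (\ z -> rev (σ z)) (! e) ∙ ap rev (subst-rev α β (concat8 C)) ∙ rr (σ (concat8 C))

module GInverse {A : Chn} (r : Redcd A) (c : ∀ i -> ChainFacts.Conj (Redcd.chain r) i) where
 open Reduce r

 N : ℕ -> Word
 N i = Conj.N (c i)

 Split : ℕ -> Set
 Split h = Σ Word \ m -> m != [] × A (2 N.+ h) == N h ++ (m ++ N (2 N.+ h))

 private
  rightN : ∀ i -> A (1 N.+ i) ++ N i == bar (2 N.+ i) ++ A i
  rightN i = Conj.rightN (c i)
  leftN : ∀ i -> N i ++ A (1 N.+ i) == A (2 N.+ i) ++ bar i
  leftN i = Conj.leftN (c i)

  N-8 : ∀ i -> N (8 N.+ i) == N i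
  N-8 i = I.++-cancelˡ (A (1 N.+ i)) _ _ (ap (_++ N (8 N.+ i)) (! (perio (1 N.+ i))) ∙ rightN (8 N.+ i) ∙ ap2 (\ x y -> rev x ++ y) (perio (6 N.+ i)) (perio i) ∙ ! (rightN i))

  N-len : ∀ i -> # (N i) N.+ len (1 N.+ i) == len (2 N.+ i) N.+ len i
  N-len i = len-++-≡ (N i) (A (1 N.+ i)) (A (2 N.+ i)) (bar i) (leftN i) ∙ ap (len (2 N.+ i) N.+_) (len-bar i)

 split : ∀ h -> # (N h) N.+ # (N (2 N.+ h)) < len (2 N.+ h) -> Split h
 split h lt' = cut-off (olap≤ (bar (4 N.+ h)) (A (3 N.+ h)) (! (rightN (2 N.+ h))) short)
  where
  short : # (bar (4 N.+ h)) ≤ len (3 N.+ h)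
  short = Q.+-cancelˡ-≤ (# (N (2 N.+ h))) _ _ (≤-tr (≤-tr (≤-re (ap (# (N (2 N.+ h)) N.+_) (len-bar (4 N.+ h)))) (Q.+-monoˡ-≤ (len (4 N.+ h)) (≤-tr (Q.m≤n+m _ (# (N h))) (Q.<⇒≤ lt'))))
   (≤-re (Q.+-comm (len (2 N.+ h)) (len (4 N.+ h)) ∙ ! (N-len (2 N.+ h)))))
  cut-off : (Σ Word \ m' -> A (3 N.+ h) == bar (4 N.+ h) ++ m' × A (2 N.+ h) == m' ++ N (2 N.+ h)) -> Split h
  cut-off (m' , _ , e) = both (olap≤ (N h) m' (leftN h ∙ ap (_++ bar h) e ∙ ++-as m' (N (2 N.+ h)) (bar h)) (Q.<⇒≤ N<m'))
   where
   N<m' : # (N h) < # m'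
   N<m' = Q.+-cancelʳ-< (# (N (2 N.+ h))) _ _ (≤-tr lt' (≤-re (ap # e ∙ #-++ m')))
   both : (Σ Word \ m -> m' == N h ++ m × A (1 N.+ h) == m ++ (N (2 N.+ h) ++ bar h)) -> Split h
   both (m , e' , _) = m , (\ z -> Q.<⇒≢ N<m' (! (ap # (e' ∙ ap (N h ++_) z) ∙ ap # (++-id (N h))))) , e ∙ ap (_++ N (2 N.+ h)) e' ∙ ++-as (N h) m (N (2 N.+ h))

 private
  oppo-left : ∀ h -> rev (N (6 N.+ h)) ++ bar (3 N.+ h) == bar (2 N.+ h) ++ A (4 N.+ h)
  oppo-left h = rev-≡ (((rev-++ (rev (N (6 N.+ h))) (bar (3 N.+ h)) ∙ (ap2 _++_ (rev-bar (3 N.+ h)) (rr (N (6 N.+ h))))) ∙ rightN (6 N.+ h) ∙ ap2 (\ x y -> rev x ++ y) (perio (4 N.+ h)) (! (rev-bar (2 N.+ h))) ∙ ! (rev-++ (bar (2 N.+ h)) (A (4 N.+ h)))))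

  oppo-right : ∀ h -> rev (N (4 N.+ h)) ++ bar (1 N.+ h) == bar h ++ A (2 N.+ h)
  oppo-right h = rev-≡ (((rev-++ (rev (N (4 N.+ h))) (bar (1 N.+ h)) ∙ (ap2 _++_ (rev-bar (1 N.+ h)) (rr (N (4 N.+ h))))) ∙ rightN (4 N.+ h) ∙ ap2 (\ x y -> rev x ++ y) (perio (2 N.+ h)) (! (rev-bar h)) ∙ ! (rev-++ (bar h) (A (2 N.+ h)))))

  E1 : ∀ h -> rev (N (6 N.+ h)) ++ A (2 N.+ h) == bar (2 N.+ h) ++ N (2 N.+ h)
  E1 h = I.++-cancelʳ (A (3 N.+ h)) _ _ ((((++-as (rev (N (6 N.+ h))) _ _) ∙ ap (rev (N (6 N.+ h)) ++_) (rel (2 N.+ h))) ∙ (! (++-as (rev (N (6 N.+ h))) _ _) ∙ ap (_++ bar (2 N.+ h)) (oppo-left h)) ∙ ((++-as (bar (2 N.+ h)) _ _) ∙ ap (bar (2 N.+ h) ++_) (! (leftN (2 N.+ h)))) ∙ ! (++-as (bar (2 N.+ h)) _ _)))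

  E2 : ∀ h -> N h ++ bar (2 N.+ h) == A (2 N.+ h) ++ rev (N (4 N.+ h))
  E2 h = I.++-cancelʳ (bar (1 N.+ h)) _ _ ((((++-as (N h) _ _) ∙ ap (N h ++_) (! (rel (1 N.+ h)))) ∙ (! (++-as (N h) _ _) ∙ ap (_++ A (2 N.+ h)) (leftN h)) ∙ ((++-as (A (2 N.+ h)) _ _) ∙ ap (A (2 N.+ h) ++_) (! (oppo-right h))) ∙ ! (++-as (A (2 N.+ h)) _ _)))

 private
  bar≡ : ∀ h (S : Split (4 N.+ h)) -> bar (2 N.+ h) == (rev (N (6 N.+ h)) ++ rev (fst S)) ++ rev (N (4 N.+ h))
  bar≡ h (m , _ , e) = ap rev e ∙ (rev-++ (N (4 N.+ h)) _) ∙ ap (_++ rev (N (4 N.+ h))) (rev-++ m (N (6 N.+ h)))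

  relₑ : ∀ h (S : Split h) (S' : Split (4 N.+ h)) -> N h ++ fst S == rev (N (4 N.+ h) ++ fst S')
  relₑ h (m , _ , A≡) S'@(m' , _) = (I.++-cancelˡ (rev (N (6 N.+ h))) _ _ (I.++-cancelʳ (N (2 N.+ h)) _ _ ((e1 (rev (N (6 N.+ h))) (N h) m (N (2 N.+ h)) ∙ ap (rev (N (6 N.+ h)) ++_) (! A≡) ∙ E1 h ∙ ap (_++ N (2 N.+ h)) (bar≡ h S' ∙ (++-as (rev (N (6 N.+ h))) _ _)))))) ∙ ! (rev-++ (N (4 N.+ h)) m')
   where
   e1 : ∀ a b c d -> (a ++ (b ++ c)) ++ d == a ++ (b ++ (c ++ d))
   e1 a b c d = solve words

  relₒ : ∀ h (S : Split h) (S' : Split (4 N.+ h)) -> fst S ++ N (2 N.+ h) == rev (fst S' ++ N (6 N.+ h))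
  relₒ h (m , _ , A≡) S'@(m' , _) = (I.++-cancelˡ (N h) _ _ (I.++-cancelʳ (rev (N (4 N.+ h))) _ _ ((ap (_++ rev (N (4 N.+ h))) (! A≡) ∙ ! (E2 h) ∙ ap (N h ++_) (bar≡ h S') ∙ ! (++-as (N h) _ _))))) ∙ ! (rev-++ m' (N (6 N.+ h)))

  odd≡ : ∀ h (S : Split h) -> A (3 N.+ h) == bar (4 N.+ h) ++ (N h ++ fst S)
  odd≡ h (m , _ , A≡) = I.++-cancelʳ (N (2 N.+ h)) _ _ (rightN (2 N.+ h) ∙ ap (bar (4 N.+ h) ++_) A≡ ∙ e1 (bar (4 N.+ h)) (N h) m (N (2 N.+ h)))
   where
   e1 : ∀ a b c d -> a ++ (b ++ (c ++ d)) == (a ++ (b ++ c)) ++ d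
   e1 a b c d = solve words

 module Ungrown (S0 : Split 0) (S2 : Split 2) (S4 : Split 4) (S6 : Split 6) where
  private
   A≡ : ∀ {h} (S : Split h) -> A (2 N.+ h) == N h ++ (fst S ++ N (2 N.+ h))
   A≡ S = snd (snd S)

   table' : ℕ -> Word
   table' 0 = N 4
   table' 1 = fst S4
   table' 2 = N 6
   table' 3 = fst S6
   table' 4 = N 0
   table' 5 = fst S0
   table' 6 = N 2
   table' _ = fst S2

   turn-over : ∀ {u v} -> u == rev v -> v == rev u
   turn-over {u} {v} e = ! (rr v) ∙ ap rev (! e)

   A-8 : A 8 == N 6 ++ (fst S6 ++ N 0)
   A-8 = A≡ S6 ∙ ap (\ z -> N 6 ++ (fst S6 ++ z)) (N-8 0)

   odd-word : ∀ h (S : Split h) x y z v w -> rev (x ++ (y ++ z)) == bar (4 N.+ h) -> N h ++ fst S == rev (w ++ v) -> rev z ++ (rev y ++ (rev x ++ (rev v ++ (rev w ++ [])))) == A (3 N.+ h)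
   odd-word h S x y z v w e e' = e1 (rev z) (rev y) (rev x) (rev v) (rev w) ∙ (ap2 _++_ (! (rev-++ x (y ++ z) ∙ ap (_++ rev x) (rev-++ y z)) ∙ e) (! (rev-++ w v) ∙ ! e')) ∙ ! (odd≡ h S)
    where
    e1 : ∀ a b c d e -> a ++ (b ++ (c ++ (d ++ (e ++ [])))) == ((a ++ b) ++ c) ++ (d ++ e)
    e1 a b c d e = solve words

  ungrown : Chn
  ungrown n = table' (n N.% 8)

  ungrown-chain : IsCh ungrown
  ungrown-chain = record { perio = \ n -> refl ; laced = inter ; nonem = \ n -> ne (n N.% 8) }
   where
   ne : ∀ n -> table' n != []
   ne 0 = Conj.N≢ (c 4)
   ne 1 = fst (snd (S4))
   ne 2 = Conj.N≢ (c 6)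
   ne 3 = fst (snd (S6))
   ne 4 = Conj.N≢ (c 0)
   ne 5 = fst (snd (S0))
   ne 6 = Conj.N≢ (c 2)
   ne (suc (suc (suc (suc (suc (suc (suc _))))))) = fst (snd (S2))
   r7 : fst S2 ++ N 4 == rev (fst S6 ++ N 0)
   r7 = relₒ 2 S2 S6 ∙ ap (\ z -> rev (fst S6 ++ z)) (N-8 0)
   inter : ∀ n -> ungrown n ++ ungrown (1 N.+ n) == rev (ungrown (4 N.+ n) ++ ungrown (5 N.+ n))
   inter 0 = turn-over (relₑ 0 S0 S4)
   inter 1 = turn-over (relₒ 0 S0 S4)
   inter 2 = turn-over (relₑ 2 S2 S6)
   inter 3 = turn-over r7
   inter 4 = relₑ 0 S0 S4
   inter 5 = relₒ 0 S0 S4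
   inter 6 = relₑ 2 S2 S6
   inter 7 = r7
   inter (suc (suc (suc (suc (suc (suc (suc (suc n)))))))) = inter n

  ungrown-lift : ∀ n -> lftd gSub ungrown n == trl 1 A n
  ungrown-lift = agree (\ n -> refl) (Perio-trl {A} 1 perio) (odd-word 6 S6 (N 4) (fst S4) (N 6) (fst S2) (N 2) (ap rev (! (A≡ S4)) ∙ ap rev (! (perio 6 ∙ refl))) (turn-over (relₑ 2 S2 S6)) ∙ perio 1)
   (three (N 0) (fst S0) (N 2) (A≡ S0)) (odd-word 0 S0 (N 6) (fst S6) (N 0) (fst S4) (N 4) (ap rev (! A-8)) (relₑ 0 S0 S4)) (three (N 2) (fst S2) (N 4) (A≡ S2))
   (odd-word 2 S2 (N 0) (fst S0) (N 2) (fst S6) (N 6) (ap rev (! (A≡ S0)) ∙ ap rev (! (perio 2))) (relₑ 2 S2 S6)) (three (N 4) (fst S4) (N 6) (A≡ S4))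
   (odd-word 4 S4 (N 2) (fst S2) (N 4) (fst S0) (N 0) (ap rev (! (A≡ S2)) ∙ ap rev (! (perio 4))) (turn-over (relₑ 0 S0 S4))) (three (N 6) (fst S6) (N 0) A-8)
   where
   three : ∀ {w} x y z -> w == x ++ (y ++ z) -> x ++ (y ++ (z ++ [])) == w
   three {w} x y z e = ap (\ t -> x ++ (y ++ t)) (++-id z) ∙ ! e

  ungrown-len : # (ungrown 0) N.+ (# (ungrown 1) N.+ (# (ungrown 2) N.+ # (ungrown 3))) < len 1 N.+ (len 2 N.+ (len 3 N.+ len 4))
  ungrown-len = ≤-tr (Q.+-mono-≤ (nonem-len (nonem 1)) (≤-tr (≤-tr (Q.m≤m+n _ (# (N 6) N.+ # (N 0))) (≤-re (alg (# (N 4)) (# (fst S4)) (# (N 6)) (# (fst S6)) (# (N 0)))))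
   (≤-re (! (ap2 N._+_ (size (N 4) (fst S4) (N 6) (! (len-4 2) ∙ ap # (A≡ S4))) (size (N 6) (fst S6) (N 0) (! (len-4 4) ∙ ap # A-8))))))) (Q.+-monoʳ-≤ (len 1) (Q.+-monoʳ-≤ (len 2) (Q.m≤n+m (len 4) (len 3))))
   where
   size : ∀ {k} x y z -> k == # (x ++ (y ++ z)) -> k == # x N.+ (# y N.+ # z)
   size x y z e = e ∙ #-++ x ∙ ap (# x N.+_) (#-++ y)
   alg : ∀ a b c d e -> (a N.+ (b N.+ (c N.+ d))) N.+ (c N.+ e) == (a N.+ (b N.+ c)) N.+ (c N.+ (d N.+ e))
   alg = ringN

open-uniq : ∀ p w -> (∀ x f' z -> w == x ++ (f' ++ z) -> z != [] -> vec f' == org -> f' == []) -> Unique (verts p w)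
open-uniq p [] h = []
open-uniq p (l :: w) h = later (p <> step l) w (\ f' z e z≢ c -> absurd (h [] (l :: f') z (ap (l ::_) e) z≢ (⊕-canˡ p (! (tip-vec p (l :: f')) ∙ ! c ∙ ! (⊕-idʳ p)))))
  :: open-uniq (p <> step l) w (\ x f' z e -> h (l :: x) f' z (ap (l ::_) e))
 where
 absurd : ∀ {f' : Word} -> l :: f' == [] -> ⊥
 absurd ()
 later : ∀ {Q : Cell -> Set} q w -> (∀ f' z -> w == f' ++ z -> z != [] -> Q (tip q f')) -> All Q (verts q w)
 later q [] k = []
 later q (m :: w) k = k [] (m :: w) refl (\ ()) :: later (q <> step m) w (\ f' z e -> k (m :: f') z (ap (m ::_) e))

greek-block : ∀ {α β X} -> α != [] -> β != [] -> Redcd X -> (∀ n -> X n == subst α β (grk n)) -> IsSimpleClosed (α ++ β ++ rev α ++ rev β)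
greek-block {α} {β} α≢ β≢ r e = closed' , long' , open-uniq org w open-factors
 where
 ᾱ β̄ w : Word
 ᾱ = rev α
 β̄ = rev β
 w = α ++ β ++ ᾱ ++ β̄
 r' : Redcd (\ n -> subst α β (grk n))
 r' = Redcd-resp e r
 open1 : Open (α ++ (β ++ ᾱ))
 open1 = Open-factor (α ++ β) _ β (tp Open (asc α β ᾱ) (Redcd.free r' 0))
  where
  asc : ∀ a b c -> (a ++ []) ++ ((b ++ (a ++ [])) ++ ((b ++ []) ++ ((c ++ (b ++ [])) ++ []))) == (a ++ b) ++ ((a ++ (b ++ c)) ++ b)
  asc a b c = solve words
 open2 : Open (β ++ (ᾱ ++ β̄))
 open2 = Open-factor (β ++ ᾱ) _ ᾱ (tp Open (asc β ᾱ β̄) (Redcd.free r' 2))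
  where
  asc : ∀ b c d -> (b ++ []) ++ ((c ++ (b ++ [])) ++ ((c ++ []) ++ ((d ++ (c ++ [])) ++ []))) == (b ++ c) ++ ((b ++ (c ++ d)) ++ c)
  asc b c d = solve words
 open3 : Open (β̄ ++ (α ++ β))
 open3 = Open-factor (β̄ ++ α) _ α (tp Open (asc β̄ α β) (Redcd.free r' 6))
  where
  asc : ∀ d a b -> (d ++ []) ++ ((a ++ (d ++ [])) ++ ((a ++ []) ++ ((b ++ (a ++ [])) ++ []))) == (d ++ a) ++ ((d ++ (a ++ b)) ++ a)
  asc d a b = solve words
 vec-loop : vec w == org
 vec-loop = (vec-++ α _) ∙ ap (vec α <>_) ((vec-++ β _) ∙ ap (vec β <>_) (vec-++ ᾱ β̄ ∙ (ap2 _<>_ (vec-rev α) (vec-rev β)))) ∙ alg (vec α) (vec β)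
  where
  alg : ∀ v u -> v <> (u <> (neg v <> neg u)) == org
  alg (a , b) (c , d) = ap2 _,_ (one a c) (one b d)
   where
   one : ∀ a c -> a + (c + (Z.- a + Z.- c)) == + 0
   one = ring
 closed' : tip org w == org
 closed' = tip-vec org w ∙ ⊕-idˡ (vec w) ∙ vec-loop
 long' : 3 ≤ # w
 long' = ≤-tr (Q.+-mono-≤ (nonem-len α≢) (Q.+-mono-≤ (nonem-len β≢) (≤-tr (≤-tr (nonem-len α≢) (≤-re (! (len-rev α)))) (Q.m≤m+n (# ᾱ) (# β̄))))) (≤-re (! (#-++ α ∙ ap (# α N.+_) (#-++ β ∙ ap (# β N.+_) (#-++ ᾱ)))))
 open-factors : ∀ x f' z -> w == x ++ (f' ++ z) -> z != [] -> vec f' == org -> f' == []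
 open-factors x f' z ew z≢ c = late (olap α x ew)
  where
  late : (Σ Word \ m -> x == α ++ m × β ++ (ᾱ ++ β̄) == m ++ (f' ++ z)) ⊎ (Σ Word \ m -> m != [] × α == x ++ m × f' ++ z == m ++ (β ++ (ᾱ ++ β̄))) -> f' == []
  late (inl (m , _ , h)) = open2 m f' z h c
  late (inr (m , _ , eα , _)) = early (olap (α ++ (β ++ ᾱ)) (x ++ f') (asc α β ᾱ β̄ ∙ ew ∙ ! (++-as x f' z)))
   where
   asc : ∀ a b c d -> (a ++ (b ++ c)) ++ d == a ++ (b ++ (c ++ d))
   asc a b c d = solve words
   early : (Σ Word \ n -> x ++ f' == (α ++ (β ++ ᾱ)) ++ n × β̄ == n ++ z) ⊎ (Σ Word \ n -> n != [] × α ++ (β ++ ᾱ) == (x ++ f') ++ n × z == n ++ β̄) -> f' == []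
   early (inr (n , _ , h , _)) = open1 x f' n (h ∙ ++-as x f' n) c
   -- The complement of f' is closed as well, and lies in the cyclic factor β⁻¹ α β.
   early (inl (n , _ , h)) = !! (z≢ (I.++-conicalˡ z x (open3 n (z ++ x) (m ++ β) (ap2 (\ s t -> s ++ (t ++ β)) h eα ∙ assoc' n z x m β) complement)))
    where
    assoc' : ∀ a b c d e -> (a ++ b) ++ ((c ++ d) ++ e) == a ++ ((b ++ c) ++ (d ++ e))
    assoc' a b c d e = solve words
    complement : vec (z ++ x) == org
    complement = vec-++ z x ∙ ⊕-comm (vec z) (vec x) ∙ ap (vec x <>_) (! (vec-++ f' z ∙ ap (_<> vec z) c ∙ ⊕-idˡ (vec z))) ∙ ! (vec-++ x (f' ++ z)) ∙ ap vec (! ew) ∙ vec-loop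

Deform : Chn -> Set
Deform A = Σ Word \ α -> Σ Word \ β -> α != [] × β != [] × IsSimpleClosed (α ++ β ++ rev α ++ rev β) × (Σ ℕ \ s -> Σ Chain \ C -> Descendant C × (∀ n -> A n == subst α β (chn C (s N.+ n))))

Deform-resp : ∀ {A B} -> (∀ n -> A n == B n) -> Deform B -> Deform A
Deform-resp e (α , β , a , b , k , s , C , d , h) = α , β , a , b , k , s , C , d , \ n -> e n ∙ h n

Deform-trl : ∀ m {A} -> Perio A -> Deform (trl m A) -> Deform A
Deform-trl m {A} per (α , β , a , b , k , s , C , d , h) = α , β , a , b , k , s N.+ 7 N.* m , C , d , \ n ->
 ! (perio-* per m n) ∙ ap A (alg m n) ∙ h (7 N.* m N.+ n) ∙ ap (\ z -> subst α β (chn C z)) (! (Q.+-assoc s (7 N.* m) n))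
 where
 alg : ∀ m n -> n N.+ m N.* 8 == m N.+ (7 N.* m N.+ n)
 alg = ringN

chn-mod : ∀ C s n -> chn C (s N.+ n) == chn C (s N.% 8 N.+ n)
chn-mod C s n = ap (chn C) (Q.+-comm s n) ∙ mod8 {A = trl n (chn C)} (Perio-trl {chn C} n (\ n -> refl)) s ∙ ap (chn C) (Q.+-comm n (s N.% 8))

lift-deform : ∀ (φ : ℕ -> Frm) -> (∀ {C} -> Descendant C -> ∀ s -> Σ Chain \ C' -> Descendant C' × (∀ n -> lftd φ (trl (s N.% 8) (chn C)) n == chn C' (s N.% 8 N.+ n))) ->
        ∀ {X} -> Deform X -> Deform (lftd φ X)
lift-deform φ lifts {X} (α , β , a , b , k0 , s , C , d , h) with lifts d s
... | C' , d' , h' = α , β , a , b , k0 , s N.% 8 , C' , d' , \ n ->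
 ⟦⟧-cong (\ k -> h k ∙ ap (subst α β) (chn-mod C s k)) (φ n) ∙ ⟦⟧-subst α β (trl (s N.% 8) (chn C)) (φ n) ∙ ap (subst α β) (h' n)

f-deform : ∀ {X} -> Deform X -> Deform (lftd fSub X)
f-deform = lift-deform fSub \ {C} d s -> eight (\ s -> Σ Chain \ C' -> Descendant C' × (∀ n -> lftd fSub (trl s (chn C)) n == chn C' (s N.+ n)))
 (f i0 C , byF i0 d , \ n -> ! (f-lifted0 C n)) (f i1 C , byF i1 d , \ n -> ! (f-lifted1 C n)) (f i2 C , byF i2 d , \ n -> ! (f-lifted2 C n)) (f i3 C , byF i3 d , \ n -> ! (f-lifted3 C n))
 (f i0 C , byF i0 d , further C 0 (f i0 C) (f-lifted0 C)) (f i1 C , byF i1 d , further C 1 (f i1 C) (f-lifted1 C)) (f i2 C , byF i2 d , further C 2 (f i2 C) (f-lifted2 C)) (f i3 C , byF i3 d , further C 3 (f i3 C) (f-lifted3 C)) s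
 where
 further : ∀ C s C' -> (∀ n -> trl s (chn C') n == lftd fSub (trl s (chn C)) n) -> ∀ n -> lftd fSub (trl (4 N.+ s) (chn C)) n == chn C' (4 N.+ s N.+ n)
 further C s C' h n = ⟦⟧-cong (\ k -> ap (chn C) (swap4 s k)) (fSub n) ∙ ! (f-trl {trl s (chn C)} (Perio-trl {chn C} s (\ n -> refl)) n) ∙ ! (h (4 N.+ n)) ∙ ap (chn C') (! (swap4 s n))
  where
  swap4 : ∀ s k -> 4 N.+ s N.+ k == s N.+ (4 N.+ k)
  swap4 = ringN

g-deform : ∀ {X} -> Deform X -> Deform (lftd gSub X)
g-deform = lift-deform gSub \ {C} d s -> eight (\ s -> Σ Chain \ C' -> Descendant C' × (∀ n -> lftd gSub (trl s (chn C)) n == chn C' (s N.+ n)))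
 (gOdd C , byOdd d , at0 C) (gEven C , byEven d , at1 C) (gOdd C , byOdd d , at2 C) (gEven C , byEven d , at3 C) (gOdd C , byOdd d , at₄ C) (gEven C , byEven d , at5 C) (gOdd C , byOdd d , further C 4 (gOdd C) (at₄ C)) (gEven C , byEven d , further C 5 (gEven C) (at5 C)) s
 where
 Lifts : Chain -> ℕ -> Chain -> Set
 Lifts C s C' = ∀ n -> lftd gSub (trl s (chn C)) n == chn C' (s N.+ n)
 further : ∀ C s C' -> Lifts C s C' -> Lifts C (2 N.+ s) C'
 further C s C' h n = ⟦⟧-cong (\ k -> ap (chn C) (swap2 s k)) (gSub n) ∙ ! (g-trl {trl s (chn C)} (Perio-trl {chn C} s (\ n -> refl)) n) ∙ h (2 N.+ n) ∙ ap (chn C') (! (swap2 s n))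
  where
  swap2 : ∀ s k -> 2 N.+ s N.+ k == s N.+ (2 N.+ k)
  swap2 = ringN
 at0 : ∀ C -> Lifts C 0 (gOdd C)
 at0 C n = ! (gOdd-lftd C n)
 at1 : ∀ C -> Lifts C 1 (gEven C)
 at1 C n = ! (gEven-lftd C n)
 at2 : ∀ C -> Lifts C 2 (gOdd C)
 at2 C = further C 0 (gOdd C) (at0 C)
 at3 : ∀ C -> Lifts C 3 (gEven C)
 at3 C = further C 1 (gEven C) (at1 C)
 at₄ : ∀ C -> Lifts C 4 (gOdd C)
 at₄ C = further C 2 (gOdd C) (at2 C)
 at5 : ∀ C -> Lifts C 5 (gEven C)
 at5 C = further C 3 (gEven C) (at3 C)

total : Chn -> ℕ
total A = # (A 0) N.+ (# (A 1) N.+ (# (A 2) N.+ # (A 3)))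

total-trl : ∀ {A} -> IsCh A -> ∀ m -> total (trl m A) == total A
total-trl {A} ch zero = refl
total-trl {A} ch (suc m) = total-trl (IsChain-suc ch) m ∙ ap (\ z -> # (A 1) N.+ (# (A 2) N.+ (# (A 3) N.+ z))) (ChainFacts.len-4 ch 0) ∙ alg (# (A 1)) (# (A 2)) (# (A 3)) (# (A 0))
 where
 alg : ∀ a b c d -> a N.+ (b N.+ (c N.+ d)) == d N.+ (a N.+ (b N.+ c))
 alg = ringN

private
 double-bound : ∀ {n0 n2 a b c d e} -> n0 N.+ a == b N.+ c -> n2 N.+ d == c N.+ b -> (b N.+ c) N.+ (b N.+ c) < e N.+ (a N.+ d) -> n0 N.+ n2 < e
 double-bound {n0} {n2} {a} {b} {c} {d} {e} h1 h2 h = Q.+-cancelʳ-< (a N.+ d) _ _ (≤-tr (≤-re (ap suc (alg n0 n2 a d ∙ (ap2 N._+_ h1 (h2 ∙ Q.+-comm c b))))) h)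
  where
  alg : ∀ w x y z -> (w N.+ x) N.+ (y N.+ z) == (w N.+ y) N.+ (x N.+ z)
  alg = ringN

module Untrimmable {A : Chn} (r : Redcd A) (short : ∀ i -> # (A (1 N.+ i)) < # (A (2 N.+ i)) N.+ # (A i)) (even≤odd : # (A 2) N.+ # (A 4) ≤ # (A 1) N.+ # (A 3)) where
 open Reduce r

 conjs : ∀ i -> Conj i
 conjs i with trim-or-conjugator i
 ... | inr c = c
 ... | inl T = !! (Q.<⇒≱ (short i) (≤-tr (Q.+-monoʳ-≤ (len (2 N.+ i)) (Q.m≤n+m (len i) (# (fst T)))) (≤-re (! (trim-len i T)))))

 open GInverse r conjs

 private
  N-size : ∀ i -> # (N i) N.+ len (1 N.+ i) == len (2 N.+ i) N.+ len i
  N-size i = len-++-≡ (N i) (A (1 N.+ i)) (A (2 N.+ i)) (bar i) (Conj.leftN (conjs i)) ∙ ap (len (2 N.+ i) N.+_) (len-bar i)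

  N-4 : ∀ i -> # (N (4 N.+ i)) == # (N i)
  N-4 i = Q.+-cancelʳ-≡ (len (1 N.+ i)) _ _ (ap (# (N (4 N.+ i)) N.+_) (! (len-4 (1 N.+ i))) ∙ N-size (4 N.+ i) ∙ (ap2 N._+_ (len-4 (2 N.+ i)) (len-4 i)) ∙ ! (N-size i))

  short1 : len 1 < len 2 N.+ len 4
  short1 = tp (\ z -> len 1 < len 2 N.+ z) (! (len-4 0)) (short 0)
  short3 : len 3 < len 2 N.+ len 4
  short3 = tp (\ z -> len 3 < z) (Q.+-comm (len 4) (len 2)) (short 2)

  split0 : # (N 0) N.+ # (N 2) < len 2
  split0 = double-bound {a = len 1} {b = len 2} {c = len 4} {d = len 3} (N-size 0 ∙ ap (len 2 N.+_) (! (len-4 0))) (N-size 2) (centre-inequality r short1 short3 even≤odd)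

  split2 : # (N 2) N.+ # (N 4) < len 4
  split2 = double-bound {a = len 3} {b = len 4} {c = len 2} {d = len 1} (N-size 2) ((ap2 N._+_ (N-4 0) refl) ∙ N-size 0 ∙ ap (len 2 N.+_) (! (len-4 0)))
   (tp (\ z -> z) (ap2 (\ x y -> (len 4 N.+ x) N.+ (len 4 N.+ x) < len 4 N.+ (len 3 N.+ y)) (len-4 2) (len-4 1))
   (centre-inequality (Redcd-trl 2 r) (tp (\ z -> z) (ap (\ x -> len 3 < len 4 N.+ x) (! (len-4 2))) (short 2)) (tp (\ z -> z) (ap2 (\ x y -> x < len 4 N.+ y) (! (len-4 1)) (! (len-4 2))) (≤-tr short1 (≤-re (Q.+-comm (len 2) (len 4)))))
   (tp (\ z -> z) (ap2 N._≤_ (Q.+-comm (len 2) (len 4) ∙ ap (len 4 N.+_) (! (len-4 2))) (Q.+-comm (len 1) (len 3) ∙ ap (len 3 N.+_) (! (len-4 1)))) even≤odd)))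

  next-split : ∀ h -> # (N h) N.+ # (N (2 N.+ h)) < len (2 N.+ h) -> # (N (4 N.+ h)) N.+ # (N (6 N.+ h)) < len (6 N.+ h)
  next-split h l = tp (\ z -> z) (! (ap2 N._<_ (ap2 N._+_ (N-4 h) (N-4 (2 N.+ h))) (len-4 (2 N.+ h)))) l

 open Ungrown (split 0 split0) (split 2 split2) (split 4 (next-split 0 split0)) (split 6 (next-split 2 split2))

 ungrowth : Σ Chn \ X -> IsCh X × (∀ n -> lftd gSub X n == trl 1 A n) × total X < total A
 ungrowth = ungrown , ungrown-chain , ungrown-lift , ≤-tr ungrown-len (≤-re (total-trl chain 1))

redcd-deform : ∀ n {A} -> Redcd A -> total A ≤ n -> Deform A
redcd-deform zero {A} r h = !! (Q.<⇒≱ (nonem-len (Reduce.nonem r 0)) (≤-tr (Q.m≤m+n (# (A 0)) _) h))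
redcd-deform (suc n) {A} r h = examine (trim-or-conjugator 0) (trim-or-conjugator 1) (trim-or-conjugator 2) (trim-or-conjugator 3)
 where
 open Reduce r

 strict-trim : ∀ i (T : Trim i) -> fst T != [] -> Deform A
 strict-trim i T t≢ = Deform-trl (1 N.+ i) {A} perio (Deform-resp {trl (1 N.+ i) A} {lftd fSub K.trimmed} (\ k -> ! (K.trimmed-lift k)) (f-deform {K.trimmed} (redcd-deform n {K.trimmed}
  (f-redcd {K.trimmed} (K.trimmed-chain t≢) (Redcd-resp {trl (1 N.+ i) A} {lftd fSub K.trimmed} (\ k -> ! (K.trimmed-lift k)) (Redcd-trl (1 N.+ i) r))) (Q.≤-pred (≤-tr smaller h)))))
  where
  T' : Trim (4 N.+ i)
  T' = trim-oppo i T
  module K = Trimmed i T T'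
  smaller : total K.trimmed < total A
  smaller = ≤-tr (Q.+-monoˡ-< _ (≤-tr (≤-tr (≤-re (ap suc (len-rev (fst T') ∙ trim-lengths i T T'))) (≤-tr (Q.m<m+n (# (fst T)) (nonem-len (nonem i))) (Q.m≤n+m _ (len (2 N.+ i)))))
   (≤-re (! (trim-len i T) ∙ ap (\ z -> # (A (1 N.+ z))) (! (Q.+-identityʳ i)))))) (≤-re (total-trl chain (1 N.+ i)))

 any-trim : ∀ i -> Trim i -> Deform A
 any-trim i (x :: t , e) = strict-trim i (x :: t , e) \ ()
 any-trim i ([] , e) = settle (Flat.flat-case r i ([] , e) (trim-oppo i ([] , e)) refl)
  where
  settle : (∀ k -> trl (2 N.+ i) A k == subst (A (2 N.+ i)) (A (4 N.+ i)) (grk k)) ⊎ (Σ (Trim (2 N.+ i)) \ T -> fst T != []) -> Deform A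
  settle (inr (T2 , t≢)) = strict-trim (2 N.+ i) T2 t≢
  settle (inl g) = Deform-trl (2 N.+ i) {A} perio (A (2 N.+ i) , A (4 N.+ i) , nonem (2 N.+ i) , nonem (4 N.+ i) , greek-block (nonem (2 N.+ i)) (nonem (4 N.+ i)) (Redcd-trl (2 N.+ i) r) g , 0 , greek , base , g)

 examine : Trim 0 ⊎ Conj 0 -> Trim 1 ⊎ Conj 1 -> Trim 2 ⊎ Conj 2 -> Trim 3 ⊎ Conj 3 -> Deform A
 examine (inl T) _ _ _ = any-trim 0 T
 examine (inr _) (inl T) _ _ = any-trim 1 T
 examine (inr _) (inr _) (inl T) _ = any-trim 2 T
 examine (inr _) (inr _) (inr _) (inl T) = any-trim 3 T
 examine (inr c0') (inr c1') (inr c2') (inr c3') = compare (Q.≤-total (len 2 N.+ len 4) (len 1 N.+ len 3))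
  where
  Short : ℕ -> Set
  Short i = len (1 N.+ i) < len (2 N.+ i) N.+ len i
  from : ∀ i -> Conj i -> Short i
  from i c = ≤-tr (Q.m<m+n (len (1 N.+ i)) (nonem-len (Conj.N≢ c))) (≤-re (len-++-≡ (A (1 N.+ i)) (Conj.N c) (bar (2 N.+ i)) (A i) (Conj.rightN c) ∙ ap (N._+ len i) (len-bar (2 N.+ i))))
  short : ∀ i -> Short i
  short 0 = from 0 c0'
  short 1 = from 1 c1'
  short 2 = from 2 c2'
  short 3 = from 3 c3'
  short (suc (suc (suc (suc i)))) = tp (\ z -> z) (! (ap2 N._<_ (len-4 (1 N.+ i)) (ap2 N._+_ (len-4 (2 N.+ i)) (len-4 i)))) (short i)
  ungrow : ∀ {B} (rB : Redcd B) -> (∀ i -> # (B (1 N.+ i)) < # (B (2 N.+ i)) N.+ # (B i)) -> # (B 2) N.+ # (B 4) ≤ # (B 1) N.+ # (B 3) -> total B ≤ suc n -> Deform B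
  ungrow {B} rB sB le hB = settle (Untrimmable.ungrowth rB sB le)
   where
   settle : (Σ Chn \ X -> IsCh X × (∀ k -> lftd gSub X k == trl 1 B k) × total X < total B) -> Deform B
   settle (X , chX , e , l) = Deform-trl 1 {B} (IsCh.perio (Redcd.chain rB)) (Deform-resp {trl 1 B} {lftd gSub X} (\ k -> ! (e k)) (g-deform {X} (redcd-deform n {X}
    (g-redcd {X} chX (Redcd-resp {trl 1 B} {lftd gSub X} (\ k -> ! (e k)) (Redcd-trl 1 rB))) (Q.≤-pred (≤-tr l hB)))))
  compare : len 2 N.+ len 4 ≤ len 1 N.+ len 3 ⊎ len 1 N.+ len 3 ≤ len 2 N.+ len 4 -> Deform A
  compare (inl le) = ungrow {A} r short le h
  compare (inr le) = Deform-trl 1 {A} perio (ungrow {trl 1 A} (Redcd-trl 1 r) (\ i -> short (1 N.+ i)) (≤-tr (≤-re (ap (len 3 N.+_) (len-4 1) ∙ Q.+-comm (len 3) (len 1))) le) (≤-tr (≤-re (total-trl chain 1)) h))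

sumOf : ∀ {X : Set} -> (X -> ℤ) -> List X -> ℤ
sumOf g [] = + 0
sumOf g (x :: xs) = g x + sumOf g xs

sumOf-↭ : ∀ {X : Set} (g : X -> ℤ) {xs ys} -> xs ↭ ys -> sumOf g xs == sumOf g ys
sumOf-↭ g ↭.refl = refl
sumOf-↭ g (↭.prep x e) = ap (\ z -> g x + z) (sumOf-↭ g e)
sumOf-↭ g (↭.swap {xs} {ys} x y e) = ap (\ z -> g x + (g y + z)) (sumOf-↭ g e) ∙ alg (g x) (g y) (sumOf g ys)
 where
 alg : ∀ a b c -> a + (b + c) == b + (a + c)
 alg = ring
sumOf-↭ g (↭.trans e e') = sumOf-↭ g e ∙ sumOf-↭ g e'

self-neg : ∀ a -> a == Z.- a -> a == + 0
self-neg (+ zero) _ = refl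
self-neg (+ suc n) ()
self-neg -[1+ n ] ()

cancelling : ∀ {X : Set} (g : X -> ℤ) (ι : X -> X) (xs : List X) -> Unique xs -> (∀ z -> ι (ι z) == z) -> (∀ {z} -> z ∈ xs -> ι z ∈ xs) -> (∀ {z} -> z ∈ xs -> g (ι z) == Z.- g z) -> sumOf g xs == + 0
cancelling g ι xs uq inv² closed anti = self-neg (sumOf g xs) (sumOf-↭ g (∼bag⇒↭ (unique∧set⇒bag uq (UP.map⁺ injective uq) (mk⇔ to from))) ∙ negated xs anti)
 where
 injective : ∀ {x y} -> ι x == ι y -> x == y
 injective {x} {y} e = ! (inv² x) ∙ ap ι e ∙ inv² y
 to : ∀ {z} -> z ∈ xs -> z ∈ map ι xs
 to {z} m = tp (_∈ map ι xs) (inv² z) (∈-map⁺ ι (closed m))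
 from : ∀ {z} -> z ∈ map ι xs -> z ∈ xs
 from m with ∈-map⁻ ι m
 ... | _ , m' , refl = closed m'
 negated : ∀ ys -> (∀ {z} -> z ∈ ys -> g (ι z) == Z.- g z) -> sumOf g (map ι ys) == Z.- sumOf g ys
 negated [] h = refl
 negated (y :: ys) h = (ap2 Z._+_ (h (hit refl)) (negated ys \ m -> h (miss m))) ∙ ! (Y.neg-distrib-+ (g y) (sumOf g ys))

neg-self : ∀ {v} -> v == neg v -> v == org
neg-self {a , b} e = ap2 _,_ (self-neg a (ap fst e)) (self-neg b (ap snd e))

neg-double : ∀ {v} -> v == neg (v <> v) -> v == org
neg-double {a , b} e = ap2 _,_ (one a (ap fst e)) (one b (ap snd e))
 where
 one : ∀ a -> a == Z.- (a + a) -> a == + 0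
 one (+ zero) _ = refl
 one (+ suc n) ()
 one -[1+ n ] ()

walk : (Q : Cell -> Set) -> (∀ c l -> Q c -> Q (c <> step l)) -> ∀ c d -> Q c -> Q d
walk Q next' (a , b) (c , d) h = line (\ z -> Q (c , z)) (\ z k -> tp Q (ap2 _,_ (+0 c) refl) (next' (c , z) U k)) (\ z k -> tp Q (ap2 _,_ (+0 c) refl) (next' (c , z) D k)) b d
 (line (\ z -> Q (z , b)) (\ z k -> tp Q (ap2 _,_ refl (+0 b)) (next' (z , b) R k)) (\ z k -> tp Q (ap2 _,_ refl (+0 b)) (next' (z , b) L k)) a c h)
 where
 line : (Z : ℤ -> Set) -> (∀ z -> Z z -> Z (z + + 1)) -> (∀ z -> Z z -> Z (z + -[1+ 0 ])) -> ∀ i j -> Z i -> Z j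
 line Z inc dec i j h = tp Z (alg i j) (by (j Z.- i))
  where
  alg : ∀ i j -> i + (j Z.- i) == j
  alg = ring
  alg₊ : ∀ i n -> (i + n) + + 1 == i + (+ 1 + n)
  alg₊ = ring
  alg₋ : ∀ i n -> (i Z.- n) + -[1+ 0 ] == i Z.- (+ 1 + n)
  alg₋ = ring
  rise : ∀ n -> Z (i + + n)
  rise zero = tp Z (! (+0 i)) h
  rise (suc n) = tp Z (alg₊ i (+ n)) (inc _ (rise n))
  fall : ∀ n -> Z (i Z.- + n)
  fall zero = tp Z (! (+0 i)) h
  fall (suc n) = tp Z (alg₋ i (+ n)) (dec _ (fall n))
  by : ∀ k -> Z (i + k)
  by (+ n) = rise n
  by -[1+ n ] = fall (suc n)

edge-between : ∀ d l -> Σ Cell \ q -> Σ Ltr \ m -> lcell q m == d × rcell q m == d <> step l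
edge-between (a , b) R = (a + + 1 , b) , U , ap2 _,_ (alg a) refl , ap2 _,_ refl (! (+0 b))
 where
 alg : ∀ a -> (a + + 1) Z.- + 1 == a
 alg = ring
edge-between (a , b) U = (a + + 1 , b + + 1) , L , ap2 _,_ (alg a) (alg b) , ap2 _,_ (alg a ∙ ! (+0 a)) refl
 where
 alg : ∀ a -> (a + + 1) Z.- + 1 == a
 alg = ring
edge-between (a , b) L = (a , b + + 1) , D , ap2 _,_ refl (alg b) , ap2 _,_ refl (alg b ∙ ! (+0 b))
 where
 alg : ∀ a -> (a + + 1) Z.- + 1 == a
 alg = ring
edge-between (a , b) D = (a , b) , R , refl , ap2 _,_ (! (+0 a)) refl

right-step : ∀ q l -> rcell q l == lcell q l <> step (trght l)
right-step (a , b) R = ap2 _,_ (! (+0 a)) refl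
right-step (a , b) U = ap2 _,_ (alg a) (! (+0 b))
 where
 alg : ∀ a -> a == (a Z.- + 1) + + 1
 alg = ring
right-step (a , b) L = ap2 _,_ (! (+0 (a Z.- + 1))) (alg b)
 where
 alg : ∀ a -> a == (a Z.- + 1) + + 1
 alg = ring
right-step (a , b) D = ap2 _,_ refl (! (+0 (b Z.- + 1)))

module _ where
 straight-right : ∀ q l -> rcell (q <> step l) l == rcell q l <> step l
 straight-right q l = lcell-⊕ q (step l) (trght l)
 turnRight² : ∀ l -> trght (trght l) == inv l
 turnRight² R = refl
 turnRight² U = refl
 turnRight² L = refl
 turnRight² D = refl
 turn-left-one : ∀ l -> turn l (tleft l) == + 1
 turn-left-one R = refl
 turn-left-one U = refl
 turn-left-one L = refl
 turn-left-one D = refl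
 turn-reverse : ∀ x l -> l != inv x -> turn (inv l) (inv x) == Z.- turn x l
 turn-reverse R R _ = refl
 turn-reverse R U _ = refl
 turn-reverse R D _ = refl
 turn-reverse R L n = !! (n refl)
 turn-reverse U R _ = refl
 turn-reverse U U _ = refl
 turn-reverse U L _ = refl
 turn-reverse U D n = !! (n refl)
 turn-reverse L L _ = refl
 turn-reverse L U _ = refl
 turn-reverse L D _ = refl
 turn-reverse L R n = !! (n refl)
 turn-reverse D R _ = refl
 turn-reverse D D _ = refl
 turn-reverse D L _ = refl
 turn-reverse D U n = !! (n refl)
 true≢false : ∀ {x} -> x == true -> x == false -> ⊥
 true≢false refl ()
 not-true : ∀ {x} -> (x == true -> ⊥) -> x == false
 not-true {true} h = !! (h refl)
 not-true {false} h = refl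
 xor-tf : ∀ {x y} -> x == true -> y == false -> x xor y == true
 xor-tf refl refl = refl
 xor-ft : ∀ {x y} -> x == false -> y == true -> x xor y == true
 xor-ft refl refl = refl
 re-base : ∀ c u u' -> (c <> neg u) <> neg (u' <> neg u) == c <> neg u'
 re-base (a , b) (c , d) (e , f') = ap2 _,_ (alg a c e) (alg b d f')
  where
  alg : ∀ a c e -> (a + Z.- c) + Z.- (e + Z.- c) == a + Z.- e
  alg = ring
 minus-plus : ∀ u v -> (u <> neg v) <> v == u
 minus-plus u v = ⊕-swap u (neg v) v ∙ ⊕-can u v

module FourNeighbours {P : Shape} {a b : Cell} (tiled : IsLatticeTiling P a b) (four : HasFourNeighbours P a b org) where
 private
  covers = fst (snd tiled)
  single = snd (snd tiled)
  vs : Fin 4 -> Cell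
  vs = fst four

 abstract
  owner : Cell -> Cell
  owner c = fst (covers c)

  owner-in : ∀ c -> InL a b (owner c)
  owner-in c = fst (snd (covers c))

  owner-tile : ∀ c -> P (c <> neg (owner c)) == true
  owner-tile c = snd (snd (covers c))

 owner-≡ : ∀ {c u} -> InL a b u -> P (c <> neg u) == true -> owner c == u
 owner-≡ {c} {u} i t = single c (owner c) u (owner-in c) i (owner-tile c) t

 owner-org : ∀ {c} -> P c == true -> owner c == org
 owner-org {c} t = owner-≡ InL-org (ap P (⊕-idʳ c) ∙ t)

 S : Cell -> Set
 S u = Σ (Fin 4) \ i -> vs i == u

 adjacent : ∀ c l -> owner c != owner (c <> step l) -> S (owner (c <> step l) <> neg (owner c))
 adjacent c l ne = go (edge-between (c <> neg u) l)
  where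
  u u' t : Cell
  u = owner c
  u' = owner (c <> step l)
  t = u' <> neg u
  here-in : P (c <> neg u) == true
  here-in = owner-tile c
  there-out : P ((c <> neg u) <> step l) == false
  there-out = not-true \ h -> ne (! (owner-≡ (owner-in c) (ap P (⊕-swap c (step l) (neg u)) ∙ h)))
  here-out : P ((c <> neg u) <> neg t) == false
  here-out = not-true \ h -> ne (owner-≡ (owner-in (c <> step l)) (ap P (! (re-base c u u')) ∙ h))
  there-in : P (((c <> neg u) <> step l) <> neg t) == true
  there-in = ap P (ap (_<> neg t) (⊕-swap c (neg u) (step l)) ∙ re-base (c <> step l) u u') ∙ owner-tile (c <> step l)
  go : (Σ Cell \ q -> Σ Ltr \ m -> lcell q m == c <> neg u × rcell q m == (c <> neg u) <> step l) -> S t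
  go (q , m , e , e') = snd (snd (snd four)) t (InL-⊕ (owner-in (c <> step l)) (InL-neg (owner-in c))) (\ z -> ne (! (! (minus-plus u' u) ∙ ap (_<> u) z ∙ ⊕-idˡ u)))
   (edgeAt q m , Bd-bdary (Tile P org) q m (xor-tf (ap P (⊕-idʳ (lcell q m) ∙ e) ∙ here-in) (ap P (⊕-idʳ (rcell q m) ∙ e') ∙ there-out))
   , Bd-bdary (Tile P t) q m (xor-ft (ap (\ z -> P (z <> neg t)) e ∙ here-out) (ap (\ z -> P (z <> neg t)) e' ∙ there-in)))

 spans : ∀ {s t} -> (∀ i -> InL s t (vs i)) -> ∀ u -> InL a b u -> InL s t u
 spans {s} {t} h u i = tp (InL s t) (owner-≡ i (ap P (⊕-can c u) ∙ owner-tile org)) (walk (\ d -> InL s t (owner d)) next' c (c <> u) (tp (InL s t) (! (owner-org (owner-tile org))) InL-org))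
  where
  c : Cell
  c = org <> neg (owner org)
  next' : ∀ d l -> InL s t (owner d) -> InL s t (owner (d <> step l))
  next' d l k with owner d ≟ᶜ owner (d <> step l)
  ... | yes e = tp (InL s t) e k
  ... | no n with adjacent d l n
  ... | j , e = tp (InL s t) (minus-plus (owner (d <> step l)) (owner d)) (InL-⊕ (tp (InL s t) e (h j)) k)

 rank-two : ∀ {s} -> (∀ i -> InL s s (vs i)) -> ⊥
 rank-two {s} h = dependent (spans h a InL-fst) (spans h b InL-snd)
  where
  dependent : InL s s a -> InL s s b -> ⊥
  dependent (m , n , e) (m' , n' , e') = fst tiled (ap2 det e e' ∙ alg m n m' n' (fst s) (snd s))
   where
   alg : ∀ m n m' n' x y -> (m * x + n * x) * (m' * y + n' * y) Z.- (m * y + n * y) * (m' * x + n' * x) == + 0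
   alg = ring

 module _ where
  fill : (t : Fin 4 -> Cell) -> (∀ i j -> t i == t j -> i == j) -> (∀ i -> S (t i)) -> ∀ k -> Σ (Fin 4) \ j -> t j == vs k
  fill t inj h k with pigeonhole (Q.n<1+n 4) index
   where
   index : Fin 5 -> Fin 4
   index i0 = k
   index (F.suc i) = fst (h i)
  ... | i0 , F.suc j , _ , e = j , ! (snd (h j)) ∙ ap vs (! e)
  ... | F.suc i , F.suc j , N.s≤s l , e = !! (FP.<⇒≢ l (inj i j (! (snd (h i)) ∙ ap vs e ∙ snd (h j))))
  ... | F.suc i , i0 , () , e
  ... | i0 , i0 , () , e

  too-few : (t : Fin 3 -> Cell) -> (∀ k -> Σ (Fin 3) \ j -> t j == vs k) -> ⊥
  too-few t h with pigeonhole (Q.n<1+n 3) (\ k -> fst (h k))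
  ... | i , j , l , e = FP.<⇒≢ l (fst (snd (snd four)) i j (! (snd (h i)) ∙ ap t e ∙ snd (h j)))

  four-of : Cell -> Cell -> Cell -> Cell -> Fin 4 -> Cell
  four-of x y z w i0 = x
  four-of x y z w i1 = y
  four-of x y z w i2 = z
  four-of x y z w i3 = w

  four-inj : ∀ {x y z w} -> x != y -> x != z -> x != w -> y != z -> y != w -> z != w -> ∀ i j -> four-of x y z w i == four-of x y z w j -> i == j
  four-inj a b c d e f' i0 i0 h = refl
  four-inj a b c d e f' i0 i1 h = !! (a h)
  four-inj a b c d e f' i0 i2 h = !! (b h)
  four-inj a b c d e f' i0 i3 h = !! (c h)
  four-inj a b c d e f' i1 i0 h = !! (a (! h))
  four-inj a b c d e f' i1 i1 h = refl
  four-inj a b c d e f' i1 i2 h = !! (d h)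
  four-inj a b c d e f' i1 i3 h = !! (e h)
  four-inj a b c d e f' i2 i0 h = !! (b (! h))
  four-inj a b c d e f' i2 i1 h = !! (d (! h))
  four-inj a b c d e f' i2 i2 h = refl
  four-inj a b c d e f' i2 i3 h = !! (f' h)
  four-inj a b c d e f' i3 i0 h = !! (c (! h))
  four-inj a b c d e f' i3 i1 h = !! (e (! h))
  four-inj a b c d e f' i3 i2 h = !! (f' (! h))
  four-inj a b c d e f' i3 i3 h = refl

  four-all : ∀ {x y z w} {Q : Cell -> Set} -> Q x -> Q y -> Q z -> Q w -> ∀ i -> Q (four-of x y z w i)
  four-all a b c d i0 = a
  four-all a b c d i1 = b
  four-all a b c d i2 = c
  four-all a b c d i3 = d

 label : Cell -> Ltr -> Cell
 label q l = owner (rcell q l)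

 Const : Cell -> Cell -> Word -> Set
 Const v q [] = ⊤
 Const v q (l :: w) = label q l == v × Const v (q <> step l) w

 Const-edge : ∀ {v q} w {r m} -> Const v q w -> EOf q w r m -> label r m == v
 Const-edge (l :: w) (e , _) ([] , t , refl , refl) = e
 Const-edge (l :: w) (_ , h) (x :: s , t , refl , refl) = Const-edge w h (s , t , refl , refl)

 changes : Cell -> Cell -> Word -> ℕ
 changes v q [] = 0
 changes v q (l :: w) with label q l ≟ᶜ v
 ... | yes _ = changes (label q l) (q <> step l) w
 ... | no _ = suc (changes (label q l) (q <> step l) w)

 no-change : ∀ v q w -> changes v q w == 0 -> Const v q w
 no-change v q [] _ = tt
 no-change v q (l :: w) e with label q l ≟ᶜ v
 no-change v q (l :: w) e | yes h = h , tp (\ z -> Const z (q <> step l) w) h (no-change (label q l) (q <> step l) w e)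
 no-change v q (l :: w) () | no _

 Cut : ℕ -> Cell -> Cell -> Word -> Set
 Cut k v q w = Σ Word \ B -> Σ Ltr \ l -> Σ Word \ w' -> w == B ++ (l :: w') × Const v q B × label (tip q B) l != v × changes (label (tip q B) l) (tip q B <> step l) w' == k

 cut-at : ∀ k v q w -> changes v q w == suc k -> Cut k v q w
 cut-at k v q (l :: w) e with label q l ≟ᶜ v
 ... | no n = [] , l , w , refl , tt , n , Q.suc-injective e
 ... | yes h = extend (cut-at k (label q l) (q <> step l) w e)
  where
  extend : Cut k (label q l) (q <> step l) w -> Cut k v q (l :: w)
  extend (B , m , w' , e1 , c , n , e2) = l :: B , m , w' , ap (l ::_) e1 , (h , tp (\ z -> Const z (q <> step l) B) h c) , (\ z -> n (z ∙ ! h)) , e2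

 module Labels {p : Cell} {y : Ltr} {w : Word} (o : Orntd P p (y :: w)) where
  open Orntd o
  W : Word
  W = y :: w

  label≢ : ∀ {q l} -> EOf p W q l -> label q l != org
  label≢ {q} {l} e z = true≢false (ap P (! (⊕-idʳ (rcell q l))) ∙ tp (\ t -> P (rcell q l <> neg t) == true) z (owner-tile (rcell q l))) (right-out e)

  label-S : ∀ {q l} -> EOf p W q l -> S (label q l)
  label-S {q} {l} e with adjacent (lcell q l) (trght l) (\ h -> label≢ e (ap owner (right-step q l) ∙ ! h ∙ owner-org (left-in e)))
  ... | i , h = i , h ∙ ap (\ t -> owner (lcell q l <> step (trght l)) <> neg t) (owner-org (left-in e)) ∙ ⊕-idʳ (owner (lcell q l <> step (trght l))) ∙ ap owner (! (right-step q l))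

  partner : ∀ {q l} -> EOf p W q l -> EOf p W ((q <> step l) <> neg (label q l)) (inv l) × label ((q <> step l) <> neg (label q l)) (inv l) == neg (label q l)
  partner {q} {l} e = find (edge-inside bdary (q <> neg u) l ((ap2 _xor_ (! (fills _)) (! (fills _))) ∙ xor-ft left-out right-in)) , label-neg
   where
   u : Cell
   u = label q l
   left-out : P (lcell (q <> neg u) l) == false
   left-out = not-true \ h -> label≢ e (! (owner-≡ (owner-in (rcell q l)) (ap P (! (lcell-⊕ q (neg u) l)) ∙ h)) ∙ owner-org (left-in e))
   right-in : P (rcell (q <> neg u) l) == true
   right-in = ap P (lcell-⊕ q (neg u) (trght l)) ∙ owner-tile (rcell q l)
   find : EdgeOf± p W (q <> neg u) l -> EOf p W ((q <> step l) <> neg u) (inv l)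
   find (inl h) = !! (true≢false (left-in h) left-out)
   find (inr h) = tp (\ z -> EOf p W z (inv l)) (⊕-swap q (neg u) (step l)) h
   label-neg : label ((q <> step l) <> neg u) (inv l) == neg u
   label-neg = owner-≡ (InL-neg (owner-in (rcell q l))) (ap P (ap (_<> neg (neg u)) (lcell-⊕ (q <> step l) (neg u) (trght (inv l)) ∙ ap (_<> neg u) (rcell-inv q l)) ∙ ⊕-can (lcell q l) (neg u)) ∙ left-in e)

  backtrack : ∀ {r x} -> EOf p W r x -> EOf p W (r <> step x) (inv x) -> ⊥
  backtrack {r} {x} e e' = true≢false (ap P (! (lcell-inv r x)) ∙ left-in e') (right-out e)

  label-of : ∀ {q l v} -> EOf p W q l -> InL a b v -> v != org -> P (lcell q l <> neg v) xor P (rcell q l <> neg v) == true -> label q l == v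
  label-of {q} {l} {v} e i n h = owner-≡ i (other h (not-true \ t -> n (! (owner-≡ i t) ∙ owner-org (left-in e))))
   where
   other : ∀ {x y} -> x xor y == true -> x == false -> y == true
   other h refl = h

  occurs : ∀ i -> Σ Cell \ q -> Σ Ltr \ l -> EOf p W q l × label q l == vs i
  occurs i with fst (snd four) i
  ... | iv , n , (e , h , k) with bdary-Bd (Tile P org) (Tile P (vs i)) e h k
  ... | q , l , h' , k' = go (edge-inside bdary q l ((ap2 _xor_ (! (fills _)) (! (fills _))) ∙ ap2 (\ x y -> P x xor P y) (! (⊕-idʳ (lcell q l))) (! (⊕-idʳ (rcell q l))) ∙ h'))
   where
   go : EdgeOf± p W q l -> Σ Cell \ q -> Σ Ltr \ l -> EOf p W q l × label q l == vs i
   go (inl e) = q , l , e , label-of e iv n k'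
   go (inr e) = q <> step l , inv l , e , label-of e iv n (xor-swap (P (rcell (q <> step l) (inv l) <> neg (vs i))) _ (ap2 (\ x y -> P (x <> neg (vs i)) xor P (y <> neg (vs i))) (rcell-inv q l) (lcell-inv q l) ∙ k'))

  neg-S : ∀ {u} -> S u -> S (neg u)
  neg-S (i , refl) = negate (occurs i)
   where
   negate : (Σ Cell \ q -> Σ Ltr \ l -> EOf p W q l × label q l == vs i) -> S (neg (vs i))
   negate (q , l , e , h) = tp S (snd (partner e) ∙ ap neg h) (label-S (fst (partner e)))

  independent : ∀ {u v} -> S u -> S v -> u != org -> v != org -> u != v -> S (u <> neg v) -> ⊥
  independent {u} {v} su sv u≢ v≢ ne sd with u ≟ᶜ neg v
  ... | yes refl = rank-two \ k -> multiple (fill (four-of v (neg v) (v <> v) (neg (v <> v))) (four-inj (\ e -> v≢ (neg-self e)) (\ e -> v≢ (⊕-canˡ v (! e ∙ ! (⊕-idʳ v)))) (\ e -> v≢ (neg-double e))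
   (\ e -> v≢ (neg-double (! (neg-neg v) ∙ ap neg e))) (\ e -> v≢ (⊕-canˡ v (! (neg-inj e) ∙ ! (⊕-idʳ v)))) (\ e -> v≢ (half (neg-self e))))
   (four-all {Q = S} sv su (tp S (ap neg (! (neg-⊕' v v)) ∙ neg-neg (v <> v)) (neg-S sd)) (tp S (! (neg-⊕' v v)) sd)) k)
   where
   neg-⊕' : ∀ x y -> neg (x <> y) == neg x <> neg y
   neg-⊕' (a , b) (c , d) = ap2 _,_ (Y.neg-distrib-+ a c) (Y.neg-distrib-+ b d)
   neg-inj : ∀ {x y} -> neg x == neg y -> x == y
   neg-inj {x} {y} e = ! (neg-neg x) ∙ ap neg e ∙ neg-neg y
   half : v <> v == org -> v == org
   half e = neg-self (⊕-canˡ v (e ∙ ! (⊕-invʳ v)))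
   multiple : ∀ {c} -> (Σ (Fin 4) \ j -> four-of v (neg v) (v <> v) (neg (v <> v)) j == c) -> InL v v c
   multiple (j , e) = tp (InL v v) e (four-all {Q = InL v v} InL-fst (InL-neg InL-fst) (InL-⊕ InL-fst InL-fst) (InL-neg (InL-⊕ InL-fst InL-fst)) j)
  ... | no n = settle (fill (four-of v (neg v) u (neg u)) (four-inj (\ e -> v≢ (neg-self e)) (\ e -> ne (! e)) (\ e -> n (! (neg-neg u) ∙ ap neg (! e))) (\ e -> n (! e)) (\ e -> ne (! (neg-inj e))) (\ e -> u≢ (neg-self e)))
   (four-all {Q = S} sv (neg-S sv) su (neg-S su)))
   where
   neg-inj : ∀ {x y} -> neg x == neg y -> x == y
   neg-inj {x} {y} e = ! (neg-neg x) ∙ ap neg e ∙ neg-neg y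
   settle : (∀ k -> Σ (Fin 4) \ j -> four-of v (neg v) u (neg u) j == vs k) -> ⊥
   settle all' = by (all' (fst sd))
    where
    ek : vs (fst sd) == u <> neg v
    ek = snd sd
    by : (Σ (Fin 4) \ j -> four-of v (neg v) u (neg u) j == vs (fst sd)) -> ⊥
    by (i0 , e) = rank-two \ i -> tp (InL v v) (snd (all' i)) (four-all {Q = InL v v} InL-fst (InL-neg InL-fst) iu (InL-neg iu) (fst (all' i)))
     where
     iu : InL v v u
     iu = tp (InL v v) (ap (_<> v) (e ∙ ek) ∙ minus-plus u v) (InL-⊕ (InL-fst {v} {v}) (InL-fst {v} {v}))
    by (i1 , e) = u≢ (! (minus-plus u v) ∙ ap (_<> v) (! (e ∙ ek)) ∙ ⊕-comm (neg v) v ∙ ⊕-invʳ v)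
    by (i2 , e) = v≢ (! (neg-neg v) ∙ ap neg (⊕-canˡ u (! (e ∙ ek) ∙ ! (⊕-idʳ u))))
    by (i3 , e) = rank-two \ i -> tp (InL u u) (snd (all' i)) (four-all {Q = InL u u} iv (InL-neg iv) InL-fst (InL-neg InL-fst) (fst (all' i)))
     where
     iv : InL u u v
     iv = tp (InL u u) (ap (\ z -> u <> neg z) (e ∙ ek) ∙ twice u v) (InL-⊕ (InL-fst {u} {u}) (InL-neg (InL-neg (InL-fst {u} {u}))))
      where
      twice : ∀ u v -> u <> neg (u <> neg v) == v
      twice (a , b) (c , d) = ap2 _,_ (alg a c) (alg b d)
       where
       alg : ∀ a c -> a + Z.- (a + Z.- c) == c
       alg = ring

  -- Where the label changes, three tiles would be pairwise adjacent if the boundary went straight on.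
  corner : ∀ {r x l} -> EOf p W r x -> EOf p W (r <> step x) l -> label r x != label (r <> step x) l -> turn x l == + 1
  corner {r} {x} {l} e e' ne with turn-cases x l
  ... | inl refl = turn-left-one x
  ... | inr (inl refl) = !! (independent (label-S e') (label-S e) (label≢ e') (label≢ e) (\ h -> ne (! h))
   (tp (\ z -> S (owner z <> neg (label r x))) (! (straight-right r x)) (adjacent (rcell r x) x (\ h -> ne (h ∙ ap owner (! (straight-right r x)))))))
  ... | inr (inr (inl refl)) = !! (ne (ap owner (! (ap (lcell (r <> step x)) (turnRight² x) ∙ lcell-inv r x))))
  ... | inr (inr (inr refl)) = !! (backtrack e e')

  last-uniq : ∀ {u1 x v1 u2 x' v2} -> W == u1 ++ (x :: v1) -> W == u2 ++ (x' :: v2) -> tip p (u1 ++ (x :: [])) == tip p (u2 ++ (x' :: [])) -> u1 ++ (x :: []) == u2 ++ (x' :: [])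
  last-uniq {u1} {x} {[]} {u2} {x'} {[]} e e' h = ! e ∙ e'
  last-uniq {u1} {x} {m :: v1} {u2} {x'} {m' :: v2} e e' h = pos-uniq (u1 ++ (x :: [])) (u2 ++ (x' :: [])) (Smp.distinct bdary) (e ∙ ! (++-as u1 (x :: []) (m :: v1))) (e' ∙ ! (++-as u2 (x' :: []) (m' :: v2))) h
  last-uniq {u1} {x} {[]} {u2} {x'} {m' :: v2} e e' h = !! (nonem-snoc u2 (! (pos-uniq [] (u2 ++ (x' :: [])) (Smp.distinct bdary) refl (e' ∙ ! (++-as u2 (x' :: []) (m' :: v2))) (! (Smp.closed bdary) ∙ ap (tip p) e ∙ h))))
   where
   nonem-snoc : ∀ (u : Word) {z} -> u ++ (z :: []) != []
   nonem-snoc [] ()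
   nonem-snoc (_ :: _) ()
  last-uniq {u1} {x} {m :: v1} {u2} {x'} {[]} e e' h = ! (last-uniq {u2} {x'} {[]} {u1} {x} {m :: v1} e' e (! h))

  InEdge : Cell -> Ltr -> Cell -> Set
  InEdge q x v = Σ Cell \ r -> EOf p W r x × r <> step x == q × label r x == v

  in-uniq : ∀ {q x v x' v'} -> InEdge q x v -> InEdge q x' v' -> x == x' × v == v'
  in-uniq {q} {x} {v} {x'} {v'} (r , (u1 , v1 , e1 , refl) , h , refl) (r' , (u2 , v2 , e2 , refl) , h' , refl) =
    conclude (I.∷ʳ-injective u1 u2 (last-uniq e1 e2 ((tip-++ p u1 (x :: []) ∙ h) ∙ ! (tip-++ p u2 (x' :: []) ∙ h'))))
   where
   conclude : u1 == u2 × x == x' -> x == x' × label (tip p u1) x == label (tip p u2) x'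
   conclude (e , e') = e' , ap2 (\ s t -> label (tip p s) t) e e'

  Pass : Set
  Pass = Cell × (Ltr × (Ltr × Cell))

  ι : Pass -> Pass
  ι (q , x , l , u) = q <> neg u , inv l , inv x , neg u

  turnAt : Pass -> ℤ
  turnAt (q , x , l , u) = turn x l

  IsPass : Pass -> Set
  IsPass (q , x , l , u) = InEdge q x u × EOf p W q l × label q l == u

  same-passes : Cell -> Ltr -> Cell -> Word -> List Pass
  same-passes v x q [] = []
  same-passes v x q (l :: w) with label q l ≟ᶜ v
  ... | yes _ = (q , x , l , v) :: same-passes (label q l) l (q <> step l) w
  ... | no _ = same-passes (label q l) l (q <> step l) w

  private
   advance : ∀ {pre q l v} -> W == pre ++ (l :: v) -> tip p pre == q -> W == (pre ++ (l :: [])) ++ v × tip p (pre ++ (l :: [])) == q <> step l × InEdge (q <> step l) l (label q l)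
   advance {pre} {q} {l} {v} e refl = e ∙ ! (++-as pre (l :: []) v) , tip-++ p pre (l :: []) , (q , (pre , v , e , refl) , refl , refl)

  split-turns : ∀ pre v x q w -> W == pre ++ w -> tip p pre == q -> InEdge q x v -> turnSum x w == sumOf turnAt (same-passes v x q w) + + changes v q w
  split-turns pre v x q [] e h i = refl
  split-turns pre v x q (l :: w) e h i@(r , er , hr , hv) with advance {pre} {q} {l} {w} e h
  ... | e' , h' , i' with split-turns (pre ++ (l :: [])) (label q l) l (q <> step l) w e' h' i' | label q l ≟ᶜ v
  ... | rec | yes _ = ap (\ z -> turn x l + z) rec ∙ ! (Y.+-assoc (turn x l) _ _)
  ... | rec | no n = (ap2 Z._+_ (corner er (pre , w , e , h ∙ ! hr) (\ z -> n (ap (\ t -> label t l) (! hr) ∙ ! z ∙ hv))) rec) ∙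
     alg (sumOf turnAt (same-passes (label q l) l (q <> step l) w)) (+ changes (label q l) (q <> step l) w)
   where
   alg : ∀ s c -> + 1 + (s + c) == s + (+ 1 + c)
   alg = ring

  passes-sound : ∀ pre v x q w -> W == pre ++ w -> tip p pre == q -> InEdge q x v -> All IsPass (same-passes v x q w)
  passes-sound pre v x q [] e h i = []
  passes-sound pre v x q (l :: w) e h i with advance {pre} {q} {l} {w} e h
  ... | e' , h' , i' with passes-sound (pre ++ (l :: [])) (label q l) l (q <> step l) w e' h' i' | label q l ≟ᶜ v
  ... | rec | yes k = (i , (pre , w , e , h) , k) :: rec
  ... | rec | no _ = rec

  passes-compl : ∀ s pre v x q {l t x' u} -> W == pre ++ (s ++ (l :: t)) -> tip p pre == q -> InEdge q x v -> IsPass (tip q s , x' , l , u) -> (tip q s , x' , l , u) ∈ same-passes v x q (s ++ (l :: t))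
  passes-compl [] pre v x q {l} {t} {x'} {u} e h i (i' , _ , k) with in-uniq i i'
  ... | refl , refl with label q l ≟ᶜ v
  ... | yes _ = hit refl
  ... | no n = !! (n k)
  passes-compl (m :: s) pre v x q {l} {t} e h i k with advance {pre} {q} {m} {s ++ (l :: t)} e h
  ... | e' , h' , i' with passes-compl s (pre ++ (m :: [])) (label q m) m (q <> step m) e' h' i' k | label q m ≟ᶜ v
  ... | rec | yes _ = miss rec
  ... | rec | no _ = rec

  passes-uniq : ∀ v x q w -> Unique (verts q w) -> Unique (same-passes v x q w)
  passes-uniq v x q [] _ = []
  passes-uniq v x q (l :: w) (n :: ns) with passes-uniq (label q l) l (q <> step l) w ns | label q l ≟ᶜ v
  ... | rec | no _ = rec
  ... | rec | yes _ = avoid (label q l) l (q <> step l) w n :: rec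
   where
   avoid : ∀ v' x' r w -> All (q !=_) (verts r w) -> All ((q , x , l , v) !=_) (same-passes v' x' r w)
   avoid v' x' r [] _ = []
   avoid v' x' r (m :: w) (k :: ks) with avoid (label r m) m (r <> step m) w ks | label r m ≟ᶜ v'
   ... | rec | yes _ = (\ e -> k (ap fst e)) :: rec
   ... | rec | no _ = rec

  wrap : Σ Cell \ v -> InEdge p (lst y w) v
  wrap with snoc y w
  ... | u , e = label (tip p u) (lst y w) , tip p u , (u , [] , e , refl) , ! (tip-++ p u (lst y w :: [])) ∙ ap (tip p) (! e) ∙ Smp.closed bdary , refl

  changes-four : changes (fst wrap) p W == 4
  changes-four = Y.+-injective (! (0+ (+ changes (fst wrap) p W)) ∙ ap (\ z -> z + + changes (fst wrap) p W) (! vanish) ∙ ! (split-turns [] (fst wrap) (lst y w) p W refl refl (snd wrap)) ∙ tangents o)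
   where
   involutive : ∀ z -> ι (ι z) == z
   involutive (q , x , l , u) = ap2 _,_ (⊕-can q (neg u)) (ap2 _,_ (inv-inv x) (ap2 _,_ (inv-inv l) (neg-neg u)))
   passes : List Pass
   passes = same-passes (fst wrap) (lst y w) p W
   sound : ∀ {z} -> z ∈ passes -> IsPass z
   sound m = All.lookup (passes-sound [] (fst wrap) (lst y w) p W refl refl (snd wrap)) m
   mird-pass : ∀ z -> IsPass z -> IsPass (ι z)
   mird-pass (q , x , l , u) ((r , er , refl , refl) , e , k) =
    ((q <> step l) <> neg u , tp (\ z -> EOf p W ((q <> step l) <> neg z) (inv l)) k (fst (partner e)) , ⊕-swap (q <> step l) (neg u) (step (inv l)) ∙ ap (_<> neg u) (step-back q l)
    , ap (\ z -> label ((q <> step l) <> neg z) (inv l)) (! k) ∙ snd (partner e) ∙ ap neg k) , partner er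
   compl : ∀ z -> IsPass z -> z ∈ passes
   compl (q , x , l , u) k@(_ , (s , t , e , refl) , _) = tp (\ z -> (q , x , l , u) ∈ same-passes (fst wrap) (lst y w) p z) (! e) (passes-compl s [] (fst wrap) (lst y w) p e refl (snd wrap) k)
   vanish : sumOf turnAt passes == + 0
   vanish = cancelling turnAt ι passes (passes-uniq (fst wrap) (lst y w) p W (Smp.distinct bdary)) involutive (\ {z} m -> compl (ι z) (mird-pass z (sound m))) (\ {z} m -> oppo-turn z (sound m))
    where
    oppo-turn : ∀ z -> IsPass z -> turnAt (ι z) == Z.- turnAt z
    oppo-turn (q , x , l , u) ((r , er , refl , _) , e , _) = turn-reverse x l \ h -> backtrack er (tp (EOf p W (r <> step x)) h e)

EOf-split : ∀ {p r m} A B -> EOf p (A ++ B) r m -> EOf p A r m ⊎ EOf (tip p A) B r m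
EOf-split {p} A B (u , v , e , refl) with split-++ A B u e
... | inl (v1 , e1 , _) = inl (u , v1 , e1 , refl)
... | inr (u1 , refl , e1) = inr (u1 , v , e1 , ! (tip-++ p A u1))

InL-combine : ∀ {a b v w u} -> InL a b v -> InL a b w -> InL v w u -> InL a b u
InL-combine {a₁ , a₂} {b₁ , b₂} (m , n , refl) (m' , n' , refl) (k , l , refl) = k * m + l * m' , k * n + l * n' , ap2 _,_ (alg m n m' n' k l a₁ b₁) (alg m n m' n' k l a₂ b₂)
 where
 alg : ∀ m n m' n' k l a b -> k * (m * a + n * b) + l * (m' * a + n' * b) == (k * m + l * m') * a + (k * n + l * n') * b
 alg = ring

nil : ∀ (w : Word) -> # w == 0 -> w == []
nil [] _ = refl

record Factored (P : Shape) (a b : Cell) : Set where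
 field
  base-point : Cell
  A B        : Word
  A≢         : A != []
  B≢         : B != []
  oriented   : Orntd P base-point (A ++ (B ++ (rev A ++ rev B)))
  into       : ∀ u -> InL a b u -> InL (vec A) (vec B) u
  onto       : ∀ u -> InL (vec A) (vec B) u -> InL a b u

module Factorization {P : Shape} {a b : Cell} (tiled : IsLatticeTiling P a b) (four : HasFourNeighbours P a b org) where
 open FourNeighbours {P} {a} {b} tiled four

 record Block (p : Cell) (W : Word) (t : Cell) : Set where
  field
   X B Y    : Word
   spot     : W == X ++ (B ++ Y)
   rest≢    : X ++ Y != []
   body≢    : B != []
   const    : Const t (tip p X) B
   collects : ∀ {r m} -> EOf p W r m -> label r m == t -> EOf (tip p X) B r m

 Block-resp : ∀ {p W t t'} -> t == t' -> Block p W t -> Block p W t'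
 Block-resp refl k = k

 record FourBlocks (p : Cell) (W : Word) : Set where
  field
   t1 t2 t3 t4 : Cell
   B1 B2 B3 B4 : Word
   word≡ : W == B1 ++ (B2 ++ (B3 ++ B4))
   n1 : B1 != []
   n2 : B2 != []
   n3 : B3 != []
   n4 : B4 != []
   k1 : Const t1 p B1
   k2 : Const t2 (tip p B1) B2
   k3 : Const t3 (tip (tip p B1) B2) B3
   k4 : Const t4 (tip (tip (tip p B1) B2) B3) B4
   d12 : t2 != t1
   d23 : t3 != t2
   d34 : t4 != t3
   d41 : t1 != t4

 changes-head : ∀ {v q l w k} -> label q l != v -> changes v q (l :: w) == suc k -> changes (label q l) (q <> step l) w == k
 changes-head {v} {q} {l} n e with label q l ≟ᶜ v
 ... | yes h = !! (n h)
 ... | no _ = Q.suc-injective e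

 module Blocks {p : Cell} {y : Ltr} {w : Word} (o : Orntd P p (y :: w)) where
  open Labels o
  open Orntd o

  contd : ∀ {X B Y} -> W == X ++ (B ++ Y) -> X ++ Y != [] -> ∀ c q -> c != [] -> (∀ {r m} -> EOf q c r m -> EOf (tip p X) B r m) ->
        Σ Word \ s -> Σ Word \ t -> B == s ++ (c ++ t) × tip (tip p X) s == q
  contd e n [] q c≢ h = !! (c≢ refl)
  contd e n (l :: []) q c≢ h with h ([] , [] , refl , refl)
  ... | s , v , e' , k = s , v , e' , k
  contd {X} {B} {Y} e n (l :: m :: c) q c≢ h = join (h ([] , m :: c , refl , refl)) (contd {X} {B} {Y} e n (m :: c) (q <> step l) (\ ()) (\ { (u , v , e' , k) -> h (l :: u , v , ap (l ::_) e' , k) }))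
   where
   x : Cell
   x = tip p X
   join : EOf x B q l -> (Σ Word \ s -> Σ Word \ t -> B == s ++ ((m :: c) ++ t) × tip x s == q <> step l) -> Σ Word \ s -> Σ Word \ t -> B == s ++ ((l :: m :: c) ++ t) × tip x s == q
   join (s1 , v1 , e1 , k1) (s , t , e2 , k2) = s1 , t , e2 ∙ ap (_++ ((m :: c) ++ t)) (I.++-cancelˡ X _ _ (! (same-place (v1 ++ Y) refl))) ∙ ++-as s1 (l :: []) ((m :: c) ++ t) , k1
    where
    W1 : W == (X ++ (s1 ++ (l :: []))) ++ (v1 ++ Y)
    W1 = e ∙ ap (\ z -> X ++ (z ++ Y)) e1 ∙ asc X s1 (l :: []) v1 Y
     where
     asc : ∀ a b c d e -> a ++ ((b ++ (c ++ d)) ++ e) == (a ++ (b ++ c)) ++ (d ++ e)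
     asc a b c d e = solve words
    W2 : W == (X ++ s) ++ (m :: (c ++ (t ++ Y)))
    W2 = e ∙ ap (\ z -> X ++ (z ++ Y)) e2 ∙ asc X s (m :: c) t Y
     where
     asc : ∀ a b c d e -> a ++ ((b ++ (c ++ d)) ++ e) == (a ++ b) ++ (c ++ (d ++ e))
     asc a b c d e = solve words
    ends : tip p (X ++ (s1 ++ (l :: []))) == tip p (X ++ s)
    ends = tip-++ p X (s1 ++ (l :: [])) ∙ tip-++ x s1 (l :: []) ∙ ap (_<> step l) k1 ∙ ! k2 ∙ ! (tip-++ p X s)
    same-place : ∀ z -> v1 ++ Y == z -> X ++ (s1 ++ (l :: [])) == X ++ s
    same-place (k :: z) ez = pos-uniq (X ++ (s1 ++ (l :: []))) (X ++ s) (Smp.distinct bdary) (W1 ∙ ap ((X ++ (s1 ++ (l :: []))) ++_) ez) W2 ends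
    same-place [] ez = !! (n (ap2 _++_ (I.++-conicalˡ X s (! (pos-uniq [] (X ++ s) (Smp.distinct bdary) refl W2
     (! (Smp.closed bdary) ∙ ap (tip p) (W1 ∙ ap ((X ++ (s1 ++ (l :: []))) ++_) ez ∙ (++-id _)) ∙ ends)))) (I.++-conicalʳ v1 Y ez)))

  reverse-contd : ∀ {t} (k : Block p W t) (k' : Block p W (neg t)) -> Σ Word \ s -> Σ Word \ s' -> Block.B k' == s ++ (rev (Block.B k) ++ s') ×
            tip (tip p (Block.X k')) s == tip (tip p (Block.X k)) (Block.B k) <> neg t
  reverse-contd {t} k k' = contd {K'.X} {K'.B} {K'.Y} (K'.spot) (K'.rest≢) (rev K.B) (E <> neg t) (\ z -> K.body≢ (rev-[] K.B z)) edges
   where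
   module K = Block k
   module K' = Block k'
   x E : Cell
   x = tip p K.X
   E = tip x K.B
   edges : ∀ {r m} -> EOf (E <> neg t) (rev K.B) r m -> EOf (tip p K'.X) K'.B r m
   edges {r} {m} (s , v , e , h) = K'.collects (transport2 (ap (\ z -> ((r' <> step m) <> step (inv m)) <> neg z) lab ∙ ap (_<> neg t) (step-back r' m) ∙ ⊕-can r t) (inv-inv m) (fst (partner inW)))
    (ap2 label (! (ap (\ z -> ((r' <> step m) <> step (inv m)) <> neg z) lab ∙ ap (_<> neg t) (step-back r' m) ∙ ⊕-can r t)) (! (inv-inv m)) ∙ snd (partner inW) ∙ ap neg lab)
    where
    r' : Cell
    r' = r <> t
    transport2 : ∀ {q q' l l'} -> q == q' -> l == l' -> EOf p W q l -> EOf p W q' l'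
    transport2 refl refl z = z
    inB : EOf x K.B (r' <> step m) (inv m)
    inB = EOf-reverse (s , v , e , ! (minus-plus (tip E s) t) ∙ ap (_<> t) (! (tip-⊕ E (neg t) s) ∙ h))
    inW : EOf p W (r' <> step m) (inv m)
    inW with inB
    ... | s1 , v1 , e1 , h1 = K.X ++ s1 , v1 ++ K.Y , K.spot ∙ ap (\ z -> K.X ++ (z ++ K.Y)) e1 ∙ asc K.X s1 (inv m :: v1) K.Y , tip-++ p K.X s1 ∙ h1
     where
     asc : ∀ a b c d -> a ++ ((b ++ c) ++ d) == (a ++ b) ++ (c ++ d)
     asc a b c d = solve words
    lab : label (r' <> step m) (inv m) == t
    lab = Const-edge K.B K.const inB

  reverse-block : ∀ {t} (k : Block p W t) (k' : Block p W (neg t)) -> Block.B k' == rev (Block.B k) × tip p (Block.X k') == tip (tip p (Block.X k)) (Block.B k) <> neg t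
  reverse-block {t} k k' = settle (reverse-contd k k') (reverse-contd k' (Block-resp (! (neg-neg t)) k))
   where
   B B' : Word
   B = Block.B k
   B' = Block.B k'
   resp-B : ∀ {t t'} (e : t == t') (k : Block p W t) -> Block.B (Block-resp e k) == Block.B k
   resp-B refl k = refl
   settle : (Σ Word \ s -> Σ Word \ s' -> B' == s ++ (rev B ++ s') × tip (tip p (Block.X k')) s == tip (tip p (Block.X k)) B <> neg t) ->
    (Σ Word \ s -> Σ Word \ s' -> Block.B (Block-resp (! (neg-neg t)) k) == s ++ (rev B' ++ s') × tip (tip p (Block.X (Block-resp (! (neg-neg t)) k))) s == tip (tip p (Block.X k')) B' <> neg (neg t)) ->
        B' == rev B × tip p (Block.X k') == tip (tip p (Block.X k)) B <> neg t
   settle (s , s' , e , h) (z , z' , e' , _) = e ∙ ap2 (\ u v -> u ++ (rev B ++ v)) s≡ s'≡ ∙ ++-id (rev B) , ap (tip (tip p (Block.X k'))) (! s≡) ∙ h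
    where
    size : ∀ (u v w : Word) -> # (u ++ (rev v ++ w)) == # u N.+ (# v N.+ # w)
    size u v w = #-++ u ∙ ap (# u N.+_) (#-++ (rev v) ∙ ap (N._+ # w) (len-rev v))
    B'≤B : # B' ≤ # B
    B'≤B = ≤-tr (≤-tr (Q.m≤m+n (# B') (# z')) (Q.m≤n+m _ (# z))) (≤-re (! (size z B' z') ∙ ap # (! e' ∙ resp-B (! (neg-neg t)) k)))
    total≡ : # s N.+ (# B N.+ # s') ≤ # B
    total≡ = ≤-tr (≤-re (! (ap # e ∙ size s B s'))) B'≤B
    zero-sum : ∀ a b c -> a N.+ (b N.+ c) ≤ b -> a == 0 × c == 0
    zero-sum a b c h = Q.m+n≡0⇒m≡0 a ac , Q.m+n≡0⇒n≡0 a ac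
     where
     ac : a N.+ c == 0
     ac = Q.n≤0⇒n≡0 (Q.+-cancelˡ-≤ b _ _ (≤-tr (≤-re (alg a b c)) (≤-tr h (≤-re (! (Q.+-identityʳ b))))))
      where
      alg : ∀ a b c -> b N.+ (a N.+ c) == a N.+ (b N.+ c)
      alg = ringN
    s≡ : s == []
    s≡ = nil s (fst (zero-sum (# s) (# B) (# s') total≡))
    s'≡ : s' == []
    s'≡ = nil s' (snd (zero-sum (# s) (# B) (# s') total≡))

  four-blocks : label p y != fst wrap -> FourBlocks p W
  four-blocks n = one (cut-at 2 (label p y) (p <> step y) w (changes-head n changes-four))
   where
   one : Cut 2 (label p y) (p <> step y) w -> FourBlocks p W
   one (C1 , l2 , w2 , e1 , c1 , m1 , h1) = two (cut-at 1 _ _ w2 h1)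
    where
    two : Cut 1 (label (tip p (y :: C1)) l2) (tip p (y :: C1) <> step l2) w2 -> FourBlocks p W
    two (C2 , l3 , w3 , e2 , c2 , m2 , h2) = three (cut-at 0 _ _ w3 h2)
     where
     p3 : Cell
     p3 = tip (tip p (y :: C1)) (l2 :: C2)
     three : Cut 0 (label p3 l3) (p3 <> step l3) w3 -> FourBlocks p W
     three (C3 , l4 , w4 , e3 , c3 , m3 , h3) = record
       { B1 = y :: C1 ; B2 = l2 :: C2 ; B3 = l3 :: C3 ; B4 = l4 :: w4 ; word≡ = W≡ ; n1 = \ () ; n2 = \ () ; n3 = \ () ; n4 = \ ()
        ; k1 = refl , c1 ; k2 = refl , c2 ; k3 = refl , c3 ; k4 = k4 ; d12 = m1 ; d23 = m2 ; d34 = m3 ; d41 = \ z -> n (z ∙ ! v0≡) }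
      where
      p4 : Cell
      p4 = tip p3 (l3 :: C3)
      W≡ : W == (y :: C1) ++ ((l2 :: C2) ++ ((l3 :: C3) ++ (l4 :: w4)))
      W≡ = ap (y ::_) (e1 ∙ ap (\ z -> C1 ++ (l2 :: z)) (e2 ∙ ap (\ z -> C2 ++ (l3 :: z)) e3))
      k4 : Const (label p4 l4) p4 (l4 :: w4)
      k4 = refl , no-change (label p4 l4) (p4 <> step l4) w4 h3
      final-edge : InEdge p (lst l4 w4) (label p4 l4)
      final-edge = from-snoc (snoc l4 w4)
       where
       V : Word
       V = (y :: C1) ++ ((l2 :: C2) ++ (l3 :: C3))
       V-end : tip p V == p4
       V-end = (tip-++ p (y :: C1) _) ∙ tip-++ (tip p (y :: C1)) (l2 :: C2) (l3 :: C3)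
       from-snoc : (Σ Word \ u -> l4 :: w4 == u ++ (lst l4 w4 :: [])) -> InEdge p (lst l4 w4) (label p4 l4)
       from-snoc (u , e) = tip p4 u , (V ++ u , [] , W-split , tip-++ p V u ∙ ap (\ z -> tip z u) V-end)
        , ap (\ z -> tip z u <> step (lst l4 w4)) (! V-end) ∙ ap (_<> step (lst l4 w4)) (! (tip-++ p V u)) ∙ ! (tip-++ p (V ++ u) (lst l4 w4 :: [])) ∙ ap (tip p) (! W-split) ∙ Smp.closed bdary
        , Const-edge (l4 :: w4) k4 (u , [] , e , refl)
        where
        W-split : W == (V ++ u) ++ (lst l4 w4 :: [])
        W-split = W≡ ∙ ap (\ z -> (y :: C1) ++ ((l2 :: C2) ++ ((l3 :: C3) ++ z))) e ∙ asc (y :: C1) (l2 :: C2) (l3 :: C3) u (lst l4 w4 :: [])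
         where
         asc : ∀ a b c d e -> a ++ (b ++ (c ++ (d ++ e))) == ((a ++ (b ++ c)) ++ d) ++ e
         asc a b c d e = solve words
      v0≡ : fst wrap == label p4 l4
      v0≡ = snd (in-uniq (snd wrap) final-edge)

  module Arranged (k : FourBlocks p W) where
   open FourBlocks k
   p2 p3 p4 : Cell
   p2 = tip p B1
   p3 = tip p2 B2
   p4 = tip p3 B3

   data Located (r : Cell) (m : Ltr) : Set where
    in1 : EOf p B1 r m -> label r m == t1 -> Located r m
    in2 : EOf p2 B2 r m -> label r m == t2 -> Located r m
    in3 : EOf p3 B3 r m -> label r m == t3 -> Located r m
    in4 : EOf p4 B4 r m -> label r m == t4 -> Located r m

   located : ∀ {r m} -> EOf p W r m -> Located r m
   located {r} {m} e with EOf-split B1 (B2 ++ (B3 ++ B4)) (tp (\ z -> EOf p z r m) word≡ e)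
   ... | inl h = in1 h (Const-edge B1 k1 h)
   ... | inr h with EOf-split B2 (B3 ++ B4) h
   ... | inl h' = in2 h' (Const-edge B2 k2 h')
   ... | inr h' with EOf-split B3 B4 h'
   ... | inl h″ = in3 h″ (Const-edge B3 k3 h″)
   ... | inr h″ = in4 h″ (Const-edge B4 k4 h″)

   every : ∀ {Q : Cell -> Set} -> Q t1 -> Q t2 -> Q t3 -> Q t4 -> ∀ i -> Q (fst four i)
   every {Q} q1 q2 q3 q4 i = by (occurs i)
    where
    by : (Σ Cell \ q -> Σ Ltr \ l -> EOf p W q l × label q l == fst four i) -> Q (fst four i)
    by (q , l , e , h) = pick (located e)
     where
     pick : Located q l -> Q (fst four i)
     pick (in1 _ g) = tp Q (! g ∙ h) q1
     pick (in2 _ g) = tp Q (! g ∙ h) q2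
     pick (in3 _ g) = tp Q (! g ∙ h) q3
     pick (in4 _ g) = tp Q (! g ∙ h) q4

   three-of : Cell -> Cell -> Cell -> Fin 3 -> Cell
   three-of x y z i0 = x
   three-of x y z i1 = y
   three-of x y z i2 = z

   d13 : t1 != t3
   d13 e = too-few (three-of t1 t2 t4) (every {\ c -> Σ (Fin 3) \ j -> three-of t1 t2 t4 j == c} (i0 , refl) (i1 , refl) (i0 , e) (i2 , refl))
   d24 : t2 != t4
   d24 e = too-few (three-of t1 t2 t3) (every {\ c -> Σ (Fin 3) \ j -> three-of t1 t2 t3 j == c} (i0 , refl) (i1 , refl) (i2 , refl) (i1 , e))

   block1 : Block p W t1
   block1 = record { X = [] ; B = B1 ; Y = B2 ++ (B3 ++ B4) ; spot = word≡ ; rest≢ = \ z -> n2 (I.++-conicalˡ B2 _ z) ; body≢ = n1 ; const = k1 ; collects = \ e h -> pick (located e) h }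
    where
    pick : ∀ {r m} -> Located r m -> label r m == t1 -> EOf p B1 r m
    pick (in1 e _) h = e
    pick (in2 _ g) h = !! (d12 (! g ∙ h))
    pick (in3 _ g) h = !! (d13 (! h ∙ g))
    pick (in4 _ g) h = !! (d41 (! h ∙ g))
   block2 : Block p W t2
   block2 = record { X = B1 ; B = B2 ; Y = B3 ++ B4 ; spot = word≡ ; rest≢ = \ z -> n1 (I.++-conicalˡ B1 _ z) ; body≢ = n2 ; const = k2 ; collects = \ e h -> pick (located e) h }
    where
    pick : ∀ {r m} -> Located r m -> label r m == t2 -> EOf p2 B2 r m
    pick (in1 _ g) h = !! (d12 (! h ∙ g))
    pick (in2 e _) h = e
    pick (in3 _ g) h = !! (d23 (! g ∙ h))
    pick (in4 _ g) h = !! (d24 (! h ∙ g))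
   block3 : Block p W t3
   block3 = record { X = B1 ++ B2 ; B = B3 ; Y = B4 ; spot = word≡ ∙ ! (++-as B1 B2 (B3 ++ B4)) ; rest≢ = \ z -> n1 (I.++-conicalˡ B1 B2 (I.++-conicalˡ (B1 ++ B2) _ z)) ; body≢ = n3
    ; const = tp (\ z -> Const t3 z B3) (! e3) k3 ; collects = \ {r} {m} e h -> tp (\ z -> EOf z B3 r m) (! e3) (pick (located e) h) }
    where
    e3 : tip p (B1 ++ B2) == p3
    e3 = tip-++ p B1 B2
    pick : ∀ {r m} -> Located r m -> label r m == t3 -> EOf p3 B3 r m
    pick (in1 _ g) h = !! (d13 (! g ∙ h))
    pick (in2 _ g) h = !! (d23 (! h ∙ g))
    pick (in3 e _) h = e
    pick (in4 _ g) h = !! (d34 (! g ∙ h))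
   block4 : Block p W t4
   block4 = record { X = B1 ++ (B2 ++ B3) ; B = B4 ; Y = [] ; spot = word≡ ∙ asc B1 B2 B3 B4 ; rest≢ = \ z -> n1 (I.++-conicalˡ B1 _ (I.++-conicalˡ (B1 ++ (B2 ++ B3)) _ z)) ; body≢ = n4
    ; const = tp (\ z -> Const t4 z B4) (! e4) k4 ; collects = \ {r} {m} e h -> tp (\ z -> EOf z B4 r m) (! e4) (pick (located e) h) }
    where
    asc : ∀ a b c d -> a ++ (b ++ (c ++ d)) == (a ++ (b ++ c)) ++ (d ++ [])
    asc a b c d = solve words
    e4 : tip p (B1 ++ (B2 ++ B3)) == p4
    e4 = tip-++ p B1 (B2 ++ B3) ∙ tip-++ p2 B2 B3
    pick : ∀ {r m} -> Located r m -> label r m == t4 -> EOf p4 B4 r m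
    pick (in1 _ g) h = !! (d41 (! g ∙ h))
    pick (in2 _ g) h = !! (d24 (! g ∙ h))
    pick (in3 _ g) h = !! (d34 (! h ∙ g))
    pick (in4 e _) h = e

   head-edge : ∀ {q} B -> B != [] -> Σ Ltr \ l -> EOf q B q l
   head-edge [] n = !! (n refl)
   head-edge (l :: B) _ = l , [] , B , refl , refl

   embed : ∀ {t r m} (b : Block p W t) -> EOf (tip p (Block.X b)) (Block.B b) r m -> EOf p W r m
   embed b (s , v , e , h) = X ++ s , v ++ Y , spot ∙ ap (\ z -> X ++ (z ++ Y)) e ∙ (asc X s _ Y) , tip-++ p X s ∙ h
    where
    open Block b
    asc : ∀ a b c d -> a ++ ((b ++ c) ++ d) == (a ++ b) ++ (c ++ d)
    asc a b c d = solve words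

   block-S : ∀ {t} -> Block p W t -> S t × t != org × InL a b t
   block-S {t} k′ with head-edge {tip p (Block.X k′)} (Block.B k′) (Block.body≢ k′)
   ... | l , e = tp S lab (label-S (embed k′ e)) , (\ z -> label≢ (embed k′ e) (lab ∙ z)) , tp (InL a b) lab (owner-in _)
    where
    lab : label (tip p (Block.X k′)) l == t
    lab = Const-edge (Block.B k′) (Block.const k′) e

   negative : ∀ {t} -> Block p W t -> Σ Cell \ r -> Σ Ltr \ m -> EOf p W r m × label r m == neg t
   negative {t} b = by (neg-S (fst (block-S b)))
    where
    by : S (neg t) -> Σ Cell \ r -> Σ Ltr \ m -> EOf p W r m × label r m == neg t
    by (i , h) = re-label (occurs i)
     where
     re-label : (Σ Cell \ r -> Σ Ltr \ m -> EOf p W r m × label r m == fst four i) -> Σ Cell \ r -> Σ Ltr \ m -> EOf p W r m × label r m == neg t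
     re-label (r , m , e , h') = r , m , e , h' ∙ h

   not-second : neg t1 != t2
   not-second h = clash (snoc-of B1 n1)
    where
    snoc-of : ∀ B -> B != [] -> Σ Word \ u -> Σ Ltr \ z -> B == u ++ (z :: [])
    snoc-of [] n = !! (n refl)
    snoc-of (x :: B) _ with snoc x B
    ... | u , e = u , lst x B , e
    clash : (Σ Word \ u -> Σ Ltr \ z -> B1 == u ++ (z :: [])) -> ⊥
    clash (u , z , e) = backtrack {tip p u} {z} (u , inv z :: (rev u ++ (B3 ++ B4)) , W≡ , refl) (u ++ (z :: []) , rev u ++ (B3 ++ B4) , W≡ ∙ ! (++-as u (z :: []) _) , tip-++ p u (z :: []))
     where
     B2≡ : B2 == inv z :: rev u
     B2≡ = fst (rb block2 h) ∙ ap rev e ∙ rev-++ u (z :: [])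
      where
      rb : ∀ {t} (b : Block p W t) -> neg t1 == t -> Block.B b == rev B1 × tip p (Block.X b) == tip p B1 <> neg t1
      rb b refl = reverse-block block1 b
     W≡ : W == u ++ (z :: inv z :: (rev u ++ (B3 ++ B4)))
     W≡ = word≡ ∙ ap2 (\ s t -> s ++ (t ++ (B3 ++ B4))) e B2≡ ∙ (++-as u (z :: []) _)

   not-fourth : neg t1 != t4
   not-fourth h = clash B1 refl n1
    where
    rb : ∀ {t} (b : Block p W t) -> neg t1 == t -> Block.B b == rev B1 × tip p (Block.X b) == tip p B1 <> neg t1
    rb b refl = reverse-block block1 b
    clash : ∀ B -> B1 == B -> B != [] -> ⊥
    clash [] e n = n refl
    clash (x :: C) e _ = backtrack {p} {x} ([] , C ++ (B2 ++ (B3 ++ B4)) , word≡ ∙ ap (_++ (B2 ++ (B3 ++ B4))) e , refl) (V , [] , W≡ , ! back-to)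
     where
     V : Word
     V = (B1 ++ (B2 ++ B3)) ++ rev C
     W≡ : W == V ++ (inv x :: [])
     W≡ = word≡ ∙ ap (\ z -> B1 ++ (B2 ++ (B3 ++ z))) (fst (rb block4 h) ∙ ap rev e) ∙ asc B1 B2 B3 (rev C) (inv x :: [])
      where
      asc : ∀ a b c d e -> a ++ (b ++ (c ++ (d ++ e))) == ((a ++ (b ++ c)) ++ d) ++ e
      asc a b c d e = solve words
     back-to : p <> step x == tip p V
     back-to = ap2 (\ s t -> s <> step t) (! (Smp.closed bdary) ∙ ap (tip p) W≡ ∙ tip-++ p V (inv x :: [])) (! (inv-inv x)) ∙ step-back (tip p V) (inv x)

   opposite1 : t3 == neg t1
   opposite1 = by (negative block1)
    where
    pick : ∀ {r m} -> label r m == neg t1 -> Located r m -> t3 == neg t1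
    pick h (in1 _ g) = !! (fst (snd (block-S block1)) (neg-self (! g ∙ h)))
    pick h (in2 _ g) = !! (not-second (! h ∙ g))
    pick h (in3 _ g) = ! g ∙ h
    pick h (in4 _ g) = !! (not-fourth (! h ∙ g))
    by : (Σ Cell \ r -> Σ Ltr \ m -> EOf p W r m × label r m == neg t1) -> t3 == neg t1
    by (r , m , e , h) = pick h (located e)

   private
    neg-inj : ∀ {x y} -> neg x == neg y -> x == y
    neg-inj {x} {y} e = ! (neg-neg x) ∙ ap neg e ∙ neg-neg y

   opposite2 : t4 == neg t2
   opposite2 = by (negative block2)
    where
    pick : ∀ {r m} -> label r m == neg t2 -> Located r m -> t4 == neg t2
    pick h (in1 _ g) = !! (d23 (opposite1 ∙ ap neg (! g ∙ h) ∙ neg-neg t2))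
    pick h (in2 _ g) = !! (fst (snd (block-S block2)) (neg-self (! g ∙ h)))
    pick h (in3 _ g) = !! (d12 (neg-inj (! h ∙ g ∙ opposite1)))
    pick h (in4 _ g) = ! g ∙ h
    by : (Σ Cell \ r -> Σ Ltr \ m -> EOf p W r m × label r m == neg t2) -> t4 == neg t2
    by (r , m , e , h) = pick h (located e)

   factored : Factored P a b
   factored = record { base-point = p ; A = B1 ; B = B2 ; A≢ = n1 ; B≢ = n2 ; oriented = tp (Orntd P p) (word≡ ∙ ap2 (\ s t -> B1 ++ (B2 ++ (s ++ t))) (fst r1) (fst r2)) o
    ; into = spans (every {InL (vec B1) (vec B2)} (tp (InL (vec B1) (vec B2)) (! t1≡) (InL-neg InL-snd)) (tp (InL (vec B1) (vec B2)) (! t2≡) InL-fst)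
    (tp (InL (vec B1) (vec B2)) (! (opposite1 ∙ ap neg t1≡ ∙ neg-neg (vec B2))) InL-snd) (tp (InL (vec B1) (vec B2)) (! (opposite2 ∙ ap neg t2≡)) (InL-neg InL-fst)))
    ; onto = \ u -> InL-combine (tp (InL a b) t2≡ (snd (snd (block-S block2)))) (tp (InL a b) (ap neg t1≡ ∙ neg-neg (vec B2)) (InL-neg (snd (snd (block-S block1))))) }
    where
    r1 : B3 == rev B1 × tip p (B1 ++ B2) == tip p B1 <> neg t1
    r1 = rb block3 opposite1
     where
     rb : ∀ {t} (b : Block p W t) -> t == neg t1 -> Block.B b == rev B1 × tip p (Block.X b) == tip p B1 <> neg t1
     rb b refl = reverse-block block1 b
    r2 : B4 == rev B2 × tip p (B1 ++ (B2 ++ B3)) == tip p2 B2 <> neg t2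
    r2 = rb block4 opposite2
     where
     rb : ∀ {t} (b : Block p W t) -> t == neg t2 -> Block.B b == rev B2 × tip p (Block.X b) == tip p2 B2 <> neg t2
     rb b refl = reverse-block block2 b
    t1≡ : t1 == neg (vec B2)
    t1≡ = ! (neg-neg t1) ∙ ap neg (⊕-canˡ p2 (! (snd r1) ∙ tip-++ p B1 B2 ∙ tip-vec p2 B2))
    t2≡ : t2 == vec B1
    t2≡ = neg-inj (⊕-canˡ p3 (! (snd r2) ∙ tip-++ p B1 (B2 ++ B3) ∙ tip-++ p2 B2 B3 ∙ tip-vec p3 B3 ∙ ap (p3 <>_) (ap vec (fst r1) ∙ vec-rev B1)))

 factor : ∀ {p W} -> Orntd P p W -> Factored P a b
 factor {p} {[]} o = !! (Q.<⇒≱ (N.s≤s N.z≤n) (Smp.long (Orntd.bdary o)))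
 factor {p} {y :: w} o = rot-to (cut-at 3 (fst wrap) p (y :: w) changes-four)
  where
  open Labels o
  open Orntd o
  rot-to : Cut 3 (fst wrap) p (y :: w) -> Factored P a b
  rot-to (C , l , w' , e , c , n , _) = Blocks.Arranged.factored o' (Blocks.four-blocks o' (\ z -> n (z ∙ ! v0≡)))
   where
   o' : Orntd P (tip p C) (l :: (w' ++ C))
   o' = Orntd-rot C (l :: w') (tp (Orntd P p) e o)
   module L' = Labels o'
   incoming : ∀ Z -> C == Z -> Σ Ltr \ x -> InEdge (tip p C) x (fst wrap)
   incoming [] refl = lst y w , snd wrap
   incoming (x :: Z) refl with snoc x Z
   ... | u , e' = lst x Z , tip p u , (u , l :: w' , e ∙ ap (_++ (l :: w')) e' ∙ ++-as u (lst x Z :: []) (l :: w') , refl) , ! (tip-++ p u (lst x Z :: [])) ∙ ap (tip p) (! e') , Const-edge C c (u , [] , e' , refl)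
   old : InEdge (tip p C) (lst l (w' ++ C)) (fst L'.wrap)
   old with snd L'.wrap
   ... | r , h , k , g = r , tp (\ z -> EOf p z r (lst l (w' ++ C))) (! e) (EOf-rot C (l :: w') (ap (tip p) (! e) ∙ Smp.closed bdary) h) , k , g
   v0≡ : fst wrap == fst L'.wrap
   v0≡ = snd (in-uniq (snd (incoming C refl)) old)

oriented-uniq : ∀ {P p W q C} -> Orntd P p W -> Orntd P q C -> Σ Word \ u -> Σ Word \ v -> C == u ++ v × W == v ++ u × tip q u == p
oriented-uniq {P} {p} {[]} oW oC = !! (Q.<⇒≱ (N.s≤s N.z≤n) (Smp.long (Orntd.bdary oW)))
oriented-uniq {P} {p} {a :: w} {q} {C} oW oC = from-first (forward oC ([] , w , refl , refl))
 where
 forward : ∀ {q C} -> Orntd P q C -> ∀ {r l} -> EOf p (a :: w) r l -> EOf q C r l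
 forward {q} {C} oC {r} {l} e = pick (edge-inside (Orntd.bdary oC) r l ((ap2 _xor_ (! (Orntd.fills oC _)) (! (Orntd.fills oC _))) ∙ xor-tf (Orntd.left-in oW e) (Orntd.right-out oW e)))
  where
  pick : EdgeOf± q C r l -> EOf q C r l
  pick (inl h) = h
  pick (inr h) = !! (true≢false (ap P (! (lcell-inv r l)) ∙ Orntd.left-in oC h) (Orntd.right-out oW e))
 from-first : EOf q C p a -> Σ Word \ u -> Σ Word \ v -> C == u ++ v × a :: w == v ++ u × tip q u == p
 from-first (u , v , refl , refl) = u , a :: v , refl , ap (a ::_) (trace (Orntd.bdary oW) (Orntd.bdary oC') (\ r l e -> inl (forward oC' e)) (a :: []) w (v ++ u) (\ ()) refl refl) , refl
  where
  oC' : Orntd P (tip q u) ((a :: v) ++ u)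
  oC' = Orntd-rot u (a :: v) oC

closed-factor : ∀ {p} x f' z -> Smp p (x ++ (f' ++ z)) -> vec f' == org -> x ++ z != [] -> f' == []
closed-factor x [] z s c n = refl
closed-factor {p} x (l :: f') z s c n = !! (at-end z refl)
 where
 returns : tip p (x ++ (l :: f')) == tip p x
 returns = tip-++ p x (l :: f') ∙ tip-vec (tip p x) (l :: f') ∙ ap (tip p x <>_) c ∙ ⊕-idʳ (tip p x)
 at-end : ∀ z' -> z == z' -> ⊥
 at-end (m :: z') refl with pos-uniq x (x ++ (l :: f')) (Smp.distinct s) refl (! (++-as x (l :: f') (m :: z'))) (! returns)
 ... | e with I.++-identityʳ-unique x e
 ... | ()
 at-end [] refl = at-start x refl
  where
  at-start : ∀ x' -> x == x' -> ⊥
  at-start [] refl = n refl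
  at-start (k :: x') refl with pos-uniq [] (k :: x') (Smp.distinct s) refl refl (! (Smp.closed s) ∙ ap (\ t -> tip p ((k :: x') ++ t)) (++-id (l :: f')) ∙ returns)
  ... | ()

loopʷ : Word -> Word -> Word
loopʷ A B = A ++ (B ++ (rev A ++ rev B))

-- One factor inside the other: A = P X Q with X Y X⁻¹ Y⁻¹ the rotation of A B A⁻¹ B⁻¹ by P.
module Nested (P' X Q B Y : Word) (e : X ++ (Q ++ (B ++ (rev (P' ++ (X ++ Q)) ++ (rev B ++ P')))) == loopʷ X Y) (len-Y : # Y == # P' N.+ (# Q N.+ # B)) where
 private
  A M : Word
  A = P' ++ (X ++ Q)
  M = rev A
  tail≡ : (Q ++ B) ++ (M ++ (rev B ++ P')) == Y ++ (rev X ++ rev Y)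
  tail≡ = (++-as Q B _) ∙ (I.++-cancelˡ X _ _ e)
  front-part : Σ Word \ k -> Y == (Q ++ B) ++ k × M ++ (rev B ++ P') == k ++ (rev X ++ rev Y)
  front-part = olap≤ (Q ++ B) Y tail≡ (≤-tr (≤-re (#-++ Q)) (≤-tr (Q.m≤n+m _ (# P')) (≤-re (! len-Y))))
  k : Word
  k = fst front-part
  k-len : # k == # P'
  k-len = Q.+-cancelˡ-≡ (# Q N.+ # B) _ _ (ap (N._+ # k) (! (#-++ Q)) ∙ ! (#-++ (Q ++ B)) ∙ ap # (! (fst (snd front-part))) ∙ len-Y ∙ (Q.+-comm (# P') _))
  M-len : # M == # P' N.+ (# X N.+ # Q)
  M-len = len-rev A ∙ #-++ P' ∙ ap (# P' N.+_) (#-++ X)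
  returns-part : Σ Word \ h -> M == (k ++ rev X) ++ h × rev Y == h ++ (rev B ++ P')
  returns-part = olap≤ (k ++ rev X) M (++-as k (rev X) (rev Y) ∙ ! (snd (snd front-part))) (≤-tr (≤-re (#-++ k ∙ (ap2 N._+_ k-len (len-rev X)))) (≤-tr (Q.+-monoʳ-≤ (# P') (Q.m≤m+n (# X) (# Q))) (≤-re (! M-len))))
  s t : Word
  s = fst returns-part
  t = rev k
  t-len : # t == # P'
  t-len = len-rev k ∙ k-len
  s-len : # s == # Q
  s-len = Q.+-cancelˡ-≡ (# P' N.+ # X) _ _ (ap (N._+ # s) (! (#-++ k ∙ (ap2 N._+_ k-len (len-rev X)))) ∙ ! (#-++ (k ++ rev X)) ∙ ap # (! (fst (snd returns-part))) ∙ M-len ∙ ! (Q.+-assoc (# P') (# X) (# Q)))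
  A-conj : A == rev s ++ (X ++ t)
  A-conj = ! (rr A) ∙ ap rev (fst (snd returns-part)) ∙ rev-++ (k ++ rev X) s ∙ ap (rev s ++_) (rev-++ k (rev X) ∙ ap (_++ t) (rr X))
  sB : s ++ (rev B ++ P') == t ++ (rev B ++ rev Q)
  sB = ! (snd (snd returns-part)) ∙ ap rev (fst (snd front-part)) ∙ rev-++ (Q ++ B) k ∙ ap (t ++_) (rev-++ Q B)

 module _ {p : Cell} (simpleC : Smp p (loopʷ A B)) (B≢ : B != []) where
  private
   left-shift : ∀ T T2 -> P' == T2 ++ rev Q -> rev B ++ T2 == T ++ rev B -> rev T2 ++ T == []
   left-shift T T2 eP eT = closed-factor (rev E) (rev T2 ++ T) (rev B ++ (E ++ B)) (tp (Smp (tip p (A ++ B))) wholeᵃ (Simple-rot (A ++ B) (rev A ++ rev B) (tp (Smp p) (! (++-as A B (rev A ++ rev B))) simpleC)))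
    (vec-++ (rev T2) T ∙ (ap2 _<>_ (vec-rev T2) (conj-vec (rev B) eT)) ∙ ⊕-comm (neg (vec T2)) (vec T2) ∙ ⊕-invʳ (vec T2)) (\ n -> B≢ (rev-[] B (I.++-conicalˡ (rev B) (E ++ B) (I.++-conicalʳ (rev E) _ n))))
    where
    E : Word
    E = rev Q ++ (X ++ Q)
    A-left : A == T2 ++ E
    A-left = ap (_++ (X ++ Q)) eP ∙ ++-as T2 (rev Q) (X ++ Q)
    asc : ∀ a b c d e f' -> ((a ++ b) ++ c) ++ ((d ++ e) ++ f') == a ++ (b ++ ((c ++ d) ++ (e ++ f')))
    asc a b c d e f' = solve words
    assoc' : ∀ a b c d e -> a ++ (b ++ ((c ++ d) ++ e)) == a ++ ((b ++ c) ++ (d ++ e))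
    assoc' a b c d e = solve words
    wholeᵃ : (rev A ++ rev B) ++ (A ++ B) == rev E ++ ((rev T2 ++ T) ++ (rev B ++ (E ++ B)))
    wholeᵃ = ap2 (\ a b -> (a ++ rev B) ++ (b ++ B)) (ap rev A-left ∙ rev-++ T2 E) A-left ∙ asc (rev E) (rev T2) (rev B) T2 E B ∙
     ap (\ z -> rev E ++ (rev T2 ++ (z ++ (E ++ B)))) eT ∙ assoc' (rev E) (rev T2) T (rev B) (E ++ B)

   right-shift : ∀ S1 S2 -> rev Q == S2 ++ P' -> S1 ++ rev B == rev B ++ S2 -> rev S1 ++ S2 == []
   right-shift S1 S2 eQ eS = closed-factor (E ++ B) (rev S1 ++ S2) (rev E ++ rev B) (tp (Smp p) wholeᵃ simpleC)
    (vec-++ (rev S1) S2 ∙ ap (_<> vec S2) (vec-rev S1 ∙ ap neg (conj-vec (rev B) (! eS))) ∙ ⊕-comm (neg (vec S2)) (vec S2) ∙ ⊕-invʳ (vec S2)) (\ n -> B≢ (I.++-conicalʳ E B (I.++-conicalˡ (E ++ B) _ n)))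
    where
    E : Word
    E = P' ++ (X ++ rev P')
    A-right : A == E ++ rev S2
    A-right = ap (\ z -> P' ++ (X ++ z)) (! (rr Q) ∙ ap rev eQ ∙ rev-++ S2 P') ∙ asc P' X (rev P') (rev S2)
     where
     asc : ∀ a b c d -> a ++ (b ++ (c ++ d)) == (a ++ (b ++ c)) ++ d
     asc a b c d = solve words
    flipped : rev S2 ++ B == B ++ rev S1
    flipped = rev-≡ (rev-++ (rev S2) B ∙ ap (rev B ++_) (rr S2) ∙ ! eS ∙ ap (_++ rev B) (! (rr S1)) ∙ ! (rev-++ B (rev S1)))
    wholeᵃ : loopʷ A B == (E ++ B) ++ ((rev S1 ++ S2) ++ (rev E ++ rev B))
    wholeᵃ = ap2 (\ a b -> a ++ (B ++ (b ++ rev B))) A-right (ap rev A-right ∙ rev-++ E (rev S2) ∙ ap (_++ rev E) (rr S2)) ∙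
      asc E (rev S2) B S2 (rev E) (rev B) ∙ ap (\ z -> E ++ (z ++ (S2 ++ (rev E ++ rev B)))) flipped ∙ assoc' E B (rev S1) S2 (rev E ++ rev B)
     where
     asc : ∀ a b c d e f' -> (a ++ b) ++ (c ++ ((d ++ e) ++ f')) == a ++ ((b ++ c) ++ (d ++ (e ++ f')))
     asc a b c d e f' = solve words
     assoc' : ∀ a b c d e -> a ++ ((b ++ c) ++ (d ++ e)) == (a ++ b) ++ ((c ++ d) ++ e)
     assoc' a b c d e = solve words

   balanced : P' == rev Q × t == s
   balanced = compare (Q.≤-total (# s) (# t))
    where
    compare : # s ≤ # t ⊎ # t ≤ # s -> P' == rev Q × t == s
    compare (inl le) = first (olap≤ s t sB le)
     where
     first : (Σ Word \ T -> t == s ++ T × rev B ++ P' == T ++ (rev B ++ rev Q)) -> P' == rev Q × t == s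
     first (T , e1 , e2) = second (olap≤ (rev B) (T ++ rev B) (e2 ∙ ! (++-as T (rev B) (rev Q))) (≤-tr (Q.m≤n+m _ (# T)) (≤-re (! (#-++ T)))))
      where
      second : (Σ Word \ T2 -> T ++ rev B == rev B ++ T2 × P' == T2 ++ rev Q) -> P' == rev Q × t == s
      second (T2 , e3 , e4) = e4 ∙ ap (_++ rev Q) (rev-[] T2 (I.++-conicalˡ (rev T2) T z)) , e1 ∙ ap (s ++_) (I.++-conicalʳ (rev T2) T z) ∙ ++-id s
       where
       z : rev T2 ++ T == []
       z = left-shift T T2 e4 (! e3)
    compare (inr le) = first (olap≤ t s (! sB) le)
     where
     first : (Σ Word \ S1 -> s == t ++ S1 × rev B ++ rev Q == S1 ++ (rev B ++ P')) -> P' == rev Q × t == s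
     first (S1 , e1 , e2) = second (olap≤ (rev B) (S1 ++ rev B) (e2 ∙ ! (++-as S1 (rev B) P')) (≤-tr (Q.m≤n+m _ (# S1)) (≤-re (! (#-++ S1)))))
      where
      second : (Σ Word \ S2 -> S1 ++ rev B == rev B ++ S2 × rev Q == S2 ++ P') -> P' == rev Q × t == s
      second (S2 , e3 , e4) = ! (e4 ∙ ap (_++ P') (I.++-conicalʳ (rev S1) S2 z)) , ! (e1 ∙ ap (t ++_) (rev-[] S1 (I.++-conicalˡ (rev S1) S2 z)) ∙ ++-id t)
       where
       z : rev S1 ++ S2 == []
       z = right-shift S1 S2 e4 e3

  same-vectors : vec X == vec A × vec Y == vec B
  same-vectors = ! vec-A , ap vec (fst (snd front-part)) ∙ vec-++ (Q ++ B) k ∙ (ap2 _<>_ (vec-++ Q B) (ap vec (! (rr k) ∙ ap rev (snd balanced ∙ s≡Q)) ∙ vec-rev Q)) ∙ ap (_<> neg (vec Q)) (⊕-comm (vec Q) (vec B)) ∙ ⊕-can (vec B) (vec Q)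
   where
   s≡Q : s == Q
   s≡Q = ! (rev-≡ (! (fst balanced) ∙ fst (align P' (rev s) A-conj (ap # (fst balanced) ∙ len-rev Q ∙ ! s-len ∙ ! (len-rev s)))))
   vec-A : vec A == vec X
   vec-A = vec-++ P' (X ++ Q) ∙ (ap2 _<>_ (ap vec (fst balanced) ∙ vec-rev Q) (vec-++ X Q)) ∙ ⊕-comm (neg (vec Q)) (vec X <> vec Q) ∙ ⊕-can (vec X) (vec Q)

loopʷ-len : ∀ A B -> # (loopʷ A B) == (# A N.+ # B) N.+ (# A N.+ # B)
loopʷ-len A B = #-++ A ∙ ap (# A N.+_) (#-++ B ∙ ap (# B N.+_) (#-++ (rev A) ∙ (ap2 N._+_ (len-rev A) (len-rev B)))) ∙ ! (Q.+-assoc (# A) (# B) _)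

double-inj : ∀ m n -> m N.+ m == n N.+ n -> m == n
double-inj zero zero e = refl
double-inj (suc m) (suc n) e = ap suc (double-inj m n (Q.suc-injective (! (Q.+-suc m m) ∙ Q.suc-injective e ∙ Q.+-suc n n)))

Factored-rot : ∀ {P a b} -> Factored P a b -> Factored P a b
Factored-rot {P} F = record { base-point = tip base-point A ; A = B ; B = rev A ; A≢ = B≢ ; B≢ = \ z -> A≢ (rev-[] A z)
 ; oriented = tp (Orntd P (tip base-point A)) (asc A B (rev A) (rev B) ∙ ap (\ z -> B ++ (rev A ++ (rev B ++ z))) (! (rr A))) (Orntd-rot A (B ++ (rev A ++ rev B)) oriented)
 ; into = \ u i -> InL-combine (tp (InL (vec B) (vec (rev A))) (ap neg (vec-rev A) ∙ neg-neg (vec A)) (InL-neg InL-snd)) InL-fst (into u i)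
 ; onto = \ u i -> onto u (InL-combine InL-snd (tp (InL (vec A) (vec B)) (! (vec-rev A)) (InL-neg InL-fst)) i) }
 where
 open Factored F
 asc : ∀ a b c d -> (b ++ (c ++ d)) ++ a == b ++ (c ++ (d ++ a))
 asc a b c d = solve words

OctagonOf : Shape -> Set
OctagonOf P = Σ Chn \ V -> IsCh V × Σ Cell \ p -> Orntd P p (⟦ oct ⟧ V)

interleave : ∀ {P p} u t m B2 A' B' -> u != [] -> t != [] -> m != [] -> B2 != [] -> A' == t ++ m -> # B' == # u N.+ # B2 ->
       B2 ++ (rev (u ++ t) ++ (rev (m ++ B2) ++ u)) == B' ++ (rev A' ++ rev B') -> Orntd P p (loopʷ (u ++ t) (m ++ B2)) -> OctagonOf P
interleave {P} {p} u t m B2 A' B' u≢ t≢ m≢ B2≢ eA' len e o = s1 (olap≤ B2 B' e (≤-tr (Q.m≤n+m _ (# u)) (≤-re (! len))))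
 where
 A B : Word
 A = u ++ t
 B = m ++ B2
 by-len : ∀ {v w : Word} -> # v == # w -> w != [] -> v != []
 by-len {v} {w} h n refl = n (nil w (! h))
 second-len : ∀ {a b c d w : Word} -> w == a ++ b -> # w == # c N.+ # d -> # a == # c -> # b == # d
 second-len {a} {b} {c} {d} {w} h k g = Q.+-cancelˡ-≡ (# a) _ _ (! (#-++ a) ∙ ap # (! h) ∙ k ∙ ap (N._+ # d) (! g))
 s1 : (Σ Word \ V4 -> B' == B2 ++ V4 × rev A ++ (rev B ++ u) == V4 ++ (rev A' ++ rev B')) -> OctagonOf P
 s1 (V4 , e1 , f1) = s2 (olap≤ V4 (rev A) (! f1) (≤-tr (≤-re l4) (≤-tr (Q.m≤m+n _ (# t)) (≤-re (! lA)))))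
  where
  l4 : # V4 == # u
  l4 = second-len {B2} {V4} {B2} {u} e1 (len ∙ Q.+-comm (# u) (# B2)) refl
  lA : # (rev A) == # u N.+ # t
  lA = len-rev A ∙ #-++ u
  s2 : (Σ Word \ V5 -> rev A == V4 ++ V5 × rev A' ++ rev B' == V5 ++ (rev B ++ u)) -> OctagonOf P
  s2 (V5 , e2 , f2) = s3 (olap≤ V5 (rev A') (! f2) (≤-tr (≤-re l5) (≤-tr (Q.m≤m+n _ (# m)) (≤-re (! lA')))))
   where
   l5 : # V5 == # t
   l5 = second-len {V4} {V5} {u} {t} e2 lA l4
   lA' : # (rev A') == # t N.+ # m
   lA' = len-rev A' ∙ ap # eA' ∙ #-++ t
   s3 : (Σ Word \ V6 -> rev A' == V5 ++ V6 × rev B ++ u == V6 ++ rev B') -> OctagonOf P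
   s3 (V6 , e3 , f3) = s4 (olap≤ V6 (rev B) (! f3) (≤-tr (≤-re l6) (≤-tr (Q.m≤m+n _ (# B2)) (≤-re (! lB)))))
    where
    l6 : # V6 == # m
    l6 = second-len {V5} {V6} {t} {m} e3 lA' l5
    lB : # (rev B) == # m N.+ # B2
    lB = len-rev B ∙ #-++ m
    s4 : (Σ Word \ V7 -> rev B == V6 ++ V7 × rev B' == V7 ++ u) -> OctagonOf P
    s4 (V7 , e4 , f4) = V , record { perio = \ n -> refl ; laced = inter ; nonem = \ n -> ne (n N.% 8) } , p , tp (Orntd P p) (ap2 (\ x y -> A ++ (B ++ (x ++ y))) e2 e4 ∙ asc u t m B2 V4 V5 V6 V7) o
     where
     asc : ∀ a b c d e f' g' h -> (a ++ b) ++ ((c ++ d) ++ ((e ++ f') ++ (g' ++ h))) == a ++ (b ++ (c ++ (d ++ (e ++ (f' ++ (g' ++ (h ++ [])))))))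
     asc a b c d e f' g' h = solve words
     table' : ℕ -> Word
     table' 0 = u
     table' 1 = t
     table' 2 = m
     table' 3 = B2
     table' 4 = V4
     table' 5 = V5
     table' 6 = V6
     table' _ = V7
     V : Chn
     V n = table' (n N.% 8)
     ne : ∀ n -> table' n != []
     ne 0 = u≢
     ne 1 = t≢
     ne 2 = m≢
     ne 3 = B2≢
     ne 4 = by-len l4 u≢
     ne 5 = by-len l5 t≢
     ne 6 = by-len l6 m≢
     ne (suc (suc (suc (suc (suc (suc (suc _))))))) = by-len (second-len {V6} {V7} {m} {B2} e4 lB l6) B2≢
     flip-over : ∀ {x y} -> rev x == y -> x == rev y
     flip-over {x} h = ! (rr x) ∙ ap rev h
     inter : ∀ n -> V n ++ V (1 N.+ n) == rev (V (4 N.+ n) ++ V (5 N.+ n))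
     inter 0 = flip-over e2
     inter 1 = flip-over (ap rev (! eA') ∙ e3)
     inter 2 = flip-over e4
     inter 3 = flip-over (ap rev (! e1) ∙ f4)
     inter 4 = ! e2
     inter 5 = ! e3 ∙ ap rev eA'
     inter 6 = ! e4
     inter 7 = ! f4 ∙ ap rev e1
     inter (suc (suc (suc (suc (suc (suc (suc (suc n)))))))) = inter n

module TwoFactorizations {P : Shape} {a b a' b' : Cell} (F' : Factored P a' b') (different : (∀ u -> InL a b u -> InL a' b' u) -> (∀ u -> InL a' b' u -> InL a b u) -> ⊥) where
 open Factored F' using () renaming (A to A'; B to B'; A≢ to A'≢; B≢ to B'≢; oriented to oriented'; into to into'; onto to onto')

 module _ (F : Factored P a b) where
  open Factored F

  apart : InL (vec A') (vec B') (vec A) -> InL (vec A') (vec B') (vec B) -> InL (vec A) (vec B) (vec A') -> InL (vec A) (vec B) (vec B') -> ⊥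
  apart i j k l = different (\ u h -> onto' u (InL-combine i j (into u h))) (\ u h -> onto u (InL-combine k l (into' u h)))

  started : ∀ u t -> t != [] -> A == u ++ t -> loopʷ A' B' == t ++ (B ++ (rev A ++ (rev B ++ u))) -> OctagonOf P
  started u t t≢ eA e = compare (olap A' t e)
   where
   A-loop : # (t ++ (B ++ (rev A ++ (rev B ++ u)))) == # (loopʷ A B)
   A-loop = (ap # (asc t B (rev A) (rev B) u) ∙ (#-++ (t ++ (B ++ (rev A ++ rev B))) ∙ (Q.+-comm _ (# u))) ∙ (! (#-++ u) ∙ ap # (! (++-as u t _))) ∙ ap (\ z -> # (z ++ (B ++ (rev A ++ rev B)))) (! eA))
    where
    asc : ∀ a b c d e -> a ++ (b ++ (c ++ (d ++ e))) == (a ++ (b ++ (c ++ d))) ++ e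
    asc a b c d e = solve words
   half : # A' N.+ # B' == # A N.+ # B
   half = double-inj _ _ (! (loopʷ-len A' B') ∙ ap # e ∙ A-loop ∙ loopʷ-len A B)
   A-len : # A == # u N.+ # t
   A-len = ap # eA ∙ #-++ u
   simpleC : Smp base-point (loopʷ A B)
   simpleC = Orntd.bdary oriented

   inner : ∀ m -> t == A' ++ m -> B' ++ (rev A' ++ rev B') == m ++ (B ++ (rev A ++ (rev B ++ u))) -> ⊥
   inner m refl e' = apart (tp (InL (vec A') (vec B')) v1 InL-fst) (tp (InL (vec A') (vec B')) v2 InL-snd) (tp (InL (vec A) (vec B)) (! v1) InL-fst) (tp (InL (vec A) (vec B)) (! v2) InL-snd)
    where
    e″ : A' ++ (m ++ (B ++ (rev (u ++ (A' ++ m)) ++ (rev B ++ u)))) == loopʷ A' B'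
    e″ = ap (A' ++_) (! (e' ∙ ap (\ z -> m ++ (B ++ (rev z ++ (rev B ++ u)))) eA))
    B'-len : # B' == # u N.+ (# m N.+ # B)
    B'-len = Q.+-cancelˡ-≡ (# A') _ _ (half ∙ ap (N._+ # B) (A-len ∙ ap (# u N.+_) (#-++ A')) ∙ alg (# u) (# A') (# m) (# B))
     where
     alg : ∀ a b c d -> a N.+ (b N.+ c) N.+ d == b N.+ (a N.+ (c N.+ d))
     alg = ringN
    vs : vec A' == vec (u ++ (A' ++ m)) × vec B' == vec B
    vs = Nested.same-vectors u A' m B B' e″ B'-len {base-point} (tp (\ z -> Smp base-point (loopʷ z B)) eA simpleC) B≢
    v1 : vec A' == vec A
    v1 = fst vs ∙ ap vec (! eA)
    v2 : vec B' == vec B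
    v2 = snd vs

   outer : ∀ m -> u == [] -> A' == t ++ m -> B ++ (rev A ++ (rev B ++ u)) == m ++ (B' ++ (rev A' ++ rev B')) -> ⊥
   outer m refl eA' e' = apart (tp (InL (vec A') (vec B')) (! v1) InL-fst) (tp (InL (vec A') (vec B')) (! v2) InL-snd) (tp (InL (vec A) (vec B)) v1 InL-fst) (tp (InL (vec A) (vec B)) v2 InL-snd)
    where
    A'≡ : A' == A ++ m
    A'≡ = eA' ∙ ap (_++ m) (! eA)
    e″ : A ++ (m ++ (B' ++ (rev ([] ++ (A ++ m)) ++ (rev B' ++ [])))) == loopʷ A B
    e″ = ap (A ++_) (! (e' ∙ ap (\ z -> m ++ (B' ++ z)) (ap2 _++_ (ap rev A'≡) (! (++-id (rev B'))))) ∙ ap (\ z -> B ++ (rev A ++ z)) (++-id (rev B)))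
    B-len : # B == # m N.+ # B'
    B-len = Q.+-cancelˡ-≡ (# A) _ _ (! half ∙ ap (N._+ # B') (ap # A'≡ ∙ #-++ A) ∙ Q.+-assoc (# A) (# m) (# B'))
    vs : vec A == vec (A ++ m) × vec B == vec B'
    vs = Nested.same-vectors [] A m B' B e″ B-len {Factored.base-point F'} (tp (\ z -> Smp (Factored.base-point F') (loopʷ z B')) A'≡ (Orntd.bdary oriented')) B'≢
    v1 : vec A == vec A'
    v1 = fst vs ∙ ap vec (! A'≡)
    v2 : vec B == vec B'
    v2 = snd vs

   beyond : ∀ m' -> A' == t ++ (B ++ m') -> rev A ++ (rev B ++ u) == m' ++ (B' ++ (rev A' ++ rev B')) -> ⊥
   beyond m' eA' e' = split-off (olap≤ (m' ++ B') (rev A) ((++-as m' B' _) ∙ ! e') (≤-tr (≤-re (#-++ m' ∙ inner-len)) (≤-tr (Q.m≤m+n (# u) (# t)) (≤-re (! A-len ∙ ! (len-rev A))))))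
    where
    A'-len : # A' == # t N.+ (# B N.+ # m')
    A'-len = ap # eA' ∙ #-++ t ∙ ap (# t N.+_) (#-++ B)
    inner-len : # m' N.+ # B' == # u
    inner-len = Q.+-cancelˡ-≡ (# t N.+ # B) _ _ (alg (# t) (# B) (# m') (# B') ∙ ap (N._+ # B') (! A'-len) ∙ half ∙ ap (N._+ # B) A-len ∙ alg' (# u) (# t) (# B))
     where
     alg : ∀ a b c d -> (a N.+ b) N.+ (c N.+ d) == (a N.+ (b N.+ c)) N.+ d
     alg = ringN
     alg' : ∀ a b c -> (a N.+ b) N.+ c == (b N.+ c) N.+ a
     alg' = ringN
    split-off : (Σ Word \ Q -> rev A == (m' ++ B') ++ Q × rev A' ++ rev B' == Q ++ (rev B ++ u)) -> ⊥
    split-off (Q , e1 , e2) = apart (tp (InL (vec A') (vec B')) (! vA) (InL-neg InL-snd)) (tp (InL (vec A') (vec B')) (! vB) InL-fst)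
     (tp (InL (vec A) (vec B)) vB InL-snd) (tp (InL (vec A) (vec B)) (ap neg vA ∙ neg-neg (vec B')) (InL-neg InL-fst))
     where
     rA : rev A == m' ++ (B' ++ Q)
     rA = e1 ∙ ++-as m' B' Q
     Q-len : # Q == # t
     Q-len = Q.+-cancelˡ-≡ (# u) _ _ (ap (N._+ # Q) (! inner-len ∙ ! (#-++ m')) ∙ ! (#-++ (m' ++ B')) ∙ ap # (! e1) ∙ len-rev A ∙ A-len)
     e″ : B' ++ (Q ++ (rev B ++ (rev (m' ++ (B' ++ Q)) ++ (rev (rev B) ++ m')))) == loopʷ B' (rev A')
     e″ = ap (B' ++_) ((ap2 (\ x y -> Q ++ (rev B ++ (x ++ (y ++ m')))) (ap rev (! rA) ∙ rr A ∙ eA) (rr B) ∙ asc Q (rev B) u t (B ++ m') ∙ (ap2 _++_ (! e2) (! eA')) ∙ ++-as (rev A') (rev B') A' ∙ ap (\ z -> rev A' ++ (rev B' ++ z)) (! (rr A'))))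
      where
      asc : ∀ a b c d e -> a ++ (b ++ ((c ++ d) ++ e)) == (a ++ (b ++ c)) ++ (d ++ e)
      asc a b c d e = solve words
     sizes : # (rev A') == # m' N.+ (# Q N.+ # (rev B))
     sizes = len-rev A' ∙ A'-len ∙ alg (# t) (# B) (# m') ∙ ap2 (\ x y -> # m' N.+ (x N.+ y)) (! Q-len) (! (len-rev B))
      where
      alg : ∀ a b c -> a N.+ (b N.+ c) == c N.+ (a N.+ b)
      alg = ringN
     turned-loop : Smp (tip base-point (A ++ B)) (loopʷ (m' ++ (B' ++ Q)) (rev B))
     turned-loop = tp (Smp (tip base-point (A ++ B))) (++-as (rev A) (rev B) (A ++ B) ∙ ap2 (\ x y -> x ++ (rev B ++ y)) rA (ap2 _++_ (! (rr A) ∙ ap rev rA) (! (rr B))))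
      (Simple-rot (A ++ B) (rev A ++ rev B) (tp (Smp base-point) (! (++-as A B (rev A ++ rev B))) simpleC))
     vs : vec B' == vec (m' ++ (B' ++ Q)) × vec (rev A') == vec (rev B)
     vs = Nested.same-vectors m' B' Q (rev B) (rev A') e″ sizes turned-loop (\ z -> B≢ (rev-[] B z))
     vA : vec A == neg (vec B')
     vA = ! (neg-neg (vec A)) ∙ ap neg (! (vec-rev A) ∙ ap vec rA ∙ ! (fst vs))
     vB : vec B == vec A'
     vB = ! (neg-neg (vec B)) ∙ ap neg (! (vec-rev B) ∙ ! (snd vs) ∙ vec-rev A') ∙ neg-neg (vec A')

   across' : ∀ m -> m != [] -> A' == t ++ m -> B ++ (rev A ++ (rev B ++ u)) == m ++ (B' ++ (rev A' ++ rev B')) -> u != [] -> OctagonOf P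
   across' m m≢ eA' e' u≢ = pick (olap m B (! e'))
    where
    pick : (Σ Word \ B2 -> B == m ++ B2 × B' ++ (rev A' ++ rev B') == B2 ++ (rev A ++ (rev B ++ u))) ⊎ (Σ Word \ m' -> m' != [] × m == B ++ m' × rev A ++ (rev B ++ u) == m' ++ (B' ++ (rev A' ++ rev B'))) -> OctagonOf P
    pick (inr (m' , _ , em , e″)) = !! (beyond m' (eA' ∙ ap (t ++_) em) e″)
    pick (inl ([] , eB , e″)) = !! (beyond [] (eA' ∙ ap (t ++_) (! (++-id m) ∙ ! eB ∙ ! (++-id B))) (! e″))
    pick (inl (x :: B2 , eB , e″)) = interleave u t m (x :: B2) A' B' u≢ t≢ m≢ (\ ()) eA'
     (Q.+-cancelˡ-≡ (# t N.+ # m) _ _ (ap (N._+ # B') (! (ap # eA' ∙ #-++ t)) ∙ half ∙ (ap2 N._+_ A-len (ap # eB ∙ #-++ m)) ∙ alg (# u) (# t) (# m) (# (x :: B2))))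
     (ap2 (\ a b -> (x :: B2) ++ (rev a ++ (rev b ++ u))) (! eA) (! eB) ∙ ! e″) (tp (Orntd P base-point) (ap2 loopʷ eA eB) oriented)
     where
     alg : ∀ a b c d -> (a N.+ b) N.+ (c N.+ d) == (b N.+ c) N.+ (a N.+ d)
     alg = ringN

   compare : (Σ Word \ m -> t == A' ++ m × B' ++ (rev A' ++ rev B') == m ++ (B ++ (rev A ++ (rev B ++ u)))) ⊎ (Σ Word \ m -> m != [] × A' == t ++ m × B ++ (rev A ++ (rev B ++ u)) == m ++ (B' ++ (rev A' ++ rev B'))) -> OctagonOf P
   compare (inl (m , e1 , e2)) = !! (inner m e1 e2)
   compare (inr (m , m≢ , e1 , e2)) = by-start u refl
    where
    by-start : ∀ z -> u == z -> OctagonOf P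
    by-start [] z = !! (outer m z e1 e2)
    by-start (x :: z) h = across' m m≢ e1 e2 \ n -> cons≢ (! h ∙ n)
     where
     cons≢ : ∀ {x : Ltr} {z : Word} -> x :: z != []
     cons≢ ()

 arrange : ∀ n (F : Factored P a b) u v -> # u ≤ n -> loopʷ (Factored.A F) (Factored.B F) == u ++ v -> loopʷ A' B' == v ++ u -> OctagonOf P
 arrange n F u v le e e' = decide (olap A u e)
  where
  open Factored F
  decide : (Σ Word \ m -> u == A ++ m × B ++ (rev A ++ rev B) == m ++ v) ⊎ (Σ Word \ m -> m != [] × A == u ++ m × v == m ++ (B ++ (rev A ++ rev B))) -> OctagonOf P
  decide (inr (t , t≢ , eA , ev)) = started F u t t≢ eA (e' ∙ ap (_++ u) ev ∙ asc t B (rev A) (rev B) u)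
   where
   asc : ∀ a b c d e -> (a ++ (b ++ (c ++ d))) ++ e == a ++ (b ++ (c ++ (d ++ e)))
   asc a b c d e = solve words
  decide (inl (m , eu , ev)) = again n le
   where
   shorter : suc (# m) ≤ # u
   shorter = ≤-tr (Q.+-monoˡ-≤ (# m) (nonem-len A≢)) (≤-re (! (ap # eu ∙ #-++ A)))
   again : ∀ n -> # u ≤ n -> OctagonOf P
   again zero le = !! (Q.<⇒≱ (N.s≤s N.z≤n) (≤-tr shorter le))
   again (suc n) le = arrange n (Factored-rot F) m (v ++ A) (Q.≤-pred (≤-tr shorter le)) (ap (\ z -> B ++ (rev A ++ (rev B ++ z))) (rr A) ∙ asc B (rev A) (rev B) A ∙ ap (_++ A) ev ∙ ++-as m v A)
    (e' ∙ ap (v ++_) eu ∙ ! (++-as v A m))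
    where
    asc : ∀ a b c d -> a ++ (b ++ (c ++ d)) == (a ++ (b ++ c)) ++ d
    asc a b c d = solve words

two-factorizations : ∀ {P a b a' b'} -> Factored P a b -> Factored P a' b' -> ((∀ u -> InL a b u -> InL a' b' u) -> (∀ u -> InL a' b' u -> InL a b u) -> ⊥) -> OctagonOf P
two-factorizations F F' d with oriented-uniq (Factored.oriented F') (Factored.oriented F)
... | u , v , e , e' , _ = TwoFactorizations.arrange F' d (# u) F u v Q.≤-refl e e'

oct-rot : ∀ {P p V} -> IsCh V -> Orntd P p (⟦ oct ⟧ V) -> Orntd P (tip p (V 0)) (⟦ oct ⟧ (trl 1 V))
oct-rot {P} {p} {V} ch o = tp (Orntd P (tip p (V 0))) (asc (V 1) (V 2) (V 3) (V 4) (V 5) (V 6) (V 7) (V 0) ∙ ap (\ z -> V 1 ++ (V 2 ++ (V 3 ++ (V 4 ++ (V 5 ++ (V 6 ++ (V 7 ++ (z ++ [])))))))) (! (IsCh.perio ch 0)))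
 (Orntd-rot (V 0) (V 1 ++ (V 2 ++ (V 3 ++ (V 4 ++ (V 5 ++ (V 6 ++ (V 7 ++ []))))))) o)
 where
 asc : ∀ a b c d e f' g' h -> (a ++ (b ++ (c ++ (d ++ (e ++ (f' ++ (g' ++ []))))))) ++ h == a ++ (b ++ (c ++ (d ++ (e ++ (f' ++ (g' ++ (h ++ [])))))))
 asc a b c d e f' g' h = solve words

oct-trl : ∀ n {P p V} -> IsCh V -> Orntd P p (⟦ oct ⟧ V) -> Σ Cell \ q -> Orntd P q (⟦ oct ⟧ (trl n V))
oct-trl zero {P} {p} ch o = p , o
oct-trl (suc n) {P} {p} {V} ch o = oct-trl n {P} {tip p (V 0)} {trl 1 V} (IsChain-suc ch) (oct-rot ch o)

first-win : ∀ {p V} -> IsCh V -> Smp p (⟦ oct ⟧ V) -> Open (⟦ win 0 ⟧ V)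
first-win {p} {V} ch s u f' v e c = closed-factor u f' (v ++ rest) (tp (Smp p) wholeᵃ s) c (\ n -> IsCh.nonem ch 4 (I.++-conicalˡ (V 4) _ (I.++-conicalʳ v rest (I.++-conicalʳ u (v ++ rest) n))))
 where
 rest : Word
 rest = V 4 ++ (V 5 ++ (V 6 ++ (V 7 ++ [])))
 asc : ∀ a b c d r -> a ++ (b ++ (c ++ (d ++ r))) == (a ++ (b ++ (c ++ (d ++ [])))) ++ r
 asc a b c d r = solve words
 assoc' : ∀ a b c d -> (a ++ (b ++ c)) ++ d == a ++ (b ++ (c ++ d))
 assoc' a b c d = solve words
 wholeᵃ : ⟦ oct ⟧ V == u ++ (f' ++ (v ++ rest))
 wholeᵃ = asc (V 0) (V 1) (V 2) (V 3) rest ∙ ap (_++ rest) e ∙ assoc' u f' v rest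

-- Equal first letters of V 0 and V 4 would put two cells of P into the same class modulo the lattice.
first-heads : ∀ {P p V} -> IsCh V -> Orntd P p (⟦ oct ⟧ V) -> hd (V 0) != hd (V 4)
first-heads {P} {p} {V} ch o h = start-with (uncons (nonem 0)) (uncons (nonem 2)) (uncons (nonem 4))
 where
 open IsCh ch
 start-with : (Σ Ltr \ l -> Σ Word \ x -> V 0 == l :: x) -> (Σ Ltr \ m -> Σ Word \ z -> V 2 == m :: z) -> (Σ Ltr \ k -> Σ Word \ y -> V 4 == k :: y) -> ⊥
 start-with (l , x , e0) (m , z , e2) (k , y , e4) = L.det-nonzero dependent
  where
  word≡ : ⟦ oct ⟧ V == loop (l :: (x ++ V 1)) (m :: (z ++ V 3))
  word≡ = pair-loop ch ∙ ap2 (\ s t -> loop (s ++ V 1) (t ++ V 3)) e0 e2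
  o' : Orntd P p (loop (l :: (x ++ V 1)) (m :: (z ++ V 3)))
  o' = tp (Orntd P p) word≡ o
  module L = LoopTiling l (x ++ V 1) m (z ++ V 3) (Orntd.bdary o') P (Orntd.fills o')
  γ : Cell
  γ = L.α <> L.β
  l≡k : l == k
  l≡k = unjust (ap hd (! e0) ∙ h ∙ ap hd e4)
   where
   unjust : ∀ {a b : Ltr} -> just a == just b -> a == b
   unjust refl = refl
  far-edge : EOf p (loop (l :: (x ++ V 1)) (m :: (z ++ V 3))) (p <> γ) l
  far-edge = L.A ++ L.B , y ++ (V 5 ++ rev L.B) , ! (++-as L.A L.B (rev L.A ++ rev L.B)) ∙ ap (\ t -> (L.A ++ L.B) ++ t) (ap (_++ rev L.B) reversed ∙ ++-as (l :: y) (V 5) (rev L.B)) ,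
    tip-vec p (L.A ++ L.B) ∙ ap (p <>_) (vec-++ L.A L.B)
   where
   reversed : rev L.A == (l :: y) ++ V 5
   reversed = ap (\ s -> rev (s ++ V 1)) (! e0) ∙ ap rev (laced 0) ∙ rr (V 4 ++ V 5) ∙ ap (_++ V 5) (e4 ∙ ap (_:: y) (! l≡k))
  c : Cell
  c = lcell p l
  moved : (c <> γ) <> neg c == γ
  moved = ⊕-swap c γ (neg c) ∙ ap (_<> γ) (⊕-invʳ c) ∙ ⊕-idˡ γ
  γ≡ : γ == org
  γ≡ = ⊕-canˡ c (! (L.class-uniq c c (c <> γ) (tp (InL L.α L.β) (! (⊕-invʳ c)) InL-org) (tp (InL L.α L.β) (! moved) (InL-⊕ InL-fst InL-snd))
   (Orntd.left-in o' ([] , (x ++ V 1) ++ (L.B ++ rev L.A ++ rev L.B) , refl , refl)) (ap P (! (lcell-⊕ p γ l)) ∙ Orntd.left-in o' far-edge)) ∙ ! (⊕-idʳ c))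
  dependent : det L.α L.β == + 0
  dependent = ap (det L.α) β≡ ∙ alg (fst L.α) (snd L.α)
   where
   β≡ : L.β == neg L.α
   β≡ = ⊕-canˡ L.α (γ≡ ∙ ! (⊕-invʳ L.α))
   alg : ∀ a b -> a * (Z.- b) Z.- b * (Z.- a) == + 0
   alg = ring

oct-redcd : ∀ {P p V} -> IsCh V -> Orntd P p (⟦ oct ⟧ V) -> Redcd V
oct-redcd {P} {p} {V} ch o = record { chain = ch ; free = windows ; heads = heads' }
 where
 windows : ∀ j -> Open (⟦ win j ⟧ V)
 windows j with oct-trl j ch o
 ... | q , oj = tp Open (ap2 _++_ (ap V (Q.+-identityʳ j)) (ap2 _++_ (ap V (Q.+-comm j 1)) (ap2 _++_ (ap V (Q.+-comm j 2)) (ap2 _++_ (ap V (Q.+-comm j 3)) refl)))) (first-win {q} {trl j V} (IsChain-trl j ch) (Orntd.bdary oj))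
 heads' : ∀ j -> hd (V j) != hd (V (4 N.+ j))
 heads' j h with oct-trl j ch o
 ... | q , oj = first-heads {P} {q} {trl j V} (IsChain-trl j ch) oj (ap (\ z -> hd (V z)) (Q.+-identityʳ j) ∙ h ∙ ap (\ z -> hd (V z)) (Q.+-comm 4 j))

polyomino-deform : (P : Shape) -> IsPolyomino P -> TwoFourNeighbourTilings P -> Σ Chain \ C -> Descendant C × Σ Shape \ Φ -> Bounds (concat8 C) Φ × IsDeformation P Φ
polyomino-deform P (W , sW , p , hW) (a , b , a' , b' , (t1 , f1) , (t2 , f2) , different) = from-orien (orient (Simple-at sW p) hW)
 where
 from-oct : OctagonOf P -> Σ Chain \ C -> Descendant C × Σ Shape \ Φ -> Bounds (concat8 C) Φ × IsDeformation P Φ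
 from-oct (V , ch , q , o) = conclude (redcd-deform (total V) (oct-redcd ch o) Q.≤-refl)
  where
  conclude : Deform V -> Σ Chain \ C -> Descendant C × Σ Shape \ Φ -> Bounds (concat8 C) Φ × IsDeformation P Φ
  conclude (α , β , α≢ , β≢ , block , s , C , d , e) = C , d , inside org (concat8 C) , bounds , concat8 C , bounds , α , β , α≢ , β≢ , block , outline (oct-trl (7 N.* s) ch o)
   where
   bounds : Bounds (concat8 C) (inside org (concat8 C))
   bounds = descendant-simple C d , org , \ c -> refl
   unshifted : ∀ n -> trl (7 N.* s) V n == subst α β (chn C n)
   unshifted n = e (7 N.* s N.+ n) ∙ ap (subst α β) (ap (chn C) (alg s n) ∙ perio-* {A = chn C} (\ _ -> refl) s n)
    where
    alg : ∀ s n -> s N.+ (7 N.* s N.+ n) == n N.+ s N.* 8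
    alg = ringN
   word≡ : ⟦ oct ⟧ (trl (7 N.* s) V) == subst α β (concat8 C)
   word≡ = ⟦⟧-cong unshifted oct ∙ ⟦⟧-subst α β (chn C) oct ∙ ap (subst α β) (oct-concat C)
   outline : (Σ Cell \ r -> Orntd P r (⟦ oct ⟧ (trl (7 N.* s) V))) -> Bounds (subst α β (concat8 C)) P
   outline (r , o') = (Smp.closed s0 , Smp.long s0 , Smp.distinct s0) , r , \ c -> Orntd.fills o' c ∙ ap (\ z -> inside r z c) word≡
    where
    s0 : Smp org (subst α β (concat8 C))
    s0 = tp (\ z -> Smp z (subst α β (concat8 C))) (⊕-invʳ r) (Simple-⊕ (neg r) (tp (Smp r) word≡ (Orntd.bdary o')))
 from-orien : (Σ Word \ W' -> Orntd P p W') -> Σ Chain \ C -> Descendant C × Σ Shape \ Φ -> Bounds (concat8 C) Φ × IsDeformation P Φ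
 from-orien (W' , o) = from-oct (two-factorizations (Factorization.factor t1 (f1 org InL-org) o) (Factorization.factor t2 (f2 org InL-org) o)
  \ h k -> different ((\ u i -> u , h u i , \ c -> refl) , \ u i -> u , k u i , \ c -> refl))

theorem1 : ((P : Shape) → IsPolyomino P → TwoFourNeighbourTilings P →
               Σ Chain λ U → Descendant U × Σ Shape λ Φ → Bounds (concat8 U) Φ × IsDeformation P Φ)
             × ((U : Chain) → Descendant U → IsSimpleClosed (concat8 U))
             × ((U : Chain) (Φ P : Shape) → Descendant U → Bounds (concat8 U) Φ →
                  IsDeformation P Φ → TwoFourNeighbourTilings P)
theorem1 = polyomino-deform , descendant-simple , deform-two-tilings
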